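{- Let $G(\beta,w)$ be the generating function of near-cubic rooted planar maps whose root-vertex has degree $1$, each equipped with a spanning forest, counted by the number of faces (variable $w$) and the number of connected components of the forest minus one (variable $\beta$). Let $W=2G-w/\beta$. Then $G$ is the unique formal power series in $w$ satisfying $G=O(w^2)$ and $$\begin{aligned}0={}&\Big(3\beta^4w(W')^4-\beta^3(5W\beta-\beta w+w)(W')^3+4(\beta+1)(5W\beta-\beta w+w)^2\Big)W''\\&-48\beta^2w(\beta+1)(W')^3+8\beta(\beta+1)(5W\beta-\beta w+w)(W')^2+4(\beta^2-1)(5W\beta-\beta w+w)W',\end{aligned}$$ where primes denote derivatives with respect to $w$.
   Context: A rooted planar map is a proper embedding of a connected planar graph (loops and multiple edges allowed) in the oriented sphere, up to orientation-preserving homeomorphism, with a distinguished corner whose vertex is the root-vertex. A map is near-cubic if every non-root vertex has degree $3$. A spanning forest of a map is a subset of its edges containing no cycle (spanning all vertices); its connected components are counted including isolated vertices. -}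

module Defs where

open import Data.Nat as ℕ using (ℕ; zero; suc; _∸_)
open import Data.Integer as ℤ using (ℤ; +_)
open import Data.Fin using (Fin; toℕ) renaming (zero to fz; suc to fs)
open import Data.List using (List; []; _∷_; map; foldr; concatMap; allFin)
open import Data.Bool.ListAction using (all; any)
open import Data.List.Relation.Unary.All using (All)
open import Data.List.Relation.Unary.Any using (Any)
open import Data.List.Relation.Unary.AllPairs using (AllPairs)
open import Data.Bool using (Bool; true; false; _∧_; _∨_; not; if_then_else_)
open import Data.Product using (Σ; _×_; _,_; proj₁; proj₂)
open import Relation.Binary.PropositionalEquality using (_≡_)
open import Relation.Nullary using (¬_)

-- Polynomials in β with integer coefficients: coefficient lists
-- (index i = coefficient of β^i), compared coefficientwise.

Poly : Set
Poly = List ℤ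

coeff : Poly → ℕ → ℤ
coeff []      _       = + 0
coeff (a ∷ p) zero    = a
coeff (a ∷ p) (suc n) = coeff p n

infix 4 _≈P_
_≈P_ : Poly → Poly → Set
p ≈P q = ∀ n → coeff p n ≡ coeff q n

NonZeroP : Poly → Set
NonZeroP p = ¬ (∀ n → coeff p n ≡ + 0)

_+P_ : Poly → Poly → Poly
[]      +P q       = q
(a ∷ p) +P []      = a ∷ p
(a ∷ p) +P (b ∷ q) = (a ℤ.+ b) ∷ (p +P q)

_*P_ : Poly → Poly → Poly
[]      *P q = []
(a ∷ p) *P q = map (a ℤ.*_) q +P (+ 0 ∷ (p *P q))

negP : Poly → Poly
negP = map (λ a → ℤ.- a)

constP : ℤ → Poly
constP c = c ∷ []

βP : Poly
βP = + 0 ∷ + 1 ∷ []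

βpow : ℕ → Poly
βpow zero    = constP (+ 1)
βpow (suc k) = βP *P βpow k

sumP : List Poly → Poly
sumP = foldr _+P_ []

-- Rational functions in β (the field ℚ(β)) as fractions num / den.
-- Denominators are required to be nonzero where series are quantified.

RatFun : Set
RatFun = Poly × Poly

num den : RatFun → Poly
num = proj₁
den = proj₂

infix 4 _≈F_
_≈F_ : RatFun → RatFun → Set
(a , b) ≈F (c , d) = (a *P d) ≈P (c *P b)

fromPoly : Poly → RatFun
fromPoly p = p , constP (+ 1)

0F : RatFun
0F = fromPoly []

_+F_ : RatFun → RatFun → RatFun
(a , b) +F (c , d) = ((a *P d) +P (c *P b)) , (b *P d)

_*F_ : RatFun → RatFun → RatFun
(a , b) *F (c , d) = (a *P c) , (b *P d)

negF : RatFun → RatFun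
negF (a , b) = negP a , b

Series : Set
Series = ℕ → RatFun

sumTo : ℕ → (ℕ → RatFun) → RatFun
sumTo zero    f = f zero
sumTo (suc n) f = sumTo n f +F f (suc n)

_⊕_ : Series → Series → Series
(f ⊕ g) n = f n +F g n

_⊖_ : Series → Series → Series
(f ⊖ g) n = f n +F negF (g n)

_⊗_ : Series → Series → Series
(f ⊗ g) n = sumTo n (λ i → f i *F g (n ∸ i))

infixl 6 _⊕_ _⊖_
infixl 7 _⊗_

cst : RatFun → Series
cst c zero    = c
cst c (suc _) = 0F

cstℤ : ℤ → Series
cstℤ k = cst (fromPoly (constP k))

wS : Series
wS zero          = 0F
wS (suc zero)    = fromPoly (constP (+ 1))
wS (suc (suc _)) = 0F

βS : Series
βS = cst (fromPoly βP)

invβS : Series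
invβS = cst (constP (+ 1) , βP)

D : Series → Series
D f n = fromPoly (constP (+ suc n)) *F f (suc n)

_^S_ : Series → ℕ → Series
f ^S zero  = cstℤ (+ 1)
f ^S suc k = f ⊗ (f ^S k)

Wof : Series → Series
Wof G = cstℤ (+ 2) ⊗ G ⊖ wS ⊗ invβS

odeExpr : Series → Series
odeExpr G =
    ( cstℤ (+ 3) ⊗ (βS ^S 4) ⊗ wS ⊗ (W′ ^S 4)
    ⊖ (βS ^S 3) ⊗ X ⊗ (W′ ^S 3)
    ⊕ cstℤ (+ 4) ⊗ (βS ⊕ cstℤ (+ 1)) ⊗ (X ^S 2) ) ⊗ W″
  ⊖ cstℤ (+ 48) ⊗ (βS ^S 2) ⊗ wS ⊗ (βS ⊕ cstℤ (+ 1)) ⊗ (W′ ^S 3)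
  ⊕ cstℤ (+ 8) ⊗ βS ⊗ (βS ⊕ cstℤ (+ 1)) ⊗ X ⊗ (W′ ^S 2)
  ⊕ cstℤ (+ 4) ⊗ ((βS ^S 2) ⊖ cstℤ (+ 1)) ⊗ X ⊗ W′
  where
    W  = Wof G
    W′ = D W
    W″ = D W′
    X  = cstℤ (+ 5) ⊗ W ⊗ βS ⊖ βS ⊗ wS ⊕ wS

ODE : Series → Set
ODE G = ∀ n → odeExpr G n ≈F 0F

eqB : ∀ {d} → Fin d → Fin d → Bool
eqB i j = toℕ i ℕ.≡ᵇ toℕ j

leB : ∀ {d} → Fin d → Fin d → Bool
leB i j = toℕ i ℕ.≤ᵇ toℕ j

countB : ∀ {d} → (Fin d → Bool) → ℕ
countB {d} p = foldr (λ i acc → if p i then suc acc else acc) 0 (allFin d)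

stepR : ∀ {d} → (Fin d → List (Fin d)) → (Fin d → Bool) → (Fin d → Bool)
stepR {d} nb R j = R j ∨ any (λ i → R i ∧ any (eqB j) (nb i)) (allFin d)

iterR : ∀ {d} → ℕ → (Fin d → List (Fin d)) → (Fin d → Bool) → (Fin d → Bool)
iterR zero    nb R = R
iterR (suc k) nb R = iterR k nb (stepR nb R)

-- Reach nb i j = true iff j is reachable from i following nb-arrows
-- (d iterations suffice since there are only d elements).
Reach : ∀ {d} → (Fin d → List (Fin d)) → Fin d → Fin d → Bool
Reach {d} nb i = iterR d nb (eqB i)

-- number of classes of the reachability relation of a symmetric-closure-like
-- step structure: count elements that are minimal in their class
numClasses : ∀ {d} → (Fin d → List (Fin d)) → ℕ
numClasses {d} nb =
  countB (λ i → all (λ j → not (Reach nb i j) ∨ leB i j) (allFin d))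

-- Combinatorial maps: darts Fin d, rotation σ (vertices = σ-cycles),
-- fixed-point-free involution α (edges = α-orbits), root dart (= root corner).

record Map (d : ℕ) : Set where
  field
    σ σ⁻ α   : Fin d → Fin d
    σσ⁻      : ∀ i → σ (σ⁻ i) ≡ i
    σ⁻σ      : ∀ i → σ⁻ (σ i) ≡ i
    αα       : ∀ i → α (α i) ≡ i
    α-fpf    : ∀ i → ¬ (α i ≡ i)
    root     : Fin d
    connected : ∀ i j → Reach (λ k → σ k ∷ α k ∷ []) i j ≡ true

  sameV : Fin d → Fin d → Bool
  sameV = Reach (λ k → σ k ∷ [])

  vdeg : Fin d → ℕ
  vdeg i = countB (sameV i)

  #vertices : ℕ
  #vertices = numClasses (λ k → σ k ∷ [])

  #faces : ℕ
  #faces = numClasses (λ k → σ (α k) ∷ [])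

  -- genus 0 via Euler: V - E + F = 2 with E = d/2
  Planar : Set
  Planar = 2 ℕ.* (#vertices ℕ.+ #faces) ≡ d ℕ.+ 4

  NearCubic : Set
  NearCubic = ∀ i → sameV root i ≡ false → vdeg i ≡ 3

  RootDeg1 : Set
  RootDeg1 = vdeg root ≡ 1

  -- Spanning forests.  An edge subset is a dart subset S closed under α.
  -- A cycle in S: a nonempty list of darts d₁ … d_k in S, at pairwise
  -- distinct vertices, on pairwise distinct edges, such that α dᵢ lies at
  -- the vertex of dᵢ₊₁ (indices mod k).  Such a list has length ≤ d.

  αClosed : (Fin d → Bool) → Bool
  αClosed S = all (λ i → eqBool (S (α i)) (S i)) (allFin d)
    where
      eqBool : Bool → Bool → Bool
      eqBool true  b = b
      eqBool false b = not b

  private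
    distinctAll : List (Fin d) → Bool
    distinctAll []       = true
    distinctAll (x ∷ xs) =
      all (λ y → not (eqB x y) ∧ not (eqB x (α y)) ∧ not (sameV x y)) xs
      ∧ distinctAll xs

    chainFrom : Fin d → List (Fin d) → Bool
    chainFrom first []             = true
    chainFrom first (z ∷ [])       = sameV (α z) first
    chainFrom first (z ∷ z′ ∷ r)   = sameV (α z) z′ ∧ chainFrom first (z′ ∷ r)

  isCycle : (Fin d → Bool) → List (Fin d) → Bool
  isCycle S []       = false
  isCycle S (x ∷ xs) = all S (x ∷ xs) ∧ distinctAll (x ∷ xs) ∧ chainFrom x (x ∷ xs)

  private
    listsOfLen : ℕ → List (List (Fin d))
    listsOfLen zero    = [] ∷ []
    listsOfLen (suc k) = concatMap (λ l → map (_∷ l) (allFin d)) (listsOfLen k)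

    lens : ℕ → List ℕ
    lens zero    = []
    lens (suc k) = suc k ∷ lens k

  acyclic : (Fin d → Bool) → Bool
  acyclic S = all (λ k → all (λ l → not (isCycle S l)) (listsOfLen k)) (lens d)

  isForest : (Fin d → Bool) → Bool
  isForest S = αClosed S ∧ acyclic S

  components : (Fin d → Bool) → ℕ
  components S = numClasses (λ k → σ k ∷ (if S k then α k ∷ [] else []))

  private
    allSubsets : ∀ n → List (Fin n → Bool)
    allSubsets zero    = (λ ()) ∷ []
    allSubsets (suc n) =
      concatMap (λ s → (λ { fz → true ; (fs i) → s i })
                     ∷ (λ { fz → false ; (fs i) → s i }) ∷ [])
                (allSubsets n)

  forestPoly : Poly
  forestPoly =
    sumP (map (λ S → if isForest S then βpow (components S ∸ 1) else [])
              (allSubsets d))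

RMap : Set
RMap = Σ ℕ Map

Iso : RMap → RMap → Set
Iso (d , M) (d′ , M′) =
  Σ (Fin d → Fin d′) λ f → Σ (Fin d′ → Fin d) λ f⁻ →
    (∀ i → f⁻ (f i) ≡ i) × (∀ j → f (f⁻ j) ≡ j) ×
    (∀ i → f (Map.σ M i) ≡ Map.σ M′ (f i)) ×
    (∀ i → f (Map.α M i) ≡ Map.α M′ (f i)) ×
    (f (Map.root M) ≡ Map.root M′)

Admissible : ℕ → RMap → Set
Admissible n (d , M) =
  Map.Planar M × Map.NearCubic M × Map.RootDeg1 M × Map.#faces M ≡ n

-- g is the generating function G(β,w) = Σₙ g(n) wⁿ: the coefficient of wⁿ is
-- the sum, over isomorphism classes of admissible maps with n faces, of the
-- forest polynomial (computed on a list of class representatives).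
IsMapGF : (ℕ → Poly) → Set
IsMapGF g = ∀ n → Σ (List RMap) λ Ms →
  All (Admissible n) Ms ×
  AllPairs (λ M M′ → ¬ Iso M M′) Ms ×
  (∀ M → Admissible n M → Any (Iso M) Ms) ×
  (g n ≈P sumP (map (λ M → Map.forestPoly (proj₂ M)) Ms))

GSeries : (ℕ → Poly) → Series
GSeries g n = fromPoly (g n)

module Submission where

-- Explore a forested near-cubic map from its root, one edge at a time.  The part still to be explored
-- is a map whose root vertex has p darts that may lie in the forest and m that do not: the next dart
-- reveals a new cubic vertex (joined by a forest edge or not) or is matched with a dart of the same
-- block, which cuts the block in two.  The letters recorded form a word that determines the map and
-- its forest up to isomorphism, the pops count the faces and the letters "new" the components but one.
-- Hence the generating functions F p m satisfy
--   F (p+1) m = F (p+2) m + F p (m+1),   F 0 (m+2) = Σ F 0 i · F 0 (m−i) + β F 2 (m+1),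
-- and G = F 1 0.  The first relation says that F p m = N[xᵐ cᵖ] for a linear functional N on series
-- in x, where c = c² + x; the second is the loop equation of a one-cut matrix model with potential
-- V′ = x − β c².  It is solved by D N[f] = L[f], where L[xᵏ] is the constant term in z of
-- (z + S + R/z)ᵏ and the series R, S in w are given by the saddle point equations L[V′] = 0 and
-- L[x V′] = 2w.  With s = √(1−4x), linear relations between the moments of 1/s and x/s express
-- R, S, R′, S′ through each other; U = 2βG − w satisfies U′ = 2(1+β)S − 1 and
-- 5U − (β−1)w = U′ ((1+β)R + 3w), and eliminating R and S leaves the equation.
-- All this takes place over ℚ, with β specialised to large integers; a polynomial that vanishes
-- there is zero.  Uniqueness: at order wⁿ the equation is linear in the coefficient of w^{n+1},
-- with leading factor −2n(n+1)(1+β).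

open import Level using (0ℓ)
open import Algebra.Bundles using (CommutativeRing)
open import Data.Nat as ℕ using (ℕ; zero; suc; _≤_; _<_; z≤n; s≤s)
open import Data.Fin using (Fin; toℕ)
open import Data.Bool using (Bool; true; false; if_then_else_)
open import Data.List using (List; []; _∷_; map; filterᵇ; allFin; concatMap; length)
open import Data.List.Relation.Unary.All as All using (All; []; _∷_)
open import Data.List.Relation.Unary.AllPairs as AllPairs using (AllPairs; []; _∷_)
open import Data.List.Relation.Unary.Any using (Any; here; there)
open import Data.List.Relation.Unary.Unique.Propositional using (Unique)
open import Data.List.Membership.Propositional using (_∈_)
open import Data.Product using (Σ; ∃; _,_; _×_; proj₁; proj₂)
open import Data.Sum using (_⊎_; inj₁; inj₂)
open import Data.Empty using (⊥; ⊥-elim)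
open import Relation.Nullary using (¬_; Dec; yes; no)
import Data.Nat.Properties as ℕP

-- The exploration works in any genus. The letter `merge`, for an edge between two different blocks,
-- is kept so that every forested map has a word before planarity is used. Euler's count then reads
-- 2 `pops` + 4 `merges` = `verts` + 3, so the merges count the genus and planarity becomes the
-- absence of merges; no separation property of curves is needed. The loop equation is quadratic in
-- N. Its derivative in w is linear in the moments L, which have an explicit generating function,
-- the inverse square root of a quadratic polynomial in a second variable y. Both sides of the
-- differentiated equation solve one linear first-order problem in w, which has a single solution;
-- this replaces any spectral curve argument. By Euler's relation every dart of a block counts for
-- half a face, hence orders in w are measured in half units. Evaluation at integers β ≥ 1 gives a
-- field in which 1/β exists and 1 + β cancels. A coefficient of a competing solution H involves the
-- denominators of finitely many coefficients only, so the excluded integers may depend on the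
-- coefficient.

private

 -- Reachability, orbits and counting on finite sets.

 module Finite where
  open import Defs
  open import Data.Nat using (_+_)
  open import Data.Nat.Induction using (<-wellFounded)
  open import Induction.WellFounded using (Acc; acc)
  import Data.Fin.Properties as FinP
  open import Data.List using (_++_; foldr)
  import Data.List.Properties as ListP
  import Data.List.Membership.Propositional.Properties as MemP
  open import Data.List.Membership.Propositional.Properties.WithK using (unique∧set⇒bag)
  open import Data.List.Relation.Binary.BagAndSetEquality using (∼bag⇒↭)
  open import Data.List.Relation.Binary.Permutation.Propositional using (_↭_)
  import Data.List.Relation.Binary.Permutation.Propositional.Properties as PermP
  import Data.List.Relation.Unary.All.Properties as AllP
  import Data.List.Relation.Unary.Unique.Propositional.Properties as UniP
  open import Data.Bool.ListAction using (all; any)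
  open import Data.Bool using (_∧_; _∨_; not)
  import Data.Bool.Properties as BoolP
  open import Function using (_∘_; mk⇔)
  open import Relation.Binary.PropositionalEquality
  open import Relation.Binary.Construct.Closure.ReflexiveTransitive using (Star; ε; _◅_; _◅◅_)

  private variable
    A B : Set

  unique-↭ : {xs ys : List A} → Unique xs → Unique ys →
    (∀ {z} → z ∈ xs → z ∈ ys) → (∀ {z} → z ∈ ys → z ∈ xs) → xs ↭ ys
  unique-↭ u v f g = ∼bag⇒↭ (unique∧set⇒bag u v (mk⇔ f g))

  map-unique : {f : A → B} {xs : List A} → Unique xs →
    (∀ {x y} → x ∈ xs → y ∈ xs → f x ≡ f y → x ≡ y) → Unique (map f xs)
  map-unique [] inj = []
  map-unique {f = f} (px ∷ u) inj =
    AllP.map⁺ (All.tabulate λ y∈ e → All.lookup px y∈ (inj (here refl) (there y∈) e)) ∷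
    map-unique u (λ x y → inj (there x) (there y))

  ∧-true : ∀ {a b} → a ∧ b ≡ true → a ≡ true × b ≡ true
  ∧-true {true} e = refl , e

  ∨-true : ∀ {a b} → a ∨ b ≡ true → a ≡ true ⊎ b ≡ true
  ∨-true {true} e = inj₁ refl
  ∨-true {false} e = inj₂ e

  bool-cases : ∀ a → a ≡ true ⊎ a ≡ false
  bool-cases true = inj₁ refl
  bool-cases false = inj₂ refl

  true≢false : ∀ {a} → a ≡ true → a ≡ false → ⊥
  true≢false refl ()

  module _ (p : A → Bool) where

    any-true⁻ : ∀ xs → any p xs ≡ true → ∃ λ x → x ∈ xs × p x ≡ true
    any-true⁻ (x ∷ xs) e with ∨-true {p x} e
    ... | inj₁ px = x , here refl , px
    ... | inj₂ e′ with any-true⁻ xs e′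
    ... | y , y∈ , py = y , there y∈ , py

    any-true⁺ : ∀ {x xs} → x ∈ xs → p x ≡ true → any p xs ≡ true
    any-true⁺ (here refl) px rewrite px = refl
    any-true⁺ {xs = y ∷ _} (there x∈) px rewrite any-true⁺ x∈ px = BoolP.∨-zeroʳ (p y)

    all-true⁻ : ∀ {xs} → all p xs ≡ true → ∀ {x} → x ∈ xs → p x ≡ true
    all-true⁻ {y ∷ _} e (here refl) = proj₁ (∧-true e)
    all-true⁻ {y ∷ _} e (there x∈) = all-true⁻ (proj₂ (∧-true {p y} e)) x∈

    all-true⁺ : ∀ xs → (∀ {x} → x ∈ xs → p x ≡ true) → all p xs ≡ true
    all-true⁺ [] h = refl
    all-true⁺ (x ∷ xs) h rewrite h (here refl) = all-true⁺ xs (h ∘ there)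

    all-false⁻ : ∀ xs → all p xs ≡ false → ∃ λ x → x ∈ xs × p x ≡ false
    all-false⁻ (x ∷ xs) e with p x in eq
    ... | false = x , here refl , eq
    ... | true with all-false⁻ xs e
    ... | y , y∈ , py = y , there y∈ , py

    ∈-filterᵇ⁺ : ∀ {x xs} → x ∈ xs → p x ≡ true → x ∈ filterᵇ p xs
    ∈-filterᵇ⁺ {xs = y ∷ _} (here refl) px rewrite px = here refl
    ∈-filterᵇ⁺ {xs = y ∷ _} (there x∈) px with p y
    ... | true = there (∈-filterᵇ⁺ x∈ px)
    ... | false = ∈-filterᵇ⁺ x∈ px

    ∈-filterᵇ⁻ : ∀ {x xs} → x ∈ filterᵇ p xs → x ∈ xs × p x ≡ true
    ∈-filterᵇ⁻ {xs = y ∷ _} x∈ with p y in eq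
    ∈-filterᵇ⁻ {xs = y ∷ _} (here refl) | true = here refl , eq
    ∈-filterᵇ⁻ {xs = y ∷ _} (there x∈) | true with ∈-filterᵇ⁻ x∈
    ... | x∈′ , px = there x∈′ , px
    ∈-filterᵇ⁻ {xs = y ∷ _} x∈ | false with ∈-filterᵇ⁻ x∈
    ... | x∈′ , px = there x∈′ , px

    filterᵇ-unique : ∀ {xs} → Unique xs → Unique (filterᵇ p xs)
    filterᵇ-unique [] = []
    filterᵇ-unique {x ∷ xs} (px ∷ u) with p x
    ... | true = All.tabulate (λ y∈ → All.lookup px (proj₁ (∈-filterᵇ⁻ y∈))) ∷ filterᵇ-unique u
    ... | false = filterᵇ-unique u

  eqB-true⁻ : ∀ {d} {i j : Fin d} → eqB i j ≡ true → i ≡ j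
  eqB-true⁻ {i = i} {j} e = FinP.toℕ-injective (ℕP.≡ᵇ⇒≡ (toℕ i) (toℕ j) (subst Data.Bool.T (sym e) _))

  eqB-refl : ∀ {d} (i : Fin d) → eqB i i ≡ true
  eqB-refl i = go (toℕ i)
    where
    go : ∀ n → (n ℕ.≡ᵇ n) ≡ true
    go zero = refl
    go (suc n) = go n

  eqB-false⁺ : ∀ {d} {i j : Fin d} → ¬ (i ≡ j) → eqB i j ≡ false
  eqB-false⁺ {i = i} {j} ne with bool-cases (eqB i j)
  ... | inj₁ t = ⊥-elim (ne (eqB-true⁻ t))
  ... | inj₂ f = f

  leB-true⁻ : ∀ {d} {i j : Fin d} → leB i j ≡ true → toℕ i ≤ toℕ j
  leB-true⁻ {i = i} {j} e = ℕP.≤ᵇ⇒≤ (toℕ i) (toℕ j) (subst Data.Bool.T (sym e) _)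

  leB-false⁻ : ∀ {d} {i j : Fin d} → leB i j ≡ false → toℕ j < toℕ i
  leB-false⁻ {i = i} {j} e = ℕP.≰⇒> λ le → subst Data.Bool.T e (ℕP.≤⇒≤ᵇ le)

  allFin-unique : ∀ d → Unique (allFin d)
  allFin-unique d = UniP.tabulate⁺ (λ e → e)

  ∈-allFin : ∀ {d} (i : Fin d) → i ∈ allFin d
  ∈-allFin = MemP.∈-allFin

  countB-length : ∀ {d} (p : Fin d → Bool) → countB p ≡ length (filterᵇ p (allFin d))
  countB-length {d} p = go (allFin d)
    where
    go : ∀ xs → foldr (λ i acc → if p i then suc acc else acc) 0 xs ≡ length (filterᵇ p xs)
    go [] = refl
    go (x ∷ xs) with p x
    ... | true = cong suc (go xs)
    ... | false = go xs

  countB-unique : ∀ {d} (p : Fin d → Bool) {L : List (Fin d)} → Unique L →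
    (∀ {i} → i ∈ L → p i ≡ true) → (∀ {i} → p i ≡ true → i ∈ L) → countB p ≡ length L
  countB-unique {d} p {L} u f g = trans (countB-length p) (PermP.↭-length
    (unique-↭ (filterᵇ-unique p (allFin-unique d)) u
      (λ z∈ → g (proj₂ (∈-filterᵇ⁻ p {xs = allFin d} z∈)))
      (λ z∈ → ∈-filterᵇ⁺ p (∈-allFin _) (f z∈))))

  Path : ∀ {d} → (Fin d → List (Fin d)) → Fin d → Fin d → Set
  Path nb = Star (λ i j → j ∈ nb i)

  module _ {d} (nb : Fin d → List (Fin d)) where

    private
      Closed : (Fin d → Bool) → Set
      Closed R = ∀ i j → R i ≡ true → j ∈ nb i → R j ≡ true

      stepR-true⁻ : ∀ R j → stepR nb R j ≡ true → R j ≡ true ⊎ ∃ λ i → R i ≡ true × j ∈ nb i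
      stepR-true⁻ R j e with ∨-true {R j} e
      ... | inj₁ r = inj₁ r
      ... | inj₂ e′ with any-true⁻ _ (allFin d) e′
      ... | i , _ , q with ∧-true {R i} q
      ... | ri , q′ with any-true⁻ _ (nb i) q′
      ... | k , k∈ , t rewrite eqB-true⁻ {i = j} {k} t = inj₂ (i , ri , k∈)

      stepR-⊇ : ∀ R j → R j ≡ true → stepR nb R j ≡ true
      stepR-⊇ R j e rewrite e = refl

      stepR-true⁺ : ∀ R i j → R i ≡ true → j ∈ nb i → stepR nb R j ≡ true
      stepR-true⁺ R i j r j∈ = trans (cong (R j ∨_)
        (any-true⁺ _ (∈-allFin i) (cong₂ _∧_ r (any-true⁺ (eqB j) j∈ (eqB-refl j))))) (BoolP.∨-zeroʳ (R j))

      iterR-⊇ : ∀ k R j → R j ≡ true → iterR k nb R j ≡ true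
      iterR-⊇ zero R j r = r
      iterR-⊇ (suc k) R j r = iterR-⊇ k _ j (stepR-⊇ R j r)

      iterR-⊆ : ∀ k R (Q : Fin d → Set) → (∀ i j → Q i → j ∈ nb i → Q j) → (∀ j → R j ≡ true → Q j) →
        ∀ j → iterR k nb R j ≡ true → Q j
      iterR-⊆ zero R Q cl h = h
      iterR-⊆ (suc k) R Q cl h = iterR-⊆ k _ Q cl λ j e → case-step j (stepR-true⁻ R j e)
        where
        case-step : ∀ j → (R j ≡ true ⊎ ∃ λ i → R i ≡ true × j ∈ nb i) → Q j
        case-step j (inj₁ r) = h j r
        case-step j (inj₂ (i , ri , j∈)) = cl i j (h i ri) j∈

      missing : (Fin d → Bool) → List (Fin d) → ℕ
      missing R xs = length (filterᵇ (λ i → not (R i)) xs)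

      missing-mono : ∀ R R′ xs → (∀ i → R i ≡ true → R′ i ≡ true) → missing R′ xs ≤ missing R xs
      missing-mono R R′ [] h = z≤n
      missing-mono R R′ (x ∷ xs) h with R x in e | R′ x in e′
      ... | true | true = missing-mono R R′ xs h
      ... | true | false = ⊥-elim (true≢false (h x e) e′)
      ... | false | true = ℕP.m≤n⇒m≤1+n (missing-mono R R′ xs h)
      ... | false | false = s≤s (missing-mono R R′ xs h)

      missing-strict : ∀ R R′ xs → (∀ i → R i ≡ true → R′ i ≡ true) → ∀ {j} → j ∈ xs →
        R j ≡ false → R′ j ≡ true → missing R′ xs < missing R xs
      missing-strict R R′ (x ∷ xs) h (here refl) f t rewrite f | t = s≤s (missing-mono R R′ xs h)
      missing-strict R R′ (x ∷ xs) h (there j∈) f t with R x in e | R′ x in e′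
      ... | true | true = missing-strict R R′ xs h j∈ f t
      ... | true | false = ⊥-elim (true≢false (h x e) e′)
      ... | false | true = ℕP.m≤n⇒m≤1+n (missing-strict R R′ xs h j∈ f t)
      ... | false | false = s≤s (missing-strict R R′ xs h j∈ f t)

      -- Either a step adds an element or the set is already closed.
      iterR-closed : ∀ k R → missing R (allFin d) ≤ k → Closed (iterR k nb R)
      iterR-closed zero R m i j _ _ with bool-cases (R j)
      ... | inj₁ t = t
      ... | inj₂ f with filterᵇ (λ i → not (R i)) (allFin d) | ∈-filterᵇ⁺ (λ i → not (R i)) (∈-allFin j) (cong not f)
      iterR-closed zero R () i j _ _ | inj₂ f | _ ∷ _ | _
      iterR-closed (suc k) R m with FinP.any? (λ j → BoolP._≟_ (stepR nb R j ∧ not (R j)) true)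
      ... | yes (j , e) = iterR-closed k (stepR nb R) (ℕP.≤-pred (ℕP.≤-trans
              (missing-strict R (stepR nb R) (allFin d) (stepR-⊇ R) (∈-allFin j)
                (not-true (proj₂ (∧-true {stepR nb R j} e))) (proj₁ (∧-true e))) m))
        where
        not-true : ∀ {a} → not a ≡ true → a ≡ false
        not-true {false} _ = refl
      ... | no none = λ i j r j∈ → iterR-⊇ (suc k) R j (closed i j (iterR-⊆ (suc k) R (λ i → R i ≡ true) closed (λ _ r → r) i r) j∈)
        where
        closed : Closed R
        closed i j r j∈ with bool-cases (R j)
        ... | inj₁ t = t
        ... | inj₂ f = ⊥-elim (none (j , cong₂ _∧_ (stepR-true⁺ R i j r j∈) (cong not f)))

    Reach⇒Path : ∀ {i j} → Reach nb i j ≡ true → Path nb i j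
    Reach⇒Path {i} {j} = iterR-⊆ d (eqB i) (Path nb i) (λ _ _ p e → p ◅◅ (e ◅ ε)) (λ j e → subst (Path nb i) (eqB-true⁻ e) ε) j

    Path⇒Reach : ∀ {i j} → Path nb i j → Reach nb i j ≡ true
    Path⇒Reach {i} {j} p = go p (iterR-⊇ d (eqB i) i (eqB-refl i))
      where
      bound : missing (eqB i) (allFin d) ≤ d
      bound = ℕP.≤-trans (ListP.length-filter _ (allFin d)) (ℕP.≤-reflexive (ListP.length-tabulate (λ x → x)))
      go : ∀ {k} → Path nb k j → iterR d nb (eqB i) k ≡ true → iterR d nb (eqB i) j ≡ true
      go ε r = r
      go (e ◅ q) r = go q (iterR-closed d (eqB i) bound _ _ r e)

    -- `numClasses` counts the least elements of classes. A labelling that is constant exactly on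
    -- the classes is injective on these minima, and descending from any element to a smaller
    -- reachable one ends at a minimum, so the minima correspond to the labels. Vertices, faces and
    -- components are all counted this way.
    numClasses-labels : {L : Set} (lab : Fin d → L) {Ls : List L} → Unique Ls →
      (∀ i → lab i ∈ Ls) → (∀ {l} → l ∈ Ls → ∃ λ i → lab i ≡ l) →
      (∀ {i j} → Path nb i j → lab i ≡ lab j) → (∀ {i j} → lab i ≡ lab j → Path nb i j) →
      numClasses nb ≡ length Ls
    numClasses-labels lab {Ls} uL lab∈ hit resp conn = trans (countB-length isMin)
      (trans (sym (ListP.length-map lab mins)) (PermP.↭-length
        (unique-↭ (map-unique (filterᵇ-unique isMin (allFin-unique d)) inj) uL into onto)))
      where
      isMin : Fin d → Bool
      isMin i = all (λ j → not (Reach nb i j) ∨ leB i j) (allFin d)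
      mins = filterᵇ isMin (allFin d)
      min≤ : ∀ {i j} → i ∈ mins → lab i ≡ lab j → toℕ i ≤ toℕ j
      min≤ {i} {j} i∈ e with ∨-true (all-true⁻ _ (proj₂ (∈-filterᵇ⁻ isMin {xs = allFin d} i∈)) (∈-allFin j))
      ... | inj₁ n = ⊥-elim (true≢false n (cong not (Path⇒Reach (conn e))))
      ... | inj₂ le = leB-true⁻ {i = i} {j} le
      inj : ∀ {x y} → x ∈ mins → y ∈ mins → lab x ≡ lab y → x ≡ y
      inj x∈ y∈ e = FinP.toℕ-injective (ℕP.≤-antisym (min≤ x∈ e) (min≤ y∈ (sym e)))
      into : ∀ {z} → z ∈ map lab mins → z ∈ Ls
      into z∈ with MemP.∈-map⁻ lab z∈
      ... | i , _ , refl = lab∈ i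
      least : ∀ i → Acc _<_ (toℕ i) → ∃ λ j → lab i ≡ lab j × isMin j ≡ true
      least i (acc rs) with bool-cases (isMin i)
      ... | inj₁ t = i , refl , t
      ... | inj₂ f with all-false⁻ _ (allFin d) f
      ... | j , _ , g with Reach nb i j in r
      ... | true with least j (rs (leB-false⁻ {i = i} {j} g))
      ... | k , e , t = k , trans (resp (Reach⇒Path r)) e , t
      onto : ∀ {z} → z ∈ Ls → z ∈ map lab mins
      onto z∈ with hit z∈
      ... | i , refl with least i (<-wellFounded _)
      ... | j , e , t rewrite e = MemP.∈-map⁺ lab (∈-filterᵇ⁺ isMin (∈-allFin j) t)

  module _ {d} (f : Fin d → Fin d) (inj : ∀ {x y} → f x ≡ f y → x ≡ y) where

    private
      iter : ℕ → Fin d → Fin d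
      iter zero x = x
      iter (suc n) x = f (iter n x)

      cancel : ∀ m n x → iter m x ≡ iter (m + n) x → x ≡ iter n x
      cancel zero n x e = e
      cancel (suc m) n x e = cancel m n x (inj e)

      iter-path : ∀ n x → Path (λ k → f k ∷ []) x (iter n x)
      iter-path zero x = ε
      iter-path (suc n) x = iter-path n x ◅◅ (here refl ◅ ε)

      iter-suc : ∀ n x → iter n (f x) ≡ f (iter n x)
      iter-suc zero x = refl
      iter-suc (suc n) x = cong f (iter-suc n x)

    -- The pigeonhole principle gives i < j with equal iterates at x. Cancelling i applications of
    -- the injective f makes x a positive iterate of itself, hence a point of the forward orbit of f
    -- x. So forward reachability under an injection of a finite set is symmetric.
    step-back : ∀ x → Path (λ k → f k ∷ []) (f x) x
    step-back x with FinP.pigeonhole (ℕP.n<1+n d) (λ i → iter (toℕ i) x)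
    ... | i , j , i<j , e with ℕP.m≤n⇒∃[o]m+o≡n i<j
    ... | o , eq = subst (Path _ (f x)) (sym (trans x≡ (sym (iter-suc o x)))) (iter-path o (f x))
      where
      x≡ : x ≡ iter (suc o) x
      x≡ = cancel (toℕ i) (suc o) x (trans e (cong (λ m → iter m x) (trans (sym eq) (sym (ℕP.+-suc (toℕ i) o)))))

    orbit-sym : ∀ {x y} → Path (λ k → f k ∷ []) x y → Path (λ k → f k ∷ []) y x
    orbit-sym ε = ε
    orbit-sym {x} (here refl ◅ p) = orbit-sym p ◅◅ step-back x

 -- Edge subsets and cycles as inductive data.

 module Subsets where
  open Finite
  open import Defs
  open import Data.Nat using (_∸_)
  open import Data.Fin using () renaming (zero to fz; suc to fs)
  open import Data.List using (foldr; concat)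
  open import Data.Bool.ListAction using (all; any; and)
  open import Data.Bool using (_∧_; _∨_; not)
  open import Relation.Binary.PropositionalEquality
  import Data.List.Membership.Propositional.Properties as MemP
  import Data.List.Relation.Unary.All.Properties as AllP

  forestTerm : ∀ {d} → Map d → (Fin d → Bool) → Poly
  forestTerm M S = if Map.isForest M S then βpow (Map.components M S ∸ 1) else []

  private
    -- The enumeration of subsets inside `forestPoly` is private and cannot be named. With `sumP`
    -- abstracted to a variable both sides become rigid, and unification supplies the list.
    subsets-top : ∀ {d} (M : Map d) → Σ (List (Fin d → Bool)) λ L → Map.forestPoly M ≡ sumP (map (forestTerm M) L)
    subsets-top M with sumP
    ... | f = _ , refl

    subsets-tail : ∀ n (M : Map (suc n)) → Σ (List (Fin n → Bool)) λ L → Σ ((Fin n → Bool) → List (Fin (suc n) → Bool)) λ h →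
      proj₁ (subsets-top M) ≡ concat (map h L)
    subsets-tail n M with concat {A = Fin (suc n) → Bool}
    ... | f = _ , _ , refl

  mutual
    subsets : ∀ {d} → Map d → ∀ n → List (Fin n → Bool)
    subsets = _
    private
      subsets-solve : ∀ n (M : Map (suc n)) → proj₁ (subsets-tail n M) ≡ subsets M n
      -- Abstracting `suc n` and `M` separates the size of the map from n. The unknown `subsets` is
      -- then applied to distinct variables, so that it is determined for all arguments.
      subsets-solve n M with suc n | M
      ... | w1 | w2 = refl

  forestPoly≡ : ∀ {d} (M : Map d) → Map.forestPoly M ≡ sumP (map (forestTerm M) (subsets M d))
  forestPoly≡ M = refl

  private
    lens-top : ∀ {d} (M : Map d) → Σ (List ℕ) λ L → Σ (ℕ → List (List (Fin d))) λ ls → ∀ S →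
      Map.acyclic M S ≡ all (λ k → all (λ l → not (Map.isCycle M S l)) (ls k)) L
    lens-top M with and
    ... | f = _ , _ , λ S → refl

    lens-tail : ∀ n (M : Map (suc n)) → Σ (List ℕ) λ L → proj₁ (lens-top M) ≡ suc n ∷ L
    lens-tail n M = _ , refl

  lists : ∀ {d} → Map d → ℕ → List (List (Fin d))
  lists M = proj₁ (proj₂ (lens-top M))

  mutual
    lens : ∀ {d} → Map d → ℕ → List ℕ
    lens = _
    private
      lens-solve : ∀ n (M : Map (suc n)) → proj₁ (lens-tail n M) ≡ lens M n
      lens-solve n M with suc n | M
      ... | w1 | w2 = refl

  acyclic≡ : ∀ {d} (M : Map d) S → Map.acyclic M S ≡ all (λ k → all (λ l → not (Map.isCycle M S l)) (lists M k)) (lens M d)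
  acyclic≡ M S = refl

  private
    αClosed-top : ∀ {d} (M : Map d) S → Σ (Fin d → Bool) λ e → Map.αClosed M S ≡ all e (allFin d)
    αClosed-top M S with and
    ... | f = _ , refl

  module _ {d} (M : Map d) where
    open Map M

    αClosed-true⁺ : ∀ S → (∀ i → S (α i) ≡ S i) → αClosed S ≡ true
    αClosed-true⁺ S h = all-true⁺ (proj₁ (αClosed-top M S)) (allFin d) λ {i} _ → go i (h i)
      where
      go : ∀ i → S (α i) ≡ S i → proj₁ (αClosed-top M S) i ≡ true
      go i eq with S (α i) | S i | eq
      ... | true | _ | refl = refl
      ... | false | _ | refl = refl

    αClosed-true⁻ : ∀ S → αClosed S ≡ true → ∀ i → S (α i) ≡ S i
    αClosed-true⁻ S e i = go (all-true⁻ (proj₁ (αClosed-top M S)) {allFin d} e (∈-allFin i))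
      where
      go : proj₁ (αClosed-top M S) i ≡ true → S (α i) ≡ S i
      go eq with S (α i) | S i
      go eq | true | true = refl
      go eq | false | false = refl

    mutual
      -- The two private tests inside `isCycle`. They are solved from its unfolding on a list with
      -- two darts in front, where both recur on the remaining list of variables.
      edgeDistinct : List (Fin d) → Bool
      edgeDistinct = _
      closedChain : Fin d → Fin d → List (Fin d) → Bool
      closedChain = _
      private
        isCycle-solve : ∀ S x xs z → isCycle S (x ∷ z ∷ xs) ≡
          all S (x ∷ z ∷ xs) ∧ (all (λ y → not (eqB x y) ∧ not (eqB x (α y)) ∧ not (sameV x y)) (z ∷ xs) ∧
            (all (λ y → not (eqB z y) ∧ not (eqB z (α y)) ∧ not (sameV z y)) xs ∧ edgeDistinct xs)) ∧ (sameV (α x) z ∧ closedChain x z xs)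
        isCycle-solve S x xs z with _∧_
        ... | f = refl

    isCycle≡ : ∀ S x xs → isCycle S (x ∷ xs) ≡ all S (x ∷ xs) ∧ edgeDistinct (x ∷ xs) ∧ closedChain x x xs
    isCycle≡ S x [] = refl
    isCycle≡ S x (z ∷ xs) = refl

    DistinctEdges : Fin d → Fin d → Set
    DistinctEdges x y = ¬ x ≡ y × ¬ x ≡ α y × sameV x y ≡ false

    -- The darts z ∷ zs form a walk along edges that ends at the vertex of x.
    data Walk (x : Fin d) : Fin d → List (Fin d) → Set where
      edge[] : ∀ {z} → sameV (α z) x ≡ true → Walk x z []
      edge∷ : ∀ {z z′ r} → sameV (α z) z′ ≡ true → Walk x z′ r → Walk x z (z′ ∷ r)

    private
      not-true : ∀ {a} → not a ≡ true → a ≡ false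
      not-true {false} _ = refl

      distinct⁻ : ∀ xs → edgeDistinct xs ≡ true → AllPairs DistinctEdges xs
      distinct⁻ [] e = []
      distinct⁻ (x ∷ xs) e = All.tabulate (λ {y} y∈ → head y (all-true⁻ _ {xs} (proj₁ (∧-true e)) y∈)) ∷ distinct⁻ xs (proj₂ (∧-true e))
        where
        head : ∀ y → not (eqB x y) ∧ not (eqB x (α y)) ∧ not (sameV x y) ≡ true → DistinctEdges x y
        head y t = (λ { refl → true≢false (eqB-refl x) (not-true (proj₁ (∧-true t))) }) ,
          (λ { refl → true≢false (eqB-refl (α y)) (not-true (proj₁ (∧-true (proj₂ (∧-true {not (eqB x y)} t))))) }) ,
          not-true (proj₂ (∧-true (proj₂ (∧-true {not (eqB x y)} t))))

      distinct⁺ : ∀ xs → AllPairs DistinctEdges xs → edgeDistinct xs ≡ true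
      distinct⁺ [] [] = refl
      distinct⁺ (x ∷ xs) (p ∷ ps) = cong₂ _∧_ (all-true⁺ (λ y → not (eqB x y) ∧ not (eqB x (α y)) ∧ not (sameV x y)) xs λ {y} y∈ → head y (All.lookup p y∈)) (distinct⁺ xs ps)
        where
        head : ∀ y → DistinctEdges x y → not (eqB x y) ∧ not (eqB x (α y)) ∧ not (sameV x y) ≡ true
        head y (p , q , r) = cong₂ _∧_ (cong not (eqB-false⁺ p)) (cong₂ _∧_ (cong not (eqB-false⁺ q)) (cong not r))

      walk⁻ : ∀ x z xs → closedChain x z xs ≡ true → Walk x z xs
      walk⁻ x z [] e = edge[] e
      walk⁻ x z (z′ ∷ r) e = edge∷ (proj₁ (∧-true e)) (walk⁻ x z′ r (proj₂ (∧-true e)))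

      walk⁺ : ∀ {x z xs} → Walk x z xs → closedChain x z xs ≡ true
      walk⁺ (edge[] e) = e
      walk⁺ (edge∷ e w) = cong₂ _∧_ e (walk⁺ w)

    isCycle⁻ : ∀ S x xs → isCycle S (x ∷ xs) ≡ true →
      (∀ {z} → z ∈ x ∷ xs → S z ≡ true) × AllPairs DistinctEdges (x ∷ xs) × Walk x x xs
    isCycle⁻ S x xs e with trans (sym (isCycle≡ S x xs)) e
    ... | e′ = all-true⁻ S (proj₁ (∧-true {all S (x ∷ xs)} e′)) ,
      distinct⁻ (x ∷ xs) (proj₁ (∧-true {edgeDistinct (x ∷ xs)} (proj₂ (∧-true {all S (x ∷ xs)} e′)))) ,
      walk⁻ x x xs (proj₂ (∧-true {edgeDistinct (x ∷ xs)} (proj₂ (∧-true {all S (x ∷ xs)} e′))))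

    isCycle⁺ : ∀ S x xs → (∀ {z} → z ∈ x ∷ xs → S z ≡ true) → AllPairs DistinctEdges (x ∷ xs) → Walk x x xs → isCycle S (x ∷ xs) ≡ true
    isCycle⁺ S x xs s p w = trans (isCycle≡ S x xs) (cong₂ _∧_ (all-true⁺ S (x ∷ xs) s) (cong₂ _∧_ (distinct⁺ (x ∷ xs) p) (walk⁺ w)))

    private
      ∈-concatMap : ∀ {A B : Set} (f : A → List B) {x y xs} → x ∈ xs → y ∈ f x → y ∈ concatMap f xs
      ∈-concatMap f x∈ y∈ = MemP.∈-concat⁺′ y∈ (MemP.∈-map⁺ f x∈)

      ∈-lists : ∀ l → l ∈ lists M (length l)
      ∈-lists [] = here refl
      ∈-lists (x ∷ l) = ∈-concatMap (λ l → map (_∷ l) (allFin d)) (∈-lists l) (MemP.∈-map⁺ (_∷ l) (∈-allFin x))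

      ∈-lens : ∀ k n → suc k ≤ n → suc k ∈ lens M n
      ∈-lens k (suc n) (s≤s k≤n) with ℕP.m≤n⇒m<n∨m≡n k≤n
      ... | inj₁ k<n = there (∈-lens k n k<n)
      ... | inj₂ refl = here refl

    acyclic⁺ : ∀ S → (∀ x xs → isCycle S (x ∷ xs) ≡ true → ⊥) → acyclic S ≡ true
    acyclic⁺ S h = all-true⁺ (λ k → all (λ l → not (isCycle S l)) (lists M k)) (lens M d) λ {k} _ →
      all-true⁺ (λ l → not (isCycle S l)) (lists M k) λ {l} _ → go l
      where
      go : ∀ l → not (isCycle S l) ≡ true
      go [] = refl
      go (x ∷ xs) with bool-cases (isCycle S (x ∷ xs))
      ... | inj₁ t = ⊥-elim (h x xs t)
      ... | inj₂ f = cong not f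

    acyclic⁻ : ∀ S → acyclic S ≡ true → ∀ x xs → length (x ∷ xs) ≤ d → isCycle S (x ∷ xs) ≡ true → ⊥
    acyclic⁻ S e x xs le t = true≢false t (not-true (all-true⁻ (λ l → not (isCycle S l)) {lists M (length (x ∷ xs))}
      (all-true⁻ (λ k → all (λ l → not (isCycle S l)) (lists M k)) {lens M d} e (∈-lens (length xs) d le)) (∈-lists (x ∷ xs))))

    private
      _≐_ : ∀ {n} → (Fin n → Bool) → (Fin n → Bool) → Set
      S ≐ T = ∀ i → S i ≡ T i

      -- In the enumeration the two ways to extend a subset by a new element are anonymous
      -- functions; they are captured here together with their values.
      record Extension (n : ℕ) : Set where
        field
          with-0 without-0 : (Fin n → Bool) → Fin (suc n) → Bool
          eq : subsets M (suc n) ≡ concatMap (λ s → with-0 s ∷ without-0 s ∷ []) (subsets M n)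
          with₀ : ∀ s → with-0 s fz ≡ true
          without₀ : ∀ s → without-0 s fz ≡ false
          withₛ : ∀ s i → with-0 s (fs i) ≡ s i
          withoutₛ : ∀ s i → without-0 s (fs i) ≡ s i

      extension : ∀ n → Extension n
      extension n = record { with-0 = _ ; without-0 = _ ; eq = refl ; with₀ = λ _ → refl ; without₀ = λ _ → refl ; withₛ = λ _ _ → refl ; withoutₛ = λ _ _ → refl }

    subsets-complete : ∀ n (S : Fin n → Bool) → ∃ λ T → T ∈ subsets M n × S ≐ T
    subsets-complete zero S = _ , here refl , λ ()
    subsets-complete (suc n) S with subsets-complete n (λ i → S (fs i))
    ... | T , T∈ , h with S fz in e
    ... | true = with-0 T , subst (with-0 T ∈_) (sym eq) (∈-concatMap (λ s → with-0 s ∷ without-0 s ∷ []) T∈ (here refl)) ,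
            λ { fz → trans e (sym (with₀ T)) ; (fs i) → trans (h i) (sym (withₛ T i)) }
      where open Extension (extension n)
    ... | false = without-0 T , subst (without-0 T ∈_) (sym eq) (∈-concatMap (λ s → with-0 s ∷ without-0 s ∷ []) T∈ (there (here refl))) ,
            λ { fz → trans e (sym (without₀ T)) ; (fs i) → trans (h i) (sym (withoutₛ T i)) }
      where open Extension (extension n)

    subsets-distinct : ∀ n → AllPairs (λ S T → ¬ S ≐ T) (subsets M n)
    subsets-distinct zero = [] ∷ []
    subsets-distinct (suc n) = subst (AllPairs _) (sym eq) (go (subsets-distinct n))
      where
      open Extension (extension n)
      f : (Fin n → Bool) → List (Fin (suc n) → Bool)
      f s = with-0 s ∷ without-0 s ∷ []
      tail : ∀ {s T} → T ∈ f s → ∀ i → T (fs i) ≡ s i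
      tail (here refl) = withₛ _
      tail (there (here refl)) = withoutₛ _
      far : ∀ {s ss} → All (λ T → ¬ s ≐ T) ss → ∀ {T} → T ∈ f s → All (λ T′ → ¬ T ≐ T′) (concatMap f ss)
      far {s} {ss} al {T} T∈ = All.tabulate λ {T′} T′∈ h → far′ T′∈ h
        where
        far′ : ∀ {T′} → T′ ∈ concatMap f ss → T ≐ T′ → ⊥
        far′ T′∈ h with MemP.∈-concat⁻′ (map f ss) T′∈
        ... | _ , T′∈l , l∈ with MemP.∈-map⁻ f l∈
        ... | s′ , s′∈ , refl = All.lookup al s′∈ λ i → trans (sym (tail T∈ i)) (trans (h (fs i)) (tail T′∈l i))
      go : ∀ {ss} → AllPairs (λ S T → ¬ S ≐ T) ss → AllPairs (λ S T → ¬ S ≐ T) (concatMap f ss)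
      go [] = []
      go {s ∷ ss} (p ∷ ps) = ((λ h → true≢false (trans (sym (h fz)) (with₀ s)) (without₀ s)) ∷ far p (here refl)) ∷ far p (there (here refl)) ∷ go ps

 -- Words, runs, and the faces that a run closes.

 module Runs where
  open import Data.Nat using (_+_)
  open import Data.List using (_++_; concat)
  import Data.List.Properties as ListP
  import Data.List.Membership.Propositional.Properties as MemP
  open import Data.List.Relation.Binary.Permutation.Propositional as Perm using (_↭_; ↭-refl; ↭-sym; ↭-trans; prep)
  import Data.List.Relation.Binary.Permutation.Propositional.Properties as PermP
  import Data.List.Relation.Binary.Permutation.Setoid.Properties as PermS
  open import Data.List.Relation.Binary.Pointwise using (Pointwise; []; _∷_)
  import Data.List.Relation.Unary.All.Properties as AllP
  open import Relation.Binary.PropositionalEquality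
  open import Relation.Binary.Definitions using (DecidableEquality)

  -- `match` carries the position of the partner, which tells where the block is cut. `merge`
  -- carries nothing: words with merges need not determine a map, and only words without merges are
  -- counted.
  data Word : Set where
    done : Word
    pop forest skip new merge : Word → Word
    match : ℕ → Word → Word

  pops news verts merges : Word → ℕ
  -- The face of the last block is closed by `done` itself.
  pops done = 1
  pops (pop w) = suc (pops w)
  pops (forest w) = pops w
  pops (skip w) = pops w
  pops (new w) = pops w
  pops (match _ w) = pops w
  pops (merge w) = pops w
  news done = 0
  news (pop w) = news w
  news (forest w) = news w
  news (skip w) = news w
  news (new w) = suc (news w)
  news (match _ w) = news w
  news (merge w) = news w
  verts done = 0
  verts (pop w) = verts w
  verts (forest w) = suc (verts w)
  verts (skip w) = verts w
  verts (new w) = suc (verts w)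
  verts (match _ w) = verts w
  verts (merge w) = verts w
  merges done = 0
  merges (pop w) = merges w
  merges (forest w) = merges w
  merges (skip w) = merges w
  merges (new w) = merges w
  merges (match _ w) = merges w
  merges (merge w) = suc (merges w)

  legs : {A : Set} → List A → List A → List (List A) → List A
  legs ps ms st = ps ++ ms ++ concat st

  darts : {A : Set} → List A → List A → List (List A) → List A → List A
  darts ps ms st U = legs ps ms st ++ U

  module _ {A : Set} where

    Unique-resp : {xs ys : List A} → xs ↭ ys → Unique xs → Unique ys
    Unique-resp p u = PermS.Unique-resp-↭ (setoid A) (Perm.↭⇒↭ₛ p) u

    shift₃ : ∀ (R : List A) b x y U → R ++ b ∷ x ∷ y ∷ U ↭ b ∷ x ∷ y ∷ (R ++ U)
    shift₃ R b x y U = ↭-trans (PermP.shift b R _) (prep b (↭-trans (PermP.shift x R _) (prep x (PermP.shift y R _))))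

    darts-attach : ∀ {R U b x y U′} a → U ↭ b ∷ x ∷ y ∷ U′ → a ∷ (R ++ U) ↭ a ∷ b ∷ x ∷ y ∷ (R ++ U′)
    darts-attach {R} a p = prep a (↭-trans (PermP.++⁺ˡ R p) (shift₃ R _ _ _ _))

    legs-skip : ∀ (a : A) ps ms st → legs (a ∷ ps) ms st ↭ legs ps (ms ++ a ∷ []) st
    legs-skip a ps ms st = ↭-trans (↭-trans
      (↭-sym (PermP.shift a ps (ms ++ concat st)))
      (PermP.++⁺ˡ ps (↭-sym (PermP.shift a ms (concat st)))))
      (Perm.↭-reflexive (cong (ps ++_) (sym (ListP.++-assoc ms (a ∷ []) (concat st)))))

    darts-skip : ∀ (a : A) ps ms st U → darts (a ∷ ps) ms st U ↭ darts ps (ms ++ a ∷ []) st U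
    darts-skip a ps ms st U = PermP.++⁺ʳ U (legs-skip a ps ms st)

    legs-match : ∀ (a b : A) l₁ l₂ st → legs [] (a ∷ l₁ ++ b ∷ l₂) st ↭ a ∷ b ∷ legs [] l₁ (l₂ ∷ st)
    legs-match a b l₁ l₂ st = prep a (↭-trans
      (Perm.↭-reflexive (ListP.++-assoc l₁ (b ∷ l₂) (concat st))) (PermP.shift b l₁ _))

    darts-match : ∀ (a b : A) l₁ l₂ st U → darts [] (a ∷ l₁ ++ b ∷ l₂) st U ↭ a ∷ b ∷ darts [] l₁ (l₂ ∷ st) U
    darts-match a b l₁ l₂ st U = PermP.++⁺ʳ U (legs-match a b l₁ l₂ st)

    concat-split : ∀ (s₁ : List (List A)) l s₂ → concat (s₁ ++ l ∷ s₂) ↭ l ++ concat (s₁ ++ s₂)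
    concat-split [] l s₂ = ↭-refl
    concat-split (m ∷ s₁) l s₂ = ↭-trans (PermP.++⁺ˡ m (concat-split s₁ l s₂))
      (↭-trans (Perm.↭-reflexive (sym (ListP.++-assoc m l _)))
      (↭-trans (PermP.++⁺ʳ (concat (s₁ ++ s₂)) (PermP.++-comm m l)) (Perm.↭-reflexive (ListP.++-assoc l m _))))

    -- An edge to another block makes one boundary out of two. After `ms` it runs around the other
    -- block from just behind b, that is, through `l₂` and then `l₁`.
    legs-merge : ∀ (a b : A) ms l₁ l₂ s₁ s₂ →
      legs [] (a ∷ ms) (s₁ ++ (l₁ ++ b ∷ l₂) ∷ s₂) ↭ a ∷ b ∷ legs [] (ms ++ l₂ ++ l₁) (s₁ ++ s₂)
    legs-merge a b ms l₁ l₂ s₁ s₂ = prep a (↭-trans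
      (PermP.++⁺ˡ ms (↭-trans (concat-split s₁ (l₁ ++ b ∷ l₂) s₂) (PermP.++⁺ʳ (concat (s₁ ++ s₂))
         (↭-trans (PermP.shift b l₁ l₂) (prep b (PermP.++-comm l₁ l₂))))))
      (↭-trans (PermP.shift b ms _) (prep b (Perm.↭-reflexive (sym (ListP.++-assoc ms (l₂ ++ l₁) _))))))

    darts-merge : ∀ (a b : A) ms l₁ l₂ s₁ s₂ U →
      darts [] (a ∷ ms) (s₁ ++ (l₁ ++ b ∷ l₂) ∷ s₂) U ↭ a ∷ b ∷ darts [] (ms ++ l₂ ++ l₁) (s₁ ++ s₂) U
    darts-merge a b ms l₁ l₂ s₁ s₂ U = PermP.++⁺ʳ U (legs-merge a b ms l₁ l₂ s₁ s₂)

  -- One edge {a, b} is removed from the darts D, leaving D′.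
  record Resolved {A : Set} (D D′ : List A) (a b : A) : Set where
    field
      a≢b : ¬ a ≡ b
      ≢a : ∀ {z} → z ∈ D′ → ¬ z ≡ a
      ≢b : ∀ {z} → z ∈ D′ → ¬ z ≡ b
      cases : ∀ {z} → z ∈ D → z ≡ a ⊎ z ≡ b ⊎ z ∈ D′
      a∈ : a ∈ D
      b∈ : b ∈ D
      ⊆ : ∀ {z} → z ∈ D′ → z ∈ D
      unique : Unique D′

  resolved : {A : Set} {D D′ : List A} {a b : A} → Unique D → D ↭ a ∷ b ∷ D′ → Resolved D D′ a b
  resolved {A} {D} {D′} {a} {b} u p with Unique-resp p u
  ... | (a# ∷ (b# ∷ u′)) = record
    { a≢b = All.lookup a# (here refl)
    ; ≢a = λ z∈ e → All.lookup a# (there z∈) (sym e)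
    ; ≢b = λ z∈ e → All.lookup b# z∈ (sym e)
    ; cases = λ z∈ → sort (PermP.∈-resp-↭ p z∈)
    ; a∈ = PermP.∈-resp-↭ (↭-sym p) (here refl)
    ; b∈ = PermP.∈-resp-↭ (↭-sym p) (there (here refl))
    ; ⊆ = λ z∈ → PermP.∈-resp-↭ (↭-sym p) (there (there z∈))
    ; unique = u′ }
    where
    sort : ∀ {z} → z ∈ a ∷ b ∷ D′ → z ≡ a ⊎ z ≡ b ⊎ z ∈ D′
    sort (here e) = inj₁ e
    sort (there (here e)) = inj₂ (inj₁ e)
    sort (there (there z∈)) = inj₂ (inj₂ z∈)

  module _ {A : Set} (σ α : A → A) (S : A → Bool) where

    -- a and b = α a form an edge leading to the vertex (b x y), which leaves the unvisited darts.
    record Attach (a b x y : A) (U U′ : List A) : Set where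
      constructor attach
      field
        αa : α a ≡ b
        σb : σ b ≡ x
        σx : σ x ≡ y
        σy : σ y ≡ b
        U↭ : U ↭ b ∷ x ∷ y ∷ U′

    -- Run w ps ms st U: exploring from the state (ps, ms, st, U) follows the word w.  Here ps ++ ms and
    -- the members of st list the unresolved darts on the boundary of each unfinished face, U the darts
    -- at unvisited vertices; the darts in ps may still turn out to belong to the forest.
    data Run : Word → List A → List A → List (List A) → List A → Set where
      done : Run done [] [] [] []
      pop : ∀ {w ms st U} → Run w [] ms st U → Run (pop w) [] [] (ms ∷ st) U
      forest : ∀ {w a b x y ps ms st U U′} → S a ≡ true → S b ≡ true → Attach a b x y U U′ →
        Run w (x ∷ y ∷ ps) ms st U′ → Run (forest w) (a ∷ ps) ms st U
      skip : ∀ {w a ps ms st U} → S a ≡ false → Run w ps (ms ++ a ∷ []) st U → Run (skip w) (a ∷ ps) ms st U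
      new : ∀ {w a b x y ms st U U′} → S a ≡ false → S b ≡ false → Attach a b x y U U′ →
        Run w (x ∷ y ∷ []) ms st U′ → Run (new w) [] (a ∷ ms) st U
      match : ∀ {w i a b ms l₁ l₂ st U} → S a ≡ false → S b ≡ false → α a ≡ b → ms ≡ l₁ ++ b ∷ l₂ → length l₁ ≡ i →
        Run w [] l₁ (l₂ ∷ st) U → Run (match i w) [] (a ∷ ms) st U
      merge : ∀ {w a b ms l₁ l₂ st s₁ s₂ U} → S a ≡ false → S b ≡ false → α a ≡ b → st ≡ s₁ ++ (l₁ ++ b ∷ l₂) ∷ s₂ →
        Run w [] (ms ++ l₂ ++ l₁) (s₁ ++ s₂) U → Run (merge w) [] (a ∷ ms) st U

    U-split : ∀ {a b x y U U′} → Attach a b x y U U′ → ∀ {z} → z ∈ U → z ≡ b ⊎ z ≡ x ⊎ z ≡ y ⊎ z ∈ U′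
    U-split at z∈ with PermP.∈-resp-↭ (Attach.U↭ at) z∈
    ... | here e = inj₁ e
    ... | there (here e) = inj₂ (inj₁ e)
    ... | there (there (here e)) = inj₂ (inj₂ (inj₁ e))
    ... | there (there (there z∈′)) = inj₂ (inj₂ (inj₂ z∈′))

    module _ {a b x y U U′} (at : Attach a b x y U U′) where
      private p = ↭-sym (Attach.U↭ at)
      b∈U : b ∈ U
      b∈U = PermP.∈-resp-↭ p (here refl)
      x∈U : x ∈ U
      x∈U = PermP.∈-resp-↭ p (there (here refl))
      y∈U : y ∈ U
      y∈U = PermP.∈-resp-↭ p (there (there (here refl)))
      U⊇ : ∀ {z} → z ∈ U′ → z ∈ U
      U⊇ z∈ = PermP.∈-resp-↭ p (there (there (there z∈)))

      attach-closed : (∀ {z} → z ∈ U′ → σ z ∈ U′) → ∀ {z} → z ∈ U → σ z ∈ U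
      attach-closed h z∈ with U-split at z∈
      ... | inj₁ refl = subst (_∈ U) (sym (Attach.σb at)) x∈U
      ... | inj₂ (inj₁ refl) = subst (_∈ U) (sym (Attach.σx at)) y∈U
      ... | inj₂ (inj₂ (inj₁ refl)) = subst (_∈ U) (sym (Attach.σy at)) b∈U
      ... | inj₂ (inj₂ (inj₂ z∈′)) = U⊇ (h z∈′)

    U-closed : ∀ {w ps ms st U} → Run w ps ms st U → ∀ {z} → z ∈ U → σ z ∈ U
    U-closed (pop r) = U-closed r
    U-closed (forest _ _ at r) = attach-closed at (U-closed r)
    U-closed (skip _ r) = U-closed r
    U-closed (new _ _ at r) = attach-closed at (U-closed r)
    U-closed (match _ _ _ _ _ r) = U-closed r
    U-closed (merge _ _ _ _ r) = U-closed r

    attach-unique : ∀ {R a b x y U U′} → Unique (a ∷ (R ++ U)) → Attach a b x y U U′ →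
      Resolved (a ∷ (R ++ U)) (x ∷ y ∷ (R ++ U′)) a b
    attach-unique u at = resolved u (darts-attach _ (Attach.U↭ at))

    module Faces (_≟_ : DecidableEquality A) (αα : ∀ z → α (α z) ≡ z)
      (_≈_ : A → A → Set) (≈-refl : ∀ {z} → z ≈ z) (≈-sym : ∀ {y z} → y ≈ z → z ≈ y)
      (≈-trans : ∀ {x y z} → x ≈ y → y ≈ z → x ≈ z) (face : ∀ z → z ≈ σ (α z)) where

      -- Gaps e l e′: the face walk from e passes in turn through the corners before the darts of l.
      Gaps : A → List A → A → Set
      Gaps e [] e′ = e ≈ e′
      Gaps e (u ∷ l) e′ = e ≈ u × Gaps (α u) l e′

      gaps-split : ∀ l₁ {b l₂ e e′} → Gaps e (l₁ ++ b ∷ l₂) e′ → Gaps e l₁ b × Gaps (α b) l₂ e′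
      gaps-split [] (p , q) = p , q
      gaps-split (u ∷ l₁) (p , q) with gaps-split l₁ q
      ... | r , s = (p , r) , s

      gaps-start : ∀ l {d e e′} → d ≈ e → Gaps e l e′ → Gaps d l e′
      gaps-start [] p q = ≈-trans p q
      gaps-start (u ∷ l) p (q , r) = ≈-trans p q , r

      gaps-end : ∀ l {e e′ d} → Gaps e l e′ → e′ ≈ d → Gaps e l d
      gaps-end [] p q = ≈-trans p q
      gaps-end (u ∷ l) (p , r) q = p , gaps-end l r q

      gaps-join : ∀ l₁ {l₂ e m e′} → Gaps e l₁ m → Gaps m l₂ e′ → Gaps e (l₁ ++ l₂) e′
      gaps-join [] {l₂} p q = gaps-start l₂ p q
      gaps-join (u ∷ l₁) (p , r) q = p , gaps-join l₁ r q

      Labels : (A → ℕ) → (A → ℕ) → ℕ → List A → ℕ → Set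
      Labels pre post g [] g′ = g ≡ g′
      Labels pre post g (u ∷ l) g′ = pre u ≡ g × Labels pre post (post u) l g′

      labels-split : ∀ {pre post} l₁ {l₂ g g′} → Labels pre post g (l₁ ++ l₂) g′ →
        ∃ λ h → Labels pre post g l₁ h × Labels pre post h l₂ g′
      labels-split [] p = _ , refl , p
      labels-split (u ∷ l₁) (p , q) with labels-split l₁ q
      ... | h , r , s = h , (p , r) , s

      labels-join : ∀ {pre post} l₁ {l₂ g h g′} → Labels pre post g l₁ h → Labels pre post h l₂ g′ → Labels pre post g (l₁ ++ l₂) g′
      labels-join [] refl q = q
      labels-join (u ∷ l₁) (p , r) q = p , labels-join l₁ r q

      labels-cong : ∀ {pre post pre′ post′} l {g g′} → (∀ {z} → z ∈ l → pre′ z ≡ pre z) → (∀ {z} → z ∈ l → post′ z ≡ post z) →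
        Labels pre post g l g′ → Labels pre′ post′ g l g′
      labels-cong [] hp hq p = p
      labels-cong {post = post} {post′ = post′} (u ∷ l) hp hq (p , q) = trans (hp (here refl)) p ,
        subst (λ k → Labels _ post′ k l _) (sym (hq (here refl))) (labels-cong l (λ z∈ → hp (there z∈)) (λ z∈ → hq (there z∈)) q)

      data Tri (P : A → ℕ → List A → Set) : List A → List ℕ → List (List A) → Set where
        [] : Tri P [] [] []
        _∷_ : ∀ {d k l es gs st} → P d k l → Tri P es gs st → Tri P (d ∷ es) (k ∷ gs) (l ∷ st)

      tri-insert : ∀ {P : A → ℕ → List A → Set} {Q : A → List A → Set} {es₁ s₁ es₂ s₂ gs d k l} → Pointwise Q es₁ s₁ →
        Tri P (es₁ ++ es₂) gs (s₁ ++ s₂) → P d k l →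
        ∃ λ gs′ → Tri P (es₁ ++ d ∷ es₂) gs′ (s₁ ++ l ∷ s₂) × (∀ {m} → m ∈ gs → m ∈ gs′) × k ∈ gs′
      tri-insert [] t p = _ , p ∷ t , there , here refl
      tri-insert (_ ∷ q) (p′ ∷ t) p with tri-insert q t p
      ... | _ , t′ , inc , k∈ = _ , p′ ∷ t′ , (λ { (here e) → here e ; (there m∈) → there (inc m∈) }) , there k∈

      tri-map : ∀ {P P′ : A → ℕ → List A → Set} {es gs st} → (∀ {d k l} → (∀ {z} → z ∈ l → z ∈ concat st) → P d k l → P′ d k l) →
        Tri P es gs st → Tri P′ es gs st
      tri-map f [] = []
      tri-map {st = l ∷ st} f (p ∷ t) = f (λ z∈ → MemP.∈-++⁺ˡ z∈) p ∷
        tri-map (λ sub → f (λ z∈ → MemP.∈-++⁺ʳ l (sub z∈))) t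

      pw-split : ∀ {P : A → List A → Set} {es} s₁ {l s₂} → Pointwise P es (s₁ ++ l ∷ s₂) →
        ∃ λ es₁ → ∃ λ e → ∃ λ es₂ → es ≡ es₁ ++ e ∷ es₂ × Pointwise P es₁ s₁ × P e l × Pointwise P es₂ s₂
      pw-split [] (p ∷ q) = _ , _ , _ , refl , [] , p , q
      pw-split (_ ∷ s₁) (p ∷ q) with pw-split s₁ q
      ... | _ , _ , _ , refl , q₁ , r , q₂ = _ , _ , _ , refl , p ∷ q₁ , r , q₂

      pw-join : ∀ {P : A → List A → Set} {es₁ es₂ s₁ s₂} → Pointwise P es₁ s₁ → Pointwise P es₂ s₂ → Pointwise P (es₁ ++ es₂) (s₁ ++ s₂)
      pw-join [] q = q
      pw-join (p ∷ ps) q = p ∷ pw-join ps q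

      -- The labels around a block close up. The dart d fixes the face of the corner where the block
      -- starts, also when `l` is empty and no label of a dart records it.
      Anchored : (A → ℕ) → (A → ℕ) → (ℕ → A) → ℕ → A → ℕ → List A → Set
      Anchored pre post rep n d k l = Labels pre post k l k × d ≈ rep k × k < n

      -- pre z and post z label the faces of the corners before and after the dart z.
      record Labelling (n : ℕ) (e : A) (top : List A) (es : List A) (st : List (List A)) (U D : List A) : Set where
        field
          pre post : A → ℕ
          rep : ℕ → A
          g : ℕ
          gs : List ℕ
          top-anchored : Anchored pre post rep n e g top
          st-anchored : Tri (Anchored pre post rep n) es gs st
          edge : ∀ {z} → z ∈ D → post (α z) ≡ pre z
          corner : ∀ {z} → z ∈ U → post z ≡ pre (σ z)
          pre< : ∀ {z} → z ∈ D → pre z < n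
          post< : ∀ {z} → z ∈ D → post z < n
          pre≈ : ∀ {z} → z ∈ D → z ≈ rep (pre z)
          onto : ∀ {k} → k < n → k ≡ g ⊎ k ∈ gs ⊎ ∃ λ z → z ∈ D × post z ≡ k

      upd : (A → ℕ) → A → ℕ → A → ℕ → A → ℕ
      upd f a u b v z with z ≟ a | z ≟ b
      ... | yes _ | _ = u
      ... | no _ | yes _ = v
      ... | no _ | no _ = f z

      upd-a : ∀ f a u b v → upd f a u b v a ≡ u
      upd-a f a u b v with a ≟ a | a ≟ b
      ... | yes _ | _ = refl
      ... | no n | _ = ⊥-elim (n refl)

      upd-b : ∀ f a u b v → ¬ a ≡ b → upd f a u b v b ≡ v
      upd-b f a u b v a≢b with b ≟ a | b ≟ b
      ... | yes e | _ = ⊥-elim (a≢b (sym e))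
      ... | no _ | yes _ = refl
      ... | no _ | no n = ⊥-elim (n refl)

      upd-other : ∀ f a u b v {z} → ¬ z ≡ a → ¬ z ≡ b → upd f a u b v z ≡ f z
      upd-other f a u b v {z} na nb with z ≟ a | z ≟ b
      ... | yes e | _ = ⊥-elim (na e)
      ... | no _ | yes e = ⊥-elim (nb e)
      ... | no _ | no _ = refl

      labels-start : ∀ {n e es st U D top} (L : Labelling n e top es st U D) → ∀ l {d h} →
        (∀ {z} → z ∈ l → z ∈ D) → Gaps d l e → Labels (Labelling.pre L) (Labelling.post L) h l (Labelling.g L) → d ≈ Labelling.rep L h
      labels-start L [] sub c refl = ≈-trans c (proj₁ (proj₂ (Labelling.top-anchored L)))
      labels-start L (u ∷ l) sub (p , _) (refl , _) = ≈-trans p (Labelling.pre≈ L (sub (here refl)))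

      module Extend {a b} (α-ab : α a ≡ b) {D D′} (R : Resolved D D′ a b) {n e top es st U} (L : Labelling n e top es st U D′) where
        open Resolved R
        open Labelling L
        α-ba : α b ≡ a
        α-ba = trans (cong α (sym α-ab)) (αα a)

        module _ (h k : ℕ) where
          -- The two sides of the edge: the corners before a and after b lie in one face, those
          -- after a and before b in another or the same.
          pre⁺ post⁺ : A → ℕ
          pre⁺ = upd pre a h b k
          post⁺ = upd post a k b h

          pre-o : ∀ {z} → z ∈ D′ → pre⁺ z ≡ pre z
          pre-o z∈ = upd-other pre a h b k (≢a z∈) (≢b z∈)
          post-o : ∀ {z} → z ∈ D′ → post⁺ z ≡ post z
          post-o z∈ = upd-other post a k b h (≢a z∈) (≢b z∈)
          pre-a : pre⁺ a ≡ h
          pre-a = upd-a pre a h b k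
          pre-b : pre⁺ b ≡ k
          pre-b = upd-b pre a h b k a≢b
          post-a : post⁺ a ≡ k
          post-a = upd-a post a k b h
          post-b : post⁺ b ≡ h
          post-b = upd-b post a k b h a≢b

          labels⁺ : ∀ l {g g′} → (∀ {z} → z ∈ l → z ∈ D′) → Labels pre post g l g′ → Labels pre⁺ post⁺ g l g′
          labels⁺ l sub = labels-cong l (λ z∈ → pre-o (sub z∈)) (λ z∈ → post-o (sub z∈))

          anchored⁺ : ∀ {d m l} → (∀ {z} → z ∈ l → z ∈ D′) → Anchored pre post rep n d m l → Anchored pre⁺ post⁺ rep n d m l
          anchored⁺ {l = l} sub (p , q) = labels⁺ l sub p , q

          tri⁺ : ∀ {es gs st} → (∀ {z} → z ∈ concat st → z ∈ D′) → Tri (Anchored pre post rep n) es gs st → Tri (Anchored pre⁺ post⁺ rep n) es gs st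
          tri⁺ sub = tri-map (λ s → anchored⁺ (λ z∈ → sub (s z∈)))

          edge⁺ : ∀ {z} → z ∈ D → post⁺ (α z) ≡ pre⁺ z
          edge⁺ {z} z∈ with cases z∈
          ... | inj₁ refl = trans (cong post⁺ α-ab) (trans post-b (sym pre-a))
          ... | inj₂ (inj₁ refl) = trans (cong post⁺ α-ba) (trans post-a (sym pre-b))
          ... | inj₂ (inj₂ z∈′) = trans (upd-other post a k b h
                  (λ e → ≢b z∈′ (trans (sym (αα z)) (trans (cong α e) α-ab)))
                  (λ e → ≢a z∈′ (trans (sym (αα z)) (trans (cong α e) α-ba))))
                  (trans (edge z∈′) (sym (pre-o z∈′)))

          pre<⁺ : h < n → k < n → ∀ {z} → z ∈ D → pre⁺ z < n
          pre<⁺ h< k< z∈ with cases z∈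
          ... | inj₁ refl = subst (_< n) (sym pre-a) h<
          ... | inj₂ (inj₁ refl) = subst (_< n) (sym pre-b) k<
          ... | inj₂ (inj₂ z∈′) = subst (_< n) (sym (pre-o z∈′)) (pre< z∈′)

          post<⁺ : h < n → k < n → ∀ {z} → z ∈ D → post⁺ z < n
          post<⁺ h< k< z∈ with cases z∈
          ... | inj₁ refl = subst (_< n) (sym post-a) k<
          ... | inj₂ (inj₁ refl) = subst (_< n) (sym post-b) h<
          ... | inj₂ (inj₂ z∈′) = subst (_< n) (sym (post-o z∈′)) (post< z∈′)

          pre≈⁺ : a ≈ rep h → b ≈ rep k → ∀ {z} → z ∈ D → z ≈ rep (pre⁺ z)
          pre≈⁺ a≈ b≈ z∈ with cases z∈
          ... | inj₁ refl = subst (λ m → a ≈ rep m) (sym pre-a) a≈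
          ... | inj₂ (inj₁ refl) = subst (λ m → b ≈ rep m) (sym pre-b) b≈
          ... | inj₂ (inj₂ z∈′) = subst (λ m → _ ≈ rep m) (sym (pre-o z∈′)) (pre≈ z∈′)

          onto-a : ∃ λ z → z ∈ D × post⁺ z ≡ k
          onto-a = a , a∈ , post-a
          onto-o : ∀ {m} → (∃ λ z → z ∈ D′ × post z ≡ m) → ∃ λ z → z ∈ D × post⁺ z ≡ m
          onto-o (z , z∈ , p) = z , ⊆ z∈ , trans (post-o z∈) p

      -- Attaching a vertex lengthens the face gaps on both sides of the edge, which creates no new face.
      attach-labelling : ∀ {n a b x y U U′ es st} R e l → Attach a b x y U U′ → Resolved (a ∷ (R ++ U)) (x ∷ y ∷ (R ++ U′)) a b →
        (∀ {z} → z ∈ U′ → σ z ∈ U′) → (∀ {z} → z ∈ l → z ∈ R) → (∀ {z} → z ∈ concat st → z ∈ R) → Gaps b l e → e ≈ a →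
        Labelling n e (x ∷ y ∷ l) es st U′ (x ∷ y ∷ (R ++ U′)) → Labelling n e (a ∷ l) es st U (a ∷ (R ++ U))
      attach-labelling {n} {a} {b} {x} {y} {U} {U′} R e l at res cl l⊆ st⊆ gaps e≈a L with Labelling.top-anchored L in top-eq
      ... | (px , py , rest) , e≈g , g<n = record
        { pre = pre⁺ g h ; post = post⁺ g h ; rep = rep ; g = g ; gs = gs
        ; top-anchored = (pre-a g h , subst (λ k → Labels (pre⁺ g h) (post⁺ g h) k l g) (sym (post-a g h)) (labels⁺ g h l in-l rest)) , e≈g , g<n
        ; st-anchored = tri⁺ g h (λ z∈ → there (there (MemP.∈-++⁺ˡ (st⊆ z∈)))) st-anchored
        ; edge = edge⁺ g h
        ; corner = corner⁺
        ; pre< = pre<⁺ g h g<n h<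
        ; post< = post<⁺ g h g<n h<
        ; pre≈ = pre≈⁺ g h (≈-trans (≈-sym e≈a) e≈g) (labels-start L l in-l gaps rest)
        ; onto = onto⁺ }
        where
        open Labelling L
        open Extend (Attach.αa at) res L
        open Resolved res
        h = post y
        x∈ : x ∈ x ∷ y ∷ (R ++ U′)
        x∈ = here refl
        y∈ : y ∈ x ∷ y ∷ (R ++ U′)
        y∈ = there (here refl)
        in-l : ∀ {z} → z ∈ l → z ∈ x ∷ y ∷ (R ++ U′)
        in-l z∈ = there (there (MemP.∈-++⁺ˡ (l⊆ z∈)))
        in-U : ∀ {z} → z ∈ U′ → z ∈ x ∷ y ∷ (R ++ U′)
        in-U z∈ = there (there (MemP.∈-++⁺ʳ R z∈))
        h< : h < n
        h< = post< y∈
        corner⁺ : ∀ {z} → z ∈ U → post⁺ g h z ≡ pre⁺ g h (σ z)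
        corner⁺ z∈ with U-split at z∈
        ... | inj₁ refl = trans (post-b g h) (trans (sym px) (trans (sym (pre-o g h x∈)) (cong (pre⁺ g h) (sym (Attach.σb at)))))
        ... | inj₂ (inj₁ refl) = trans (post-o g h x∈) (trans (sym py) (trans (sym (pre-o g h y∈)) (cong (pre⁺ g h) (sym (Attach.σx at)))))
        ... | inj₂ (inj₂ (inj₁ refl)) = trans (post-o g h y∈) (trans (sym (pre-b g h)) (cong (pre⁺ g h) (sym (Attach.σy at))))
        ... | inj₂ (inj₂ (inj₂ z∈′)) = trans (post-o g h (in-U z∈′)) (trans (corner z∈′) (sym (pre-o g h (in-U (cl z∈′)))))
        onto⁺ : ∀ {k} → k < n → k ≡ g ⊎ k ∈ gs ⊎ ∃ λ z → z ∈ a ∷ (R ++ U) × post⁺ g h z ≡ k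
        onto⁺ k< with onto k<
        ... | inj₁ e = inj₁ e
        ... | inj₂ (inj₁ k∈) = inj₂ (inj₁ k∈)
        ... | inj₂ (inj₂ w) = inj₂ (inj₂ (onto-o g h w))

      attach-gaps : ∀ {a b x y U U′ e l} → Attach a b x y U U′ → e ≈ a → Gaps b l e → Gaps e (x ∷ y ∷ l) e
      attach-gaps {a} {b} {x} {y} {l = l} at e≈a gb =
        ≈-trans e≈a (subst (a ≈_) (trans (cong σ αa) σb) (face a)) ,
        subst (α x ≈_) (trans (cong σ (αα x)) σx) (face (α x)) ,
        gaps-start l (subst (α y ≈_) (trans (cong σ (αα y)) σy) (face (α y))) gb
        where open Attach at

      labelling-⊆ : ∀ {n e top es st U D D′} → (∀ {z} → z ∈ D → z ∈ D′) → (∀ {z} → z ∈ D′ → z ∈ D) →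
        Labelling n e top es st U D → Labelling n e top es st U D′
      labelling-⊆ f g L = record
        { Labelling L
        ; edge = λ z∈ → Labelling.edge L (g z∈) ; pre< = λ z∈ → Labelling.pre< L (g z∈)
        ; post< = λ z∈ → Labelling.post< L (g z∈) ; pre≈ = λ z∈ → Labelling.pre≈ L (g z∈)
        ; onto = λ k< → onto-⊆ (Labelling.onto L k<) }
        where
        onto-⊆ : ∀ {k} → k ≡ Labelling.g L ⊎ k ∈ Labelling.gs L ⊎ (∃ λ z → z ∈ _ × Labelling.post L z ≡ k) → _
        onto-⊆ (inj₁ e) = inj₁ e
        onto-⊆ (inj₂ (inj₁ k∈)) = inj₂ (inj₁ k∈)
        onto-⊆ (inj₂ (inj₂ (z , z∈ , p))) = inj₂ (inj₂ (z , f z∈ , p))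

      -- When the current block is empty, its boundary has been walked completely. This is the only
      -- step that introduces a face: it receives the label n, represented by e.
      pop-labelling : ∀ {n e l d es st U D} → Labelling n d l es st U D → Labelling (suc n) e [] (d ∷ es) (l ∷ st) U D
      pop-labelling {n} {e} {D = D} L = record
        { pre = pre ; post = post ; rep = rep⁺ ; g = n ; gs = g ∷ gs
        ; top-anchored = refl , subst (e ≈_) (sym rep-new) ≈-refl , ℕP.≤-refl
        ; st-anchored = up top-anchored ∷ tri-map (λ _ → up) st-anchored
        ; edge = edge ; corner = corner ; pre< = λ z∈ → ℕP.m≤n⇒m≤1+n (pre< z∈) ; post< = λ z∈ → ℕP.m≤n⇒m≤1+n (post< z∈)
        ; pre≈ = λ z∈ → subst (_ ≈_) (sym (rep-old (pre< z∈))) (pre≈ z∈)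
        ; onto = onto⁺ }
        where
        open Labelling L
        rep⁺ : ℕ → A
        rep⁺ k with k ℕ.≟ n
        ... | yes _ = e
        ... | no _ = rep k
        rep-new : rep⁺ n ≡ e
        rep-new with n ℕ.≟ n
        ... | yes _ = refl
        ... | no ne = ⊥-elim (ne refl)
        rep-old : ∀ {k} → k < n → rep⁺ k ≡ rep k
        rep-old {k} k< with k ℕ.≟ n
        ... | yes e = ⊥-elim (ℕP.<⇒≢ k< e)
        ... | no _ = refl
        up : ∀ {d k l} → Anchored pre post rep n d k l → Anchored pre post rep⁺ (suc n) d k l
        up (p , q , k<) = p , subst (_ ≈_) (sym (rep-old k<)) q , ℕP.m≤n⇒m≤1+n k<
        onto⁺ : ∀ {k} → k < suc n → k ≡ n ⊎ k ∈ g ∷ gs ⊎ ∃ λ z → z ∈ D × post z ≡ k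
        onto⁺ k< with ℕP.m≤n⇒m<n∨m≡n (ℕP.≤-pred k<)
        ... | inj₂ e = inj₁ e
        ... | inj₁ k<′ with onto k<′
        ... | inj₁ e = inj₂ (inj₁ (here e))
        ... | inj₂ (inj₁ k∈) = inj₂ (inj₁ (there k∈))
        ... | inj₂ (inj₂ w) = inj₂ (inj₂ w)

      -- Skipping turns the block cyclically past a, so that its walk starts at α a. The label h
      -- reached after `l` is the one in front of a, where the unturned block starts.
      skip-labelling : ∀ {n a e l es st U D} → a ∈ D → e ≈ a → Labelling n (α a) (l ++ a ∷ []) es st U D → Labelling n e (a ∷ l) es st U D
      skip-labelling {n} {a} {e} {l} {D = D} a∈ e≈a L with labels-split l (proj₁ (Labelling.top-anchored L))
      ... | h , p , (pa , q) = record
          { pre = pre ; post = post ; rep = rep ; g = h ; gs = gs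
          ; top-anchored = (pa , subst (λ k → Labels pre post k l h) (sym q) p) ,
              subst (λ k → e ≈ rep k) pa (≈-trans e≈a (pre≈ a∈)) , subst (_< n) pa (pre< a∈)
          ; st-anchored = st-anchored
          ; edge = edge ; corner = corner ; pre< = pre< ; post< = post< ; pre≈ = pre≈
          ; onto = λ k< → onto⁺ (onto k<) }
          where
          open Labelling L
          onto⁺ : ∀ {k} → k ≡ g ⊎ k ∈ gs ⊎ (∃ λ z → z ∈ D × post z ≡ k) → k ≡ h ⊎ k ∈ gs ⊎ (∃ λ z → z ∈ D × post z ≡ k)
          onto⁺ (inj₁ e) = inj₂ (inj₂ (a , a∈ , trans q (sym e)))
          onto⁺ (inj₂ w) = inj₂ w

      -- A matched edge cuts the block in two; both gaps around it close up inside one part each.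
      match-labelling : ∀ {n a b e es l₁ l₂ st U D D′} → α a ≡ b → Resolved D D′ a b →
        (∀ {z} → z ∈ U → σ z ∈ U) → (∀ {z} → z ∈ l₁ → z ∈ D′) → (∀ {z} → z ∈ l₂ → z ∈ D′) →
        (∀ {z} → z ∈ concat st → z ∈ D′) → (∀ {z} → z ∈ U → z ∈ D′) → e ≈ a →
        Labelling n b l₁ (a ∷ es) (l₂ ∷ st) U D′ → Labelling n e (a ∷ l₁ ++ b ∷ l₂) es st U D
      match-labelling {n} {a} {b} {e} {es} {l₁} {l₂} {st} {U} {D} {D′} αab res cl in₁ in₂ in-st in-U e≈a L = split _ refl (Labelling.st-anchored L)
        where
        open Labelling L
        open Extend αab res L
        split : ∀ gs₀ → gs₀ ≡ gs → Tri (Anchored pre post rep n) (a ∷ es) gs₀ (l₂ ∷ st) → Labelling n e (a ∷ l₁ ++ b ∷ l₂) es st U D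
        split (k ∷ gs′) eq ((p₂ , a≈ , k<) ∷ t) = record
          { pre = pre⁺ k g ; post = post⁺ k g ; rep = rep ; g = k ; gs = gs′
          ; top-anchored = (pre-a k g , labels-join l₁ (subst (λ h → Labels (pre⁺ k g) (post⁺ k g) h l₁ g) (sym (post-a k g)) (labels⁺ k g l₁ in₁ (proj₁ top-anchored)))
               (pre-b k g , subst (λ h → Labels (pre⁺ k g) (post⁺ k g) h l₂ k) (sym (post-b k g)) (labels⁺ k g l₂ in₂ p₂))) , ≈-trans e≈a a≈ , k<
          ; st-anchored = tri⁺ k g in-st t
          ; edge = edge⁺ k g
          ; corner = λ z∈ → trans (post-o k g (in-U z∈)) (trans (corner z∈) (sym (pre-o k g (in-U (cl z∈)))))
          ; pre< = pre<⁺ k g k< g< ; post< = post<⁺ k g k< g<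
          ; pre≈ = pre≈⁺ k g a≈ (proj₁ (proj₂ top-anchored))
          ; onto = λ m< → onto⁺ (onto m<) }
          where
          g< = proj₂ (proj₂ top-anchored)
          onto⁺ : ∀ {m} → m ≡ g ⊎ m ∈ gs ⊎ (∃ λ z → z ∈ D′ × post z ≡ m) → m ≡ k ⊎ m ∈ gs′ ⊎ (∃ λ z → z ∈ D × post⁺ k g z ≡ m)
          onto⁺ (inj₁ e) = inj₂ (inj₂ (subst (λ m → ∃ λ z → z ∈ D × post⁺ k g z ≡ m) (sym e) (onto-a k g)))
          onto⁺ (inj₂ (inj₁ m∈)) with subst (_ ∈_) (sym eq) m∈
          ... | here e = inj₁ e
          ... | there m∈′ = inj₂ (inj₁ m∈′)
          onto⁺ (inj₂ (inj₂ w)) = inj₂ (inj₂ (onto-o k g w))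

      -- Around the joined block the labels go from g to h along `ms`, from h to k along `l₂` and
      -- from k back to g along `l₁`. Giving a the labels h, g and b the labels g, h closes up both
      -- original blocks: the current one starts at h, the other at k.
      merge-labelling : ∀ {n a b e d es₁ es₂ ms l₁ l₂ s₁ s₂ U D D′} {Q : A → List A → Set} → α a ≡ b → Resolved D D′ a b →
        (∀ {z} → z ∈ U → σ z ∈ U) → (∀ {z} → z ∈ ms ++ l₂ ++ l₁ → z ∈ D′) →
        (∀ {z} → z ∈ concat (s₁ ++ s₂) → z ∈ D′) → (∀ {z} → z ∈ U → z ∈ D′) → e ≈ a →
        Gaps a (l₂ ++ l₁) b → Gaps d l₁ b → Pointwise Q es₁ s₁ →
        Labelling n b (ms ++ l₂ ++ l₁) (es₁ ++ es₂) (s₁ ++ s₂) U D′ →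
        Labelling n e (a ∷ ms) (es₁ ++ d ∷ es₂) (s₁ ++ (l₁ ++ b ∷ l₂) ∷ s₂) U D
      merge-labelling {n} {a} {b} {e} {d} {es₁} {es₂} {ms} {l₁} {l₂} {s₁} {s₂} {U} {D} {D′} αab res cl in-top in-st in-U e≈a ga gd pw L
        with labels-split ms (proj₁ (Labelling.top-anchored L))
      ... | h , pm , p with labels-split l₂ p
      ... | k , p₂ , p₁ = record
          { pre = pre⁺ h g ; post = post⁺ h g ; rep = rep ; g = h ; gs = proj₁ ins
          ; top-anchored = (pre-a h g , subst (λ m → Labels (pre⁺ h g) (post⁺ h g) m ms h) (sym (post-a h g)) (labels⁺ h g ms in-ms pm)) , ≈-trans e≈a a≈h , h<
          ; st-anchored = proj₁ (proj₂ ins)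
          ; edge = edge⁺ h g
          ; corner = λ z∈ → trans (post-o h g (in-U z∈)) (trans (corner z∈) (sym (pre-o h g (in-U (cl z∈)))))
          ; pre< = pre<⁺ h g h< g< ; post< = post<⁺ h g h< g<
          ; pre≈ = pre≈⁺ h g a≈h b≈g
          ; onto = λ m< → onto⁺ (onto m<) }
          where
          open Labelling L
          open Extend αab res L
          g< = proj₂ (proj₂ top-anchored)
          in-ms : ∀ {z} → z ∈ ms → z ∈ D′
          in-ms z∈ = in-top (MemP.∈-++⁺ˡ z∈)
          in₂ : ∀ {z} → z ∈ l₂ → z ∈ D′
          in₂ z∈ = in-top (MemP.∈-++⁺ʳ ms (MemP.∈-++⁺ˡ z∈))
          in₁ : ∀ {z} → z ∈ l₁ → z ∈ D′
          in₁ z∈ = in-top (MemP.∈-++⁺ʳ ms (MemP.∈-++⁺ʳ l₂ z∈))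
          b≈g : b ≈ rep g
          b≈g = proj₁ (proj₂ top-anchored)
          last≈ : ∀ l {d m} → (∀ {z} → z ∈ l → z ∈ D′) → Gaps d l b → Labels pre post m l g → d ≈ rep m
          last≈ [] sub c refl = ≈-trans c b≈g
          last≈ (u ∷ l) sub (c , _) (refl , _) = ≈-trans c (pre≈ (sub (here refl)))
          a≈h : a ≈ rep h
          a≈h = last≈ (l₂ ++ l₁) (λ z∈ → in-top (MemP.∈-++⁺ʳ ms z∈)) ga p
          d≈k : d ≈ rep k
          d≈k = last≈ l₁ in₁ gd p₁
          last< : ∀ l {m m′} → (∀ {z} → z ∈ l → z ∈ D′) → m < n → Labels pre post m l m′ → m′ < n
          last< [] sub m< refl = m<
          last< (z ∷ l) sub m< (_ , q) = last< l (λ z∈ → sub (there z∈)) (post< (sub (here refl))) q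
          h< : h < n
          h< = last< ms in-ms g< pm
          k< : k < n
          k< = last< l₂ in₂ h< p₂
          block : Labels (pre⁺ h g) (post⁺ h g) k (l₁ ++ b ∷ l₂) k
          block = labels-join l₁ (labels⁺ h g l₁ in₁ p₁)
            (pre-b h g , subst (λ m → Labels (pre⁺ h g) (post⁺ h g) m l₂ k) (sym (post-b h g)) (labels⁺ h g l₂ in₂ p₂))
          ins : ∃ λ gs′ → Tri (Anchored (pre⁺ h g) (post⁺ h g) rep n) (es₁ ++ d ∷ es₂) gs′ (s₁ ++ (l₁ ++ b ∷ l₂) ∷ s₂) × (∀ {m} → m ∈ gs → m ∈ gs′) × k ∈ gs′
          ins = tri-insert pw (tri⁺ h g in-st st-anchored) (block , d≈k , k<)
          onto⁺ : ∀ {m} → m ≡ g ⊎ m ∈ gs ⊎ (∃ λ z → z ∈ D′ × post z ≡ m) → m ≡ h ⊎ m ∈ proj₁ ins ⊎ (∃ λ z → z ∈ D × post⁺ h g z ≡ m)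
          onto⁺ (inj₁ e) = inj₂ (inj₂ (subst (λ m → ∃ λ z → z ∈ D × post⁺ h g z ≡ m) (sym e) (onto-a h g)))
          onto⁺ (inj₂ (inj₁ m∈)) = inj₂ (inj₁ (proj₁ (proj₂ (proj₂ ins)) m∈))
          onto⁺ (inj₂ (inj₂ w)) = inj₂ (inj₂ (onto-o h g w))

      -- The labelling is built backwards from the end of the run. Every letter extends it to the
      -- edge that it resolves; only `pop` and `done` use a new label. The induction keeps track of
      -- the corners at which blocks start, because an empty block has no dart to carry its face.
      faces : ∀ {w ps ms st U} → Run w ps ms st U → Unique (darts ps ms st U) → ∀ {e es} → Gaps e (ps ++ ms) e →
        Pointwise (λ d l → Gaps d l d) es st → Labelling (pops w) e (ps ++ ms) es st U (darts ps ms st U)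
      faces done u {e} ge [] = record
        { pre = λ _ → 0 ; post = λ _ → 0 ; rep = λ _ → e ; g = 0 ; gs = []
        ; top-anchored = refl , ≈-refl , s≤s z≤n ; st-anchored = []
        ; edge = λ () ; corner = λ () ; pre< = λ () ; post< = λ () ; pre≈ = λ ()
        ; onto = λ { (s≤s z≤n) → inj₁ refl } }
      faces (pop r) u ge (gd ∷ gst) = pop-labelling (faces r u gd gst)
      faces (forest {a = a} {b} {x} {y} {ps} {ms} {st} _ _ at r) u {e} (e≈a , ge) gst =
        attach-labelling (legs ps ms st) e (ps ++ ms) at res (U-closed r) in-R st-R gb e≈a
          (faces r (Resolved.unique res) (attach-gaps {l = ps ++ ms} at e≈a gb) gst)
        where
        res = attach-unique {legs ps ms st} u at
        gb : Gaps b (ps ++ ms) e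
        gb = subst (λ d → Gaps d (ps ++ ms) e) (Attach.αa at) ge
        in-R : ∀ {z} → z ∈ ps ++ ms → z ∈ legs ps ms st
        in-R z∈ with MemP.∈-++⁻ ps z∈
        ... | inj₁ p = MemP.∈-++⁺ˡ p
        ... | inj₂ q = MemP.∈-++⁺ʳ ps (MemP.∈-++⁺ˡ q)
        st-R : ∀ {z} → z ∈ concat st → z ∈ legs ps ms st
        st-R z∈ = MemP.∈-++⁺ʳ ps (MemP.∈-++⁺ʳ ms z∈)
      faces (new {a = a} {b} {x} {y} {ms} {st} _ _ at r) u {e} (e≈a , ge) gst =
        attach-labelling (legs [] ms st) e ms at res (U-closed r) MemP.∈-++⁺ˡ (MemP.∈-++⁺ʳ ms) gb e≈a
          (faces r (Resolved.unique res) (attach-gaps {l = ms} at e≈a gb) gst)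
        where
        res = attach-unique {legs [] ms st} u at
        gb : Gaps b ms e
        gb = subst (λ d → Gaps d ms e) (Attach.αa at) ge
      faces (skip {a = a} {ps} {ms} {st} {U} _ r) u {e} (e≈a , ge) gst =
        labelling-⊆ (PermP.∈-resp-↭ (↭-sym perm)) (PermP.∈-resp-↭ perm)
          (skip-labelling (PermP.∈-resp-↭ perm (here refl)) e≈a
            (subst (λ l → Labelling _ (α a) l _ st U (darts ps (ms ++ a ∷ []) st U)) (sym assoc)
              (faces r (Unique-resp perm u) (subst (λ l → Gaps (α a) l (α a)) assoc (gaps-join (ps ++ ms) ge (e≈a , ≈-refl))) gst)))
        where
        perm = darts-skip a ps ms st U
        assoc : (ps ++ ms) ++ a ∷ [] ≡ ps ++ ms ++ a ∷ []
        assoc = ListP.++-assoc ps ms (a ∷ [])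
      faces (match {a = a} {b} {l₁ = l₁} {l₂} {st} {U} _ _ αab refl _ r) u {e} (e≈a , ge) gst =
        match-labelling αab res (U-closed r) (λ z∈ → MemP.∈-++⁺ˡ (MemP.∈-++⁺ˡ z∈)) (λ z∈ → MemP.∈-++⁺ˡ (MemP.∈-++⁺ʳ l₁ (MemP.∈-++⁺ˡ z∈)))
          (λ z∈ → MemP.∈-++⁺ˡ (MemP.∈-++⁺ʳ l₁ (MemP.∈-++⁺ʳ l₂ z∈))) (MemP.∈-++⁺ʳ (legs [] l₁ (l₂ ∷ st))) e≈a
          (faces r (Resolved.unique res) g₁ (g₂ ∷ gst))
        where
        res = resolved u (darts-match a b l₁ l₂ st U)
        g₁ : Gaps b l₁ b
        g₁ = subst (λ d → Gaps d l₁ b) αab (proj₁ (gaps-split l₁ ge))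
        g₂ : Gaps a l₂ a
        g₂ = gaps-end l₂ (subst (λ d → Gaps d l₂ e) (trans (cong α (sym αab)) (αα a)) (proj₂ (gaps-split l₁ ge))) e≈a
      faces (merge {a = a} {b} {ms} {l₁} {l₂} {s₁ = s₁} {s₂} {U} _ _ αab refl r) u {e} (e≈a , ge) gst with pw-split s₁ gst
      ... | es₁ , d , es₂ , refl , gs₁ , gd , gs₂ =
        merge-labelling αab res (U-closed r) (λ z∈ → MemP.∈-++⁺ˡ (MemP.∈-++⁺ˡ z∈))
          (λ z∈ → MemP.∈-++⁺ˡ (MemP.∈-++⁺ʳ (ms ++ l₂ ++ l₁) z∈)) (MemP.∈-++⁺ʳ (legs [] (ms ++ l₂ ++ l₁) (s₁ ++ s₂))) e≈a
          ga (proj₁ (gaps-split l₁ gd)) gs₁ (faces r (Resolved.unique res) (gaps-join ms gb ga) (pw-join gs₁ gs₂))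
        where
        res = resolved u (darts-merge a b ms l₁ l₂ s₁ s₂ U)
        gb : Gaps b ms a
        gb = gaps-end ms (subst (λ c → Gaps c ms e) αab ge) e≈a
        ga : Gaps a (l₂ ++ l₁) b
        ga = gaps-join l₂ (subst (λ c → Gaps c l₂ d) (trans (cong α (sym αab)) (αα a)) (proj₂ (gaps-split l₁ gd))) (proj₁ (gaps-split l₁ gd))

 -- Vertices, forest components and connectedness along a run.

 module Forward where
  open Runs
  open import Data.Nat using (_+_)
  open import Data.List using (_++_; concat)
  import Data.List.Properties as ListP
  import Data.List.Membership.Propositional.Properties as MemP
  open import Data.List.Relation.Binary.Permutation.Propositional as Perm using (_↭_; ↭-refl; ↭-sym; ↭-trans; prep)
  import Data.List.Relation.Binary.Permutation.Propositional.Properties as PermP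
  import Data.List.Relation.Binary.Permutation.Setoid.Properties as PermS
  open import Data.List.Relation.Binary.Pointwise using (Pointwise; []; _∷_)
  import Data.List.Relation.Unary.All.Properties as AllP
  open import Relation.Binary.PropositionalEquality
  open import Relation.Binary.Definitions using (DecidableEquality)

  module Marks {A : Set} (σ α : A → A) (S : A → Bool) (_≟_ : DecidableEquality A) (αα : ∀ z → α (α z) ≡ z) where

    set₃ : (A → ℕ) → A → A → A → ℕ → A → ℕ
    set₃ f b x y v z with z ≟ b | z ≟ x | z ≟ y
    ... | yes _ | _ | _ = v
    ... | no _ | yes _ | _ = v
    ... | no _ | no _ | yes _ = v
    ... | no _ | no _ | no _ = f z

    set₃-b : ∀ f b x y v → set₃ f b x y v b ≡ v
    set₃-b f b x y v with b ≟ b | b ≟ x | b ≟ y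
    ... | yes _ | _ | _ = refl
    ... | no ne | _ | _ = ⊥-elim (ne refl)
    set₃-x : ∀ f b x y v → set₃ f b x y v x ≡ v
    set₃-x f b x y v with x ≟ b | x ≟ x | x ≟ y
    ... | yes _ | _ | _ = refl
    ... | no _ | yes _ | _ = refl
    ... | no _ | no ne | _ = ⊥-elim (ne refl)
    set₃-y : ∀ f b x y v → set₃ f b x y v y ≡ v
    set₃-y f b x y v with y ≟ b | y ≟ x | y ≟ y
    ... | yes _ | _ | _ = refl
    ... | no _ | yes _ | _ = refl
    ... | no _ | no _ | yes _ = refl
    ... | no _ | no _ | no ne = ⊥-elim (ne refl)
    set₃-other : ∀ f b x y v {z} → ¬ z ≡ b → ¬ z ≡ x → ¬ z ≡ y → set₃ f b x y v z ≡ f z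
    set₃-other f b x y v {z} nb nx ny with z ≟ b | z ≟ x | z ≟ y
    ... | yes e | _ | _ = ⊥-elim (nb e)
    ... | no _ | yes e | _ = ⊥-elim (nx e)
    ... | no _ | no _ | yes e = ⊥-elim (ny e)
    ... | no _ | no _ | no _ = refl

    setℕ : (ℕ → A) → ℕ → A → ℕ → A
    setℕ f k b l with l ℕ.≟ k
    ... | yes _ = b
    ... | no _ = f l
    setℕ-new : ∀ f k b → setℕ f k b k ≡ b
    setℕ-new f k b with k ℕ.≟ k
    ... | yes _ = refl
    ... | no ne = ⊥-elim (ne refl)
    setℕ-old : ∀ f k b {l} → l < k → setℕ f k b l ≡ f l
    setℕ-old f k b {l} l< with l ℕ.≟ k
    ... | yes e = ⊥-elim (ℕP.<⇒≢ l< e)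
    ... | no _ = refl

    unique-++ʳ : ∀ (R : List A) {U} → Unique (R ++ U) → Unique U
    unique-++ʳ [] u = u
    unique-++ʳ (_ ∷ R) (_ ∷ u) = unique-++ʳ R u

    disjoint-++ : ∀ (R : List A) {U z} → Unique (R ++ U) → z ∈ R → ¬ z ∈ U
    disjoint-++ (r ∷ R) (p ∷ u) (here refl) z∈U = All.lookup p (MemP.∈-++⁺ʳ R z∈U) refl
    disjoint-++ (r ∷ R) (p ∷ u) (there z∈) z∈U = disjoint-++ R u z∈ z∈U

    record Fresh (R : List A) (a b x y : A) (U U′ : List A) : Set where
      field
        b∉ : ¬ b ∈ U′
        x∉ : ¬ x ∈ U′
        y∉ : ¬ y ∈ U′
        leg∉ : ∀ {z} → z ∈ a ∷ R → ¬ z ∈ U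
        a∉′ : ¬ a ∈ U′
        leg≢b : ∀ {z} → z ∈ a ∷ R → ¬ z ≡ b
        leg≢x : ∀ {z} → z ∈ a ∷ R → ¬ z ≡ x
        leg≢y : ∀ {z} → z ∈ a ∷ R → ¬ z ≡ y

    fresh : ∀ {R a b x y U U′} → Unique (a ∷ R ++ U) → Attach σ α S a b x y U U′ → Fresh R a b x y U U′
    fresh {R} {a} {b} {x} {y} {U} {U′} u at with Unique-resp (Attach.U↭ at) (unique-++ʳ (a ∷ R) u)
    ... | pb ∷ px ∷ py ∷ _ = record
      { b∉ = λ i → All.lookup pb (there (there i)) refl
      ; x∉ = λ i → All.lookup px (there i) refl
      ; y∉ = λ i → All.lookup py i refl
      ; leg∉ = dis
      ; a∉′ = λ i → dis (here refl) (U⊇ σ α S at i)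
      ; leg≢b = λ i e → dis i (subst (_∈ U) (sym e) (b∈U σ α S at))
      ; leg≢x = λ i e → dis i (subst (_∈ U) (sym e) (x∈U σ α S at))
      ; leg≢y = λ i e → dis i (subst (_∈ U) (sym e) (y∈U σ α S at)) }
      where
      dis : ∀ {z} → z ∈ a ∷ R → ¬ z ∈ U
      dis = disjoint-++ (a ∷ R) u

    module Set₃ {R a b x y U U′} (at : Attach σ α S a b x y U U′) (F : Fresh R a b x y U U′)
      (f t : A → ℕ) (v : ℕ) (outside′ : ∀ {z} → ¬ z ∈ U′ → t z ≡ set₃ f b x y v z) where
      open Fresh F
      t-b : t b ≡ v
      t-b = trans (outside′ b∉) (set₃-b f b x y v)
      t-x : t x ≡ v
      t-x = trans (outside′ x∉) (set₃-x f b x y v)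
      t-y : t y ≡ v
      t-y = trans (outside′ y∉) (set₃-y f b x y v)
      outside⁺ : ∀ {z} → ¬ z ∈ U → t z ≡ f z
      outside⁺ z∉ = trans (outside′ (λ i → z∉ (U⊇ σ α S at i)))
        (set₃-other f b x y v (λ e → z∉ (subst (_∈ U) (sym e) (b∈U σ α S at)))
          (λ e → z∉ (subst (_∈ U) (sym e) (x∈U σ α S at))) (λ e → z∉ (subst (_∈ U) (sym e) (y∈U σ α S at))))
      t-a : t a ≡ f a
      t-a = outside⁺ (leg∉ (here refl))
      corner⁺ : (∀ {z} → z ∈ U′ → t (σ z) ≡ t z) → ∀ {z} → z ∈ U → t (σ z) ≡ t z
      corner⁺ h z∈ with U-split σ α S at z∈
      ... | inj₁ refl = trans (cong t (Attach.σb at)) (trans t-x (sym t-b))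
      ... | inj₂ (inj₁ refl) = trans (cong t (Attach.σx at)) (trans t-y (sym t-x))
      ... | inj₂ (inj₂ (inj₁ refl)) = trans (cong t (Attach.σy at)) (trans t-b (sym t-y))
      ... | inj₂ (inj₂ (inj₂ z∈′)) = h z∈′
      on-U : (P : ℕ → Set) → P v → (∀ {z} → z ∈ U′ → P (t z)) → ∀ {z} → z ∈ U → P (t z)
      on-U P pv h z∈ with U-split σ α S at z∈
      ... | inj₁ refl = subst P (sym t-b) pv
      ... | inj₂ (inj₁ refl) = subst P (sym t-x) pv
      ... | inj₂ (inj₂ (inj₁ refl)) = subst P (sym t-y) pv
      ... | inj₂ (inj₂ (inj₂ z∈′)) = h z∈′
      legs⁺ : (P : A → ℕ → Set) → P x v → P y v → (∀ {z} → z ∈ a ∷ R → P z (f z)) → ∀ {z} → z ∈ x ∷ y ∷ R → P z (set₃ f b x y v z)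
      legs⁺ P px py h (here refl) = subst (P x) (sym (set₃-x f b x y v)) px
      legs⁺ P px py h (there (here refl)) = subst (P y) (sym (set₃-y f b x y v)) py
      legs⁺ P px py h (there (there z∈)) = subst (P _) (sym (set₃-other f b x y v (leg≢b (there z∈)) (leg≢x (there z∈)) (leg≢y (there z∈)))) (h (there z∈))

    -- t numbers the vertices by time of discovery; rep gives the dart through which a vertex was reached.
    record Timing (k m : ℕ) (t₀ : A → ℕ) (rep₀ : ℕ → A) (U D : List A) : Set where
      field
        t : A → ℕ
        rep : ℕ → A
        outside : ∀ {z} → ¬ z ∈ U → t z ≡ t₀ z
        rep-old : ∀ {l} → l < k → rep l ≡ rep₀ l
        corner : ∀ {z} → z ∈ U → t (σ z) ≡ t z
        lower : ∀ {z} → z ∈ U → k ≤ t z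
        upper : ∀ {z} → z ∈ U → t z < k + m
        orbit : ∀ {z} → z ∈ U → z ≡ rep (t z) ⊎ z ≡ σ (rep (t z)) ⊎ z ≡ σ (σ (rep (t z)))
        cube : ∀ {z} → z ∈ U → σ (σ (σ z)) ≡ z
        rep∈ : ∀ {l} → k ≤ l → l < k + m → rep l ∈ U × t (rep l) ≡ l
        parent : ∀ {z} → z ∈ D → S z ≡ true → (t (α z) < t z × z ≡ rep (t z)) ⊎ (t z < t (α z) × α z ≡ rep (t (α z)))

    timing-⊆ : ∀ {k m t₀ rep₀ U D D′} → (∀ {z} → z ∈ D → S z ≡ true → z ∈ D′) → Timing k m t₀ rep₀ U D′ → Timing k m t₀ rep₀ U D
    timing-⊆ f T = record { Timing T ; parent = λ z∈ s → Timing.parent T (f z∈ s) s }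

    -- The new vertex gets the time k and b as its entry dart. As a lies at an older vertex, the
    -- edge leads from b to the parent of the new vertex, which is what `parent` asks.
    timing-attach : ∀ {k m t₀ rep₀ R a b x y U U′} (at : Attach σ α S a b x y U U′) → Unique (a ∷ R ++ U) →
      Resolved (a ∷ (R ++ U)) (x ∷ y ∷ (R ++ U′)) a b → t₀ a < k →
      Timing (suc k) m (set₃ t₀ b x y k) (setℕ rep₀ k b) U′ (x ∷ y ∷ (R ++ U′)) → Timing k (suc m) t₀ rep₀ U (a ∷ (R ++ U))
    timing-attach {k} {m} {t₀} {rep₀} {R} {a} {b} {x} {y} {U} {U′} at u res a<k T = record
      { t = t ; rep = rep ; outside = outside⁺
      ; rep-old = λ l< → trans (rep-old (ℕP.m≤n⇒m≤1+n l<)) (setℕ-old rep₀ k b l<)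
      ; corner = corner⁺ corner
      ; lower = on-U (k ≤_) ℕP.≤-refl (λ z∈ → ℕP.<⇒≤ (lower z∈))
      ; upper = on-U (_< k + suc m) (ℕP.m<m+n k (s≤s z≤n)) (λ {z} z∈ → subst (t z <_) (sym (ℕP.+-suc k m)) (upper z∈))
      ; orbit = orbit⁺ ; cube = cube⁺ ; rep∈ = rep∈⁺ ; parent = parent⁺ }
      where
      open Timing T
      open Attach at
      open Set₃ at (fresh {R} u at) t₀ t k outside
      rep-k : rep k ≡ b
      rep-k = trans (rep-old ℕP.≤-refl) (setℕ-new rep₀ k b)
      αb : α b ≡ a
      αb = trans (cong α (sym αa)) (αα a)
      at-b : rep (t b) ≡ b
      at-b = trans (cong rep t-b) rep-k
      orbit⁺ : ∀ {z} → z ∈ U → z ≡ rep (t z) ⊎ z ≡ σ (rep (t z)) ⊎ z ≡ σ (σ (rep (t z)))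
      orbit⁺ z∈ with U-split σ α S at z∈
      ... | inj₁ refl = inj₁ (sym at-b)
      ... | inj₂ (inj₁ refl) = inj₂ (inj₁ (sym (trans (cong σ (trans (cong rep t-x) rep-k)) σb)))
      ... | inj₂ (inj₂ (inj₁ refl)) = inj₂ (inj₂ (sym (trans (cong σ (trans (cong σ (trans (cong rep t-y) rep-k)) σb)) σx)))
      ... | inj₂ (inj₂ (inj₂ z∈′)) = orbit z∈′
      cube⁺ : ∀ {z} → z ∈ U → σ (σ (σ z)) ≡ z
      cube⁺ z∈ with U-split σ α S at z∈
      ... | inj₁ refl = trans (cong (λ z → σ (σ z)) σb) (trans (cong σ σx) σy)
      ... | inj₂ (inj₁ refl) = trans (cong (λ z → σ (σ z)) σx) (trans (cong σ σy) σb)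
      ... | inj₂ (inj₂ (inj₁ refl)) = trans (cong (λ z → σ (σ z)) σy) (trans (cong σ σb) σx)
      ... | inj₂ (inj₂ (inj₂ z∈′)) = cube z∈′
      rep∈⁺ : ∀ {l} → k ≤ l → l < k + suc m → rep l ∈ U × t (rep l) ≡ l
      rep∈⁺ {l} k≤l l< with ℕP.m≤n⇒m<n∨m≡n k≤l
      ... | inj₂ refl = subst (_∈ U) (sym rep-k) (b∈U σ α S at) , trans (cong t rep-k) t-b
      ... | inj₁ k<l with rep∈ k<l (subst (l <_) (ℕP.+-suc k m) l<)
      ... | i , e = U⊇ σ α S at i , e
      a<b : t a < t b
      a<b = subst₂ _<_ (sym t-a) (sym t-b) a<k
      parent⁺ : ∀ {z} → z ∈ a ∷ (R ++ U) → S z ≡ true → (t (α z) < t z × z ≡ rep (t z)) ⊎ (t z < t (α z) × α z ≡ rep (t (α z)))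
      parent⁺ z∈ s with Resolved.cases res z∈
      ... | inj₁ refl = inj₂ (subst (λ c → t a < t c) (sym αa) a<b , trans αa (sym (trans (cong (λ c → rep (t c)) αa) at-b)))
      ... | inj₂ (inj₁ refl) = inj₁ (subst (λ c → t c < t b) (sym αb) a<b , sym at-b)
      ... | inj₂ (inj₂ z∈′) = parent z∈′ s

    false-cases : ∀ {D D′ a b} → Resolved D D′ a b → S a ≡ false → S b ≡ false → ∀ {z} → z ∈ D → S z ≡ true → z ∈ D′
    false-cases res sa sb z∈ s with Resolved.cases res z∈
    ... | inj₁ refl = ⊥-elim (tf s sa)
      where
      tf : ∀ {v} → v ≡ true → v ≡ false → ⊥
      tf refl ()
    ... | inj₂ (inj₁ refl) = ⊥-elim (tf s sb)
      where
      tf : ∀ {v} → v ≡ true → v ≡ false → ⊥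
      tf refl ()
    ... | inj₂ (inj₂ z∈′) = z∈′

    timing : ∀ {w ps ms st U} → Run σ α S w ps ms st U → Unique (darts ps ms st U) → ∀ k t₀ rep₀ →
      (∀ {z} → z ∈ legs ps ms st → t₀ z < k) → Timing k (verts w) t₀ rep₀ U (darts ps ms st U)
    timing done u k t₀ rep₀ h = record
      { t = t₀ ; rep = rep₀ ; outside = λ _ → refl ; rep-old = λ _ → refl
      ; corner = λ () ; lower = λ () ; upper = λ () ; orbit = λ () ; cube = λ ()
      ; rep∈ = λ k≤l l< → ⊥-elim (ℕP.<⇒≱ l< (subst (_≤ _) (sym (ℕP.+-identityʳ k)) k≤l)) ; parent = λ () }
    timing (pop r) u k t₀ rep₀ h = timing r u k t₀ rep₀ h
    timing (forest {a = a} {b} {x} {y} {ps} {ms} {st} _ _ at r) u k t₀ rep₀ h =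
      timing-attach {R = legs ps ms st} at u res (h (here refl))
        (timing r (Resolved.unique res) (suc k) (set₃ t₀ b x y k) (setℕ rep₀ k b)
          (Set₃.legs⁺ at (fresh {legs ps ms st} u at) t₀ (set₃ t₀ b x y k) k (λ _ → refl) (λ _ l → l < suc k)
            ℕP.≤-refl ℕP.≤-refl (λ z∈ → ℕP.m≤n⇒m≤1+n (h z∈))))
      where
      res = attach-unique σ α S {legs ps ms st} u at
    timing (new {a = a} {b} {x} {y} {ms} {st} _ _ at r) u k t₀ rep₀ h =
      timing-attach {R = legs [] ms st} at u res (h (here refl))
        (timing r (Resolved.unique res) (suc k) (set₃ t₀ b x y k) (setℕ rep₀ k b)
          (Set₃.legs⁺ at (fresh {legs [] ms st} u at) t₀ (set₃ t₀ b x y k) k (λ _ → refl) (λ _ l → l < suc k)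
            ℕP.≤-refl ℕP.≤-refl (λ z∈ → ℕP.m≤n⇒m≤1+n (h z∈))))
      where
      res = attach-unique σ α S {legs [] ms st} u at
    timing (skip {a = a} {ps} {ms} {st} {U} _ r) u k t₀ rep₀ h =
      timing-⊆ (λ z∈ _ → PermP.∈-resp-↭ perm z∈)
        (timing r (Unique-resp perm u) k t₀ rep₀ (λ z∈ → h (PermP.∈-resp-↭ (↭-sym (legs-skip a ps ms st)) z∈)))
      where
      perm = darts-skip a ps ms st U
    timing (match {a = a} {b} {l₁ = l₁} {l₂} {st} {U} sa sb _ refl _ r) u k t₀ rep₀ h =
      timing-⊆ (false-cases res sa sb)
        (timing r (Resolved.unique res) k t₀ rep₀ (λ z∈ → h (PermP.∈-resp-↭ (↭-sym (legs-match a b l₁ l₂ st)) (there (there z∈)))))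
      where
      res = resolved u (darts-match a b l₁ l₂ st U)
    timing (merge {a = a} {b} {ms} {l₁} {l₂} {s₁ = s₁} {s₂} {U} sa sb _ refl r) u k t₀ rep₀ h =
      timing-⊆ (false-cases res sa sb)
        (timing r (Resolved.unique res) k t₀ rep₀ (λ z∈ → h (PermP.∈-resp-↭ (↭-sym (legs-merge a b ms l₁ l₂ s₁ s₂)) (there (there z∈)))))
      where
      res = resolved u (darts-merge a b ms l₁ l₂ s₁ s₂ U)

    module Components (_≈_ : A → A → Set) (≈-sym : ∀ {y z} → y ≈ z → z ≈ y)
      (≈-trans : ∀ {x y z} → x ≈ y → y ≈ z → x ≈ z) (vertex : ∀ z → z ≈ σ z) (edge : ∀ z → S z ≡ true → z ≈ α z) where

      -- c numbers the forest components met by the run.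
      record Coloring (k m : ℕ) (c₀ : A → ℕ) (rep₀ : ℕ → A) (U D : List A) : Set where
        field
          c : A → ℕ
          rep : ℕ → A
          outside : ∀ {z} → ¬ z ∈ U → c z ≡ c₀ z
          rep-old : ∀ {l} → l < k → rep l ≡ rep₀ l
          corner : ∀ {z} → z ∈ U → c (σ z) ≡ c z
          upper : ∀ {z} → z ∈ U → c z < k + m
          rep∈ : ∀ {l} → k ≤ l → l < k + m → rep l ∈ U × c (rep l) ≡ l
          same : ∀ {z} → z ∈ D → S z ≡ true → c (α z) ≡ c z
          conn : ∀ {z} → z ∈ U → z ≈ rep (c z)

      coloring-⊆ : ∀ {k m c₀ rep₀ U D D′} → (∀ {z} → z ∈ D → S z ≡ true → z ∈ D′) → Coloring k m c₀ rep₀ U D′ → Coloring k m c₀ rep₀ U D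
      coloring-⊆ f T = record { Coloring T ; same = λ z∈ s → Coloring.same T (f z∈ s) s }

      module _ {a b x y U U′} (at : Attach σ α S a b x y U U′) where
        open Attach at
        b≈x : b ≈ x
        b≈x = subst (b ≈_) σb (vertex b)
        b≈y : b ≈ y
        b≈y = ≈-trans b≈x (subst (x ≈_) σx (vertex x))
        b≈b : b ≈ b
        b≈b = ≈-trans b≈x (≈-sym b≈x)

        conn⁺ : ∀ {d} {c : A → ℕ} {rep : ℕ → A} → b ≈ d → rep (c b) ≡ d → rep (c x) ≡ d → rep (c y) ≡ d →
          (∀ {z} → z ∈ U′ → z ≈ rep (c z)) → ∀ {z} → z ∈ U → z ≈ rep (c z)
        conn⁺ b≈d eb ex ey h z∈ with U-split σ α S at z∈
        ... | inj₁ refl = subst (b ≈_) (sym eb) b≈d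
        ... | inj₂ (inj₁ refl) = subst (x ≈_) (sym ex) (≈-trans (≈-sym b≈x) b≈d)
        ... | inj₂ (inj₂ (inj₁ refl)) = subst (y ≈_) (sym ey) (≈-trans (≈-sym b≈y) b≈d)
        ... | inj₂ (inj₂ (inj₂ z∈′)) = h z∈′

      coloring-forest : ∀ {k m c₀ rep₀ R a b x y U U′} (at : Attach σ α S a b x y U U′) → Unique (a ∷ R ++ U) →
        Resolved (a ∷ (R ++ U)) (x ∷ y ∷ (R ++ U′)) a b → S a ≡ true → c₀ a < k → a ≈ rep₀ (c₀ a) →
        Coloring k m (set₃ c₀ b x y (c₀ a)) rep₀ U′ (x ∷ y ∷ (R ++ U′)) → Coloring k m c₀ rep₀ U (a ∷ (R ++ U))
      coloring-forest {k} {m} {c₀} {rep₀} {R} {a} {b} {x} {y} {U} {U′} at u res sa a<k a≈ T = record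
        { c = c ; rep = rep ; outside = outside⁺ ; rep-old = rep-old ; corner = corner⁺ corner
        ; upper = on-U (_< k + m) (ℕP.m≤n⇒m≤n+o m a<k) upper
        ; rep∈ = λ k≤l l< → U⊇ σ α S at (proj₁ (rep∈ k≤l l<)) , proj₂ (rep∈ k≤l l<)
        ; same = same⁺
        ; conn = conn⁺ at {rep = rep} (≈-trans (≈-sym (subst (a ≈_) αa (edge a sa))) a≈)
            (trans (cong rep t-b) rep-a) (trans (cong rep t-x) rep-a) (trans (cong rep t-y) rep-a) conn }
        where
        open Coloring T
        open Attach at
        open Set₃ at (fresh {R} u at) c₀ c (c₀ a) outside
        rep-a : rep (c₀ a) ≡ rep₀ (c₀ a)
        rep-a = rep-old a<k
        same⁺ : ∀ {z} → z ∈ a ∷ (R ++ U) → S z ≡ true → c (α z) ≡ c z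
        same⁺ z∈ s with Resolved.cases res z∈
        ... | inj₁ refl = trans (cong c αa) (trans t-b (sym t-a))
        ... | inj₂ (inj₁ refl) = trans (cong c (trans (cong α (sym αa)) (αα a))) (trans t-a (sym t-b))
        ... | inj₂ (inj₂ z∈′) = same z∈′ s

      coloring-new : ∀ {k m c₀ rep₀ R a b x y U U′} (at : Attach σ α S a b x y U U′) → Unique (a ∷ R ++ U) →
        Resolved (a ∷ (R ++ U)) (x ∷ y ∷ (R ++ U′)) a b → S a ≡ false → S b ≡ false →
        Coloring (suc k) m (set₃ c₀ b x y k) (setℕ rep₀ k b) U′ (x ∷ y ∷ (R ++ U′)) → Coloring k (suc m) c₀ rep₀ U (a ∷ (R ++ U))
      coloring-new {k} {m} {c₀} {rep₀} {R} {a} {b} {x} {y} {U} {U′} at u res sa sb T = record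
        { c = c ; rep = rep ; outside = outside⁺
        ; rep-old = λ l< → trans (rep-old (ℕP.m≤n⇒m≤1+n l<)) (setℕ-old rep₀ k b l<)
        ; corner = corner⁺ corner
        ; upper = on-U (_< k + suc m) (ℕP.m<m+n k (s≤s z≤n)) (λ {z} z∈ → subst (c z <_) (sym (ℕP.+-suc k m)) (upper z∈))
        ; rep∈ = rep∈⁺
        ; same = λ z∈ s → same (false-cases res sa sb z∈ s) s
        ; conn = conn⁺ at {rep = rep} (b≈b at) (trans (cong rep t-b) rep-k) (trans (cong rep t-x) rep-k) (trans (cong rep t-y) rep-k) conn }
        where
        open Coloring T
        open Set₃ at (fresh {R} u at) c₀ c k outside
        rep-k : rep k ≡ b
        rep-k = trans (rep-old ℕP.≤-refl) (setℕ-new rep₀ k b)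
        rep∈⁺ : ∀ {l} → k ≤ l → l < k + suc m → rep l ∈ U × c (rep l) ≡ l
        rep∈⁺ {l} k≤l l< with ℕP.m≤n⇒m<n∨m≡n k≤l
        ... | inj₂ refl = subst (_∈ U) (sym rep-k) (b∈U σ α S at) , trans (cong c rep-k) t-b
        ... | inj₁ k<l with rep∈ k<l (subst (l <_) (ℕP.+-suc k m) l<)
        ... | i , e = U⊇ σ α S at i , e

      -- A forest edge hands the colour of its old end to the new vertex, and a letter `new` opens a
      -- colour. All other letters resolve edges outside the forest, which identify no colours.
      coloring : ∀ {w ps ms st U} → Run σ α S w ps ms st U → Unique (darts ps ms st U) → ∀ k c₀ rep₀ →
        (∀ {z} → z ∈ legs ps ms st → c₀ z < k × z ≈ rep₀ (c₀ z)) → Coloring k (news w) c₀ rep₀ U (darts ps ms st U)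
      coloring done u k c₀ rep₀ h = record
        { c = c₀ ; rep = rep₀ ; outside = λ _ → refl ; rep-old = λ _ → refl
        ; corner = λ () ; upper = λ ()
        ; rep∈ = λ k≤l l< → ⊥-elim (ℕP.<⇒≱ l< (subst (_≤ _) (sym (ℕP.+-identityʳ k)) k≤l)) ; same = λ () ; conn = λ () }
      coloring (pop r) u k c₀ rep₀ h = coloring r u k c₀ rep₀ h
      coloring (forest {a = a} {b} {x} {y} {ps} {ms} {st} sa _ at r) u k c₀ rep₀ h =
        coloring-forest {R = legs ps ms st} at u res sa (proj₁ (h (here refl))) (proj₂ (h (here refl)))
          (coloring r (Resolved.unique res) k (set₃ c₀ b x y (c₀ a)) rep₀
            (Set₃.legs⁺ at (fresh {legs ps ms st} u at) c₀ (set₃ c₀ b x y (c₀ a)) (c₀ a) (λ _ → refl) (λ z l → l < k × z ≈ rep₀ l)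
              (proj₁ ha , ≈-trans (≈-sym (b≈x at)) (proj₂ ha)) (proj₁ ha , ≈-trans (≈-sym (b≈y at)) (proj₂ ha)) h))
        where
        res = attach-unique σ α S {legs ps ms st} u at
        ha : c₀ a < k × b ≈ rep₀ (c₀ a)
        ha = proj₁ (h (here refl)) , ≈-trans (≈-sym (subst (a ≈_) (Attach.αa at) (edge a sa))) (proj₂ (h (here refl)))
      coloring (new {a = a} {b} {x} {y} {ms} {st} sa sb at r) u k c₀ rep₀ h =
        coloring-new {R = legs [] ms st} at u res sa sb
          (coloring r (Resolved.unique res) (suc k) (set₃ c₀ b x y k) (setℕ rep₀ k b)
            (Set₃.legs⁺ at (fresh {legs [] ms st} u at) c₀ (set₃ c₀ b x y k) k (λ _ → refl) (λ z l → l < suc k × z ≈ setℕ rep₀ k b l)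
              (ℕP.≤-refl , subst (x ≈_) (sym (setℕ-new rep₀ k b)) (≈-sym (b≈x at)))
              (ℕP.≤-refl , subst (y ≈_) (sym (setℕ-new rep₀ k b)) (≈-sym (b≈y at)))
              (λ z∈ → ℕP.m≤n⇒m≤1+n (proj₁ (h z∈)) , subst (_ ≈_) (sym (setℕ-old rep₀ k b (proj₁ (h z∈)))) (proj₂ (h z∈)))))
        where
        res = attach-unique σ α S {legs [] ms st} u at
      coloring (skip {a = a} {ps} {ms} {st} {U} _ r) u k c₀ rep₀ h =
        coloring-⊆ (λ z∈ _ → PermP.∈-resp-↭ perm z∈)
          (coloring r (Unique-resp perm u) k c₀ rep₀ (λ z∈ → h (PermP.∈-resp-↭ (↭-sym (legs-skip a ps ms st)) z∈)))
        where
        perm = darts-skip a ps ms st U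
      coloring (match {a = a} {b} {l₁ = l₁} {l₂} {st} {U} sa sb _ refl _ r) u k c₀ rep₀ h =
        coloring-⊆ (false-cases res sa sb)
          (coloring r (Resolved.unique res) k c₀ rep₀ (λ z∈ → h (PermP.∈-resp-↭ (↭-sym (legs-match a b l₁ l₂ st)) (there (there z∈)))))
        where
        res = resolved u (darts-match a b l₁ l₂ st U)
      coloring (merge {a = a} {b} {ms} {l₁} {l₂} {s₁ = s₁} {s₂} {U} sa sb _ refl r) u k c₀ rep₀ h =
        coloring-⊆ (false-cases res sa sb)
          (coloring r (Resolved.unique res) k c₀ rep₀ (λ z∈ → h (PermP.∈-resp-↭ (↭-sym (legs-merge a b ms l₁ l₂ s₁ s₂)) (there (there z∈)))))
        where
        res = resolved u (darts-merge a b ms l₁ l₂ s₁ s₂ U)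

    module Connected (_≈_ : A → A → Set) (≈-sym : ∀ {y z} → y ≈ z → z ≈ y)
      (≈-trans : ∀ {x y z} → x ≈ y → y ≈ z → x ≈ z) (vertex : ∀ z → z ≈ σ z) (edge : ∀ z → z ≈ α z) (o : A) where

      connected-attach : ∀ {R a b x y U U′} → Attach σ α S a b x y U U′ → (∀ {z} → z ∈ a ∷ R → o ≈ z) →
        ((∀ {z} → z ∈ x ∷ y ∷ R → o ≈ z) → ∀ {z} → z ∈ U′ → o ≈ z) → ∀ {z} → z ∈ U → o ≈ z
      connected-attach {R} {a} {b} {x} {y} {U} at h ih z∈ with U-split σ α S at z∈
      ... | inj₁ refl = o≈b
        where
        o≈b = ≈-trans (h (here refl)) (subst (a ≈_) (Attach.αa at) (edge a))
      ... | inj₂ (inj₁ refl) = ≈-trans (≈-trans (h (here refl)) (subst (a ≈_) (Attach.αa at) (edge a))) (subst (b ≈_) (Attach.σb at) (vertex b))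
      ... | inj₂ (inj₂ (inj₁ refl)) = ≈-trans (≈-trans (≈-trans (h (here refl)) (subst (a ≈_) (Attach.αa at) (edge a)))
              (subst (b ≈_) (Attach.σb at) (vertex b))) (subst (x ≈_) (Attach.σx at) (vertex x))
      ... | inj₂ (inj₂ (inj₂ z∈′)) = ih in-legs z∈′
        where
        o≈b = ≈-trans (h (here refl)) (subst (a ≈_) (Attach.αa at) (edge a))
        o≈x = ≈-trans o≈b (subst (b ≈_) (Attach.σb at) (vertex b))
        in-legs : ∀ {z} → z ∈ x ∷ y ∷ R → o ≈ z
        in-legs (here refl) = o≈x
        in-legs (there (here refl)) = ≈-trans o≈x (subst (x ≈_) (Attach.σx at) (vertex x))
        in-legs (there (there z∈)) = h (there z∈)

      connected : ∀ {w ps ms st U} → Run σ α S w ps ms st U → (∀ {z} → z ∈ legs ps ms st → o ≈ z) → ∀ {z} → z ∈ U → o ≈ z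
      connected (pop r) h = connected r h
      connected (forest {ps = ps} {ms} {st} _ _ at r) h = connected-attach {R = legs ps ms st} at h (connected r)
      connected (new {ms = ms} {st} _ _ at r) h = connected-attach {R = legs [] ms st} at h (connected r)
      connected (skip {a = a} {ps} {ms} {st} _ r) h = connected r (λ z∈ → h (PermP.∈-resp-↭ (↭-sym (legs-skip a ps ms st)) z∈))
      connected (match {a = a} {b} {l₁ = l₁} {l₂} {st} _ _ _ refl _ r) h = connected r (λ z∈ → h (PermP.∈-resp-↭ (↭-sym (legs-match a b l₁ l₂ st)) (there (there z∈))))
      connected (merge {a = a} {b} {ms} {l₁} {l₂} {s₁ = s₁} {s₂} _ _ _ refl r) h =
        connected r (λ z∈ → h (PermP.∈-resp-↭ (↭-sym (legs-merge a b ms l₁ l₂ s₁ s₂)) (there (there z∈))))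

 -- Invariants of a map that a run exhausts.

 module Complete where
  open import Defs
  open Finite
  open Subsets
  open Runs
  open Forward
  open import Data.Nat using (_+_; _*_)
  import Data.Fin.Properties as FinP
  open import Data.List using (_++_; upTo)
  import Data.List.Properties as ListP
  import Data.List.Membership.Propositional.Properties as MemP
  import Data.List.Relation.Binary.Permutation.Propositional.Properties as PermP
  open import Data.List.Relation.Binary.Permutation.Propositional using (_↭_; ↭-sym)
  open import Data.List.Relation.Binary.Pointwise using (Pointwise; []; _∷_)
  import Data.List.Relation.Unary.Unique.Propositional.Properties as UniP
  open import Relation.Binary.PropositionalEquality
  open import Relation.Binary.Construct.Closure.ReflexiveTransitive using (Star; ε; _◅_; _◅◅_)
  import Relation.Binary.Construct.Closure.ReflexiveTransitive as Star

  module _ {A : Set} {σ α : A → A} {S : A → Bool} (αα : ∀ z → α (α z) ≡ z) where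

    private
      edge-closed : ∀ {D D′ a b} → Resolved D D′ a b → α a ≡ b → S a ≡ S b → (∀ {z} → z ∈ D′ → S (α z) ≡ S z) → ∀ {z} → z ∈ D → S (α z) ≡ S z
      edge-closed res ab e h z∈ with Resolved.cases res z∈
      ... | inj₁ refl = trans (cong S ab) (sym e)
      ... | inj₂ (inj₁ refl) = trans (cong S (trans (cong α (sym ab)) (αα _))) e
      ... | inj₂ (inj₂ z∈′) = h z∈′

    run-closed : ∀ {w ps ms st U} → Run σ α S w ps ms st U → Unique (darts ps ms st U) → ∀ {z} → z ∈ darts ps ms st U → S (α z) ≡ S z
    run-closed (pop r) u = run-closed r u
    run-closed (forest {ps = ps} {ms} {st} sa sb at r) u = edge-closed res (Attach.αa at) (trans sa (sym sb)) (run-closed r (Resolved.unique res))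
      where res = attach-unique σ α S {legs ps ms st} u at
    run-closed (new {ms = ms} {st} sa sb at r) u = edge-closed res (Attach.αa at) (trans sa (sym sb)) (run-closed r (Resolved.unique res))
      where res = attach-unique σ α S {legs [] ms st} u at
    run-closed (skip {a = a} {ps} {ms} {st} {U} _ r) u z∈ = run-closed r (Unique-resp perm u) (PermP.∈-resp-↭ perm z∈)
      where perm = darts-skip a ps ms st U
    run-closed (match {a = a} {b} {l₁ = l₁} {l₂} {st} {U} sa sb ab refl _ r) u = edge-closed res ab (trans sa (sym sb)) (run-closed r (Resolved.unique res))
      where res = resolved u (darts-match a b l₁ l₂ st U)
    run-closed (merge {a = a} {b} {ms} {l₁} {l₂} {s₁ = s₁} {s₂} {U} sa sb ab refl r) u = edge-closed res ab (trans sa (sym sb)) (run-closed r (Resolved.unique res))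
      where res = resolved u (darts-merge a b ms l₁ l₂ s₁ s₂ U)

  module _ {A : Set} {σ α : A → A} {S : A → Bool} where

    private
      triple-length : ∀ n {a b x y U U′} → Attach σ α S a b x y U U′ → length U′ ≡ n * 3 → length U ≡ 3 + n * 3
      triple-length n at e = trans (PermP.↭-length (Attach.U↭ at)) (cong (3 +_) e)

    U-length : ∀ {w ps ms st U} → Run σ α S w ps ms st U → length U ≡ verts w * 3
    U-length done = refl
    U-length (pop r) = U-length r
    U-length (forest {w} _ _ at r) = triple-length (verts w) at (U-length r)
    U-length (skip _ r) = U-length r
    U-length (new {w} _ _ at r) = triple-length (verts w) at (U-length r)
    U-length (match _ _ _ _ _ r) = U-length r
    U-length (merge _ _ _ _ r) = U-length r

    private
      attach-moves : ∀ {a b x y U U′} → Attach σ α S a b x y U U′ → Unique U → (Unique U′ → ∀ {z} → z ∈ U′ → ¬ σ z ≡ z) → ∀ {z} → z ∈ U → ¬ σ z ≡ z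
      attach-moves at u h z∈ e with Unique-resp (Attach.U↭ at) u
      ... | pb ∷ px ∷ py ∷ u′ with U-split σ α S at z∈
      ... | inj₁ refl = All.lookup pb (here refl) (trans (sym e) (Attach.σb at))
      ... | inj₂ (inj₁ refl) = All.lookup px (here refl) (trans (sym e) (Attach.σx at))
      ... | inj₂ (inj₂ (inj₁ refl)) = All.lookup pb (there (here refl)) (sym (trans (sym e) (Attach.σy at)))
      ... | inj₂ (inj₂ (inj₂ z∈′)) = h u′ z∈′ e

    U-moves : ∀ {w ps ms st U} → Run σ α S w ps ms st U → Unique U → ∀ {z} → z ∈ U → ¬ σ z ≡ z
    U-moves (pop r) = U-moves r
    U-moves (forest _ _ at r) u = attach-moves at u (U-moves r)
    U-moves (skip _ r) = U-moves r
    U-moves (new _ _ at r) u = attach-moves at u (U-moves r)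
    U-moves (match _ _ _ _ _ r) = U-moves r
    U-moves (merge _ _ _ _ r) = U-moves r

    -- Each letter changes both sides by the same amount. A cut adds a block and a merge removes one
    -- while each uses up two darts, which is where the summand 4 for a merge comes from. At the
    -- initial state with one dart the relation identifies `merges` with the genus.
    euler : ∀ {w ps ms st U} → Run σ α S w ps ms st U → 2 * pops w + 4 * merges w ≡ verts w + length (legs ps ms st) + 2 * suc (length st)
    euler done = refl
    euler (pop {w} {ms} {st} r) = trans (lhs (pops w) (merges w)) (trans (cong (2 +_) (euler r)) (rhs (verts w) (length (legs [] ms st)) (length st)))
      where
      open import Data.Nat.Tactic.RingSolver using (solve-∀)
      lhs : ∀ p m → 2 * suc p + 4 * m ≡ 2 + (2 * p + 4 * m)
      lhs = solve-∀
      rhs : ∀ v l n → 2 + (v + l + 2 * suc n) ≡ v + l + 2 * suc (suc n)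
      rhs = solve-∀
    euler (forest {w} {ps = ps} {ms} {st} _ _ _ r) = trans (euler r) (arith (verts w) (length (legs ps ms st)) (2 * suc (length st)))
      where
      open import Data.Nat.Tactic.RingSolver using (solve-∀)
      arith : ∀ v l n → v + suc (suc l) + n ≡ suc v + suc l + n
      arith = solve-∀
    euler (skip {w} {a} {ps} {ms} {st} _ r) = trans (euler r) (cong (λ l → verts w + l + 2 * suc (length st)) (sym (PermP.↭-length (legs-skip a ps ms st))))
    euler (new {w} {ms = ms} {st} _ _ _ r) = trans (euler r) (arith (verts w) (length (legs [] ms st)) (2 * suc (length st)))
      where
      open import Data.Nat.Tactic.RingSolver using (solve-∀)
      arith : ∀ v l n → v + suc (suc l) + n ≡ suc v + suc l + n
      arith = solve-∀
    euler (match {w} {a = a} {b} {l₁ = l₁} {l₂} {st} _ _ _ refl _ r) = trans (euler r)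
      (trans (arith (verts w) (length (legs [] l₁ (l₂ ∷ st))) (length st))
        (cong (λ l → verts w + l + 2 * suc (length st)) (sym (PermP.↭-length (legs-match a b l₁ l₂ st)))))
      where
      open import Data.Nat.Tactic.RingSolver using (solve-∀)
      arith : ∀ v l n → v + l + 2 * suc (suc n) ≡ v + suc (suc l) + 2 * suc n
      arith = solve-∀
    euler (merge {w} {a} {b} {ms} {l₁} {l₂} {s₁ = s₁} {s₂} _ _ _ refl r) = trans (lhs (pops w) (merges w)) (trans (cong (4 +_) (euler r))
      (trans (arith (verts w) (length (legs [] (ms ++ l₂ ++ l₁) (s₁ ++ s₂))) (length (s₁ ++ s₂)))
        (cong₂ (λ l n → verts w + l + 2 * suc n) (sym (PermP.↭-length (legs-merge a b ms l₁ l₂ s₁ s₂))) len)))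
      where
      open import Data.Nat.Tactic.RingSolver using (solve-∀)
      lhs : ∀ p m → 2 * p + 4 * suc m ≡ 4 + (2 * p + 4 * m)
      lhs = solve-∀
      arith : ∀ v l n → 4 + (v + l + 2 * suc n) ≡ v + suc (suc l) + 2 * suc (suc n)
      arith = solve-∀
      len : suc (length (s₁ ++ s₂)) ≡ length (s₁ ++ (l₁ ++ b ∷ l₂) ∷ s₂)
      len = trans (cong suc (ListP.length-++ s₁)) (trans (sym (ℕP.+-suc (length s₁) _)) (sym (ListP.length-++ s₁)))

  module CompleteRun {d} (σ σ⁻ α : Fin d → Fin d) (σσ⁻ : ∀ i → σ (σ⁻ i) ≡ i) (σ⁻σ : ∀ i → σ⁻ (σ i) ≡ i) (αα : ∀ i → α (α i) ≡ i)
    (S : Fin d → Bool) (root : Fin d) (σroot : σ root ≡ root) {w : Word} {U : List (Fin d)}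
    (run : Run σ α S w (root ∷ []) [] [] U) (uniq : Unique (root ∷ U)) (complete : ∀ z → z ≡ root ⊎ z ∈ U) where

    private
      in-darts : ∀ z → z ∈ root ∷ U
      in-darts z with complete z
      ... | inj₁ e = here e
      ... | inj₂ z∈ = there z∈

      root∉ : ¬ root ∈ U
      root∉ r∈ = All.lookup (AllPairs.head uniq) r∈ refl

      uniqU : Unique U
      uniqU = AllPairs.tail uniq

    dart-count : d ≡ suc (verts w * 3)
    dart-count = trans (sym (ListP.length-tabulate (λ x → x)))
      (trans (PermP.↭-length (unique-↭ (allFin-unique d) uniq (λ {z} _ → in-darts z) (λ {z} _ → ∈-allFin z)))
        (cong suc (U-length run)))

    closed : ∀ z → S (α z) ≡ S z
    closed z = run-closed αα run uniq (in-darts z)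

    σ-injective : ∀ {x y} → σ x ≡ σ y → x ≡ y
    σ-injective {x} {y} e = trans (sym (σ⁻σ x)) (trans (cong σ⁻ e) (σ⁻σ y))

    φ-injective : ∀ {x y} → σ (α x) ≡ σ (α y) → x ≡ y
    φ-injective {x} {y} e = trans (sym (αα x)) (trans (cong α (σ-injective e)) (αα y))

    private
      nbV nbF nbC nbM : Fin d → List (Fin d)
      nbV k = σ k ∷ []
      nbF k = σ (α k) ∷ []
      nbC k = σ k ∷ (if S k then α k ∷ [] else [])
      nbM k = σ k ∷ α k ∷ []

      sym-F : ∀ {x y} → Path nbF x y → Path nbF y x
      sym-F = orbit-sym (λ k → σ (α k)) φ-injective

      sym-V : ∀ {x y} → Path nbV x y → Path nbV y x
      sym-V = orbit-sym σ σ-injective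

      path-label : ∀ {L : Set} {nb} (lab : Fin d → L) → (∀ i j → j ∈ nb i → lab i ≡ lab j) → ∀ {i j} → Path nb i j → lab i ≡ lab j
      path-label lab h ε = refl
      path-label lab h (e ◅ p) = trans (h _ _ e) (path-label lab h p)

    faces≡ : numClasses (λ k → σ (α k) ∷ []) ≡ pops w
    faces≡ = trans (numClasses-labels nbF pre (UniP.upTo⁺ (pops w)) (λ i → MemP.∈-upTo⁺ (pre< (in-darts i)))
        (λ l∈ → hit (MemP.∈-upTo⁻ l∈)) (path-label pre λ { i _ (here refl) → step i })
        (λ {i} {j} e → pre≈ (in-darts i) ◅◅ subst (λ l → Path nbF (rep l) j) (sym e) (sym-F (pre≈ (in-darts j)))))
      (ListP.length-upTo (pops w))
      where
      open Faces σ α S FinP._≟_ αα (Path nbF) ε sym-F _◅◅_ (λ z → here refl ◅ ε)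
      L : Labelling (pops w) root (root ∷ []) [] [] U (root ∷ U)
      -- σ fixes the root, so the face walk from α root reaches the root in one step and the initial
      -- block closes up.
      L = faces run uniq (ε , subst (Path nbF (α root)) (trans (cong σ (αα root)) σroot) (here refl ◅ ε)) []
      open Labelling L
      at-root : post root ≡ pre root
      at-root = trans (proj₂ (proj₁ top-anchored)) (sym (proj₁ (proj₁ top-anchored)))
      corners : ∀ z → pre (σ z) ≡ post z
      corners z with complete z
      ... | inj₁ refl = trans (cong pre σroot) (sym at-root)
      ... | inj₂ z∈ = sym (corner z∈)
      step : ∀ z → pre z ≡ pre (σ (α z))
      step z = sym (trans (corners (α z)) (edge (in-darts z)))
      no-anchors : ∀ {gs k} → Tri (Anchored pre post rep (pops w)) [] gs [] → ¬ k ∈ gs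
      no-anchors [] ()
      hit : ∀ {k} → k < pops w → ∃ λ i → pre i ≡ k
      hit k< with onto k<
      ... | inj₁ refl = root , proj₁ (proj₁ top-anchored)
      ... | inj₂ (inj₁ k∈) = ⊥-elim (no-anchors st-anchored k∈)
      ... | inj₂ (inj₂ (z , _ , e)) = α z , trans (sym (edge (in-darts (α z)))) (trans (cong post (αα z)) e)

    open Marks σ α S FinP._≟_ αα

    private
      T : Timing 1 (verts w) (λ _ → 0) (λ _ → root) U (root ∷ U)
      T = timing run uniq 1 (λ _ → 0) (λ _ → root) (λ _ → s≤s z≤n)
      module T = Timing T
      t-root : T.t root ≡ 0
      t-root = T.outside root∉
      rep-0 : T.rep 0 ≡ root
      rep-0 = T.rep-old (s≤s z≤n)

      t-σ : ∀ z → T.t (σ z) ≡ T.t z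
      t-σ z with complete z
      ... | inj₁ refl = cong T.t σroot
      ... | inj₂ z∈ = T.corner z∈

      from-rep : ∀ z → Path nbV (T.rep (T.t z)) z
      from-rep z with complete z
      ... | inj₁ refl = subst (λ r → Path nbV r root) (sym (trans (cong T.rep t-root) rep-0)) ε
      ... | inj₂ z∈ with T.orbit z∈
      ... | inj₁ e = subst (Path nbV _) (sym e) ε
      ... | inj₂ (inj₁ e) = subst (Path nbV _) (sym e) (here refl ◅ ε)
      ... | inj₂ (inj₂ e) = subst (Path nbV _) (sym e) (here refl ◅ here refl ◅ ε)

      t< : ∀ z → T.t z < suc (verts w)
      t< z with complete z
      ... | inj₁ refl = subst (_< suc (verts w)) (sym t-root) (s≤s z≤n)
      ... | inj₂ z∈ = T.upper z∈

      t-same : ∀ {x y} → Path nbV x y → T.t x ≡ T.t y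
      t-same = path-label T.t λ { i _ (here refl) → sym (t-σ i) }

    vertices≡ : numClasses (λ k → σ k ∷ []) ≡ suc (verts w)
    vertices≡ = trans (numClasses-labels nbV T.t (UniP.upTo⁺ (suc (verts w))) (λ i → MemP.∈-upTo⁺ (t< i))
        (λ l∈ → hit _ (MemP.∈-upTo⁻ l∈)) t-same
        (λ {i} {j} e → sym-V (from-rep i) ◅◅ subst (λ l → Path nbV (T.rep l) j) (sym e) (from-rep j)))
      (ListP.length-upTo (suc (verts w)))
      where
      hit : ∀ l → l < suc (verts w) → ∃ λ i → T.t i ≡ l
      hit zero l< = root , t-root
      hit (suc l) l< = T.rep (suc l) , proj₂ (T.rep∈ (s≤s z≤n) l<)

    degree₃ : ∀ i → i ∈ U → countB (Reach (λ k → σ k ∷ []) i) ≡ 3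
    degree₃ i i∈ = countB-unique (Reach nbV i) distinct into out
      where
      cube : σ (σ (σ i)) ≡ i
      cube = T.cube i∈
      ne : ¬ i ≡ σ i
      ne e = U-moves run uniqU i∈ (sym e)
      distinct : Unique (i ∷ σ i ∷ σ (σ i) ∷ [])
      distinct = (ne ∷ (λ e → ne (trans (sym cube) (cong σ (sym e)))) ∷ []) ∷ ((λ e → ne (σ-injective e)) ∷ []) ∷ [] ∷ []
      into : ∀ {j} → j ∈ i ∷ σ i ∷ σ (σ i) ∷ [] → Reach nbV i j ≡ true
      into (here refl) = Path⇒Reach nbV ε
      into (there (here refl)) = Path⇒Reach nbV (here refl ◅ ε)
      into (there (there (here refl))) = Path⇒Reach nbV (here refl ◅ here refl ◅ ε)
      stay : ∀ {k j} → k ∈ i ∷ σ i ∷ σ (σ i) ∷ [] → Path nbV k j → j ∈ i ∷ σ i ∷ σ (σ i) ∷ []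
      stay k∈ ε = k∈
      stay (here refl) (here refl ◅ p) = stay (there (here refl)) p
      stay (there (here refl)) (here refl ◅ p) = stay (there (there (here refl))) p
      stay (there (there (here refl))) (here refl ◅ p) = stay (here cube) p
      out : ∀ {j} → Reach nbV i j ≡ true → j ∈ i ∷ σ i ∷ σ (σ i) ∷ []
      out r = stay (here refl) (Reach⇒Path nbV r)

    root-alone : ∀ {i j} → i ≡ root → Path nbV i j → j ≡ root
    root-alone e ε = e
    root-alone refl (here refl ◅ p) = root-alone σroot p

    root-degree : countB (Reach (λ k → σ k ∷ []) root) ≡ 1
    root-degree = countB-unique (Reach nbV root) ([] ∷ [])
      (λ { (here refl) → Path⇒Reach nbV ε }) (λ r → here (root-alone refl (Reach⇒Path nbV r)))

    cubic : ∀ i → Reach (λ k → σ k ∷ []) root i ≡ false → countB (Reach (λ k → σ k ∷ []) i) ≡ 3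
    cubic i f with complete i
    ... | inj₁ refl = ⊥-elim (true≢false (Path⇒Reach nbV ε) f)
    ... | inj₂ i∈ = degree₃ i i∈

    private
      lift-V : ∀ {nb} → (∀ k → σ k ∈ nb k) → ∀ {x y} → Path nbV x y → Path nb x y
      lift-V h ε = ε
      lift-V h (here refl ◅ p) = h _ ◅ lift-V h p

      α∈C : ∀ z → S z ≡ true → α z ∈ nbC z
      α∈C z s rewrite s = there (here refl)

      C-cases : ∀ z {y} → y ∈ nbC z → y ≡ σ z ⊎ (S z ≡ true × y ≡ α z)
      C-cases z (here e) = inj₁ e
      C-cases z (there y∈) with S z
      C-cases z (there (here e)) | true = inj₂ (refl , e)

      sym-C : ∀ {x y} → Path nbC x y → Path nbC y x
      sym-C ε = ε
      sym-C {x} (e ◅ p) with C-cases x e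
      ... | inj₁ refl = sym-C p ◅◅ lift-V (λ _ → here refl) (sym-V (here refl ◅ ε))
      ... | inj₂ (s , refl) = sym-C p ◅◅ (subst (_∈ nbC (α x)) (αα x) (α∈C (α x) (trans (closed x) s)) ◅ ε)

      sym-M : ∀ {x y} → Path nbM x y → Path nbM y x
      sym-M ε = ε
      sym-M (here refl ◅ p) = sym-M p ◅◅ lift-V (λ _ → here refl) (sym-V (here refl ◅ ε))
      sym-M {x} (there (here refl) ◅ p) = sym-M p ◅◅ (there (here (sym (αα x))) ◅ ε)

    components≡ : numClasses (λ k → σ k ∷ (if S k then α k ∷ [] else [])) ≡ suc (news w)
    components≡ = trans (numClasses-labels nbC c (UniP.upTo⁺ (suc (news w))) (λ i → MemP.∈-upTo⁺ (c< i))
        (λ l∈ → hit _ (MemP.∈-upTo⁻ l∈)) (path-label c step)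
        (λ {i} {j} e → conn′ i ◅◅ subst (λ l → Path nbC (rep l) j) (sym e) (sym-C (conn′ j))))
      (ListP.length-upTo (suc (news w)))
      where
      open Components (Path nbC) sym-C _◅◅_ (λ z → here refl ◅ ε) (λ z s → α∈C z s ◅ ε)
      colors : Coloring 1 (news w) (λ _ → 0) (λ _ → root) U (root ∷ U)
      colors = coloring run uniq 1 (λ _ → 0) (λ _ → root) (λ { (here refl) → s≤s z≤n , ε })
      open Coloring colors
      c-root : c root ≡ 0
      c-root = outside root∉
      rep-root : rep 0 ≡ root
      rep-root = rep-old (s≤s z≤n)
      c< : ∀ z → c z < suc (news w)
      c< z with complete z
      ... | inj₁ refl = subst (_< suc (news w)) (sym c-root) (s≤s z≤n)
      ... | inj₂ z∈ = upper z∈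
      hit : ∀ l → l < suc (news w) → ∃ λ i → c i ≡ l
      hit zero l< = root , c-root
      hit (suc l) l< = rep (suc l) , proj₂ (rep∈ (s≤s z≤n) l<)
      conn′ : ∀ z → Path nbC z (rep (c z))
      conn′ z with complete z
      ... | inj₁ refl = subst (Path nbC root) (sym (trans (cong rep c-root) rep-root)) ε
      ... | inj₂ z∈ = conn z∈
      c-σ : ∀ z → c (σ z) ≡ c z
      c-σ z with complete z
      ... | inj₁ refl = cong c σroot
      ... | inj₂ z∈ = corner z∈
      step : ∀ i j → j ∈ nbC i → c i ≡ c j
      step i j j∈ with C-cases i j∈
      ... | inj₁ refl = sym (c-σ i)
      ... | inj₂ (s , refl) = sym (same (in-darts i) s)

    connected-run : ∀ i j → Reach (λ k → σ k ∷ α k ∷ []) i j ≡ true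
    connected-run i j = Path⇒Reach nbM (sym-M (from-root i) ◅◅ from-root j)
      where
      open Connected (Path nbM) sym-M _◅◅_ (λ z → here refl ◅ ε) (λ z → there (here refl) ◅ ε) root
      from-root : ∀ z → Path nbM root z
      from-root z with complete z
      ... | inj₁ refl = ε
      ... | inj₂ z∈ = connected run (λ { (here refl) → ε }) z∈

    -- Forest edges join a vertex to an earlier one, each vertex having one such edge; so a walk that has
    -- once gone to a later vertex keeps doing so and cannot close up.
    module _ (M : Map d) (σ≡ : Map.σ M ≡ σ) (α≡ : Map.α M ≡ α) where

      private
        Down Up : Fin d → Set
        Down z = T.t z < T.t (α z) × α z ≡ T.rep (T.t (α z))
        Up z = T.t (α z) < T.t z × z ≡ T.rep (T.t z)

        sameV-t : ∀ {x y} → Map.sameV M x y ≡ true → T.t x ≡ T.t y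
        sameV-t {x} {y} e = t-same (Reach⇒Path nbV (subst (λ f → Reach (λ k → f k ∷ []) x y ≡ true) σ≡ e))

        αM : ∀ z → Map.α M z ≡ α z
        αM z = cong (λ f → f z) α≡

        up-down : ∀ z → S z ≡ true → Up z ⊎ Down z
        up-down z s = T.parent (in-darts z) s

        next-down : ∀ {z z′} → S z′ ≡ true → Down z → T.t (α z) ≡ T.t z′ → ¬ z ≡ α z′ → Down z′
        next-down {z} {z′} s (_ , e) eq ne with up-down z′ s
        ... | inj₂ dn = dn
        ... | inj₁ (_ , e′) = ⊥-elim (ne (trans (sym (αα z)) (cong α (trans e (trans (cong T.rep eq) (sym e′))))))

        walk-t : ∀ {x z} → Map.sameV M (Map.α M z) x ≡ true → T.t (α z) ≡ T.t x
        walk-t {x} {z} e = trans (cong T.t (sym (αM z))) (sameV-t e)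

        ne-α : ∀ {z z′} → DistinctEdges M z z′ → ¬ z ≡ α z′
        ne-α (_ , q , _) e = q (trans e (sym (αM _)))

        down-walk : ∀ {x z xs} → (∀ {y} → y ∈ z ∷ xs → S y ≡ true) → AllPairs (DistinctEdges M) (z ∷ xs) → Walk M x z xs → Down z →
          T.t z < T.t x × ∃ λ u → u ∈ z ∷ xs × Down u × T.t (α u) ≡ T.t x
        down-walk {z = z} s _ (edge[] e) dn = subst (T.t z <_) (walk-t e) (proj₁ dn) , z , here refl , dn , walk-t e
        down-walk {z = z} s ((p ∷ _) ∷ ps) (edge∷ e w) dn with down-walk (λ i → s (there i)) ps w (next-down (s (there (here refl))) dn (walk-t e) (ne-α p))
        ... | lt , u , u∈ , rest = ℕP.<-trans (subst (T.t z <_) (walk-t e) (proj₁ dn)) lt , u , there u∈ , rest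

        up-walk : ∀ {x z xs} → (∀ {y} → y ∈ z ∷ xs → S y ≡ true) → AllPairs (DistinctEdges M) (z ∷ xs) → Walk M x z xs →
          T.t x < T.t z ⊎ ∃ λ u → u ∈ z ∷ xs × Down u × T.t (α u) ≡ T.t x
        up-walk {z = z} s ps wk with up-down z (s (here refl))
        up-walk {z = z} s ps wk | inj₂ dn = inj₂ (proj₂ (down-walk s ps wk dn))
        up-walk {z = z} s ps (edge[] e) | inj₁ (lt , _) = inj₁ (subst (_< T.t z) (walk-t e) lt)
        up-walk {z = z} s (_ ∷ ps) (edge∷ e w) | inj₁ (lt , _) with up-walk (λ i → s (there i)) ps w
        ... | inj₁ lt′ = inj₁ (ℕP.<-trans lt′ (subst (_< T.t z) (walk-t e) lt))
        ... | inj₂ (u , u∈ , rest) = inj₂ (u , there u∈ , rest)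

        no-cycle : ∀ x xs → Map.isCycle M S (x ∷ xs) ≡ true → ⊥
        no-cycle x xs e with isCycle⁻ M S x xs e
        ... | s , ps , wk with up-down x (s (here refl))
        ... | inj₂ dn = ℕP.<-irrefl refl (proj₁ (down-walk s ps wk dn))
        ... | inj₁ up with up-walk s ps wk
        ... | inj₁ lt = ℕP.<-irrefl refl lt
        ... | inj₂ (u , here refl , dn , eq) = ℕP.<-asym (proj₁ up) (proj₁ dn)
        -- The walk leaves x through the entry dart of its vertex and finally comes back through the
        -- same entry dart, so its last edge would be its first.
        ... | inj₂ (u , there u∈ , dn , eq) with ps
        ... | p ∷ _ = ne-α (All.lookup p u∈) (trans (proj₂ up) (trans (cong T.rep (sym eq)) (sym (proj₂ dn))))

      run-acyclic : Map.acyclic M S ≡ true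
      run-acyclic = acyclic⁺ M S no-cycle

 -- A run determines its word, and a word determines its run up to isomorphism.

 module Compare where
  open import Defs
  open Runs
  open import Data.Nat using (_+_)
  open import Data.List using (_++_; concat)
  import Data.List.Properties as ListP
  import Data.List.Membership.Propositional.Properties as MemP
  open import Data.List.Relation.Binary.Permutation.Propositional as Perm using (_↭_; ↭-refl; ↭-sym; ↭-trans; prep)
  import Data.List.Relation.Binary.Permutation.Propositional.Properties as PermP
  open import Data.List.Relation.Binary.Pointwise using (Pointwise; []; _∷_)
  open import Data.Unit using (⊤; tt)
  open import Relation.Binary.PropositionalEquality

  module Transport {A B : Set} {σ α : A → A} {S : A → Bool} {σ′ α′ : B → B} {S′ : B → Bool} (f : A → B)
    (fσ : ∀ z → f (σ z) ≡ σ′ (f z)) (fα : ∀ z → f (α z) ≡ α′ (f z)) (fS : ∀ z → S′ (f z) ≡ S z) where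

    private
      transport-attach : ∀ {a b x y U U′} → Attach σ α S a b x y U U′ → Attach σ′ α′ S′ (f a) (f b) (f x) (f y) (map f U) (map f U′)
      transport-attach (attach αa σb σx σy p) = attach (trans (sym (fα _)) (cong f αa)) (trans (sym (fσ _)) (cong f σb))
        (trans (sym (fσ _)) (cong f σx)) (trans (sym (fσ _)) (cong f σy)) (PermP.map⁺ f p)

    transport : ∀ {w ps ms st U} → Run σ α S w ps ms st U → Run σ′ α′ S′ w (map f ps) (map f ms) (map (map f) st) (map f U)
    transport done = done
    transport (pop r) = pop (transport r)
    transport (forest sa sb at r) = forest (trans (fS _) sa) (trans (fS _) sb) (transport-attach at) (transport r)
    transport (skip {w} {a} {ps} {ms} {st} {U} sa r) = skip (trans (fS _) sa)
      (subst (λ l → Run σ′ α′ S′ w (map f ps) l (map (map f) st) (map f U)) (ListP.map-++ f ms (a ∷ [])) (transport r))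
    transport (new sa sb at r) = new (trans (fS _) sa) (trans (fS _) sb) (transport-attach at) (transport r)
    transport (match {l₁ = l₁} {l₂} sa sb ab refl len r) = match (trans (fS _) sa) (trans (fS _) sb) (trans (sym (fα _)) (cong f ab))
      (ListP.map-++ f l₁ _) (trans (ListP.length-map f l₁) len) (transport r)
    transport (merge {w} {a} {b} {ms} {l₁} {l₂} {s₁ = s₁} {s₂} {U} sa sb ab refl r) = merge (trans (fS _) sa) (trans (fS _) sb) (trans (sym (fα _)) (cong f ab))
      (trans (ListP.map-++ (map f) s₁ _) (cong (λ l → map (map f) s₁ ++ l ∷ map (map f) s₂) (ListP.map-++ f l₁ (b ∷ l₂))))
      (subst₂ (λ l s → Run σ′ α′ S′ w [] l s (map f U))
        (trans (ListP.map-++ f ms (l₂ ++ l₁)) (cong (map f ms ++_) (ListP.map-++ f l₂ l₁)))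
        (ListP.map-++ (map f) s₁ s₂) (transport r))

  module _ {A : Set} where

    unique-split : ∀ (l₁ : List A) {l₁′ b l₂ l₂′} → Unique (l₁ ++ b ∷ l₂) → l₁ ++ b ∷ l₂ ≡ l₁′ ++ b ∷ l₂′ → l₁ ≡ l₁′ × l₂ ≡ l₂′
    unique-split [] {[]} u refl = refl , refl
    unique-split [] {_ ∷ l₁′} (p ∷ u) refl = ⊥-elim (All.lookup p (MemP.∈-++⁺ʳ l₁′ (here refl)) refl)
    unique-split (_ ∷ l₁) {[]} (p ∷ u) refl = ⊥-elim (All.lookup p (MemP.∈-++⁺ʳ l₁ (here refl)) refl)
    unique-split (z ∷ l₁) {_ ∷ l₁′} (p ∷ u) e with unique-split l₁ {l₁′} u (ListP.∷-injectiveʳ e)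
    ... | e₁ , e₂ = cong₂ _∷_ (ListP.∷-injectiveˡ e) e₁ , e₂

    unique-++ˡ : ∀ (l : List A) {m} → Unique (l ++ m) → Unique l
    unique-++ˡ [] u = []
    unique-++ˡ (z ∷ l) (p ∷ u) = All.tabulate (λ i → All.lookup p (MemP.∈-++⁺ˡ i)) ∷ unique-++ˡ l u

    unique-disjoint : ∀ (l : List A) {m z} → Unique (l ++ m) → z ∈ l → z ∈ m → ⊥
    unique-disjoint (_ ∷ l) (p ∷ u) (here refl) z∈ = All.lookup p (MemP.∈-++⁺ʳ l z∈) refl
    unique-disjoint (_ ∷ l) (p ∷ u) (there i) z∈ = unique-disjoint l u i z∈

  module Deterministic {A : Set} {σ α : A → A} {S : A → Bool} where

    private
      tf : ∀ {v} → v ≡ true → v ≡ false → ⊥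
      tf refl ()

      same-attach : ∀ {a b x y U U′ b′ x′ y′ V V′} → Attach σ α S a b x y U U′ → Attach σ α S a b′ x′ y′ V V′ → U ↭ V →
        b ≡ b′ × x ≡ x′ × y ≡ y′ × U′ ↭ V′
      same-attach (attach refl refl refl _ p) (attach refl refl refl _ q) e = refl , refl , refl ,
        PermP.drop-∷ (PermP.drop-∷ (PermP.drop-∷ (↭-trans (↭-sym p) (↭-trans e q))))

      on-block : ∀ {a b ms st U l₁ l₂ b′ x y U′} → Unique (darts [] (a ∷ ms) st U) → α a ≡ b → ms ≡ l₁ ++ b ∷ l₂ → Attach σ α S a b′ x y U U′ → ⊥
      on-block {a} {ms = ms} {st} {l₁ = l₁} u refl refl at = unique-disjoint (legs [] (a ∷ ms) st) u
        (there (MemP.∈-++⁺ˡ (MemP.∈-++⁺ʳ l₁ (here refl)))) (subst (_∈ _) (sym (Attach.αa at)) (b∈U σ α S at))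

    -- The state forces the next letter: S decides between `forest` and `skip`, the place of α a
    -- decides between `new` and `match`, and distinctness of the darts fixes the position of the
    -- match. The unvisited darts matter only up to order, since the darts of an attached vertex are
    -- computed from a by α and σ.
    deterministic : ∀ {w w′ ps ms st U V} → Run σ α S w ps ms st U → Run σ α S w′ ps ms st V → merges w ≡ 0 → merges w′ ≡ 0 →
      U ↭ V → Unique (darts ps ms st U) → w ≡ w′
    deterministic done done _ _ _ _ = refl
    deterministic (pop r) (pop r′) m m′ e u = cong pop (deterministic r r′ m m′ e u)
    deterministic (forest {ps = ps} {ms} {st} sa sb at r) (forest _ _ at′ r′) m m′ e u with same-attach at at′ e
    ... | refl , refl , refl , e′ = cong forest (deterministic r r′ m m′ e′ (Resolved.unique (attach-unique σ α S {legs ps ms st} u at)))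
    deterministic (forest sa _ _ _) (skip sa′ _) _ _ _ _ = ⊥-elim (tf sa sa′)
    deterministic (skip sa _) (forest sa′ _ _ _) _ _ _ _ = ⊥-elim (tf sa′ sa)
    deterministic (skip {a = a} {ps} {ms} {st} {U} _ r) (skip _ r′) m m′ e u = cong skip (deterministic r r′ m m′ e (Unique-resp (darts-skip a ps ms st U) u))
    deterministic (new {ms = ms} {st} sa sb at r) (new _ _ at′ r′) m m′ e u with same-attach at at′ e
    ... | refl , refl , refl , e′ = cong new (deterministic r r′ m m′ e′ (Resolved.unique (attach-unique σ α S {legs [] ms st} u at)))
    deterministic (new {ms = ms} {st} sa sb at r) (match _ _ ab eq _ _) m m′ e u = ⊥-elim (on-block {ms = ms} {st} u ab eq at)
    deterministic (match {ms = ms} {st = st} _ _ ab eq _ _) (new _ _ at _) m m′ e u =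
      ⊥-elim (on-block {ms = ms} {st} (Unique-resp (PermP.++⁺ˡ (legs [] _ st) e) u) ab eq at)
    deterministic (match {a = a} {b} {l₁ = l₁} {l₂} {st} {U} _ _ refl refl refl r) (match {l₁ = l₁′} _ _ refl eq refl r′) m m′ e u
      with unique-split l₁ {l₁′} (unique-++ˡ (l₁ ++ b ∷ l₂) (unique-++ˡ (legs [] (l₁ ++ b ∷ l₂) st) (AllPairs-tail u))) eq
      where
      AllPairs-tail : ∀ {z l} → Unique (z ∷ l) → Unique {A = A} l
      AllPairs-tail (_ ∷ u) = u
    ... | refl , refl = cong (match (length l₁)) (deterministic r r′ m m′ e (Resolved.unique (resolved u (darts-match a b l₁ l₂ st U))))
    deterministic (match _ _ _ _ _ _) (merge _ _ _ _ _) _ () _ _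
    deterministic (new _ _ _ _) (merge _ _ _ _ _) _ () _ _
    deterministic (merge _ _ _ _ _) _ () _ _ _

  module Lockstep {A B : Set} {σ α : A → A} {S : A → Bool} {σ′ α′ : B → B} {S′ : B → Bool}
    (αα : ∀ z → α (α z) ≡ z) (αα′ : ∀ z → α′ (α′ z) ≡ z) where

    Same : List A → List B → Set
    Same = Pointwise (λ _ _ → ⊤)

    -- zs pairs the darts that two runs along the same word visit simultaneously.
    record Paired (ps ms : List A) (st : List (List A)) (U D : List A) (ps′ ms′ : List B) (st′ : List (List B)) (D′ : List B) : Set where
      field
        zs : List (A × B)
        firsts : map proj₁ zs ↭ D
        seconds : map proj₂ zs ↭ D′
        ps-paired : Pointwise (λ z z′ → (z , z′) ∈ zs) ps ps′
        ms-paired : Pointwise (λ z z′ → (z , z′) ∈ zs) ms ms′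
        st-paired : Pointwise (Pointwise (λ z z′ → (z , z′) ∈ zs)) st st′
        α-paired : ∀ {z z′} → (z , z′) ∈ zs → (α z , α′ z′) ∈ zs
        S-paired : ∀ {z z′} → (z , z′) ∈ zs → S z ≡ S′ z′
        σ-paired : ∀ {z} → z ∈ U → ∃ λ z′ → (z , z′) ∈ zs × (σ z , σ′ z′) ∈ zs

    private
      split-same : ∀ {P : A → B → Set} l₁ l₁′ {b b′ l₂ l₂′} → length l₁ ≡ length l₁′ → Pointwise P (l₁ ++ b ∷ l₂) (l₁′ ++ b′ ∷ l₂′) →
        Pointwise P l₁ l₁′ × Pointwise P l₂ l₂′
      split-same [] [] e (p ∷ q) = [] , q
      split-same (_ ∷ l₁) (_ ∷ l₁′) e (p ∷ q) with split-same l₁ l₁′ (ℕ.suc-injective e) q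
        where import Data.Nat.Properties as ℕ
      ... | r , s = p ∷ r , s

      split-last : ∀ {P : A → B → Set} ms ms′ {a a′} → Same ms ms′ → Pointwise P (ms ++ a ∷ []) (ms′ ++ a′ ∷ []) → Pointwise P ms ms′ × P a a′
      split-last [] [] [] (p ∷ []) = [] , p
      split-last (_ ∷ ms) (_ ∷ ms′) (_ ∷ s) (p ∷ q) with split-last ms ms′ s q
      ... | r , t = p ∷ r , t

      join-pw : ∀ {P : A → B → Set} {l₁ l₁′ l₂ l₂′} → Pointwise P l₁ l₁′ → Pointwise P l₂ l₂′ → Pointwise P (l₁ ++ l₂) (l₁′ ++ l₂′)
      join-pw [] q = q
      join-pw (p ∷ ps) q = p ∷ join-pw ps q

      map-pw : ∀ {X Y : Set} {P Q : X → Y → Set} {l l′} → (∀ {z z′} → P z z′ → Q z z′) → Pointwise P l l′ → Pointwise Q l l′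
      map-pw f [] = []
      map-pw f (p ∷ q) = f p ∷ map-pw f q

      add : ∀ {zs : List (A × B)} {c c′ : A × B} {z z′} → (z , z′) ∈ zs → (z , z′) ∈ c ∷ c′ ∷ zs
      add i = there (there i)

      pair-attach : ∀ {R R′ ps ms st a b x y U U′ ps′ ms′ st′ a′ b′ x′ y′ V V′} {D₁ D₁′} →
        (at : Attach σ α S a b x y U U′) (at′ : Attach σ′ α′ S′ a′ b′ x′ y′ V V′) →
        D₁ ≡ x ∷ y ∷ (R ++ U′) → D₁′ ≡ x′ ∷ y′ ∷ (R′ ++ V′) → S a ≡ S b → S a ≡ S′ a′ → S b ≡ S′ b′ →
        Paired (x ∷ y ∷ ps) ms st U′ D₁ (x′ ∷ y′ ∷ ps′) ms′ st′ D₁′ →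
        ∃ λ zs → map proj₁ zs ↭ a ∷ (R ++ U) × map proj₂ zs ↭ a′ ∷ (R′ ++ V) × (a , a′) ∈ zs ×
          Pointwise (λ z z′ → (z , z′) ∈ zs) ps ps′ × Pointwise (λ z z′ → (z , z′) ∈ zs) ms ms′ ×
          Pointwise (Pointwise (λ z z′ → (z , z′) ∈ zs)) st st′ ×
          (∀ {z z′} → (z , z′) ∈ zs → (α z , α′ z′) ∈ zs) × (∀ {z z′} → (z , z′) ∈ zs → S z ≡ S′ z′) ×
          (∀ {z} → z ∈ U → ∃ λ z′ → (z , z′) ∈ zs × (σ z , σ′ z′) ∈ zs)
      pair-attach {R} {R′} {a = a} {b} {x} {y} {U} {a′ = a′} {b′} {x′} {y′} at at′ refl refl sab saa sbb P with Paired.ps-paired P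
      ... | px ∷ py ∷ pps = (a , a′) ∷ (b , b′) ∷ zs ,
        ↭-trans (prep a (prep b firsts)) (↭-sym (darts-attach {R = R} a (Attach.U↭ at))) ,
        ↭-trans (prep a′ (prep b′ seconds)) (↭-sym (darts-attach {R = R′} a′ (Attach.U↭ at′))) ,
        here refl , map-pw add pps , map-pw add ms-paired , map-pw (map-pw add) st-paired , α⁺ , S⁺ , σ⁺
        where
        open Paired P
        αb : α b ≡ a
        αb = trans (cong α (sym (Attach.αa at))) (αα a)
        αb′ : α′ b′ ≡ a′
        αb′ = trans (cong α′ (sym (Attach.αa at′))) (αα′ a′)
        zs⁺ = (a , a′) ∷ (b , b′) ∷ zs
        α⁺ : ∀ {z z′} → (z , z′) ∈ zs⁺ → (α z , α′ z′) ∈ zs⁺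
        α⁺ (here refl) = there (here (cong₂ _,_ (Attach.αa at) (Attach.αa at′)))
        α⁺ (there (here refl)) = here (cong₂ _,_ αb αb′)
        α⁺ (there (there i)) = add (α-paired i)
        S⁺ : ∀ {z z′} → (z , z′) ∈ zs⁺ → S z ≡ S′ z′
        S⁺ (here refl) = saa
        S⁺ (there (here refl)) = sbb
        S⁺ (there (there i)) = S-paired i
        σ⁺ : ∀ {z} → z ∈ U → ∃ λ z′ → (z , z′) ∈ zs⁺ × (σ z , σ′ z′) ∈ zs⁺
        σ⁺ z∈ with U-split σ α S at z∈
        ... | inj₁ refl = b′ , there (here refl) , add (subst₂ (λ u v → (u , v) ∈ zs) (sym (Attach.σb at)) (sym (Attach.σb at′)) px)
        ... | inj₂ (inj₁ refl) = x′ , add px , add (subst₂ (λ u v → (u , v) ∈ zs) (sym (Attach.σx at)) (sym (Attach.σx at′)) py)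
        ... | inj₂ (inj₂ (inj₁ refl)) = y′ , add py , there (here (cong₂ _,_ (Attach.σy at) (Attach.σy at′)))
        ... | inj₂ (inj₂ (inj₂ i)) with σ-paired i
        ... | z′ , j , k = z′ , add j , add k

    -- The letters and the lengths of the lists decide which darts are resolved next, so the two
    -- states need only have the same shape. The resulting pairs form the graph of an isomorphism;
    -- `merge` is excluded because it does not say where the partner lies.
    lockstep : ∀ {w ps ms st U ps′ ms′ st′ U′} → Run σ α S w ps ms st U → Run σ′ α′ S′ w ps′ ms′ st′ U′ → merges w ≡ 0 →
      Same ps ps′ → Same ms ms′ → Pointwise Same st st′ → Paired ps ms st U (darts ps ms st U) ps′ ms′ st′ (darts ps′ ms′ st′ U′)
    lockstep done done _ _ _ _ = record
      { zs = [] ; firsts = ↭-refl ; seconds = ↭-refl ; ps-paired = [] ; ms-paired = [] ; st-paired = []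
      ; α-paired = λ () ; S-paired = λ () ; σ-paired = λ () }
    lockstep (pop r) (pop r′) m [] [] (p ∷ st) = record
      { zs = zs ; firsts = firsts ; seconds = seconds ; ps-paired = [] ; ms-paired = [] ; st-paired = ms-paired ∷ st-paired
      ; α-paired = α-paired ; S-paired = S-paired ; σ-paired = σ-paired }
      where open Paired (lockstep r r′ m [] p st)
    lockstep (forest {ps = ps} {ms} {st} sa sb at r) (forest {ps = ps′} {ms′} {st′} sa′ sb′ at′ r′) m (_ ∷ p) q s
      with pair-attach {R = legs ps ms st} {R′ = legs ps′ ms′ st′} at at′ refl refl (trans sa (sym sb)) (trans sa (sym sa′)) (trans sb (sym sb′))
        (lockstep r r′ m (tt ∷ tt ∷ p) q s)
    ... | zs , f , g , a∈ , p′ , q′ , s′ , αp , Sp , σp = record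
      { zs = zs ; firsts = f ; seconds = g ; ps-paired = a∈ ∷ p′ ; ms-paired = q′ ; st-paired = s′ ; α-paired = αp ; S-paired = Sp ; σ-paired = σp }
    lockstep (new {ms = ms} {st} sa sb at r) (new {ms = ms′} {st′} sa′ sb′ at′ r′) m [] (_ ∷ q) s
      with pair-attach {R = legs [] ms st} {R′ = legs [] ms′ st′} at at′ refl refl (trans sa (sym sb)) (trans sa (sym sa′)) (trans sb (sym sb′))
        (lockstep r r′ m (tt ∷ tt ∷ []) q s)
    ... | zs , f , g , a∈ , p′ , q′ , s′ , αp , Sp , σp = record
      { zs = zs ; firsts = f ; seconds = g ; ps-paired = [] ; ms-paired = a∈ ∷ q′ ; st-paired = s′ ; α-paired = αp ; S-paired = Sp ; σ-paired = σp }
    lockstep (skip {a = a} {ps} {ms} {st} {U} _ r) (skip {a = a′} {ps′} {ms′} {st′} {U′} _ r′) m (_ ∷ p) q s = record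
      { zs = zs ; firsts = ↭-trans firsts (↭-sym (darts-skip a ps ms st U)) ; seconds = ↭-trans seconds (↭-sym (darts-skip a′ ps′ ms′ st′ U′))
      ; ps-paired = proj₂ sp ∷ ps-paired ; ms-paired = proj₁ sp ; st-paired = st-paired
      ; α-paired = α-paired ; S-paired = S-paired ; σ-paired = σ-paired }
      where
      open Paired (lockstep r r′ m p (join-pw q (tt ∷ [])) s)
      sp = split-last ms ms′ q ms-paired
    lockstep (match {a = a} {b} {l₁ = l₁} {l₂} {st} {U} sa sb ab refl len r) (match {a = a′} {b′} {l₁ = l₁′} {l₂′} {st′} {U′} sa′ sb′ ab′ refl len′ r′) m [] (_ ∷ q) s
      with split-same l₁ l₁′ (trans len (sym len′)) q
    ... | q₁ , q₂ with lockstep r r′ m [] q₁ (q₂ ∷ s)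
    ... | P with Paired.st-paired P
    ... | s₂ ∷ s′ = record
      { zs = (a , a′) ∷ (b , b′) ∷ zs
      ; firsts = ↭-trans (prep a (prep b firsts)) (↭-sym (darts-match a b l₁ l₂ st U))
      ; seconds = ↭-trans (prep a′ (prep b′ seconds)) (↭-sym (darts-match a′ b′ l₁′ l₂′ st′ U′))
      ; ps-paired = []
      ; ms-paired = here refl ∷ join-pw (map-pw add ms-paired) (there (here refl) ∷ map-pw add s₂)
      ; st-paired = map-pw (map-pw add) s′
      ; α-paired = α⁺ ; S-paired = S⁺
      ; σ-paired = λ z∈ → proj₁ (σ-paired z∈) , add (proj₁ (proj₂ (σ-paired z∈))) , add (proj₂ (proj₂ (σ-paired z∈))) }
      where
      open Paired P
      zs⁺ = (a , a′) ∷ (b , b′) ∷ zs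
      α⁺ : ∀ {z z′} → (z , z′) ∈ zs⁺ → (α z , α′ z′) ∈ zs⁺
      α⁺ (here refl) = there (here (cong₂ _,_ ab ab′))
      α⁺ (there (here refl)) = here (cong₂ _,_ (trans (cong α (sym ab)) (αα a)) (trans (cong α′ (sym ab′)) (αα′ a′)))
      α⁺ (there (there i)) = add (α-paired i)
      S⁺ : ∀ {z z′} → (z , z′) ∈ zs⁺ → S z ≡ S′ z′
      S⁺ (here refl) = trans sa (sym sa′)
      S⁺ (there (here refl)) = trans sb (sym sb′)
      S⁺ (there (there i)) = S-paired i
    lockstep (merge _ _ _ _ _) _ ()

  module _ {A B : Set} where

    first-unique : ∀ {zs : List (A × B)} {z u v} → Unique (map proj₁ zs) → (z , u) ∈ zs → (z , v) ∈ zs → u ≡ v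
    first-unique (p ∷ _) (here refl) (here refl) = refl
    first-unique (p ∷ _) (here refl) (there j) = ⊥-elim (All.lookup p (MemP.∈-map⁺ proj₁ j) refl)
    first-unique (p ∷ _) (there i) (here refl) = ⊥-elim (All.lookup p (MemP.∈-map⁺ proj₁ i) refl)
    first-unique (_ ∷ q) (there i) (there j) = first-unique q i j

    second-unique : ∀ {zs : List (A × B)} {z u v} → Unique (map proj₂ zs) → (u , z) ∈ zs → (v , z) ∈ zs → u ≡ v
    second-unique (p ∷ _) (here refl) (here refl) = refl
    second-unique (p ∷ _) (here refl) (there j) = ⊥-elim (All.lookup p (MemP.∈-map⁺ proj₂ j) refl)
    second-unique (p ∷ _) (there i) (here refl) = ⊥-elim (All.lookup p (MemP.∈-map⁺ proj₂ i) refl)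
    second-unique (_ ∷ q) (there i) (there j) = second-unique q i j

 -- Every forested near-cubic map admits a run.

 module Explore where
  open import Defs
  open Finite
  open Subsets
  open Runs
  open Complete
  open import Data.Nat using (_+_; _*_; _∸_)
  open import Data.Nat.Induction using (<-wellFounded)
  open import Data.Nat.Tactic.RingSolver using (solve-∀)
  open import Induction.WellFounded using (Acc; acc)
  import Data.Fin.Properties as FinP
  open import Data.List using (_++_; concat)
  import Data.List.Properties as ListP
  import Data.List.Membership.Propositional.Properties as MemP
  open import Data.List.Relation.Binary.Permutation.Propositional as Perm using (_↭_; ↭-refl; ↭-sym; ↭-trans; prep)
  import Data.List.Relation.Binary.Permutation.Propositional.Properties as PermP
  import Data.List.Relation.Unary.AllPairs.Properties as AllPairsP
  import Data.List.Relation.Unary.Unique.Propositional.Properties as UniP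
  open import Data.Bool.ListAction using (any)
  open import Relation.Binary.PropositionalEquality
  open import Relation.Binary.Construct.Closure.ReflexiveTransitive using (Star; ε; _◅_; _◅◅_)

  countB-≥ : ∀ {d} (p : Fin d → Bool) {L : List (Fin d)} → Unique L → (∀ {i} → i ∈ L → p i ≡ true) → length L ≤ countB p
  countB-≥ {d} p {L} u h = subst₂ _≤_ (PermP.↭-length (unique-↭ (filterᵇ-unique inL (filterᵇ-unique p (allFin-unique d))) u fwd bwd))
      (sym (countB-length p)) (ListP.length-filter _ (filterᵇ p (allFin d)))
    where
    inL : Fin d → Bool
    inL i = any (eqB i) L
    fwd : ∀ {z} → z ∈ filterᵇ inL (filterᵇ p (allFin d)) → z ∈ L
    fwd {z} z∈ with any-true⁻ _ L (proj₂ (∈-filterᵇ⁻ inL {xs = filterᵇ p (allFin d)} z∈))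
    ... | y , y∈ , e = subst (_∈ L) (sym (eqB-true⁻ {i = z} {y} e)) y∈
    bwd : ∀ {z} → z ∈ L → z ∈ filterᵇ inL (filterᵇ p (allFin d))
    bwd {z} z∈ = ∈-filterᵇ⁺ inL (∈-filterᵇ⁺ p (∈-allFin z) (h z∈)) (any-true⁺ (eqB z) z∈ (eqB-refl z))

  unique-length≤ : ∀ {d} {L : List (Fin d)} → Unique L → length L ≤ d
  unique-length≤ {d} u = ℕP.≤-trans (countB-≥ (λ _ → true) u (λ _ → refl))
    (subst (_≤ d) (sym (countB-length {d} (λ _ → true))) (ℕP.≤-trans (ListP.length-filter _ (allFin d)) (ℕP.≤-reflexive (ListP.length-tabulate (λ x → x)))))

  module Cubic {d} (M : Map d) (near-cubic : Map.NearCubic M) (root-degree : Map.RootDeg1 M) where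
    open Map M

    σ-inj : ∀ {x y} → σ x ≡ σ y → x ≡ y
    σ-inj {x} {y} e = trans (sym (σ⁻σ x)) (trans (cong σ⁻ e) (σ⁻σ y))

    nbV : Fin d → List (Fin d)
    nbV k = σ k ∷ []

    -- Wrapped so that the endpoints can be inferred.
    record _~_ (x y : Fin d) : Set where
      constructor reach
      field is-true : sameV x y ≡ true

    open _~_ public

    to-path : ∀ {x y} → x ~ y → Path nbV x y
    to-path {x} {y} e = Reach⇒Path nbV {x} {y} (is-true e)

    V-sym : ∀ {x y} → x ~ y → y ~ x
    V-sym e = reach (Path⇒Reach nbV (orbit-sym σ σ-inj (to-path e)))

    V-trans : ∀ {x y z} → x ~ y → y ~ z → x ~ z
    V-trans e f = reach (Path⇒Reach nbV (to-path e ◅◅ to-path f))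

    V-refl : ∀ x → x ~ x
    V-refl x = reach (Path⇒Reach nbV ε)

    V-σ : ∀ x → x ~ σ x
    V-σ x = reach (Path⇒Reach nbV (here refl ◅ ε))

    not~ : ∀ {x y} → ¬ x ~ y → sameV x y ≡ false
    not~ {x} {y} n with bool-cases (sameV x y)
    ... | inj₁ t = ⊥-elim (n (reach t))
    ... | inj₂ f = f

    alone : ∀ {j} → root ~ j → j ≡ root
    alone {j} e with j FinP.≟ root
    ... | yes p = p
    ... | no ne = ⊥-elim (ℕP.<⇒≱ {1} {2} (s≤s (s≤s z≤n)) (subst (2 ≤_) root-degree
      (countB-≥ (sameV root) (((λ q → ne (sym q)) ∷ []) ∷ [] ∷ []) λ { (here refl) → is-true (V-refl root) ; (there (here refl)) → is-true e })))

    σroot : σ root ≡ root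
    σroot = alone (V-σ root)

    degree : ∀ {z} → ¬ z ≡ root → vdeg z ≡ 3
    degree {z} ne with bool-cases (sameV root z)
    ... | inj₁ t = ⊥-elim (ne (alone (reach t)))
    ... | inj₂ f = near-cubic z f

    private
      closed-count : ∀ z (L : List (Fin d)) → z ∈ L → (∀ {y} → y ∈ L → σ y ∈ L) → (∀ {y} → y ∈ L → z ~ y) → Unique L → vdeg z ≡ length L
      closed-count z L z∈ cl r u = countB-unique (sameV z) u (λ i → is-true (r i)) (λ {i} e → stay z∈ (Reach⇒Path nbV {z} {i} e))
        where
        stay : ∀ {k j} → k ∈ L → Path nbV k j → j ∈ L
        stay k∈ ε = k∈
        stay k∈ (here refl ◅ p) = stay (cl k∈) p

    -- If σ fixed z, the vertex of z would consist of one dart instead of three. A cycle of length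
    -- two is excluded in the same way, and a fourth dart exceeds the degree; so the cycle of σ has
    -- length exactly three.
    moves : ∀ {z} → ¬ z ≡ root → ¬ σ z ≡ z
    moves {z} ne e with trans (sym (degree ne)) (closed-count z (z ∷ []) (here refl) (λ { (here refl) → here e }) (λ { (here refl) → V-refl z }) ([] ∷ []))
    ... | ()

    moves₂ : ∀ {z} → ¬ z ≡ root → ¬ σ (σ z) ≡ z
    moves₂ {z} ne e with trans (sym (degree ne)) (closed-count z (z ∷ σ z ∷ []) (here refl)
      (λ { (here refl) → there (here refl) ; (there (here refl)) → here e }) (λ { (here refl) → V-refl z ; (there (here refl)) → V-σ z })
      (((λ q → moves ne (sym q)) ∷ []) ∷ [] ∷ []))
    ... | ()

    triple : ∀ {z} → ¬ z ≡ root → Unique (z ∷ σ z ∷ σ (σ z) ∷ [])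
    triple ne = ((λ q → moves ne (sym q)) ∷ (λ q → moves₂ ne (sym q)) ∷ []) ∷ ((λ q → moves ne (σ-inj (sym q))) ∷ []) ∷ [] ∷ []

    V-σ₂ : ∀ x → x ~ σ (σ x)
    V-σ₂ x = V-trans (V-σ x) (V-σ (σ x))

    cube : ∀ {z} → ¬ z ≡ root → σ (σ (σ z)) ≡ z
    cube {z} ne with σ (σ (σ z)) FinP.≟ z
    ... | yes e = e
    ... | no n = ⊥-elim (ℕP.<⇒≱ {3} {4} (s≤s (s≤s (s≤s (s≤s z≤n)))) (subst (4 ≤_) (degree ne)
      (countB-≥ (sameV z) {σ (σ (σ z)) ∷ z ∷ σ z ∷ σ (σ z) ∷ []}
        ((n ∷ (λ q → moves₂ ne (σ-inj q)) ∷ (λ q → moves ne (σ-inj (σ-inj q))) ∷ []) ∷ triple ne)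
        λ { (here refl) → is-true (V-trans (V-σ₂ z) (V-σ _)) ; (there (here refl)) → is-true (V-refl z)
          ; (there (there (here refl))) → is-true (V-σ z) ; (there (there (there (here refl)))) → is-true (V-σ₂ z) })))

  module Exploration {d} (M : Map d) (near-cubic : Map.NearCubic M) (root-degree : Map.RootDeg1 M) (S : Fin d → Bool)
    (forestS : Map.isForest M S ≡ true) where
    open Map M
    open Cubic M near-cubic root-degree

    S-closed : ∀ z → S (α z) ≡ S z
    S-closed = αClosed-true⁻ M S (proj₁ (∧-true forestS))

    data Link (v : Fin d) : Fin d → List (Fin d) → Set where
      link[] : ∀ {u} → u ~ v → Link v u []
      link∷ : ∀ {u z r} → u ~ z → Link v (α z) r → Link v u (z ∷ r)

    -- A simple path in the forest, along resolved edges, from the vertex of u to that of v.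
    record Simple (D : List (Fin d)) (u v : Fin d) : Set where
      field
        zs : List (Fin d)
        link : Link v u zs
        in-S : ∀ {z} → z ∈ zs → S z ≡ true
        ∉D : ∀ {z} → z ∈ zs → ¬ z ∈ D
        α∉D : ∀ {z} → z ∈ zs → ¬ α z ∈ D
        apart : ∀ {z} → z ∈ zs → ¬ z ~ v
        distinct : AllPairs (DistinctEdges M) zs

    -- The two facts that leave a forest dart no place but an unvisited vertex to lead to: skipped
    -- darts are outside the forest, and the vertices of pending darts are already joined within the
    -- forest by resolved edges, so that a further edge between them would close a cycle.
    record Inv (ps ms : List (Fin d)) (st : List (List (Fin d))) (U : List (Fin d)) : Set where
      field
        uniq : Unique (darts ps ms st U)
        αcl : ∀ {z} → z ∈ darts ps ms st U → α z ∈ darts ps ms st U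
        Ucl : ∀ {z} → z ∈ U → σ z ∈ U
        root∉ : ¬ root ∈ U
        Nfalse : ∀ {z} → z ∈ ms ++ concat st → S z ≡ false
        paths : ∀ {x y} → x ∈ ps → y ∈ ps → Simple (darts ps ms st U) x y

    private
      -- The coefficients make every letter decrease the weight. An attached vertex takes three
      -- darts from U, worth 6, and yields two pending ones, again worth 6; what decreases is the
      -- dart used up. A skip trades weight 3 for 2, and a cut trades two darts for one block.
      weight : ℕ → ℕ → ℕ → ℕ → ℕ
      weight u p m s = 2 * u + 3 * p + 2 * m + s

      decrease : ∀ {m n} k → n ≡ m + suc k → m < n
      decrease {m} k e = ℕP.<-≤-trans (ℕP.m<m+n m (s≤s z≤n)) (ℕP.≤-reflexive (sym e))

      weight-new : ∀ u m s → weight u 2 m s < weight (3 + u) 0 (suc m) s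
      weight-new u m s = decrease 1 (arith u m s)
        where
        arith : ∀ u m s → 2 * (3 + u) + 3 * 0 + 2 * suc m + s ≡ 2 * u + 3 * 2 + 2 * m + s + 2
        arith = solve-∀

      weight-match : ∀ u m s → weight u 0 m (suc s) < weight u 0 (2 + m) s
      weight-match u m s = decrease 2 (arith u m s)
        where
        arith : ∀ u m s → 2 * u + 3 * 0 + 2 * (2 + m) + s ≡ 2 * u + 3 * 0 + 2 * m + suc s + 3
        arith = solve-∀

      weight-merge : ∀ u m s → weight u 0 m s < weight u 0 (2 + m) (suc s)
      weight-merge u m s = decrease 4 (arith u m s)
        where
        arith : ∀ u m s → 2 * u + 3 * 0 + 2 * (2 + m) + suc s ≡ 2 * u + 3 * 0 + 2 * m + s + 5
        arith = solve-∀

      weight-skip : ∀ u p m s → weight u p (suc m) s < weight u (suc p) m s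
      weight-skip u p m s = decrease 0 (arith u p m s)
        where
        arith : ∀ u p m s → 2 * u + 3 * suc p + 2 * m + s ≡ 2 * u + 3 * p + 2 * suc m + s + 1
        arith = solve-∀

      weight-forest : ∀ u p m s → weight u (2 + p) m s < weight (3 + u) (suc p) m s
      weight-forest u p m s = decrease 2 (arith u p m s)
        where
        arith : ∀ u p m s → 2 * (3 + u) + 3 * suc p + 2 * m + s ≡ 2 * u + 3 * (2 + p) + 2 * m + s + 3
        arith = solve-∀

      μ : List (Fin d) → List (Fin d) → List (List (Fin d)) → List (Fin d) → ℕ
      μ ps ms st U = weight (length U) (length ps) (length (ms ++ concat st)) (length st)

      μ-pop : ∀ ms st U → μ [] ms st U < μ [] [] (ms ∷ st) U
      μ-pop ms st U = ℕP.+-monoʳ-< _ (ℕP.n<1+n (length st))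

      μ-new : ∀ {a x y : Fin d} ms st U U′ → length U ≡ 3 + length U′ → μ (x ∷ y ∷ []) ms st U′ < μ [] (a ∷ ms) st U
      μ-new ms st U U′ e = subst (λ u → weight (length U′) 2 (length (ms ++ concat st)) (length st) < weight u 0 (suc (length (ms ++ concat st))) (length st))
        (sym e) (weight-new (length U′) (length (ms ++ concat st)) (length st))

      μ-match : ∀ a b l₁ l₂ st U → μ [] l₁ (l₂ ∷ st) U < μ [] (a ∷ l₁ ++ b ∷ l₂) st U
      μ-match a b l₁ l₂ st U = subst (λ m → weight (length U) 0 (length (l₁ ++ l₂ ++ concat st)) (suc (length st)) < weight (length U) 0 m (length st))
        (sym (PermP.↭-length (legs-match a b l₁ l₂ st))) (weight-match (length U) (length (l₁ ++ l₂ ++ concat st)) (length st))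

      μ-merge : ∀ a b ms l₁ l₂ s₁ s₂ U → μ [] (ms ++ l₂ ++ l₁) (s₁ ++ s₂) U < μ [] (a ∷ ms) (s₁ ++ (l₁ ++ b ∷ l₂) ∷ s₂) U
      μ-merge a b ms l₁ l₂ s₁ s₂ U = subst₂ (λ m s → weight (length U) 0 (length ((ms ++ l₂ ++ l₁) ++ concat (s₁ ++ s₂))) (length (s₁ ++ s₂)) < weight (length U) 0 m s)
        (sym (PermP.↭-length (legs-merge a b ms l₁ l₂ s₁ s₂))) (sym (PermP.↭-length (PermP.shift (l₁ ++ b ∷ l₂) s₁ s₂)))
        (weight-merge (length U) (length ((ms ++ l₂ ++ l₁) ++ concat (s₁ ++ s₂))) (length (s₁ ++ s₂)))

      μ-skip : ∀ a ps ms st U → μ ps (ms ++ a ∷ []) st U < μ (a ∷ ps) ms st U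
      μ-skip a ps ms st U = subst (λ m → weight (length U) (length ps) m (length st) < weight (length U) (suc (length ps)) (length (ms ++ concat st)) (length st))
        (PermP.↭-length (legs-skip a [] ms st)) (weight-skip (length U) (length ps) (length (ms ++ concat st)) (length st))

      μ-forest : ∀ {a x y : Fin d} ps ms st U U′ → length U ≡ 3 + length U′ → μ (x ∷ y ∷ ps) ms st U′ < μ (a ∷ ps) ms st U
      μ-forest ps ms st U U′ e = subst (λ u → weight (length U′) (2 + length ps) (length (ms ++ concat st)) (length st) < weight u (suc (length ps)) (length (ms ++ concat st)) (length st))
        (sym e) (weight-forest (length U′) (length ps) (length (ms ++ concat st)) (length st))

      remove : ∀ {x : Fin d} {U} → x ∈ U → ∃ λ U′ → U ↭ x ∷ U′
      remove {x} x∈ with MemP.∈-∃++ x∈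
      ... | l , r , refl = l ++ r , PermP.shift x l r

      αcl-sub : ∀ {D D′ a b} → Resolved D D′ a b → α a ≡ b → (∀ {z} → z ∈ D → α z ∈ D) → ∀ {z} → z ∈ D′ → α z ∈ D′
      αcl-sub {a = a} {b} res ab cl {z} z∈ with Resolved.cases res (cl (Resolved.⊆ res z∈))
      ... | inj₁ e = ⊥-elim (Resolved.≢b res z∈ (trans (sym (αα z)) (trans (cong α e) ab)))
      ... | inj₂ (inj₁ e) = ⊥-elim (Resolved.≢a res z∈ (trans (sym (αα z)) (trans (cong α (trans e (sym ab))) (αα a))))
      ... | inj₂ (inj₂ i) = i

      weaken : ∀ {D D′ u v} → (∀ {z} → z ∈ D′ → z ∈ D) → Simple D u v → Simple D′ u v
      weaken sub P = record { Simple P ; ∉D = λ i j → Simple.∉D P i (sub j) ; α∉D = λ i j → Simple.α∉D P i (sub j) }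

      stay : ∀ {U z y} → (∀ {z} → z ∈ U → σ z ∈ U) → z ~ y → z ∈ U → y ∈ U
      stay cl e z∈ = go z∈ (to-path e)
        where
        go : ∀ {k j} → k ∈ _ → Path nbV k j → j ∈ _
        go k∈ ε = k∈
        go k∈ (here refl ◅ p) = go (cl k∈) p

      apart-U : ∀ {U z y} → (∀ {z} → z ∈ U → σ z ∈ U) → z ∈ U → ¬ y ∈ U → ¬ z ~ y
      apart-U cl z∈ y∉ t = y∉ (stay cl t z∈)

      link-end : ∀ {u v v′ zs} → Link v u zs → S v ≡ true → α v ~ v′ → Link v′ u (zs ++ v ∷ [])
      link-end (link[] e) s e′ = link∷ e (link[] e′)
      link-end (link∷ e l) s e′ = link∷ e (link-end l s e′)

      link-walk : ∀ {t z r a} → Link a (α z) r → α a ~ t → Walk M t z (r ++ a ∷ [])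
      link-walk (link[] e) e′ = edge∷ (is-true e) (edge[] (is-true e′))
      link-walk (link∷ e l) e′ = edge∷ (is-true e) (link-walk l e′)

      distinct-end : ∀ {zs a} → AllPairs (DistinctEdges M) zs → (∀ {z} → z ∈ zs → DistinctEdges M z a) → AllPairs (DistinctEdges M) (zs ++ a ∷ [])
      distinct-end [] h = [] ∷ []
      distinct-end {z ∷ zs} {a} (p ∷ ps) h = All.tabulate all-p ∷ distinct-end ps (λ i → h (there i))
        where
        all-p : ∀ {y} → y ∈ zs ++ a ∷ [] → DistinctEdges M z y
        all-p i with MemP.∈-++⁻ zs i
        ... | inj₁ j = All.lookup p j
        ... | inj₂ (here refl) = h (here refl)

      -- The path from α a to the vertex of a, closed by the edge of a, is a cycle in S. It is not
      -- degenerate, because the path uses resolved edges only and a is unresolved. Its darts are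
      -- distinct, so it has length at most d and is among the lists that `acyclic` inspects.
      no-loop : ∀ {D a} → a ∈ D → α a ∈ D → S a ≡ true → Simple D (α a) a → ⊥
      no-loop {D} {a} a∈ b∈ s P = close zs link refl
        where
        open Simple P
        dist : AllPairs (DistinctEdges M) (zs ++ a ∷ [])
        dist = distinct-end distinct (λ {z} i → (λ { refl → ∉D i a∈ }) , (λ e → ∉D i (subst (_∈ D) (sym e) b∈)) , not~ (apart i))
        all-S : ∀ {z} → z ∈ zs ++ a ∷ [] → S z ≡ true
        all-S i with MemP.∈-++⁻ zs i
        ... | inj₁ j = in-S j
        ... | inj₂ (here refl) = s
        contra : ∀ x xs → x ∷ xs ≡ zs ++ a ∷ [] → Walk M x x xs → ⊥
        contra x xs eq wk = acyclic⁻ M S (proj₂ (∧-true {αClosed S} forestS)) x xs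
          (unique-length≤ (AllPairs.map proj₁ (subst (AllPairs (DistinctEdges M)) (sym eq) dist)))
          (isCycle⁺ M S x xs (λ i → all-S (subst (_ ∈_) eq i)) (subst (AllPairs (DistinctEdges M)) (sym eq) dist) wk)
        close : ∀ l → Link a (α a) l → l ≡ zs → ⊥
        close [] (link[] e) refl = contra a [] refl (edge[] (is-true e))
        close (z ∷ r) (link∷ e l) refl = contra z (r ++ a ∷ []) refl (link-walk l e)

    private
      there⁻ : ∀ {z w : Fin d} {l} → ¬ z ≡ w → z ∈ w ∷ l → z ∈ l
      there⁻ ne (here e) = ⊥-elim (ne e)
      there⁻ ne (there i) = i

      unique-tail : ∀ (R : List (Fin d)) {U} → Unique (R ++ U) → Unique U
      unique-tail [] u = u
      unique-tail (_ ∷ R) (_ ∷ u) = unique-tail R u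

    find : ∀ {a U} → (∀ {z} → z ∈ U → σ z ∈ U) → ¬ root ∈ U → α a ∈ U →
      ∃ λ b → ∃ λ x → ∃ λ y → ∃ λ U′ → Attach σ α S a b x y U U′
    find {a} {U} Ucl root∉ b∈ with remove b∈
    ... | U₁ , p with remove (there⁻ (moves (λ e → root∉ (subst (_∈ U) e b∈))) (PermP.∈-resp-↭ p (Ucl b∈)))
    ... | U₂ , q with remove (there⁻ (λ e → moves (λ e → root∉ (subst (_∈ U) e b∈)) (σ-inj e))
            (there⁻ (moves₂ (λ e → root∉ (subst (_∈ U) e b∈))) (PermP.∈-resp-↭ (↭-trans p (prep _ q)) (Ucl (Ucl b∈)))))
    ... | U₃ , r = _ , _ , _ , U₃ , attach refl refl refl (cube (λ e → root∉ (subst (_∈ U) e b∈))) (↭-trans p (prep _ (↭-trans q (prep _ r))))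

    module Attached {a R U} (u : Unique (a ∷ (R ++ U))) (Ucl : ∀ {z} → z ∈ U → σ z ∈ U) {b x y U′} (at : Attach σ α S a b x y U U′) where
      res : Resolved (a ∷ (R ++ U)) (x ∷ y ∷ (R ++ U′)) a b
      res = attach-unique σ α S {R} u at
      Ucl′ : ∀ {z} → z ∈ U′ → σ z ∈ U′
      Ucl′ {z} z∈ with Unique-resp (Attach.U↭ at) (unique-tail R (AllPairs.tail u))
      ... | pb ∷ px ∷ py ∷ _ with U-split σ α S at (Ucl (U⊇ σ α S at z∈))
      ... | inj₁ e = ⊥-elim (All.lookup py z∈ (sym (σ-inj (trans e (sym (Attach.σy at))))))
      ... | inj₂ (inj₁ e) = ⊥-elim (All.lookup pb (there (there z∈)) (sym (σ-inj (trans e (sym (Attach.σb at))))))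
      ... | inj₂ (inj₂ (inj₁ e)) = ⊥-elim (All.lookup px (there z∈) (sym (σ-inj (trans e (sym (Attach.σx at))))))
      ... | inj₂ (inj₂ (inj₂ i)) = i
      U-len : length U ≡ 3 + length U′
      U-len = PermP.↭-length (Attach.U↭ at)
      bx : b ~ x
      bx = subst (b ~_) (Attach.σb at) (V-σ b)
      xy : x ~ y
      xy = subst (x ~_) (Attach.σx at) (V-σ x)
      αb : α b ≡ a
      αb = trans (cong α (sym (Attach.αa at))) (αα a)

    private
      leg∉U : ∀ (R : List (Fin d)) {U z} → Unique (R ++ U) → z ∈ R → ¬ z ∈ U
      leg∉U (r ∷ R) (p ∷ u) (here refl) j = All.lookup p (MemP.∈-++⁺ʳ R j) refl
      leg∉U (r ∷ R) (p ∷ u) (there i) j = leg∉U R u i j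

      vertex-path : ∀ {D u v} → u ~ v → Simple D u v
      vertex-path e = record { zs = [] ; link = link[] e ; in-S = λ () ; ∉D = λ () ; α∉D = λ () ; apart = λ () ; distinct = [] }

    private
      Explored : List (Fin d) → List (Fin d) → List (List (Fin d)) → List (Fin d) → Set
      Explored ps ms st U = ∃ λ w → Run σ α S w ps ms st U

      Rec : ℕ → Set
      Rec m = ∀ ps ms st U → Inv ps ms st U → μ ps ms st U < m → Explored ps ms st U

      S-b : ∀ {a b} → α a ≡ b → S b ≡ S a
      S-b {a} e = trans (cong S (sym e)) (S-closed a)

      -- Unvisited darts left over would be closed under σ and α, and by connectedness would contain
      -- the root.
      explore-done : ∀ U → Inv [] [] [] U → Explored [] [] [] U
      explore-done [] I = done , done
      explore-done (z ∷ U) I = ⊥-elim (Inv.root∉ I (go (here refl) (Reach⇒Path _ (connected z root))))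
        where
        go : ∀ {k j} → k ∈ z ∷ U → Path (λ k → σ k ∷ α k ∷ []) k j → j ∈ z ∷ U
        go k∈ ε = k∈
        go k∈ (here refl ◅ p) = go (Inv.Ucl I k∈) p
        go k∈ (there (here refl) ◅ p) = go (Inv.αcl I k∈) p

      explore-new : ∀ {a b x y U′} ms st U → Inv [] (a ∷ ms) st U → Rec (μ [] (a ∷ ms) st U) → Attach σ α S a b x y U U′ → Explored [] (a ∷ ms) st U
      explore-new {a} {b} {x} {y} {U′} ms st U I rec at with rec (x ∷ y ∷ []) ms st U′ inv′ (μ-new {a} {x} {y} ms st U U′ U-len)
        where
        open Inv I
        open Attached {a} {ms ++ concat st} uniq Ucl at
        same : ∀ {u v} → u ∈ x ∷ y ∷ [] → v ∈ x ∷ y ∷ [] → u ~ v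
        same (here refl) (here refl) = V-refl x
        same (here refl) (there (here refl)) = xy
        same (there (here refl)) (here refl) = V-sym xy
        same (there (here refl)) (there (here refl)) = V-refl y
        inv′ : Inv (x ∷ y ∷ []) ms st U′
        inv′ = record { uniq = Resolved.unique res ; αcl = αcl-sub res (Attach.αa at) αcl ; Ucl = Ucl′ ; root∉ = λ i → root∉ (U⊇ σ α S at i)
          ; Nfalse = λ i → Nfalse (there i) ; paths = λ i j → vertex-path (same i j) }
      ... | w , r = new w , Run.new (Inv.Nfalse I (here refl)) (trans (S-b (Attach.αa at)) (Inv.Nfalse I (here refl))) at r

      explore-match : ∀ {a b} l₁ l₂ st U → Inv [] (a ∷ l₁ ++ b ∷ l₂) st U → Rec (μ [] (a ∷ l₁ ++ b ∷ l₂) st U) → α a ≡ b → Explored [] (a ∷ l₁ ++ b ∷ l₂) st U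
      explore-match {a} {b} l₁ l₂ st U I rec ab with rec [] l₁ (l₂ ∷ st) U inv′ (μ-match a b l₁ l₂ st U)
        where
        open Inv I
        res = resolved uniq (darts-match a b l₁ l₂ st U)
        inv′ : Inv [] l₁ (l₂ ∷ st) U
        inv′ = record { uniq = Resolved.unique res ; αcl = αcl-sub res ab αcl ; Ucl = Ucl ; root∉ = root∉
          ; Nfalse = λ i → Nfalse (PermP.∈-resp-↭ (↭-sym (legs-match a b l₁ l₂ st)) (there (there i))) ; paths = λ () }
      ... | w , r = match (length l₁) w , Run.match (Inv.Nfalse I (here refl)) (trans (S-b ab) (Inv.Nfalse I (here refl))) ab refl refl r

      explore-merge : ∀ {a b} ms l₁ l₂ s₁ s₂ U → Inv [] (a ∷ ms) (s₁ ++ (l₁ ++ b ∷ l₂) ∷ s₂) U → Rec (μ [] (a ∷ ms) (s₁ ++ (l₁ ++ b ∷ l₂) ∷ s₂) U) → α a ≡ b →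
        Explored [] (a ∷ ms) (s₁ ++ (l₁ ++ b ∷ l₂) ∷ s₂) U
      explore-merge {a} {b} ms l₁ l₂ s₁ s₂ U I rec ab with rec [] (ms ++ l₂ ++ l₁) (s₁ ++ s₂) U inv′ (μ-merge a b ms l₁ l₂ s₁ s₂ U)
        where
        open Inv I
        res = resolved uniq (darts-merge a b ms l₁ l₂ s₁ s₂ U)
        inv′ : Inv [] (ms ++ l₂ ++ l₁) (s₁ ++ s₂) U
        inv′ = record { uniq = Resolved.unique res ; αcl = αcl-sub res ab αcl ; Ucl = Ucl ; root∉ = root∉
          ; Nfalse = λ i → Nfalse (PermP.∈-resp-↭ (↭-sym (legs-merge a b ms l₁ l₂ s₁ s₂)) (there (there i))) ; paths = λ () }
      ... | w , r = merge w , Run.merge (Inv.Nfalse I (here refl)) (trans (S-b ab) (Inv.Nfalse I (here refl))) ab refl r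

      explore-skip : ∀ {a} ps ms st U → Inv (a ∷ ps) ms st U → Rec (μ (a ∷ ps) ms st U) → S a ≡ false → Explored (a ∷ ps) ms st U
      explore-skip {a} ps ms st U I rec f with rec ps (ms ++ a ∷ []) st U inv′ (μ-skip a ps ms st U)
        where
        open Inv I
        perm = darts-skip a ps ms st U
        inv′ : Inv ps (ms ++ a ∷ []) st U
        inv′ = record { uniq = Unique-resp perm uniq ; αcl = λ i → PermP.∈-resp-↭ perm (αcl (PermP.∈-resp-↭ (↭-sym perm) i)) ; Ucl = Ucl ; root∉ = root∉
          ; Nfalse = nf ; paths = λ i j → weaken (PermP.∈-resp-↭ (↭-sym perm)) (paths (there i) (there j)) }
          where
          nf : ∀ {z} → z ∈ (ms ++ a ∷ []) ++ concat st → S z ≡ false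
          nf i with PermP.∈-resp-↭ (↭-sym (legs-skip a [] ms st)) i
          ... | here refl = f
          ... | there j = Nfalse j
      ... | w , r = skip w , Run.skip f r

      module _ {a b x y U′} ps ms st U (I : Inv (a ∷ ps) ms st U) (t : S a ≡ true) (at : Attach σ α S a b x y U U′) where
        open Inv I
        open Attached {a} {legs ps ms st} uniq Ucl at
        private
          Sb : S b ≡ true
          Sb = trans (S-b (Attach.αa at)) t
          D₀ D₁ : List (Fin d)
          D₀ = darts (a ∷ ps) ms st U
          D₁ = darts (x ∷ y ∷ ps) ms st U′
          a∉U : ¬ a ∈ U
          a∉U = leg∉U (legs (a ∷ ps) ms st) uniq (here refl)
          b∈D₀ : b ∈ D₀
          b∈D₀ = subst (_∈ D₀) (Attach.αa at) (αcl (here refl))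
          a∉D₁ : ¬ a ∈ D₁
          a∉D₁ i = Resolved.≢a res i refl
          b∉D₁ : ¬ b ∈ D₁
          b∉D₁ i = Resolved.≢b res i refl
          sub : ∀ {z} → z ∈ D₁ → z ∈ D₀
          sub = Resolved.⊆ res
          in-U : ∀ {z} → z ∈ U → z ∈ D₀
          in-U i = MemP.∈-++⁺ʳ (legs (a ∷ ps) ms st) i
          ps∉U : ∀ {p} → p ∈ ps → ¬ p ∈ U
          ps∉U p∈ = leg∉U (legs (a ∷ ps) ms st) uniq (there (MemP.∈-++⁺ˡ p∈))

        -- A path between the new vertex and an older pending dart p is the given path between a and
        -- p, extended by the edge of a at the end where the new vertex lies. It stays simple
        -- because the darts at the new vertex were unvisited, whereas the vertices on the given
        -- path had been visited. `inward` is the same in the opposite direction.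
        outward : ∀ {v p} → v ~ b → p ∈ ps → Simple D₁ v p
        outward {v} {p} e p∈ = record
          { zs = b ∷ zs ; link = link∷ e (subst (λ u → Link p u zs) (sym αb) link)
          ; in-S = λ { (here refl) → Sb ; (there i) → in-S i }
          ; ∉D = λ { (here refl) → b∉D₁ ; (there i) j → ∉D i (sub j) }
          ; α∉D = λ { (here refl) j → a∉D₁ (subst (_∈ D₁) αb j) ; (there i) j → α∉D i (sub j) }
          ; apart = λ { (here refl) → apart-U Ucl (b∈U σ α S at) (ps∉U p∈) ; (there i) → apart i }
          ; distinct = All.tabulate (λ i → (λ { refl → ∉D i b∈D₀ }) , (λ e′ → α∉D i (subst (_∈ D₀) e′ b∈D₀)) ,
              not~ (apart-U Ucl (b∈U σ α S at) (λ j → ∉D i (in-U j)))) ∷ distinct }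
          where open Simple (paths (here refl) (there p∈))

        inward : ∀ {v p} → v ∈ U → b ~ v → p ∈ ps → Simple D₁ p v
        inward {v} {p} v∈ e p∈ = record
          { zs = zs ++ a ∷ [] ; link = link-end link t (subst (_~ v) (sym (Attach.αa at)) e)
          ; in-S = λ i → on i in-S t
          ; ∉D = λ {z} i → on {λ z → ¬ z ∈ D₁} i (λ i j → ∉D i (sub j)) a∉D₁
          ; α∉D = λ {z} i → on {λ z → ¬ α z ∈ D₁} i (λ i j → α∉D i (sub j)) (λ j → b∉D₁ (subst (_∈ D₁) (Attach.αa at) j))
          ; apart = λ {z} i → on {λ z → ¬ z ~ v} i (λ i t → apart-U Ucl v∈ (λ j → ∉D i (in-U j)) (V-sym t)) (λ t → apart-U Ucl v∈ a∉U (V-sym t))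
          ; distinct = distinct-end distinct (λ i → (λ { refl → ∉D i (here refl) }) , (λ { refl → ∉D i (αcl (here refl)) }) , not~ (apart i)) }
          where
          open Simple (paths (there p∈) (here refl))
          on : ∀ {P : Fin d → Set} {z} → z ∈ zs ++ a ∷ [] → (∀ {z} → z ∈ zs → P z) → P a → P z
          on i f g with MemP.∈-++⁻ zs i
          ... | inj₁ j = f j
          ... | inj₂ (here refl) = g

        paths′ : ∀ {u v} → u ∈ x ∷ y ∷ ps → v ∈ x ∷ y ∷ ps → Simple D₁ u v
        paths′ (here refl) (here refl) = vertex-path (V-refl x)
        paths′ (here refl) (there (here refl)) = vertex-path xy
        paths′ (there (here refl)) (here refl) = vertex-path (V-sym xy)
        paths′ (there (here refl)) (there (here refl)) = vertex-path (V-refl y)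
        paths′ (here refl) (there (there j)) = outward (V-sym bx) j
        paths′ (there (here refl)) (there (there j)) = outward (V-sym (V-trans bx xy)) j
        paths′ (there (there i)) (here refl) = inward (x∈U σ α S at) bx i
        paths′ (there (there i)) (there (here refl)) = inward (y∈U σ α S at) (V-trans bx xy) i
        paths′ (there (there i)) (there (there j)) = weaken sub (paths (there i) (there j))

        forest-inv : Inv (x ∷ y ∷ ps) ms st U′
        forest-inv = record { uniq = Resolved.unique res ; αcl = αcl-sub res (Attach.αa at) αcl ; Ucl = Ucl′ ; root∉ = λ i → root∉ (U⊇ σ α S at i)
          ; Nfalse = Nfalse ; paths = paths′ }

        explore-forest : Rec (μ (a ∷ ps) ms st U) → Explored (a ∷ ps) ms st U
        explore-forest rec with rec (x ∷ y ∷ ps) ms st U′ forest-inv (μ-forest {a} {x} {y} ps ms st U U′ U-len)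
        ... | w , r = forest w , Run.forest t Sb at r

      -- A forest dart cannot lead to itself, to a pending dart (a cycle) or to a skipped one (those
      -- are outside the forest); so it leads to a new vertex.
      explore-pending : ∀ a ps ms st U → Inv (a ∷ ps) ms st U → Rec (μ (a ∷ ps) ms st U) → S a ≡ true →
        α a ∈ legs (a ∷ ps) ms st ⊎ α a ∈ U → Explored (a ∷ ps) ms st U
      explore-pending a ps ms st U I rec t (inj₂ b∈) = let (b , x , y , U′ , at) = find (Inv.Ucl I) (Inv.root∉ I) b∈ in explore-forest ps ms st U I t at rec
      explore-pending a ps ms st U I rec t (inj₁ (here e)) = ⊥-elim (α-fpf a e)
      explore-pending a ps ms st U I rec t (inj₁ (there i)) with MemP.∈-++⁻ ps i
      ... | inj₁ b∈ = ⊥-elim (no-loop (here refl) (Inv.αcl I (here refl)) t (Inv.paths I (there b∈) (here refl)))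
      ... | inj₂ b∈ = ⊥-elim (true≢false (trans (S-b refl) t) (Inv.Nfalse I b∈))

      leg-match : ∀ a ms st U → Inv [] (a ∷ ms) st U → Rec (μ [] (a ∷ ms) st U) → (∃ λ l₁ → ∃ λ l₂ → ms ≡ l₁ ++ α a ∷ l₂) → Explored [] (a ∷ ms) st U
      leg-match a ms st U I rec (l₁ , l₂ , refl) = explore-match l₁ l₂ st U I rec refl

      leg-merge : ∀ a ms st U {l} → Inv [] (a ∷ ms) st U → Rec (μ [] (a ∷ ms) st U) → (∃ λ l₁ → ∃ λ l₂ → l ≡ l₁ ++ α a ∷ l₂) →
        (∃ λ s₁ → ∃ λ s₂ → st ≡ s₁ ++ l ∷ s₂) → Explored [] (a ∷ ms) st U
      leg-merge a ms st U I rec (l₁ , l₂ , refl) (s₁ , s₂ , refl) = explore-merge ms l₁ l₂ s₁ s₂ U I rec refl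

      explore-known : ∀ a ms st U → Inv [] (a ∷ ms) st U → Rec (μ [] (a ∷ ms) st U) → α a ∈ ms ⊎ α a ∈ concat st → Explored [] (a ∷ ms) st U
      explore-known a ms st U I rec (inj₁ b∈ms) = leg-match a ms st U I rec (MemP.∈-∃++ b∈ms)
      explore-known a ms st U I rec (inj₂ b∈st) = let (l , b∈l , l∈) = MemP.∈-concat⁻′ st b∈st in leg-merge a ms st U {l} I rec (MemP.∈-∃++ b∈l) (MemP.∈-∃++ l∈)

      explore-leg : ∀ a ms st U → Inv [] (a ∷ ms) st U → Rec (μ [] (a ∷ ms) st U) →
        α a ∈ legs [] (a ∷ ms) st ⊎ α a ∈ U → Explored [] (a ∷ ms) st U
      explore-leg a ms st U I rec (inj₂ b∈) = let (b , x , y , U′ , at) = find (Inv.Ucl I) (Inv.root∉ I) b∈ in explore-new ms st U I rec at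
      explore-leg a ms st U I rec (inj₁ (here e)) = ⊥-elim (α-fpf a e)
      explore-leg a ms st U I rec (inj₁ (there i)) = explore-known a ms st U I rec (MemP.∈-++⁻ ms i)

      explore-step : ∀ ps ms st U → Inv ps ms st U → Rec (μ ps ms st U) → Explored ps ms st U
      explore-step [] [] [] U I rec = explore-done U I
      explore-step [] [] (ms ∷ st) U I rec with rec [] ms st U (record { Inv I ; paths = λ () }) (μ-pop ms st U)
      ... | w , r = pop w , Run.pop r
      explore-step [] (a ∷ ms) st U I rec = explore-leg a ms st U I rec (MemP.∈-++⁻ (legs [] (a ∷ ms) st) (Inv.αcl I (here refl)))
      explore-step (a ∷ ps) ms st U I rec with bool-cases (S a)
      ... | inj₁ t = explore-pending a ps ms st U I rec t (MemP.∈-++⁻ (legs (a ∷ ps) ms st) (Inv.αcl I (here refl)))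
      ... | inj₂ f = explore-skip ps ms st U I rec f

      explore-acc : ∀ ps ms st U → Inv ps ms st U → Acc _<_ (μ ps ms st U) → Explored ps ms st U
      explore-acc ps ms st U I (acc rs) = explore-step ps ms st U I λ ps′ ms′ st′ U′ I′ lt → explore-acc ps′ ms′ st′ U′ I′ (rs lt)

    explore : ∀ U → Unique (root ∷ U) → (∀ z → z ∈ root ∷ U) → ∃ λ w → Run σ α S w (root ∷ []) [] [] U
    explore U u complete = explore-acc (root ∷ []) [] [] U inv (<-wellFounded _)
      where
      inv : Inv (root ∷ []) [] [] U
      inv = record
        { uniq = u ; αcl = λ _ → complete _
        ; Ucl = λ {z} z∈ → there⁻ (λ e → All.lookup (AllPairs.head u) z∈ (sym (σ-inj (trans e (sym σroot))))) (complete (σ z))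
        ; root∉ = λ i → All.lookup (AllPairs.head u) i refl
        ; Nfalse = λ () ; paths = λ { (here refl) (here refl) → vertex-path (V-refl root) } }

 -- Every valid word is realised by a forested map.

 module Realize where
  open import Defs
  open Finite
  open Subsets
  open Runs
  open Complete
  open Compare
  open Explore
  open import Data.Nat using (_+_; _*_; _∸_)
  open import Data.Nat.Tactic.RingSolver using (solve-∀)
  open import Data.Fin using () renaming (zero to fz; suc to fs)
  import Data.Fin.Properties as FinP
  open import Data.List using (_++_; concat; tabulate)
  import Data.List.Properties as ListP
  import Data.List.Membership.Propositional.Properties as MemP
  open import Data.List.Relation.Binary.Permutation.Propositional as Perm using (_↭_; ↭-refl; ↭-sym; ↭-trans; prep)
  import Data.List.Relation.Binary.Permutation.Propositional.Properties as PermP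
  import Data.List.Relation.Unary.Unique.Propositional.Properties as UniP
  open import Data.Product using (swap)
  open import Relation.Binary.PropositionalEquality

  -- The words of runs without merges, from a state with the given numbers of darts.
  data Valid : Word → ℕ → ℕ → List ℕ → Set where
    done : Valid done 0 0 []
    pop : ∀ {w m st} → Valid w 0 m st → Valid (pop w) 0 0 (m ∷ st)
    forest : ∀ {w p m st} → Valid w (2 + p) m st → Valid (forest w) (1 + p) m st
    skip : ∀ {w p m st} → Valid w p (1 + m) st → Valid (skip w) (1 + p) m st
    new : ∀ {w m st} → Valid w 2 m st → Valid (new w) 0 (1 + m) st
    match : ∀ {w m i j st} → m ≡ i + suc j → Valid w 0 i (j ∷ st) → Valid (match i w) 0 (1 + m) st

  valid-merges : ∀ {w p m st} → Valid w p m st → merges w ≡ 0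
  valid-merges done = refl
  valid-merges (pop v) = valid-merges v
  valid-merges (forest v) = valid-merges v
  valid-merges (skip v) = valid-merges v
  valid-merges (new v) = valid-merges v
  valid-merges (match _ v) = valid-merges v

  run-valid : ∀ {A : Set} {σ α : A → A} {S w ps ms st U} → Run σ α S w ps ms st U → merges w ≡ 0 → Valid w (length ps) (length ms) (map length st)
  run-valid done _ = done
  run-valid (pop r) m = pop (run-valid r m)
  run-valid (forest _ _ _ r) m = forest (run-valid r m)
  run-valid (skip {w} {a} {ps} {ms} {st} _ r) m = skip (subst (λ n → Valid w (length ps) n (map length st)) (trans (ListP.length-++ ms) (ℕP.+-comm (length ms) 1)) (run-valid r m))
  run-valid (new _ _ _ r) m = new (run-valid r m)
  run-valid (match {l₁ = l₁} _ _ _ refl refl r) m = match (ListP.length-++ l₁) (run-valid r m)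
  run-valid (merge _ _ _ _ _) ()

  module _ {A : Set} where

    Agree : {B : Set} → List (A × B) → (A → B) → Set
    Agree zs f = ∀ {x y} → (x , y) ∈ zs → f x ≡ y

    -- Association lists for σ, α and S that make the word a run.
    record Wiring (w : Word) (ps ms : List A) (st : List (List A)) (U : List A) : Set where
      field
        αs σs : List (A × A)
        Ss : List (A × Bool)
        α-firsts : map proj₁ αs ↭ darts ps ms st U
        α-sym : ∀ {x y} → (x , y) ∈ αs → (y , x) ∈ αs
        α-moves : ∀ {x y} → (x , y) ∈ αs → ¬ x ≡ y
        σ-firsts : map proj₁ σs ↭ U
        σ-seconds : map proj₂ σs ↭ U
        S-firsts : map proj₁ Ss ↭ darts ps ms st U
        S-false : ∀ {z} → z ∈ ms ++ concat st → (z , false) ∈ Ss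
        run : ∀ σ α S → Agree αs α → Agree σs σ → Agree Ss S → Run σ α S w ps ms st U

    private
      edge-sym : ∀ {a b : A} {αs} → (∀ {x y} → (x , y) ∈ αs → (y , x) ∈ αs) → ∀ {x y} → (x , y) ∈ (a , b) ∷ (b , a) ∷ αs → (y , x) ∈ (a , b) ∷ (b , a) ∷ αs
      edge-sym h (here refl) = there (here refl)
      edge-sym h (there (here refl)) = here refl
      edge-sym h (there (there i)) = there (there (h i))

      edge-moves : ∀ {a b : A} {αs} → ¬ a ≡ b → (∀ {x y} → (x , y) ∈ αs → ¬ x ≡ y) → ∀ {x y} → (x , y) ∈ (a , b) ∷ (b , a) ∷ αs → ¬ x ≡ y
      edge-moves ne h (here refl) = ne
      edge-moves ne h (there (here refl)) e = ne (sym e)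
      edge-moves ne h (there (there i)) = h i

      cycle : A → A → A → List (A × A) → List (A × A)
      cycle b x y σs = (b , x) ∷ (x , y) ∷ (y , b) ∷ σs

      cycle-seconds : ∀ {b x y : A} {σs U} → map proj₂ σs ↭ U → map proj₂ (cycle b x y σs) ↭ b ∷ x ∷ y ∷ U
      cycle-seconds {b} {x} {y} p = ↭-trans (prep x (prep y (prep b p))) (↭-trans (prep x (Perm.swap y b ↭-refl)) (Perm.swap x b ↭-refl))

      tail² : {B : Set} {f : A → B} {u v : A × B} {zs : List (A × B)} → Agree (u ∷ v ∷ zs) f → Agree zs f
      tail² h i = h (there (there i))

      attach-list : ∀ {σ α : A → A} {S a b x y U} {σs : List (A × A)} {αs : List (A × A)} → Agree ((a , b) ∷ (b , a) ∷ αs) α → Agree (cycle b x y σs) σ →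
        Attach σ α S a b x y (b ∷ x ∷ y ∷ U) U
      attach-list hα hσ = attach (hα (here refl)) (hσ (here refl)) (hσ (there (here refl))) (hσ (there (there (here refl)))) ↭-refl

      split-length : ∀ i {j} (ms : List A) → length ms ≡ i + suc j → ∃ λ l₁ → ∃ λ b → ∃ λ l₂ → ms ≡ l₁ ++ b ∷ l₂ × length l₁ ≡ i × length l₂ ≡ j
      split-length zero (b ∷ l₂) e = [] , b , l₂ , refl , refl , ℕP.suc-injective e
      split-length (suc i) (z ∷ ms) e with split-length i ms (ℕP.suc-injective e)
      ... | l₁ , b , l₂ , p , q , r = z ∷ l₁ , b , l₂ , cong (z ∷_) p , cong suc q , r

    -- The word itself prescribes the wiring; a new vertex takes the next three darts of U, and by
    -- Euler's count U has just enough of them. A skipped dart enters `Ss` only when its edge is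
    -- resolved later on. `S-false` supplies the value that the letter `skip` needs already at the
    -- time of skipping.
    wire : ∀ {w p m sts} → Valid w p m sts → ∀ (ps ms : List A) st U → length ps ≡ p → length ms ≡ m → map length st ≡ sts →
      length U ≡ verts w * 3 → Unique (darts ps ms st U) → Wiring w ps ms st U
    wire done [] [] [] [] _ _ _ _ _ = record
      { αs = [] ; σs = [] ; Ss = [] ; α-firsts = ↭-refl ; α-sym = λ () ; α-moves = λ () ; σ-firsts = ↭-refl ; σ-seconds = ↭-refl
      ; S-firsts = ↭-refl ; S-false = λ () ; run = λ _ _ _ _ _ _ → done }
    wire (pop v) [] [] (ms ∷ st) U _ _ refl eU u = record
      { αs = αs ; σs = σs ; Ss = Ss ; α-firsts = α-firsts ; α-sym = α-sym ; α-moves = α-moves ; σ-firsts = σ-firsts ; σ-seconds = σ-seconds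
      ; S-firsts = S-firsts ; S-false = S-false ; run = λ σ α S hα hσ hS → pop (run σ α S hα hσ hS) }
      where open Wiring (wire v [] ms st U refl refl refl eU u)
    wire (forest v) (a ∷ ps) ms st (b ∷ x ∷ y ∷ U) refl em es eU u = record
      { αs = (a , b) ∷ (b , a) ∷ αs ; σs = cycle b x y σs ; Ss = (a , true) ∷ (b , true) ∷ Ss
      ; α-firsts = ↭-trans (prep a (prep b α-firsts)) (↭-sym perm) ; α-sym = edge-sym α-sym ; α-moves = edge-moves (Resolved.a≢b res) α-moves
      ; σ-firsts = prep b (prep x (prep y σ-firsts)) ; σ-seconds = cycle-seconds σ-seconds
      ; S-firsts = ↭-trans (prep a (prep b S-firsts)) (↭-sym perm) ; S-false = λ i → there (there (S-false i))
      ; run = λ σ α S hα hσ hS → forest (hS (here refl)) (hS (there (here refl))) (attach-list hα hσ)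
          (run σ α S (λ i → hα (there (there i))) (λ i → hσ (there (there (there i)))) (tail² {f = S} hS)) }
      where
      perm = darts-attach {R = legs ps ms st} a (↭-refl {x = b ∷ x ∷ y ∷ U})
      res = resolved u perm
      open Wiring (wire v (x ∷ y ∷ ps) ms st U refl em es (ℕP.suc-injective (ℕP.suc-injective (ℕP.suc-injective eU))) (Resolved.unique res))
    wire (skip v) (a ∷ ps) ms st U refl em es eU u = record
      { αs = αs ; σs = σs ; Ss = Ss ; α-firsts = ↭-trans α-firsts (↭-sym perm) ; α-sym = α-sym ; α-moves = α-moves ; σ-firsts = σ-firsts ; σ-seconds = σ-seconds
      ; S-firsts = ↭-trans S-firsts (↭-sym perm) ; S-false = λ i → S-false (PermP.∈-resp-↭ (legs-skip a [] ms st) (there i))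
      ; run = λ σ α S hα hσ hS → skip (hS (S-false (PermP.∈-resp-↭ (legs-skip a [] ms st) (here refl)))) (run σ α S hα hσ hS) }
      where
      perm = darts-skip a ps ms st U
      open Wiring (wire v ps (ms ++ a ∷ []) st U refl (trans (ListP.length-++ ms) (trans (ℕP.+-comm (length ms) 1) (cong suc em))) es eU (Unique-resp perm u))
    wire (new v) [] (a ∷ ms) st (b ∷ x ∷ y ∷ U) _ em es eU u = record
      { αs = (a , b) ∷ (b , a) ∷ αs ; σs = cycle b x y σs ; Ss = (a , false) ∷ (b , false) ∷ Ss
      ; α-firsts = ↭-trans (prep a (prep b α-firsts)) (↭-sym perm) ; α-sym = edge-sym α-sym ; α-moves = edge-moves (Resolved.a≢b res) α-moves
      ; σ-firsts = prep b (prep x (prep y σ-firsts)) ; σ-seconds = cycle-seconds σ-seconds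
      ; S-firsts = ↭-trans (prep a (prep b S-firsts)) (↭-sym perm) ; S-false = λ { (here refl) → here refl ; (there i) → there (there (S-false i)) }
      ; run = λ σ α S hα hσ hS → new (hS (here refl)) (hS (there (here refl))) (attach-list hα hσ)
          (run σ α S (λ i → hα (there (there i))) (λ i → hσ (there (there (there i)))) (tail² {f = S} hS)) }
      where
      perm = darts-attach {R = legs [] ms st} a (↭-refl {x = b ∷ x ∷ y ∷ U})
      res = resolved u perm
      open Wiring (wire v (x ∷ y ∷ []) ms st U refl (ℕP.suc-injective em) es (ℕP.suc-injective (ℕP.suc-injective (ℕP.suc-injective eU))) (Resolved.unique res))
    wire (match {i = i} em′ v) [] (a ∷ ms) st U _ em es eU u with split-length i ms (trans (ℕP.suc-injective em) em′)
    ... | l₁ , b , l₂ , refl , e₁ , e₂ = record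
      { αs = (a , b) ∷ (b , a) ∷ αs ; σs = σs ; Ss = (a , false) ∷ (b , false) ∷ Ss
      ; α-firsts = ↭-trans (prep a (prep b α-firsts)) (↭-sym perm) ; α-sym = edge-sym α-sym ; α-moves = edge-moves (Resolved.a≢b res) α-moves
      ; σ-firsts = σ-firsts ; σ-seconds = σ-seconds
      ; S-firsts = ↭-trans (prep a (prep b S-firsts)) (↭-sym perm) ; S-false = λ j → S-false⁺ (PermP.∈-resp-↭ (legs-match a b l₁ l₂ st) j)
      ; run = λ σ α S hα hσ hS → match (hS (here refl)) (hS (there (here refl))) (hα (here refl)) refl e₁
          (run σ α S (λ i → hα (there (there i))) hσ (tail² {f = S} hS)) }
      where
      perm = darts-match a b l₁ l₂ st U
      res = resolved u perm
      open Wiring (wire v [] l₁ (l₂ ∷ st) U refl e₁ (cong₂ _∷_ e₂ es) eU (Resolved.unique res))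
      S-false⁺ : ∀ {z} → z ∈ a ∷ b ∷ legs [] l₁ (l₂ ∷ st) → (z , false) ∈ (a , false) ∷ (b , false) ∷ Ss
      S-false⁺ (here refl) = here refl
      S-false⁺ (there (here refl)) = there (here refl)
      S-false⁺ (there (there j)) = there (there (S-false j))

  module Assoc {A B : Set} {D₀ : List A} (zs : List (A × B)) (firsts : map proj₁ zs ↭ D₀) (uniq : Unique D₀) (complete : ∀ z → z ∈ D₀) where

    private
      entry : ∀ z → ∃ λ y → (z , y) ∈ zs
      entry z with MemP.∈-map⁻ proj₁ (PermP.∈-resp-↭ (↭-sym firsts) (complete z))
      ... | (_ , y) , i , refl = y , i

    fn : A → B
    fn z = proj₁ (entry z)

    fn∈ : ∀ z → (z , fn z) ∈ zs
    fn∈ z = proj₂ (entry z)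

    agree : Agree zs fn
    agree {x} i = first-unique (Unique-resp (↭-sym firsts) uniq) (fn∈ x) i

  -- The word is followed by the exploration of M equipped with the forest S.
  record Explored {d} (M : Map d) (S : Fin d → Bool) (w : Word) : Set where
    field
      U : List (Fin d)
      uniq : Unique (Map.root M ∷ U)
      complete : ∀ z → z ∈ Map.root M ∷ U
      run : Run (Map.σ M) (Map.α M) S w (Map.root M ∷ []) [] [] U
      no-merge : merges w ≡ 0

  private
    planar-count : ∀ v p → 2 * p + 4 * 0 ≡ v + 1 + 2 → 2 * (suc v + p) ≡ suc (v * 3) + 4
    planar-count v p e = trans (lhs v p) (trans (cong (λ n → 2 * suc v + n) e) (rhs v))
      where
      lhs : ∀ v p → 2 * (suc v + p) ≡ 2 * suc v + (2 * p + 4 * 0)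
      lhs = solve-∀
      rhs : ∀ v → 2 * suc v + (v + 1 + 2) ≡ suc (v * 3) + 4
      rhs = solve-∀

    -- Planarity is Euler's count without the term 4m, so a positive m would make a number larger
    -- than itself.
    no-merges : ∀ v p m → 2 * p + 4 * m ≡ v + 1 + 2 → 2 * (suc v + p) ≡ suc (v * 3) + 4 → m ≡ 0
    no-merges v p zero e f = refl
    no-merges v p (suc m) e f = ⊥-elim (ℕP.<-irrefl refl (ℕP.<-≤-trans (ℕP.m<m+n (2 * (suc v + p)) {4 * suc m} (s≤s z≤n))
        (ℕP.≤-reflexive (trans (lhs v p m) (trans (cong (λ n → 2 * suc v + n) e) (trans (rhs v) (sym f)))))))
      where
      lhs : ∀ v p m → 2 * (suc v + p) + 4 * suc m ≡ 2 * suc v + (2 * p + 4 * suc m)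
      lhs = solve-∀
      rhs : ∀ v → 2 * suc v + (v + 1 + 2) ≡ suc (v * 3) + 4
      rhs = solve-∀

  -- The darts are 0, ..., 3v with root 0. The lists of `wire` cover every dart once and so are
  -- graphs of functions; the pair of the root with itself completes σ, and reversing all pairs
  -- gives its inverse.
  realize : ∀ {w} → Valid w 1 0 [] → ∃ λ d → Σ (Map d) λ M → ∃ λ S → Explored M S w × Admissible (pops w) (d , M)
  realize {w} v = suc n , M , Sf , record { U = U ; uniq = uniq ; complete = complete ; run = run ; no-merge = valid-merges v } ,
      trans (cong₂ (λ a b → 2 * (a + b)) C.vertices≡ C.faces≡)
        (planar-count (verts w) (pops w) (trans (cong (λ m → 2 * pops w + 4 * m) (sym (valid-merges v))) (euler run))) ,
      C.cubic , C.root-degree , C.faces≡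
    where
    n = verts w * 3
    root : Fin (suc n)
    root = fz
    U : List (Fin (suc n))
    U = tabulate fs
    uniq : Unique (root ∷ U)
    uniq = allFin-unique (suc n)
    complete : ∀ z → z ∈ root ∷ U
    complete = ∈-allFin
    W : Wiring w (root ∷ []) [] [] U
    W = wire v (root ∷ []) [] [] U refl refl refl (ListP.length-tabulate fs) uniq
    module W = Wiring W
    module Aα = Assoc W.αs W.α-firsts uniq complete
    module AS = Assoc W.Ss W.S-firsts uniq complete
    σs : List (Fin (suc n) × Fin (suc n))
    σs = (root , root) ∷ W.σs
    module Aσ = Assoc σs (prep root W.σ-firsts) uniq complete
    swapped : map proj₁ (map swap σs) ≡ map proj₂ σs
    swapped = sym (ListP.map-∘ σs)
    module Aσ⁻ = Assoc (map swap σs) (subst (_↭ root ∷ U) (sym swapped) (prep root W.σ-seconds)) uniq complete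
    σf σ⁻f αf : Fin (suc n) → Fin (suc n)
    σf = Aσ.fn
    σ⁻f = Aσ⁻.fn
    αf = Aα.fn
    Sf : Fin (suc n) → Bool
    Sf = AS.fn
    σσ⁻ : ∀ i → σf (σ⁻f i) ≡ i
    σσ⁻ i with MemP.∈-map⁻ swap (Aσ⁻.fn∈ i)
    ... | (x , y) , j , e = Aσ.agree (subst (_∈ σs) (cong swap (sym e)) j)
    σ⁻σ : ∀ i → σ⁻f (σf i) ≡ i
    σ⁻σ i = Aσ⁻.agree (MemP.∈-map⁺ swap (Aσ.fn∈ i))
    αα : ∀ i → αf (αf i) ≡ i
    αα i = Aα.agree (W.α-sym (Aα.fn∈ i))
    α-fpf : ∀ i → ¬ αf i ≡ i
    α-fpf i e = W.α-moves (Aα.fn∈ i) (sym e)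
    σroot : σf root ≡ root
    σroot = Aσ.agree (here refl)
    run : Run σf αf Sf w (root ∷ []) [] [] U
    run = W.run σf αf Sf Aα.agree (λ i → Aσ.agree (there i)) AS.agree
    complete′ : ∀ z → z ≡ root ⊎ z ∈ U
    complete′ z with complete z
    ... | here e = inj₁ e
    ... | there i = inj₂ i
    module C = CompleteRun σf σ⁻f αf σσ⁻ σ⁻σ αα Sf root σroot run uniq complete′
    M : Map (suc n)
    M = record { σ = σf ; σ⁻ = σ⁻f ; α = αf ; σσ⁻ = σσ⁻ ; σ⁻σ = σ⁻σ ; αα = αα ; α-fpf = α-fpf ; root = root ; connected = C.connected-run }

  module Facts {d} (M : Map d) (near-cubic : Map.NearCubic M) (root-degree : Map.RootDeg1 M) {S : Fin d → Bool} {w : Word} {U : List (Fin d)}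
    (run : Run (Map.σ M) (Map.α M) S w (Map.root M ∷ []) [] [] U) (uniq : Unique (Map.root M ∷ U)) (complete : ∀ z → z ∈ Map.root M ∷ U) where
    private
      complete′ : ∀ z → z ≡ Map.root M ⊎ z ∈ U
      complete′ z with complete z
      ... | here e = inj₁ e
      ... | there i = inj₂ i
      module C = CompleteRun (Map.σ M) (Map.σ⁻ M) (Map.α M) (Map.σσ⁻ M) (Map.σ⁻σ M) (Map.αα M) S (Map.root M) (Cubic.σroot M near-cubic root-degree) run uniq complete′

    faces≡ : Map.#faces M ≡ pops w
    faces≡ = C.faces≡

    components≡ : Map.components M S ≡ suc (news w)
    components≡ = C.components≡

    is-forest : Map.isForest M S ≡ true
    is-forest = cong₂ Data.Bool._∧_ (αClosed-true⁺ M S C.closed) (C.run-acyclic M refl refl)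

    planar-merges : Map.Planar M → merges w ≡ 0
    planar-merges pl = no-merges (verts w) (pops w) (merges w) (euler run)
      (trans (sym (cong₂ (λ a b → 2 * (a + b)) C.vertices≡ C.faces≡)) (trans pl (cong (_+ 4) C.dart-count)))

  explored : ∀ {n d} (M : Map d) → Admissible n (d , M) → ∀ S → Map.isForest M S ≡ true →
    ∃ λ w → Explored M S w × Valid w 1 0 [] × pops w ≡ n × Map.components M S ≡ suc (news w)
  explored {n} {d} M (pl , nc , rd , fa) S fo with MemP.∈-∃++ (∈-allFin (Map.root M))
  ... | l , r , eq = go (Exploration.explore M nc rd S fo U uniq complete)
    where
    U = l ++ r
    perm : allFin d ↭ Map.root M ∷ U
    perm = ↭-trans (Perm.↭-reflexive eq) (PermP.shift (Map.root M) l r)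
    uniq : Unique (Map.root M ∷ U)
    uniq = Unique-resp perm (allFin-unique d)
    complete : ∀ z → z ∈ Map.root M ∷ U
    complete z = PermP.∈-resp-↭ perm (∈-allFin z)
    go : (∃ λ w → Run (Map.σ M) (Map.α M) S w (Map.root M ∷ []) [] [] U) → _
    go (w , run) = w , record { U = U ; uniq = uniq ; complete = complete ; run = run ; no-merge = F.planar-merges pl } ,
      run-valid run (F.planar-merges pl) , trans (sym F.faces≡) fa , F.components≡
      where module F = Facts M nc rd run uniq complete

 -- Isomorphism classes of forested maps correspond to valid words.

 module Bijection where
  open import Defs
  open Finite
  open Subsets
  open Runs
  open Compare
  open Explore
  open Realize
  open import Data.Nat using (_+_; _∸_)
  open import Data.List using (_++_)
  import Data.List.Properties as ListP
  open import Data.List.Membership.Propositional using (find; lose)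
  import Data.List.Membership.Propositional.Properties as MemP
  open import Data.List.Relation.Binary.Permutation.Propositional as Perm using (_↭_; ↭-refl; ↭-sym; ↭-trans; prep)
  import Data.List.Relation.Binary.Permutation.Propositional.Properties as PermP
  open import Data.List.Relation.Binary.Pointwise using (Pointwise; []; _∷_)
  import Data.List.Relation.Unary.All.Properties as AllP
  import Data.List.Relation.Unary.AllPairs.Properties as AllPairsP
  open import Data.Unit using (tt)
  open import Data.Product using (swap)
  open import Relation.Binary.PropositionalEquality
  open import Relation.Binary.Construct.Closure.ReflexiveTransitive using (Star; ε; _◅_)

  -- The pairs visited in lockstep contain each dart of either map once, hence define mutually
  -- inverse functions, and they respect σ, α and the forests.
  iso-of-words : ∀ {n n′ d d′} {M : Map d} {M′ : Map d′} {S S′ w} → Admissible n (d , M) → Admissible n′ (d′ , M′) →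
    Explored M S w → Explored M′ S′ w → Σ (Iso (d , M) (d′ , M′)) λ i → ∀ z → S z ≡ S′ (proj₁ i z)
  iso-of-words {d = d} {d′} {M} {M′} {S} {S′} (_ , nc , rd , _) (_ , nc′ , rd′ , _) E E′ =
    (f , f⁻ , f⁻f , ff⁻ , fσ , fα , froot) , λ z → S-paired (A.fn∈ z)
    where
    module E = Explored E
    module E′ = Explored E′
    open Lockstep {σ = Map.σ M} {Map.α M} {S} {Map.σ M′} {Map.α M′} {S′} (Map.αα M) (Map.αα M′)
    open Paired (lockstep E.run E′.run E.no-merge (tt ∷ []) [] [])
    swapped : map proj₁ (map swap zs) ≡ map proj₂ zs
    swapped = sym (ListP.map-∘ zs)
    module A = Assoc zs firsts E.uniq E.complete
    module B = Assoc (map swap zs) (subst (_↭ Map.root M′ ∷ E′.U) (sym swapped) seconds) E′.uniq E′.complete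
    f : Fin d → Fin d′
    f = A.fn
    f⁻ : Fin d′ → Fin d
    f⁻ = B.fn
    f⁻f : ∀ i → f⁻ (f i) ≡ i
    f⁻f i = B.agree (MemP.∈-map⁺ swap (A.fn∈ i))
    ff⁻ : ∀ j → f (f⁻ j) ≡ j
    ff⁻ j with MemP.∈-map⁻ swap (B.fn∈ j)
    ... | (x , y) , k , e = A.agree (subst (_∈ zs) (cong swap (sym e)) k)
    root∈ : (Map.root M , Map.root M′) ∈ zs
    root∈ with ps-paired
    ... | p ∷ [] = p
    froot : f (Map.root M) ≡ Map.root M′
    froot = A.agree root∈
    fα : ∀ i → f (Map.α M i) ≡ Map.α M′ (f i)
    fα i = A.agree (α-paired (A.fn∈ i))
    split : ∀ i → i ≡ Map.root M ⊎ i ∈ E.U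
    split i with E.complete i
    ... | here e = inj₁ e
    ... | there i∈ = inj₂ i∈
    fσ : ∀ i → f (Map.σ M i) ≡ Map.σ M′ (f i)
    fσ i with split i
    -- The root is never in U and so is not covered by `σ-paired`; both rotations fix their root
    -- because it has degree 1.
    ... | inj₁ refl = trans (cong f (Cubic.σroot M nc rd)) (trans froot (sym (trans (cong (Map.σ M′) froot) (Cubic.σroot M′ nc′ rd′))))
    ... | inj₂ i∈ with σ-paired i∈
    ... | z′ , p , q = trans (A.agree q) (cong (Map.σ M′) (sym (A.agree p)))

  -- An automorphism fixes the root, and by connectedness every dart is reached from the root by σ
  -- and α. Hence different forests of one map are not identified by a symmetry, and each forest
  -- counts once.
  rigid : ∀ {d} (M : Map d) (i : Iso (d , M) (d , M)) → ∀ z → proj₁ i z ≡ z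
  rigid M (f , f⁻ , _ , _ , fσ , fα , froot) z = go froot (Reach⇒Path (λ k → Map.σ M k ∷ Map.α M k ∷ []) {Map.root M} {z} (Map.connected M (Map.root M) z))
    where
    go : ∀ {x y} → f x ≡ x → Path (λ k → Map.σ M k ∷ Map.α M k ∷ []) x y → f y ≡ y
    go e ε = e
    go e (here refl ◅ p) = go (trans (fσ _) (cong (Map.σ M) e)) p
    go e (there (here refl) ◅ p) = go (trans (fα _) (cong (Map.α M) e)) p

  explored-unique : ∀ {d} {M : Map d} {S w w′} → Explored M S w → Explored M S w′ → w ≡ w′
  explored-unique {M = M} E E′ = Deterministic.deterministic E.run E′.run E.no-merge E′.no-merge
      (PermP.drop-∷ (unique-↭ E.uniq E′.uniq (λ _ → E′.complete _) (λ _ → E.complete _))) E.uniq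
    where
    module E = Explored E
    module E′ = Explored E′

  explored-iso : ∀ {d d′} {M : Map d} {M′ : Map d′} {S w} → Explored M S w → (i : Iso (d , M) (d′ , M′)) →
    ∀ S′ → (∀ z → S′ (proj₁ i z) ≡ S z) → Explored M′ S′ w
  explored-iso {M = M} {M′} {S} {w} E (f , f⁻ , f⁻f , ff⁻ , fσ , fα , froot) S′ h = record
    { U = map f E.U
    ; uniq = subst (λ r → Unique (r ∷ map f E.U)) froot (map-unique E.uniq (λ {x} {y} _ _ e → trans (sym (f⁻f x)) (trans (cong f⁻ e) (f⁻f y))))
    ; complete = λ z → subst (λ r → z ∈ r ∷ map f E.U) froot (subst (_∈ map f (Map.root M ∷ E.U)) (ff⁻ z) (MemP.∈-map⁺ f (E.complete (f⁻ z))))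
    ; run = subst (λ r → Run (Map.σ M′) (Map.α M′) S′ w (r ∷ []) [] [] (map f E.U)) froot (Transport.transport f fσ fα h E.run)
    ; no-merge = E.no-merge }
    where module E = Explored E

  module Choice {X W : Set} (R : X → W → Set) (P : W → Set) (Q : X → W → Set) where

    private
      Chosen : X → Set
      Chosen x = ∃ λ w → R x w × P w × Q x w

      chosen : ∀ {xs} → All Chosen xs → List W
      chosen [] = []
      chosen ((w , _) ∷ gs) = w ∷ chosen gs

      chosen⁻ : ∀ {xs} (gs : All Chosen xs) {w} → w ∈ chosen gs → ∃ λ x → x ∈ xs × R x w × P w
      chosen⁻ ((w , r , p , _) ∷ gs) (here refl) = _ , here refl , r , p
      chosen⁻ (_ ∷ gs) (there w∈) with chosen⁻ gs w∈
      ... | x , x∈ , rest = x , there x∈ , rest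

    -- The words chosen for the items are distinct since no two items share a word. They exhaust
    -- `ys` since a word there comes from some item, and that item has only one word.
    matching : (∀ {x w w′} → R x w → R x w′ → w ≡ w′) → ∀ {xs ys} → All Chosen xs → AllPairs (λ x y → ∀ w → R x w → R y w → ⊥) xs →
      Unique ys → (∀ {w} → P w → w ∈ ys) → (∀ {w} → w ∈ ys → ∃ λ x → x ∈ xs × R x w) → ∃ λ zs → zs ↭ ys × Pointwise Q xs zs
    matching functional {xs} {ys} gs di uy into onto = chosen gs , unique-↭ (chosen-unique gs di) uy (into′ gs) onto′ , pointwise gs
      where
      chosen⁺ : ∀ {xs} (gs : All Chosen xs) {x w} → x ∈ xs → R x w → w ∈ chosen gs
      chosen⁺ ((w , r , _) ∷ gs) (here refl) r′ = here (functional r′ r)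
      chosen⁺ (_ ∷ gs) (there x∈) r′ = there (chosen⁺ gs x∈ r′)
      chosen-unique : ∀ {xs} (gs : All Chosen xs) → AllPairs (λ x y → ∀ w → R x w → R y w → ⊥) xs → Unique (chosen gs)
      chosen-unique [] [] = []
      chosen-unique ((w , r , _) ∷ gs) (p ∷ ps) = All.tabulate (λ {w′} w′∈ e → clash w′∈ e) ∷ chosen-unique gs ps
        where
        clash : ∀ {w′} → w′ ∈ chosen gs → w ≡ w′ → ⊥
        clash w′∈ refl with chosen⁻ gs w′∈
        ... | x , x∈ , r′ , _ = All.lookup p x∈ w r r′
      pointwise : ∀ {xs} (gs : All Chosen xs) → Pointwise Q xs (chosen gs)
      pointwise [] = []
      pointwise ((_ , _ , _ , e) ∷ gs) = e ∷ pointwise gs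
      into′ : ∀ {xs} (gs : All Chosen xs) {w} → w ∈ chosen gs → w ∈ ys
      into′ gs w∈ = into (proj₂ (proj₂ (proj₂ (chosen⁻ gs w∈))))
      onto′ : ∀ {w} → w ∈ ys → w ∈ chosen gs
      onto′ w∈ with onto w∈
      ... | x , x∈ , r = chosen⁺ gs x∈ r

  Item : Set
  Item = Σ RMap λ M → Fin (proj₁ M) → Bool

  itemsOf : RMap → List Item
  itemsOf (d , M) = map (λ S → (d , M) , S) (filterᵇ (Map.isForest M) (subsets M d))

  items : List RMap → List Item
  items = concatMap itemsOf

  itemsOf⁻ : ∀ {M x} → x ∈ itemsOf M → Σ (Fin (proj₁ M) → Bool) λ S → x ≡ (M , S) × S ∈ subsets (proj₂ M) (proj₁ M) × Map.isForest (proj₂ M) S ≡ true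
  itemsOf⁻ {d , M} x∈ with MemP.∈-map⁻ (λ S → (d , M) , S) x∈
  ... | S , S∈ , refl with ∈-filterᵇ⁻ (Map.isForest M) {xs = subsets M d} S∈
  ... | S∈′ , fo = S , refl , S∈′ , fo

  items⁻ : ∀ Ms {x} → x ∈ items Ms → proj₁ x ∈ Ms × Map.isForest (proj₂ (proj₁ x)) (proj₂ x) ≡ true
  items⁻ Ms x∈ with MemP.∈-concat⁻′ (map itemsOf Ms) x∈
  ... | l , x∈l , l∈ with MemP.∈-map⁻ itemsOf l∈
  ... | M , M∈ , refl with itemsOf⁻ {M} x∈l
  ... | S , refl , _ , fo = M∈ , fo

  Rel : Item → Word → Set
  Rel ((d , M) , S) w = Explored M S w

  Weighs : Item → Word → Set
  Weighs ((d , M) , S) w = Map.components M S ≡ suc (news w)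

  Good : ℕ → Item → Set
  Good n x = ∃ λ w → Rel x w × Valid w 1 0 [] × pops w ≡ n × Weighs x w

  item-good : ∀ n (x : Item) → Admissible n (proj₁ x) → Map.isForest (proj₂ (proj₁ x)) (proj₂ x) ≡ true → Good n x
  item-good n ((d , M) , S) ad fo = explored {n} {d} M ad S fo

  allPairs-filterᵇ : ∀ {A : Set} {R : A → A → Set} (p : A → Bool) {xs} → AllPairs R xs → AllPairs R (filterᵇ p xs)
  allPairs-filterᵇ p [] = []
  allPairs-filterᵇ p {x ∷ xs} (q ∷ qs) with p x
  ... | true = All.tabulate (λ i → All.lookup q (proj₁ (∈-filterᵇ⁻ p {xs = xs} i))) ∷ allPairs-filterᵇ p qs
  ... | false = allPairs-filterᵇ p qs

  explored-forest : ∀ n {d} (M : Map d) S w → Admissible n (d , M) → Explored M S w → Map.isForest M S ≡ true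
  explored-forest n M S w (_ , nc , rd , _) E = Facts.is-forest M nc rd {S} {w} {Explored.U E} (Explored.run E) (Explored.uniq E) (Explored.complete E)

  subset-item : ∀ {d} (M : Map d) S {Ms} → S ∈ subsets M d → Map.isForest M S ≡ true → (d , M) ∈ Ms → ((d , M) , S) ∈ items Ms
  subset-item {d} M S S∈ fo M∈ = MemP.∈-concat⁺′ (MemP.∈-map⁺ (λ S → (d , M) , S) (∈-filterᵇ⁺ (Map.isForest M) S∈ fo)) (MemP.∈-map⁺ itemsOf M∈)

  module _ {n : ℕ} where

    iso-item : ∀ {w d} {M : Map d} {S} → Explored M S w → ∀ {Ms} → All (Admissible n) Ms → ∀ {d′} (M′ : Map d′) → (d′ , M′) ∈ Ms → Iso (d , M) (d′ , M′) →
      ∃ λ x → x ∈ items Ms × Rel x w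
    iso-item {w} {M = M} {S} E {Ms} ad {d′} M′ M′∈ i with subsets-complete M′ d′ (λ z → S (proj₁ (proj₂ i) z))
    ... | T , T∈ , h = ((d′ , M′) , T) , subset-item M′ T {Ms} T∈ (explored-forest n M′ T w (All.lookup ad M′∈) E′) M′∈ , E′
      where
      E′ : Explored M′ T w
      E′ = explored-iso E i T λ z → trans (sym (h (proj₁ i z))) (cong S (proj₁ (proj₂ (proj₂ i)) z))

    realized-item : ∀ {w d} (M : Map d) S → Explored M S w → ∀ Ms → All (Admissible n) Ms → Any (Iso (d , M)) Ms → ∃ λ x → x ∈ items Ms × Rel x w
    realized-item M S E Ms ad any with find any
    ... | (d′ , M′) , M′∈ , i = iso-item {M = M} {S} E ad M′ M′∈ i

    -- A shared word yields an isomorphism that matches the forests. Within one map it is the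
    -- identity by `rigid`, so the forests coincide; between two listed maps it contradicts their
    -- being representatives of different classes.
    items-distinct : ∀ Ms → All (Admissible n) Ms → AllPairs (λ M M′ → ¬ Iso M M′) Ms →
      AllPairs (λ x y → ∀ w → Rel x w → Rel y w → ⊥) (items Ms)
    items-distinct [] [] [] = []
    items-distinct (M ∷ Ms) (adM ∷ ad) (p ∷ ps) = AllPairsP.++⁺ (AllPairsP.map⁺ (AllPairs.map same (allPairs-filterᵇ _ (subsets-distinct (proj₂ M) _))))
        (items-distinct Ms ad ps) (All.tabulate λ x∈ → All.tabulate λ y∈ → far x∈ y∈)
      where
      same : ∀ {S T} → ¬ (∀ i → S i ≡ T i) → ∀ w → Rel (M , S) w → Rel (M , T) w → ⊥
      same {S} {T} ne w r r′ with iso-of-words {S = S} {T} adM adM r r′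
      ... | i , h = ne λ z → trans (h z) (cong T (rigid (proj₂ M) i z))
      far : ∀ {x y} → x ∈ itemsOf M → y ∈ items Ms → ∀ w → Rel x w → Rel y w → ⊥
      far {x} {y} x∈ y∈ w r r′ with itemsOf⁻ {M} x∈
      ... | S , refl , _ , _ = All.lookup p (proj₁ (items⁻ Ms y∈)) (proj₁ (iso-of-words {S = S} {proj₂ y} adM (All.lookup ad (proj₁ (items⁻ Ms y∈))) r r′))

    items-words : ∀ Ms → All (Admissible n) Ms → All (Good n) (items Ms)
    items-words Ms ad = All.tabulate λ {x} x∈ → item-good n x (All.lookup ad (proj₁ (items⁻ Ms x∈))) (proj₂ (items⁻ Ms x∈))

    words-items : ∀ Ms → All (Admissible n) Ms → (∀ M → Admissible n M → Any (Iso M) Ms) →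
      ∀ {w} → Valid w 1 0 [] → pops w ≡ n → ∃ λ x → x ∈ items Ms × Rel x w
    words-items Ms ad cov v e = realized e (realize v)
      where
      realized : ∀ {w} → pops w ≡ n → (∃ λ d → Σ (Map d) λ M → ∃ λ S → Explored M S w × Admissible (pops w) (d , M)) → ∃ λ x → x ∈ items Ms × Rel x w
      realized e (d , M , S , E , adm) = realized-item M S E Ms ad (cov (d , M) (subst (λ k → Admissible k (d , M)) e adm))

    -- Sending a map with a forest to its exploration word is a bijection from isomorphism classes to valid words.
    bijection : ∀ Ms → All (Admissible n) Ms → AllPairs (λ M M′ → ¬ Iso M M′) Ms → (∀ M → Admissible n M → Any (Iso M) Ms) →
      ∀ ys → Unique ys → (∀ {w} → w ∈ ys → Valid w 1 0 [] × pops w ≡ n) → (∀ {w} → Valid w 1 0 [] → pops w ≡ n → w ∈ ys) →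
      ∃ λ zs → zs ↭ ys × Pointwise Weighs (items Ms) zs
    bijection Ms ad di cov ys uy sound compl = Choice.matching Rel (λ w → Valid w 1 0 [] × pops w ≡ n) Weighs
      rel-functional (regroup (items-words Ms ad)) (items-distinct Ms ad di) uy (λ { (v , p) → compl v p })
      (λ w∈ → words-items Ms ad cov (proj₁ (sound w∈)) (proj₂ (sound w∈)))
      where
      rel-functional : ∀ {x w w′} → Rel x w → Rel x w′ → w ≡ w′
      rel-functional {(d , M) , S} = explored-unique {S = S}
      regroup : ∀ {xs} → All (Good n) xs → All (λ x → ∃ λ w → Rel x w × (Valid w 1 0 [] × pops w ≡ n) × Weighs x w) xs
      regroup = All.map λ { (w , r , v , p , e) → w , r , (v , p) , e }

 -- Integer coefficients in a ring, formal power series and derivations.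

 module Ring where
  open import Algebra.Bundles using (RawRing)
  open import Algebra.Structures using (IsCommutativeRing)
  import Algebra.Solver.Ring
  open import Algebra.Solver.Ring.AlmostCommutativeRing using (AlmostCommutativeRing; fromCommutativeRing; _-Raw-AlmostCommutative⟶_)
  import Algebra.Properties.Ring
  import Algebra.Properties.Semiring.Mult.TCOptimised
  open import Data.Integer as ℤ using (ℤ; +_; -[1+_])
  import Data.Integer.Properties as ℤP
  open import Data.Maybe using (Maybe; just; nothing)
  import Relation.Binary.PropositionalEquality as ≡
  open ≡ using (_≡_)
  import Relation.Binary.Reasoning.Setoid

  module Integers (R : CommutativeRing 0ℓ 0ℓ) where
    open CommutativeRing R
    open Algebra.Properties.Ring ring using (-‿distribˡ-*; -‿+-comm; -0#≈0#; -‿involutive)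
    open Algebra.Properties.Semiring.Mult.TCOptimised semiring renaming (_×_ to _·_)
    open Relation.Binary.Reasoning.Setoid setoid

    ι : ℤ → Carrier
    ι (+ n) = n · 1#
    ι -[1+ n ] = - (suc n · 1#)

    ×-suc : ∀ n → suc n · 1# ≈ 1# + n · 1#
    ×-suc zero = sym (+-identityʳ 1#)
    ×-suc (suc n) = +-comm _ _

    private
      cancel : ∀ a b → (1# + a) - (1# + b) ≈ a - b
      cancel a b = begin
        (1# + a) - (1# + b) ≈⟨ +-congˡ (sym (-‿+-comm 1# b)) ⟩
        (1# + a) + (- 1# - b) ≈⟨ +-congʳ (+-comm 1# a) ⟩
        (a + 1#) + (- 1# - b) ≈⟨ +-assoc a 1# _ ⟩
        a + (1# + (- 1# - b)) ≈⟨ +-congˡ (sym (+-assoc 1# (- 1#) (- b))) ⟩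
        a + ((1# - 1#) - b) ≈⟨ +-congˡ (+-congʳ (-‿inverseʳ 1#)) ⟩
        a + (0# - b) ≈⟨ +-congˡ (+-identityˡ (- b)) ⟩
        a - b ∎

      ι-⊖ : ∀ m n → ι (m ℤ.⊖ n) ≈ m · 1# - n · 1#
      ι-⊖ zero zero = sym (-‿inverseʳ 0#)
      ι-⊖ zero (suc n) = sym (+-identityˡ _)
      ι-⊖ (suc m) zero = sym (trans (+-congˡ -0#≈0#) (+-identityʳ _))
      ι-⊖ (suc m) (suc n) = begin
        ι (suc m ℤ.⊖ suc n) ≡⟨ ≡.cong ι (ℤP.[1+m]⊖[1+n]≡m⊖n m n) ⟩
        ι (m ℤ.⊖ n) ≈⟨ ι-⊖ m n ⟩
        m · 1# - n · 1# ≈⟨ cancel _ _ ⟨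
        (1# + m · 1#) - (1# + n · 1#) ≈⟨ +-cong (×-suc m) (-‿cong (×-suc n)) ⟨
        suc m · 1# - suc n · 1# ∎

    ι-+ : ∀ i j → ι (i ℤ.+ j) ≈ ι i + ι j
    ι-+ (+ m) (+ n) = ×-homo-+ 1# m n
    ι-+ (+ m) -[1+ n ] = ι-⊖ m (suc n)
    ι-+ -[1+ m ] (+ n) = trans (ι-⊖ n (suc m)) (+-comm _ _)
    ι-+ -[1+ m ] -[1+ n ] = trans (-‿cong (trans (reflexive (≡.cong (λ k → suc k · 1#) (≡.sym (ℕP.+-suc m n)))) (×-homo-+ 1# (suc m) (suc n)))) (sym (-‿+-comm _ _))

    ι-neg : ∀ i → ι (ℤ.- i) ≈ - ι i
    ι-neg (+ zero) = sym -0#≈0#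
    ι-neg (+ suc n) = refl
    ι-neg -[1+ n ] = sym (-‿involutive _)

    private
      ι-pos : ∀ m j → ι (+ m ℤ.* j) ≈ ι (+ m) * ι j
      ι-pos m (+ n) = trans (reflexive (≡.cong ι (≡.sym (ℤP.pos-* m n)))) (×1-homo-* m n)
      ι-pos m -[1+ n ] = begin
        ι (+ m ℤ.* ℤ.- (+ suc n)) ≡⟨ ≡.cong ι (≡.sym (ℤP.neg-distribʳ-* (+ m) (+ suc n))) ⟩
        ι (ℤ.- (+ m ℤ.* + suc n)) ≈⟨ ι-neg (+ m ℤ.* + suc n) ⟩
        - ι (+ m ℤ.* + suc n) ≈⟨ -‿cong (ι-pos m (+ suc n)) ⟩
        - (ι (+ m) * ι (+ suc n)) ≈⟨ Algebra.Properties.Ring.-‿distribʳ-* ring _ _ ⟩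
        ι (+ m) * ι -[1+ n ] ∎

    ι-* : ∀ i j → ι (i ℤ.* j) ≈ ι i * ι j
    ι-* (+ m) j = ι-pos m j
    ι-* -[1+ m ] j = begin
      ι (ℤ.- (+ suc m) ℤ.* j) ≡⟨ ≡.cong ι (≡.sym (ℤP.neg-distribˡ-* (+ suc m) j)) ⟩
      ι (ℤ.- (+ suc m ℤ.* j)) ≈⟨ ι-neg (+ suc m ℤ.* j) ⟩
      - ι (+ suc m ℤ.* j) ≈⟨ -‿cong (ι-pos (suc m) j) ⟩
      - (ι (+ suc m) * ι j) ≈⟨ -‿distribˡ-* _ _ ⟩
      ι -[1+ m ] * ι j ∎

  module IntegerSolver (R : CommutativeRing 0ℓ 0ℓ) where
    open CommutativeRing R using (_≈_; refl; reflexive)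
    open Integers R

    private
      morphism : ℤ.+-*-rawRing -Raw-AlmostCommutative⟶ fromCommutativeRing R
      morphism = record { ⟦_⟧ = ι ; +-homo = ι-+ ; *-homo = ι-* ; -‿homo = ι-neg ; 0-homo = refl ; 1-homo = refl }

      dec : ∀ i j → Maybe (ι i ≈ ι j)
      dec i j with i ℤ.≟ j
      ... | yes e = just (reflexive (≡.cong ι e))
      ... | no _ = nothing

    open Algebra.Solver.Ring ℤ.+-*-rawRing (fromCommutativeRing R) morphism dec public
      using (Polynomial; solve; prove; _:=_; _:+_; _:*_; _:-_; :-_; con; var)

  -- Kept apart from the modules that use them, whose instances would each duplicate the ring solver.
  module Identities (R : CommutativeRing 0ℓ 0ℓ) where
    open CommutativeRing R
    open IntegerSolver R
    open Integers R using (ι)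

    interchange : ∀ a b c d → (a + b) + (c + d) ≈ (a + c) + (b + d)
    interchange = solve 4 (λ a b c d → (a :+ b) :+ (c :+ d) := (a :+ c) :+ (b :+ d)) refl

    rotate : ∀ a b c d → a + (b + (c + d)) ≈ (b + c) + (a + d)
    rotate = solve 4 (λ a b c d → a :+ (b :+ (c :+ d)) := (b :+ c) :+ (a :+ d)) refl

    zero-factors : ∀ x y → ι (+ 0) * (x * y) ≈ ι (+ 0) * x * y + x * (ι (+ 0) * y)
    zero-factors = solve 2 (λ x y → con (+ 0) :* (x :* y) := con (+ 0) :* x :* y :+ x :* (con (+ 0) :* y)) refl

    suc-factor : ∀ k a b c → (1# + k) * (a * b + c) ≈ a * ((1# + k) * b) + (c + k * c)
    suc-factor = solve 4 (λ k a b c → (con (+ 1) :+ k) :* (a :* b :+ c) := a :* ((con (+ 1) :+ k) :* b) :+ (c :+ k :* c)) refl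

    horner-+ : ∀ a b x p q → a + b + x * (p + q) ≈ a + x * p + (b + x * q)
    horner-+ = solve 5 (λ a b x p q → a :+ b :+ x :* (p :+ q) := a :+ x :* p :+ (b :+ x :* q)) refl

    horner-scale : ∀ a b x p → a * b + x * (a * p) ≈ a * (b + x * p)
    horner-scale = solve 4 (λ a b x p → a :* b :+ x :* (a :* p) := a :* (b :+ x :* p)) refl

    horner-* : ∀ a x p q → a * q + (0# + x * (p * q)) ≈ (a + x * p) * q
    horner-* = solve 4 (λ a x p q → a :* q :+ (con (+ 0) :+ x :* (p :* q)) := (a :+ x :* p) :* q) refl

    horner-neg : ∀ a x p → - a + x * (- p) ≈ - (a + x * p)
    horner-neg = solve 3 (λ a x p → :- a :+ x :* (:- p) := :- (a :+ x :* p)) refl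

    horner-x : ∀ x → 0# + x * (1# + x * 0#) ≈ x
    horner-x = solve 1 (λ x → con (+ 0) :+ x :* (con (+ 1) :+ x :* con (+ 0)) := x) refl

    neg-zero : 0# ≈ - 0#
    neg-zero = solve 0 (con (+ 0) := :- con (+ 0)) refl

    neg-neg : ∀ a → a ≈ - - a
    neg-neg = solve 1 (λ a → a := :- (:- a)) refl

  module PowerSeries (R : CommutativeRing 0ℓ 0ℓ) where
    open CommutativeRing R
    open Integers R using (ι; ×-suc)
    open Relation.Binary.Reasoning.Setoid setoid

    PS : Set
    PS = ℕ → Carrier

    Pointwise : PS → PS → Set
    Pointwise f g = ∀ n → f n ≈ g n

    -- A record, so that the two sides can be inferred from the type.
    infix 4 _≋_
    record _≋_ (f g : PS) : Set where
      constructor coeffs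
      field at : Pointwise f g

    open _≋_ public

    add : PS → PS → PS
    add f g n = f n + g n

    neg : PS → PS
    neg f n = - f n

    zeroS : PS
    zeroS _ = 0#

    tl : PS → PS
    tl f n = f (suc n)

    -- The Cauchy product, by recursion on the left factor, so that its laws follow by induction
    -- passing from f to `tl f`.
    conv : PS → PS → PS
    conv f g zero = f 0 * g 0
    conv f g (suc n) = f 0 * g (suc n) + conv (tl f) g n

    const : Carrier → PS
    const a zero = a
    const a (suc _) = 0#

    private
      conv-cong : ∀ {f f′ g g′} → Pointwise f f′ → Pointwise g g′ → Pointwise (conv f g) (conv f′ g′)
      conv-cong p q zero = *-cong (p 0) (q 0)
      conv-cong p q (suc n) = +-cong (*-cong (p 0) (q (suc n))) (conv-cong (λ k → p (suc k)) q n)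

      conv-tl : ∀ f g n → conv f g (suc n) ≈ conv f (tl g) n + f (suc n) * g 0
      conv-tl f g zero = refl
      conv-tl f g (suc n) = trans (+-congˡ (conv-tl (tl f) g n)) (sym (+-assoc _ _ _))

      conv-comm : ∀ f g → Pointwise (conv f g) (conv g f)
      conv-comm f g zero = *-comm _ _
      conv-comm f g (suc n) = begin
        f 0 * g (suc n) + conv (tl f) g n ≈⟨ +-cong (*-comm _ _) (conv-comm (tl f) g n) ⟩
        g (suc n) * f 0 + conv g (tl f) n ≈⟨ +-comm _ _ ⟩
        conv g (tl f) n + g (suc n) * f 0 ≈⟨ conv-tl g f n ⟨
        conv g f (suc n) ∎

      conv-+ˡ : ∀ f g h n → conv (λ k → f k + g k) h n ≈ conv f h n + conv g h n
      conv-+ˡ f g h zero = distribʳ _ _ _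
      conv-+ˡ f g h (suc n) = trans (+-cong (distribʳ _ _ _) (conv-+ˡ (tl f) (tl g) h n))
        (Identities.interchange R _ _ _ _)

      conv-scale : ∀ a f g n → conv (λ k → a * f k) g n ≈ a * conv f g n
      conv-scale a f g zero = *-assoc _ _ _
      conv-scale a f g (suc n) = trans (+-cong (*-assoc _ _ _) (conv-scale a (tl f) g n)) (sym (distribˡ _ _ _))

      conv-0 : ∀ g n → conv (λ _ → 0#) g n ≈ 0#
      conv-0 g zero = zeroˡ _
      conv-0 g (suc n) = trans (+-cong (zeroˡ _) (conv-0 g n)) (+-identityˡ _)

      conv-assoc : ∀ f g h → Pointwise (conv (conv f g) h) (conv f (conv g h))
      conv-assoc f g h zero = *-assoc _ _ _
      conv-assoc f g h (suc n) = begin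
        f 0 * g 0 * h (suc n) + conv (λ k → f 0 * g (suc k) + conv (tl f) g k) h n
          ≈⟨ +-cong (*-assoc _ _ _) (trans (conv-+ˡ _ _ h n) (+-cong (conv-scale (f 0) (tl g) h n) (conv-assoc (tl f) g h n))) ⟩
        f 0 * (g 0 * h (suc n)) + (f 0 * conv (tl g) h n + conv (tl f) (conv g h) n)
          ≈⟨ +-assoc _ _ _ ⟨
        f 0 * (g 0 * h (suc n)) + f 0 * conv (tl g) h n + conv (tl f) (conv g h) n
          ≈⟨ +-congʳ (distribˡ _ _ _) ⟨
        f 0 * (g 0 * h (suc n) + conv (tl g) h n) + conv (tl f) (conv g h) n ∎

    const-* : ∀ a f n → conv (const a) f n ≈ a * f n
    const-* a f zero = refl
    const-* a f (suc n) = trans (+-congˡ (conv-0 f n)) (+-identityʳ _)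

    psRing : CommutativeRing 0ℓ 0ℓ
    psRing = record
      { Carrier = PS ; _≈_ = _≋_ ; _+_ = add ; _*_ = conv ; -_ = neg ; 0# = zeroS ; 1# = const 1#
      ; isCommutativeRing = record
        { isRing = record
          { +-isAbelianGroup = record
            { isGroup = record
              { isMonoid = record
                { isSemigroup = record
                  { isMagma = record
                    { isEquivalence = record
                      { refl = coeffs λ _ → refl ; sym = λ p → coeffs λ n → sym (at p n) ; trans = λ p q → coeffs λ n → trans (at p n) (at q n) }
                    ; ∙-cong = λ p q → coeffs λ n → +-cong (at p n) (at q n) }
                  ; assoc = λ f g h → coeffs λ n → +-assoc _ _ _ }
                ; identity = (λ f → coeffs λ n → +-identityˡ _) , (λ f → coeffs λ n → +-identityʳ _) }
              ; inverse = (λ f → coeffs λ n → -‿inverseˡ _) , (λ f → coeffs λ n → -‿inverseʳ _)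
              ; ⁻¹-cong = λ p → coeffs λ n → -‿cong (at p n) }
            ; comm = λ f g → coeffs λ n → +-comm _ _ }
          ; *-cong = λ p q → coeffs (conv-cong (at p) (at q))
          ; *-assoc = λ f g h → coeffs (conv-assoc f g h)
          ; *-identity = (λ f → coeffs λ n → trans (const-* 1# f n) (*-identityˡ _)) ,
              (λ f → coeffs λ n → trans (conv-comm f _ n) (trans (const-* 1# f n) (*-identityˡ _)))
          ; distrib = (λ f g h → coeffs λ n → trans (conv-comm f _ n) (trans (conv-+ˡ g h f n) (+-cong (conv-comm g f n) (conv-comm h f n)))) ,
              (λ f g h → coeffs λ n → conv-+ˡ g h f n) }
        ; *-comm = λ f g → coeffs (conv-comm f g) } }

    private module S = CommutativeRing psRing

    const-cong : ∀ {a b} → a ≈ b → const a ≋ const b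
    const-cong {a} {b} e = coeffs go
      where
      go : Pointwise (const a) (const b)
      go zero = e
      go (suc n) = refl

    const-0 : const 0# ≋ S.0#
    const-0 = coeffs go
      where
      go : Pointwise (const 0#) zeroS
      go zero = refl
      go (suc n) = refl

    const-mul : ∀ a b → const (a * b) ≋ const a S.* const b
    const-mul a b = coeffs go
      where
      go : Pointwise (const (a * b)) (conv (const a) (const b))
      go zero = refl
      go (suc n) = sym (trans (const-* a (const b) (suc n)) (zeroʳ a))

    const-add : ∀ a b → const (a + b) ≋ const a S.+ const b
    const-add a b = coeffs go
      where
      go : Pointwise (const (a + b)) (add (const a) (const b))
      go zero = refl
      go (suc n) = sym (+-identityˡ 0#)

    const-neg : ∀ a → const (- a) ≋ S.- const a
    const-neg a = coeffs go
      where
      go : Pointwise (const (- a)) (neg (const a))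
      go zero = refl
      go (suc n) = sym (Algebra.Properties.Ring.-0#≈0# (CommutativeRing.ring R))

    X : PS
    X zero = 0#
    X (suc n) = const 1# n

    X-* : ∀ f n → (X S.* f) (suc n) ≈ f n
    X-* f n = trans (+-cong (zeroˡ _) (trans (const-* 1# f n) (*-identityˡ _))) (+-identityˡ _)

    X-*₀ : ∀ f → (X S.* f) 0 ≈ 0#
    X-*₀ f = zeroˡ _

    X-tl : ∀ {f} → f 0 ≈ 0# → f ≋ X S.* tl f
    X-tl {f} e = coeffs go
      where
      go : Pointwise f (conv X (tl f))
      go zero = trans e (sym (X-*₀ (tl f)))
      go (suc n) = sym (X-* (tl f) n)

    numeral : ℕ → Carrier
    numeral n = ι (+ n)

    numeral-suc : ∀ n → numeral (suc n) ≈ 1# + numeral n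
    numeral-suc = ×-suc

    -- θ is the Euler operator X D. It keeps degrees, so its product rule follows the recursion of
    -- `conv`; the product rule of D is then read off one degree higher.
    θ D : PS → PS
    θ f n = numeral n * f n
    D f n = numeral (suc n) * f (suc n)

    private
      θ-tl : ∀ f n → tl (θ f) n ≈ f (suc n) + θ (tl f) n
      θ-tl f n = trans (*-congʳ (numeral-suc n)) (trans (distribʳ _ _ _) (+-congʳ (*-identityˡ _)))

      θ-conv : ∀ f g → Pointwise (θ (conv f g)) (add (conv (θ f) g) (conv f (θ g)))
      θ-conv f g zero = Identities.zero-factors R (f 0) (g 0)
      θ-conv f g (suc n) = begin
        numeral (suc n) * (f 0 * g (suc n) + conv (tl f) g n) ≈⟨ *-congʳ (numeral-suc n) ⟩
        (1# + numeral n) * (f 0 * g (suc n) + conv (tl f) g n)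
          ≈⟨ Identities.suc-factor R (numeral n) (f 0) (g (suc n)) (conv (tl f) g n) ⟩
        f 0 * ((1# + numeral n) * g (suc n)) + (conv (tl f) g n + θ (conv (tl f) g) n)
          ≈⟨ +-cong (*-congˡ (*-congʳ (sym (numeral-suc n)))) (+-congˡ (θ-conv (tl f) g n)) ⟩
        f 0 * θ g (suc n) + (conv (tl f) g n + (conv (θ (tl f)) g n + conv (tl f) (θ g) n))
          ≈⟨ Identities.rotate R _ _ _ _ ⟩
        (conv (tl f) g n + conv (θ (tl f)) g n) + (f 0 * θ g (suc n) + conv (tl f) (θ g) n)
          ≈⟨ +-congʳ (trans (sym (conv-+ˡ (tl f) (θ (tl f)) g n)) (conv-cong (λ k → sym (θ-tl f k)) (λ _ → refl) n)) ⟩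
        conv (tl (θ f)) g n + (f 0 * θ g (suc n) + conv (tl f) (θ g) n)
          ≈⟨ +-congʳ (sym (trans (+-congʳ (trans (*-congʳ (zeroˡ _)) (zeroˡ _))) (+-identityˡ _))) ⟩
        (θ f 0 * g (suc n) + conv (tl (θ f)) g n) + (f 0 * θ g (suc n) + conv (tl f) (θ g) n) ∎

    θ-* : ∀ f g → θ (f S.* g) ≋ θ f S.* g S.+ f S.* θ g
    θ-* f g = coeffs (θ-conv f g)

    θ-D : ∀ f → θ f ≋ X S.* D f
    θ-D f = coeffs go
      where
      go : Pointwise (θ f) (conv X (D f))
      go zero = trans (zeroˡ _) (sym (X-*₀ (D f)))
      go (suc n) = sym (X-* (D f) n)

    D-* : ∀ f g → D (f S.* g) ≋ D f S.* g S.+ f S.* D g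
    D-* f g = coeffs λ n → trans (θ-conv f g (suc n)) (+-cong
      (trans (+-congʳ (trans (*-congʳ (zeroˡ _)) (zeroˡ _))) (+-identityˡ _))
      (trans (conv-tl f (θ g) n) (trans (+-congˡ (trans (*-congˡ (zeroˡ _)) (zeroʳ _))) (+-identityʳ _))))

    D-cong : ∀ {f g} → f ≋ g → D f ≋ D g
    D-cong p = coeffs λ n → *-congˡ (at p (suc n))
    D-+ : ∀ f g → D (f S.+ g) ≋ D f S.+ D g
    D-+ f g = coeffs λ n → distribˡ _ _ _
    D-neg : ∀ f → D (S.- f) ≋ S.- D f
    D-neg f = coeffs λ n → sym (Algebra.Properties.Ring.-‿distribʳ-* (CommutativeRing.ring R) _ _)
    D-zero : D S.0# ≋ S.0#
    D-zero = coeffs λ n → zeroʳ _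
    D-const : ∀ a → D (const a) ≋ S.0#
    D-const a = coeffs λ n → zeroʳ _
    D-X : D X ≋ S.1#
    D-X = coeffs λ { zero → *-identityˡ _ ; (suc n) → zeroʳ _ }

    θ-+ : ∀ f g → θ (f S.+ g) ≋ θ f S.+ θ g
    θ-+ f g = coeffs λ n → distribˡ _ _ _
    θ-neg : ∀ f → θ (S.- f) ≋ S.- θ f
    θ-neg f = coeffs λ n → sym (Algebra.Properties.Ring.-‿distribʳ-* (CommutativeRing.ring R) _ _)
    θ-const : ∀ a → θ (const a) ≋ S.0#
    θ-const a = coeffs λ { zero → zeroˡ _ ; (suc n) → zeroʳ _ }
    θ-X : θ X ≋ X
    θ-X = coeffs λ { zero → zeroˡ _ ; (suc zero) → *-identityˡ _ ; (suc (suc n)) → zeroʳ _ }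

    -- A derivation of the coefficients extends to series. For series in y over series in w this
    -- provides the derivative in w next to θ in y.
    lift : (Carrier → Carrier) → PS → PS
    lift δ f n = δ (f n)

    lift-* : ∀ δ → (∀ a b → δ (a + b) ≈ δ a + δ b) → (∀ a b → δ (a * b) ≈ δ a * b + a * δ b) →
      ∀ f g → lift δ (f S.* g) ≋ lift δ f S.* g S.+ f S.* lift δ g
    lift-* δ δ-+ δ-* f g = coeffs (go f)
      where
      go : ∀ f → Pointwise (lift δ (conv f g)) (add (conv (lift δ f) g) (conv f (lift δ g)))
      go f zero = δ-* _ _
      go f (suc n) = trans (δ-+ _ _) (trans (+-cong (δ-* _ _) (go (tl f) n))
        (Identities.interchange R _ _ _ _))

    module Rational (inv : ℕ → Carrier) (inv-law : ∀ n → inv n * numeral (suc n) ≈ 1#) where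

      cancel-numeral : ∀ n {a b} → numeral (suc n) * a ≈ numeral (suc n) * b → a ≈ b
      cancel-numeral n {a} {b} e = begin
        a ≈⟨ *-identityˡ a ⟨
        1# * a ≈⟨ *-congʳ (inv-law n) ⟨
        inv n * numeral (suc n) * a ≈⟨ *-assoc _ _ _ ⟩
        inv n * (numeral (suc n) * a) ≈⟨ *-congˡ e ⟩
        inv n * (numeral (suc n) * b) ≈⟨ *-assoc _ _ _ ⟨
        inv n * numeral (suc n) * b ≈⟨ *-congʳ (inv-law n) ⟩
        1# * b ≈⟨ *-identityˡ b ⟩
        b ∎

      numeral-inv : ∀ n a → numeral (suc n) * (inv n * a) ≈ a
      numeral-inv n a = trans (sym (*-assoc _ _ _)) (trans (*-congʳ (trans (*-comm _ _) (inv-law n))) (*-identityˡ _))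

      D-injective : ∀ {f g} → f 0 ≈ g 0 → D f ≋ D g → f ≋ g
      D-injective {f} {g} p q = coeffs λ { zero → p ; (suc n) → cancel-numeral n (at q n) }

      θ-injective : ∀ {f g} → f 0 ≈ g 0 → θ f ≋ θ g → f ≋ g
      θ-injective {f} {g} p q = coeffs λ { zero → p ; (suc n) → cancel-numeral n (at q (suc n)) }

      ∫ : PS → PS
      ∫ f zero = 0#
      ∫ f (suc n) = inv n * f n

      D-∫ : ∀ f → D (∫ f) ≋ f
      D-∫ f = coeffs λ n → numeral-inv n (f n)

    numeral-const : ∀ n → Integers.ι psRing (+ n) ≋ const (numeral n)
    numeral-const zero = S.sym const-0
    numeral-const (suc n) = S.trans (Integers.×-suc psRing n) (S.trans (S.+-congˡ (numeral-const n))
      (S.trans (S.sym (const-add 1# (numeral n))) (const-cong (sym (numeral-suc n)))))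

 -- Enumeration of the valid words with a given number of faces.

 module Count where
  open Runs
  open Realize
  open import Data.Nat using (_+_; _*_)
  open import Data.Nat.Tactic.RingSolver using (solve-∀)
  open import Data.List using (_++_)
  open import Data.List.Membership.Propositional using (find; lose)
  import Data.List.Membership.Propositional.Properties as MemP
  import Data.List.Relation.Unary.All.Properties as AllP
  import Data.List.Relation.Unary.Unique.Propositional.Properties as UniP
  open import Data.List.Relation.Binary.Disjoint.Propositional using (Disjoint)
  open import Relation.Binary.PropositionalEquality

  splits : ℕ → List (ℕ × ℕ)
  splits zero = (0 , 0) ∷ []
  splits (suc m) = (0 , suc m) ∷ map (λ ij → suc (proj₁ ij) , proj₂ ij) (splits m)

  -- The first argument is fuel and bounds the number of letters; n is the number of faces still to
  -- be closed. Fuel is needed because letters that create vertices enlarge the state.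
  words : ℕ → ℕ → ℕ → ℕ → List ℕ → List Word
  matches : ℕ → ℕ → List ℕ → List (ℕ × ℕ) → List Word
  words zero n p m st = []
  words (suc f) n (suc p) m st = map forest (words f n (suc (suc p)) m st) ++ map skip (words f n p (suc m) st)
  words (suc f) n zero (suc zero) st = map new (words f n 2 0 st)
  words (suc f) n zero (suc (suc m)) st = matches f n st (splits m) ++ map new (words f n 2 (suc m) st)
  words (suc f) n zero zero (m ∷ st) = pop-words n
    where
    pop-words : ℕ → List Word
    pop-words zero = []
    pop-words (suc n) = map pop (words f n 0 m st)
  words (suc f) n zero zero [] = done-words n
    where
    done-words : ℕ → List Word
    done-words (suc zero) = done ∷ []
    done-words _ = []
  matches f n st [] = []
  matches f n st ((i , j) ∷ ijs) = map (match i) (words f n 0 i (j ∷ st)) ++ matches f n st ijs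

  splits-sound : ∀ m → All (λ ij → proj₁ ij + proj₂ ij ≡ m) (splits m)
  splits-sound zero = refl ∷ []
  splits-sound (suc m) = refl ∷ AllP.map⁺ (All.map (cong suc) (splits-sound m))

  splits-complete : ∀ i j → (i , j) ∈ splits (i + j)
  splits-complete zero zero = here refl
  splits-complete zero (suc j) = here refl
  splits-complete (suc i) j = there (MemP.∈-map⁺ (λ ij → suc (proj₁ ij) , proj₂ ij) (splits-complete i j))

  splits-distinct : ∀ m → AllPairs (λ a b → proj₁ a ≢ proj₁ b) (splits m)
  splits-distinct zero = [] ∷ []
  splits-distinct (suc m) = AllP.map⁺ (All.tabulate λ _ ()) ∷ go (splits-distinct m)
    where
    go : ∀ {ijs} → AllPairs (λ a b → proj₁ a ≢ proj₁ b) ijs → AllPairs (λ a b → proj₁ a ≢ proj₁ b) (map (λ ij → suc (proj₁ ij) , proj₂ ij) ijs)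
    go [] = []
    go (p ∷ ps) = AllP.map⁺ (All.map (λ ne e → ne (ℕP.suc-injective e)) p) ∷ go ps

  needs : List ℕ → ℕ
  needs [] = 0
  needs (m ∷ st) = m + 2 + needs st

  -- Euler's relation from this state: a valid word that creates v vertices and closes n faces has v
  -- + `need` = 2n, each block of m darts contributing m + 2.
  need : ℕ → ℕ → List ℕ → ℕ
  need p m st = p + m + 2 + needs st

  sizes : List ℕ → ℕ
  sizes [] = 0
  sizes (m ∷ st) = suc (m + sizes st)

  -- A bound for the number of letters of a word that creates v vertices.
  work : ℕ → ℕ → ℕ → List ℕ → ℕ
  work v p m st = 4 * v + (2 * p + (m + sizes st))

  -- Fuel suffices if it exceeds `work` for every v that Euler's relation allows. At most one v is
  -- allowed; if n is too small there is none, and then no fuel is required.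
  record Enough (f n p m : ℕ) (st : List ℕ) : Set where
    constructor enough
    field spare : ∀ v → v + need p m st ≡ 2 * n → work v p m st < f

  open Enough public

  private
    less : ∀ {a b f} → suc a ≡ b → b < suc f → a < f
    less refl (s≤s lt) = lt

  enough-pop : ∀ {f n m st} → Enough (suc f) (suc n) 0 0 (m ∷ st) → Enough f n 0 m st
  enough-pop {n = n} {m} {st} h = enough λ v e → less (work-eq v m (sizes st)) (spare h v (trans (need-eq v m (needs st)) (trans (cong (2 +_) e) (double n))))
    where
    work-eq : ∀ v m z → suc (4 * v + (0 + (m + z))) ≡ 4 * v + (0 + (0 + suc (m + z)))
    work-eq = solve-∀
    need-eq : ∀ v m z → v + (2 + (m + 2 + z)) ≡ 2 + (v + (m + 2 + z))
    need-eq = solve-∀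
    double : ∀ n → 2 + 2 * n ≡ 2 * suc n
    double = solve-∀

  enough-forest : ∀ {f n p m st} → Enough (suc f) n (suc p) m st → Enough f n (suc (suc p)) m st
  enough-forest {p = p} {m} {st} h = enough λ v e → ℕP.≤-trans (ℕP.n≤1+n _) (less (work-eq v p m (sizes st)) (spare h (suc v) (trans (need-eq v p m (needs st)) e)))
    where
    work-eq : ∀ v p m z → suc (suc (4 * v + (2 * suc (suc p) + (m + z)))) ≡ 4 * suc v + (2 * suc p + (m + z))
    work-eq = solve-∀
    need-eq : ∀ v p m z → suc v + (suc p + m + 2 + z) ≡ v + (suc (suc p) + m + 2 + z)
    need-eq = solve-∀

  enough-skip : ∀ {f n p m st} → Enough (suc f) n (suc p) m st → Enough f n p (suc m) st
  enough-skip {p = p} {m} {st} h = enough λ v e → less (work-eq v p m (sizes st)) (spare h v (trans (need-eq v p m (needs st)) e))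
    where
    work-eq : ∀ v p m z → suc (4 * v + (2 * p + (suc m + z))) ≡ 4 * v + (2 * suc p + (m + z))
    work-eq = solve-∀
    need-eq : ∀ v p m z → v + (suc p + m + 2 + z) ≡ v + (p + suc m + 2 + z)
    need-eq = solve-∀

  enough-new : ∀ {f n m st} → Enough (suc f) n 0 (suc m) st → Enough f n 2 m st
  enough-new {m = m} {st} h = enough λ v e → less (work-eq v m (sizes st)) (spare h (suc v) (trans (need-eq v m (needs st)) e))
    where
    work-eq : ∀ v m z → suc (4 * v + (4 + (m + z))) ≡ 4 * suc v + (0 + (suc m + z))
    work-eq = solve-∀
    need-eq : ∀ v m z → suc v + (suc m + 2 + z) ≡ v + (2 + m + 2 + z)
    need-eq = solve-∀

  enough-match : ∀ {f n m i j st} → i + j ≡ m → Enough (suc f) n 0 (suc (suc m)) st → Enough f n 0 i (j ∷ st)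
  enough-match {i = i} {j} {st} refl h = enough λ v e → less (work-eq v i j (sizes st)) (spare h v (trans (need-eq v i j (needs st)) e))
    where
    work-eq : ∀ v i j z → suc (4 * v + (0 + (i + suc (j + z)))) ≡ 4 * v + (0 + (suc (suc (i + j)) + z))
    work-eq = solve-∀
    need-eq : ∀ v i j z → v + (suc (suc (i + j)) + 2 + z) ≡ v + (i + 2 + (j + 2 + z))
    need-eq = solve-∀

  valid-euler : ∀ {w p m st} → Valid w p m st → verts w + need p m st ≡ 2 * pops w
  valid-euler done = refl
  valid-euler (pop {w} {m} {st} v) = trans (arith (verts w) m (needs st)) (trans (cong (2 +_) (valid-euler v)) (double (pops w)))
    where
    arith : ∀ v m z → v + (2 + (m + 2 + z)) ≡ 2 + (v + (m + 2 + z))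
    arith = solve-∀
    double : ∀ n → 2 + 2 * n ≡ 2 * suc n
    double = solve-∀
  valid-euler (forest {w} {p} {m} {st} v) = trans (arith (verts w) p m (needs st)) (valid-euler v)
    where
    arith : ∀ v p m z → suc v + (suc p + m + 2 + z) ≡ v + (suc (suc p) + m + 2 + z)
    arith = solve-∀
  valid-euler (skip {w} {p} {m} {st} v) = trans (arith (verts w) p m (needs st)) (valid-euler v)
    where
    arith : ∀ v p m z → v + (suc p + m + 2 + z) ≡ v + (p + suc m + 2 + z)
    arith = solve-∀
  valid-euler (new {w} {m} {st} v) = trans (arith (verts w) m (needs st)) (valid-euler v)
    where
    arith : ∀ v m z → suc v + (suc m + 2 + z) ≡ v + (2 + m + 2 + z)
    arith = solve-∀
  valid-euler (match {w} {i = i} {j} {st} refl v) = trans (arith (verts w) i j (needs st)) (valid-euler v)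
    where
    arith : ∀ v i j z → v + (suc (i + suc j) + 2 + z) ≡ v + (i + 2 + (j + 2 + z))
    arith = solve-∀

  matches-complete : ∀ {f n st w i j ijs} → (i , j) ∈ ijs → w ∈ words f n 0 i (j ∷ st) → match i w ∈ matches f n st ijs
  matches-complete (here refl) w∈ = MemP.∈-++⁺ˡ (MemP.∈-map⁺ (match _) w∈)
  matches-complete {f} {n} {st} {i = i} {ijs = (i′ , j′) ∷ _} (there ij∈) w∈ = MemP.∈-++⁺ʳ (map (match i′) (words f n 0 i′ (j′ ∷ st))) (matches-complete {f} {n} {st} {i = i} ij∈ w∈)

  words-complete : ∀ f {n p m st w} → Enough f n p m st → Valid w p m st → pops w ≡ n → w ∈ words f n p m st
  words-complete zero {w = w} h v refl with spare h (verts w) (valid-euler v)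
  ... | ()
  words-complete (suc f) h done refl = here refl
  words-complete (suc f) h (pop {w} {m} {st} v) refl = MemP.∈-map⁺ pop (words-complete f (enough-pop {n = pops w} {m} {st} h) v refl)
  words-complete (suc f) h (forest {p = p} v) refl = MemP.∈-++⁺ˡ (MemP.∈-map⁺ forest (words-complete f (enough-forest {p = p} h) v refl))
  words-complete (suc f) h (skip {w} {p = p} {m} {st} v) refl = MemP.∈-++⁺ʳ (map forest (words f (pops w) (suc (suc p)) m st)) (MemP.∈-map⁺ skip (words-complete f (enough-skip {p = p} h) v refl))
  words-complete (suc f) h (new {m = zero} v) refl = MemP.∈-map⁺ new (words-complete f (enough-new h) v refl)
  words-complete (suc f) h (new {w} {suc m} {st} v) refl = MemP.∈-++⁺ʳ (matches f (pops w) st (splits m)) (MemP.∈-map⁺ new (words-complete f (enough-new h) v refl))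
  words-complete (suc f) h (match {w} {m} {i} {j} {st} e v) refl with trans e (ℕP.+-suc i j)
  words-complete (suc f) h (match {w} {.(suc (i + j))} {i} {j} {st} e v) refl | refl =
    MemP.∈-++⁺ˡ (matches-complete {f} {pops w} {st} {i = i} (splits-complete i j) (words-complete f (enough-match {i = i} {j} refl h) v refl))

  Sound : ℕ → ℕ → ℕ → List ℕ → Word → Set
  Sound n p m st w = Valid w p m st × pops w ≡ n

  mutual
    words-sound : ∀ f n p m st → All (Sound n p m st) (words f n p m st)
    words-sound zero n p m st = []
    words-sound (suc f) zero zero zero [] = []
    words-sound (suc f) (suc zero) zero zero [] = (done , refl) ∷ []
    words-sound (suc f) (suc (suc n)) zero zero [] = []
    words-sound (suc f) zero zero zero (m ∷ st) = []
    words-sound (suc f) (suc n) zero zero (m ∷ st) = AllP.map⁺ (All.map (λ (v , e) → pop v , cong suc e) (words-sound f n 0 m st))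
    words-sound (suc f) n zero (suc zero) st = AllP.map⁺ (All.map (λ (v , e) → new v , e) (words-sound f n 2 0 st))
    words-sound (suc f) n zero (suc (suc m)) st = AllP.++⁺ (matches-sound f n m st (splits-sound m)) (AllP.map⁺ (All.map (λ (v , e) → new v , e) (words-sound f n 2 (suc m) st)))
    words-sound (suc f) n (suc p) m st = AllP.++⁺ (AllP.map⁺ (All.map (λ (v , e) → forest v , e) (words-sound f n (suc (suc p)) m st))) (AllP.map⁺ (All.map (λ (v , e) → skip v , e) (words-sound f n p (suc m) st)))

    matches-sound : ∀ f n m st {ijs} → All (λ ij → proj₁ ij + proj₂ ij ≡ m) ijs → All (Sound n 0 (suc (suc m)) st) (matches f n st ijs)
    matches-sound f n m st [] = []
    matches-sound f n m st {(i , j) ∷ _} (e ∷ es) = AllP.++⁺ (AllP.map⁺ (All.map (λ (v , e′) → match (sym (trans (ℕP.+-suc i j) (cong suc e))) v , e′) (words-sound f n 0 i (j ∷ st)))) (matches-sound f n m st es)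

  private
    apart : ∀ {A B C : Set} {f : A → C} {g : B → C} {xs ys} → (∀ x y → f x ≢ g y) → Disjoint (map f xs) (map g ys)
    apart {f = f} {g} ne (p , q) with MemP.∈-map⁻ f p | MemP.∈-map⁻ g q
    ... | x , _ , refl | y , _ , e = ne x y e

    matches-match : ∀ f n st ijs → All (λ w → ∃ λ i → ∃ λ j → ∃ λ w′ → w ≡ match i w′ × (i , j) ∈ ijs) (matches f n st ijs)
    matches-match f n st [] = []
    matches-match f n st ((i , j) ∷ ijs) = AllP.++⁺ (AllP.map⁺ (All.tabulate λ {w} _ → i , j , w , refl , here refl))
      (All.map (λ (i , j , w , e , k) → i , j , w , e , there k) (matches-match f n st ijs))

  mutual
    words-unique : ∀ f n p m st → Unique (words f n p m st)
    words-unique zero n p m st = []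
    words-unique (suc f) zero zero zero [] = []
    words-unique (suc f) (suc zero) zero zero [] = [] ∷ []
    words-unique (suc f) (suc (suc n)) zero zero [] = []
    words-unique (suc f) zero zero zero (m ∷ st) = []
    words-unique (suc f) (suc n) zero zero (m ∷ st) = UniP.map⁺ (λ { refl → refl }) (words-unique f n 0 m st)
    words-unique (suc f) n zero (suc zero) st = UniP.map⁺ (λ { refl → refl }) (words-unique f n 2 0 st)
    words-unique (suc f) n zero (suc (suc m)) st = match-new f n m st (words-unique f n 2 (suc m) st)
    words-unique (suc f) n (suc p) m st = forest-skip (words-unique f n (suc (suc p)) m st) (words-unique f n p (suc m) st)

    forest-skip : ∀ {ws ws′} → Unique ws → Unique ws′ → Unique (map forest ws ++ map skip ws′)
    forest-skip u u′ = UniP.++⁺ (UniP.map⁺ (λ { refl → refl }) u) (UniP.map⁺ (λ { refl → refl }) u′) (apart λ _ _ ())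

    match-new : ∀ f n m st {ws} → Unique ws → Unique (matches f n st (splits m) ++ map new ws)
    match-new f n m st u = UniP.++⁺ (matches-unique f n st (splits-distinct m)) (UniP.map⁺ (λ { refl → refl }) u)
      (λ (p , q) → clash (All.lookup (matches-match f n st (splits m)) p) (MemP.∈-map⁻ new q))
      where
      clash : ∀ {w : Word} {P : ℕ → ℕ → Set} {Q : Word → Set} → (∃ λ i → ∃ λ j → ∃ λ w′ → w ≡ match i w′ × P i j) → (∃ λ y → Q y × w ≡ new y) → ⊥
      clash (_ , _ , _ , refl , _) (_ , _ , ())

    matches-unique : ∀ f n st {ijs} → AllPairs (λ a b → proj₁ a ≢ proj₁ b) ijs → Unique (matches f n st ijs)
    matches-unique f n st [] = []
    matches-unique f n st {(i , j) ∷ ijs} (p ∷ ps) = UniP.++⁺ (UniP.map⁺ (λ { refl → refl }) (words-unique f n 0 i (j ∷ st))) (matches-unique f n st ps)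
      (λ (q , r) → clash (MemP.∈-map⁻ (match i) q) (All.lookup (matches-match f n st ijs) r))
      where
      clash : ∀ {w} {Q : Word → Set} → (∃ λ y → Q y × w ≡ match i y) → (∃ λ i′ → ∃ λ j′ → ∃ λ w′ → w ≡ match i′ w′ × (i′ , j′) ∈ ijs) → ⊥
      clash (_ , _ , refl) (_ , _ , _ , refl , k) = All.lookup p k refl

  -- From the initial state v + 3 = 2n, and the work 4v + 2 is at most 4(v + 3) = 8n.
  plenty : ∀ n → Enough (suc (4 * (2 * n))) n 1 0 []
  plenty n = enough λ v e → s≤s (subst (λ k → work v 1 0 [] ≤ 4 * k) e (ℕP.≤-trans (ℕP.+-monoʳ-≤ (4 * v) (s≤s (s≤s z≤n))) (ℕP.≤-reflexive (sym (ℕP.*-distribˡ-+ 4 v 3)))))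

 -- Evaluation of polynomials in β at large integers.

 module Evaluate where
  open import Defs using (Poly; coeff; _≈P_; NonZeroP; _+P_; _*P_; negP; constP; βP; βpow; sumP)
  open Ring
  open import Data.Nat using (_⊔_)
  open import Data.Integer as ℤ using (ℤ; +_; ∣_∣)
  import Data.Integer.Properties as ℤP
  import Relation.Binary.PropositionalEquality as ≡
  open ≡ using (_≡_; _≢_)

  module Evaluation (R : CommutativeRing 0ℓ 0ℓ) (x : CommutativeRing.Carrier R) where
    open CommutativeRing R
    open Integers R

    ev : Poly → Carrier
    ev [] = 0#
    ev (a ∷ p) = ι a + x * ev p

    ev-zero : ∀ p → (∀ n → coeff p n ≡ + 0) → ev p ≈ 0#
    ev-zero [] h = refl
    ev-zero (a ∷ p) h = trans (+-cong (reflexive (≡.cong ι (h 0))) (trans (*-congˡ (ev-zero p (λ n → h (suc n)))) (zeroʳ x))) (+-identityˡ 0#)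

    ev-cong : ∀ p q → p ≈P q → ev p ≈ ev q
    ev-cong [] q h = sym (ev-zero q (λ n → ≡.sym (h n)))
    ev-cong (a ∷ p) [] h = ev-zero (a ∷ p) h
    ev-cong (a ∷ p) (b ∷ q) h = +-cong (reflexive (≡.cong ι (h 0))) (*-congˡ (ev-cong p q (λ n → h (suc n))))

    ev-+ : ∀ p q → ev (p +P q) ≈ ev p + ev q
    ev-+ [] q = sym (+-identityˡ _)
    ev-+ (a ∷ p) [] = sym (+-identityʳ _)
    ev-+ (a ∷ p) (b ∷ q) = trans (+-cong (ι-+ a b) (*-congˡ (ev-+ p q)))
      (Identities.horner-+ R (ι a) (ι b) x (ev p) (ev q))

    ev-scale : ∀ a p → ev (map (a ℤ.*_) p) ≈ ι a * ev p
    ev-scale a [] = sym (zeroʳ _)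
    ev-scale a (b ∷ p) = trans (+-cong (ι-* a b) (*-congˡ (ev-scale a p))) (Identities.horner-scale R (ι a) (ι b) x (ev p))

    ev-* : ∀ p q → ev (p *P q) ≈ ev p * ev q
    ev-* [] q = sym (zeroˡ _)
    ev-* (a ∷ p) q = trans (ev-+ (map (a ℤ.*_) q) (+ 0 ∷ (p *P q))) (trans (+-cong (ev-scale a q) (+-congˡ (*-congˡ (ev-* p q))))
      (Identities.horner-* R (ι a) x (ev p) (ev q)))

    ev-neg : ∀ p → ev (negP p) ≈ - ev p
    ev-neg [] = Identities.neg-zero R
    ev-neg (a ∷ p) = trans (+-cong (ι-neg a) (*-congˡ (ev-neg p))) (Identities.horner-neg R (ι a) x (ev p))

    ev-const : ∀ a → ev (constP a) ≈ ι a
    ev-const a = trans (+-congˡ (zeroʳ x)) (+-identityʳ _)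

    ev-β : ev βP ≈ x
    ev-β = Identities.horner-x R x

  Eventually : (ℕ → Set) → Set
  Eventually P = ∃ λ k₀ → ∀ k → k₀ ≤ k → P k

  eventually-× : ∀ {P Q} → Eventually P → Eventually Q → Eventually (λ k → P k × Q k)
  eventually-× (k , h) (l , h′) = k ⊔ l , λ m le → h m (ℕP.≤-trans (ℕP.m≤m⊔n k l) le) , h′ m (ℕP.≤-trans (ℕP.m≤n⊔m k l) le)

  eventually-map : ∀ {P Q : ℕ → Set} → (∀ k → P k → Q k) → Eventually P → Eventually Q
  eventually-map f (k , h) = k , λ m le → f m (h m le)

  eventually-upto : ∀ {P : ℕ → ℕ → Set} → (∀ n → Eventually (P n)) → ∀ N → Eventually (λ k → ∀ n → n ≤ N → P n k)
  eventually-upto h zero = eventually-map (λ { k p .0 ℕ.z≤n → p }) (h 0)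
  eventually-upto {P} h (suc N) = eventually-map (λ k (p , q) n n≤ → pick k p q n (ℕP.m≤n⇒m<n∨m≡n n≤)) (eventually-× (eventually-upto {P} h N) (h (suc N)))
    where
    pick : ∀ k → (∀ n → n ≤ N → P n k) → P (suc N) k → ∀ n → n ℕ.< suc N ⊎ n ≡ suc N → P n k
    pick k p q n (inj₁ (ℕ.s≤s lt)) = p n lt
    pick k p q n (inj₂ ≡.refl) = q

  -- Evaluation is done in ℤ first, where absolute values and divisibility bound the zeros;
  -- characteristic 0 transfers the result to the field.
  evℤ : ℕ → Poly → ℤ
  evℤ k [] = + 0
  evℤ k (a ∷ p) = a ℤ.+ + k ℤ.* evℤ k p

  coeff-+ : ∀ p q n → coeff (p +P q) n ≡ coeff p n ℤ.+ coeff q n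
  coeff-+ [] q n = ≡.sym (ℤP.+-identityˡ _)
  coeff-+ (a ∷ p) [] n = ≡.sym (ℤP.+-identityʳ _)
  coeff-+ (a ∷ p) (b ∷ q) zero = ≡.refl
  coeff-+ (a ∷ p) (b ∷ q) (suc n) = coeff-+ p q n

  coeff-neg : ∀ p n → coeff (negP p) n ≡ ℤ.- coeff p n
  coeff-neg [] n = ≡.refl
  coeff-neg (a ∷ p) zero = ≡.refl
  coeff-neg (a ∷ p) (suc n) = coeff-neg p n

  -- For k > |a|, a + k v vanishes only if v does.
  zero-or-nonvanishing : ∀ p → (∀ n → coeff p n ≡ + 0) ⊎ Eventually (λ k → evℤ k p ≢ + 0)
  zero-or-nonvanishing [] = inj₁ λ _ → ≡.refl
  zero-or-nonvanishing (a ∷ p) with zero-or-nonvanishing p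
  ... | inj₂ e = inj₂ (eventually-map (λ k (k> , ne) z → ne (vanish k k> (evℤ k p) z)) (eventually-× (suc ∣ a ∣ , λ _ le → le) e))
    where
    vanish : ∀ k → ∣ a ∣ ℕ.< k → ∀ v → a ℤ.+ + k ℤ.* v ≡ + 0 → v ≡ + 0
    vanish k k> v z = ℤP.∣i∣≡0⇒i≡0 (small ∣ v ∣ (≡.sym (≡.trans (≡.sym (ℤP.∣-i∣≡∣i∣ a)) (≡.trans (≡.cong ∣_∣ -a≡) (ℤP.abs-* (+ k) v)))))
      where
      -a≡ : ℤ.- a ≡ + k ℤ.* v
      -a≡ = ≡.trans (≡.sym (ℤP.+-identityʳ _)) (≡.trans (≡.cong (ℤ._+_ (ℤ.- a)) (≡.sym z)) (≡.trans (≡.sym (ℤP.+-assoc (ℤ.- a) a (+ k ℤ.* v)))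
        (≡.trans (≡.cong (ℤ._+ (+ k ℤ.* v)) (ℤP.+-inverseˡ a)) (ℤP.+-identityˡ _))))
      small : ∀ u → k ℕ.* u ≡ ∣ a ∣ → u ≡ 0
      small zero _ = ≡.refl
      small (suc u) e = ⊥-elim (ℕP.<⇒≱ k> (≡.subst (k ≤_) e (ℕP.m≤m*n k (suc u))))
  ... | inj₁ h with a ℤ.≟ + 0
  ... | yes ≡.refl = inj₁ λ { zero → ≡.refl ; (suc n) → h n }
  ... | no a≢0 = inj₂ (0 , λ k _ z → a≢0 (≡.trans (≡.sym (≡.trans (≡.cong (λ v → a ℤ.+ + k ℤ.* v) (evℤ-zero k p h)) (≡.trans (≡.cong (ℤ._+_ a) (ℤP.*-zeroʳ (+ k))) (ℤP.+-identityʳ a)))) z))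
    where
    evℤ-zero : ∀ k p → (∀ n → coeff p n ≡ + 0) → evℤ k p ≡ + 0
    evℤ-zero k [] h = ≡.refl
    evℤ-zero k (a ∷ p) h = ≡.trans (≡.cong₂ (λ a v → a ℤ.+ + k ℤ.* v) (h 0) (evℤ-zero k p (λ n → h (suc n)))) (≡.trans (ℤP.+-identityˡ _) (ℤP.*-zeroʳ (+ k)))

  module Specialise (K : CommutativeRing 0ℓ 0ℓ) (char0 : ∀ n → ¬ (CommutativeRing._≈_ K (PowerSeries.numeral K (suc n)) (CommutativeRing.0# K))) where
    open CommutativeRing K
    open Integers K
    private module E (k : ℕ) = Evaluation K (ι (+ k))

    ι≉0 : ∀ {i} → i ≢ + 0 → ¬ ι i ≈ 0#
    ι≉0 {+ zero} ne _ = ne ≡.refl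
    ι≉0 {+ suc n} _ e = char0 n e
    ι≉0 {ℤ.-[1+ n ]} _ e = char0 n (trans (Identities.neg-neg K (ι (+ suc n))) (trans (-‿cong e) (sym (Identities.neg-zero K))))

    ev-ι : ∀ k p → E.ev k p ≈ ι (evℤ k p)
    ev-ι k [] = refl
    ev-ι k (a ∷ p) = sym (trans (ι-+ a (+ k ℤ.* evℤ k p)) (+-congˡ (trans (ι-* (+ k) (evℤ k p)) (*-congˡ (sym (ev-ι k p))))))

    nonzero-eventually : ∀ p → NonZeroP p → Eventually (λ k → ¬ E.ev k p ≈ 0#)
    nonzero-eventually p nz with zero-or-nonvanishing p
    ... | inj₁ h = ⊥-elim (nz h)
    ... | inj₂ e = eventually-map (λ k ne z → ι≉0 ne (trans (sym (ev-ι k p)) z)) e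

    zero-eventually : ∀ p → Eventually (λ k → E.ev k p ≈ 0#) → ∀ n → coeff p n ≡ + 0
    zero-eventually p (k₀ , h) with zero-or-nonvanishing p
    ... | inj₁ z = z
    ... | inj₂ (k₁ , ne) = ⊥-elim (ι≉0 (ne (k₀ ⊔ k₁) (ℕP.m≤n⊔m k₀ k₁)) (trans (sym (ev-ι (k₀ ⊔ k₁) p)) (h (k₀ ⊔ k₁) (ℕP.m≤m⊔n k₀ k₁))))

    ≈P-eventually : ∀ p q → Eventually (λ k → E.ev k p ≈ E.ev k q) → p ≈P q
    ≈P-eventually p q e n = ℤP.i-j≡0⇒i≡j (coeff p n) (coeff q n) (≡.trans (≡.sym (≡.trans (coeff-+ p (negP q) n) (≡.cong (ℤ._+_ (coeff p n)) (coeff-neg q n))))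
      (zero-eventually (p +P negP q) (eventually-map (λ k h → trans (E.ev-+ k p (negP q)) (trans (+-cong h (E.ev-neg k q)) (-‿inverseʳ _))) e) n))

 -- The generating function: moments, saddle point equations, differential equation and uniqueness.

 module Analysis where
  open import Defs as Frozen using (Poly; RatFun; Series; RMap; Map; num; den; fromPoly; 0F; _≈F_; _≈P_; _*P_; _+F_; _*F_; negF; sumTo; _⊕_; _⊖_; _⊗_; cst; cstℤ; wS; βS; invβS; _^S_; Wof; odeExpr; constP; βP; sumP; βpow; NonZeroP; IsMapGF; GSeries; ODE)
  open Subsets
  open Runs
  open Bijection
  open Ring
  open Count
  open Evaluate
  open import Data.Nat using (_∸_)
  open import Data.Integer as ℤ using (+_)
  open import Data.Rational as ℚ using (ℚ)
  import Data.Rational.Properties as ℚP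
  open import Data.List using (_++_)
  open import Data.List.Relation.Binary.Permutation.Propositional as Perm using (_↭_)
  open import Data.List.Relation.Binary.Pointwise as Zip using ([]; _∷_)
  import Relation.Binary.PropositionalEquality as ≡
  open ≡ using (_≡_)
  import Relation.Binary.Reasoning.Setoid

  -- Everything that the analysis requires of the coefficients; ℚ is supplied at the end.
  record Field : Set₁ where
    field
      K : CommutativeRing 0ℓ 0ℓ
      recip : ∀ x → ¬ CommutativeRing._≈_ K x (CommutativeRing.0# K) → ∃ λ y → CommutativeRing._≈_ K (CommutativeRing._*_ K x y) (CommutativeRing.1# K)
      char0 : ∀ n → ¬ (CommutativeRing._≈_ K (PowerSeries.numeral K (suc n)) (CommutativeRing.0# K))

  module Theorem (field₀ : Field) where
    open Field field₀
    private
      module K = CommutativeRing K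
      module IK where
        open Integers K public
        open IntegerSolver K public
    open PowerSeries K

    inv : ℕ → K.Carrier
    inv n = proj₁ (recip (numeral (suc n)) (char0 n))

    inv-law : ∀ n → inv n K.* numeral (suc n) K.≈ K.1#
    inv-law n = K.trans (K.*-comm _ _) (proj₂ (recip (numeral (suc n)) (char0 n)))

    zero-divisor : ∀ {x y} → x K.* y K.≈ K.0# → ¬ x K.≈ K.0# → y K.≈ K.0#
    zero-divisor {x} {y} e ne with recip x ne
    ... | x⁻¹ , p = K.trans (K.sym (K.*-identityˡ y)) (K.trans (K.*-congʳ (K.trans (K.sym p) (K.*-comm x x⁻¹))) (K.trans (K.*-assoc x⁻¹ x y) (K.trans (K.*-congˡ e) (K.zeroʳ x⁻¹))))

    open Rational inv inv-law
    private
      module A = CommutativeRing psRing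
      module I where
        open Integers psRing public
        open IntegerSolver psRing public
      module Y = PowerSeries psRing
      module B = CommutativeRing Y.psRing
      module J where
        open Integers Y.psRing public
        open IntegerSolver Y.psRing public

    -- Linear functionals on series in x with values in series in w.

    module Pairing where
      open K using (_≈_; 0#) renaming (Carrier to C)
      open A hiding (_≈_; 0#; Carrier)

      -- Ord k f means f = O(w^{k/2}).
      _≈[_]_ : PS → ℕ → PS → Set
      f ≈[ n ] g = ∀ m → m ≤ n → f m ≈ g m

      Ord : ℕ → PS → Set
      Ord k f = ∀ n → 2 ℕ.* n < k → f n ≈ 0#

      conv-≈ : ∀ n {f f′ g g′} → f ≈[ n ] f′ → g ≈[ n ] g′ → (f * g) ≈[ n ] (f′ * g′)
      conv-≈ n {f} {f′} {g} {g′} p q m m≤n = go m f f′ (λ k k≤ → p k (ℕP.≤-trans k≤ m≤n)) (λ k k≤ → q k (ℕP.≤-trans k≤ m≤n))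
        where
        go : ∀ m f f′ → f ≈[ m ] f′ → g ≈[ m ] g′ → conv f g m ≈ conv f′ g′ m
        go zero f f′ p q = K.*-cong (p 0 z≤n) (q 0 z≤n)
        go (suc m) f f′ p q = K.+-cong (K.*-cong (p 0 z≤n) (q (suc m) ℕP.≤-refl))
          (go m (tl f) (tl f′) (λ k k≤ → p (suc k) (s≤s k≤)) (λ k k≤ → q k (ℕP.m≤n⇒m≤1+n k≤)))

      conv-≈⁺ : ∀ n {f f′ g g′} → f 0 ≈ 0# → f′ 0 ≈ 0# → g 0 ≈ 0# → g′ 0 ≈ 0# → f ≈[ n ] f′ → g ≈[ n ] g′ → (f * g) ≈[ suc n ] (f′ * g′)
      conv-≈⁺ n {f} {f′} {g} {g′} f₀ f′₀ g₀ g′₀ p q m m≤ = K.trans (at (factor f g f₀ g₀) m) (K.trans (inner m m≤) (K.sym (at (factor f′ g′ f′₀ g′₀) m)))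
        where
        factor : ∀ f g → f 0 ≈ 0# → g 0 ≈ 0# → f * g ≋ X * (X * (tl f * tl g))
        factor f g f₀ g₀ = A.trans (*-cong (X-tl f₀) (X-tl g₀)) (I.solve 3 (λ x u v → (x I.:* u) I.:* (x I.:* v) I.:= x I.:* (x I.:* (u I.:* v))) A.refl X (tl f) (tl g))
        P P′ : PS
        P = tl f * tl g
        P′ = tl f′ * tl g′
        inner : ∀ m → m ≤ suc n → (X * (X * P)) m ≈ (X * (X * P′)) m
        inner zero _ = K.trans (X-*₀ (X * P)) (K.sym (X-*₀ (X * P′)))
        inner (suc zero) _ = K.trans (X-* (X * P) 0) (K.trans (K.trans (X-*₀ P) (K.sym (X-*₀ P′))) (K.sym (X-* (X * P′) 0)))
        inner (suc (suc m)) (s≤s m<n) = K.trans (X-* (X * P) (suc m)) (K.trans (X-* P m)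
          (K.trans (conv-≈ m {tl f} {tl f′} {tl g} {tl g′} (λ k k≤ → p (suc k) (ℕP.≤-trans (s≤s k≤) m<n)) (λ k k≤ → q (suc k) (ℕP.≤-trans (s≤s k≤) m<n)) m ℕP.≤-refl)
          (K.sym (K.trans (X-* (X * P′) (suc m)) (X-* P′ m)))))

      ord-+ : ∀ {k f g} → Ord k f → Ord k g → Ord k (f + g)
      ord-+ p q n lt = K.trans (K.+-cong (p n lt) (q n lt)) (K.+-identityˡ 0#)

      ord-neg : ∀ {k f} → Ord k f → Ord k (- f)
      ord-neg p n lt = K.trans (K.-‿cong (p n lt)) (Algebra.Properties.Ring.-0#≈0# K.ring)
        where import Algebra.Properties.Ring

      ord-cong : ∀ {k f g} → f ≋ g → Ord k f → Ord k g
      ord-cong e p n lt = K.trans (K.sym (at e n)) (p n lt)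

      ord-≤ : ∀ {k l f} → l ≤ k → Ord k f → Ord l f
      ord-≤ l≤k p n lt = p n (ℕP.<-≤-trans lt l≤k)

      ord-* : ∀ k l {f g} → Ord k f → Ord l g → Ord (k ℕ.+ l) (f * g)
      ord-* k l {f} {g} p q n = go n f k p
        where
        go : ∀ n f k → Ord k f → 2 ℕ.* n < k ℕ.+ l → conv f g n ≈ 0#
        go zero f zero p lt = K.trans (K.*-congˡ (q 0 lt)) (K.zeroʳ _)
        go zero f (suc k) p lt = K.trans (K.*-congʳ (p 0 (s≤s z≤n))) (K.zeroˡ _)
        go (suc n) f k p lt = K.trans (K.+-cong (head k p lt) (tail-part k p lt)) (K.+-identityˡ 0#)
          where
          head : ∀ k → Ord k f → 2 ℕ.* suc n < k ℕ.+ l → f 0 K.* g (suc n) ≈ 0#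
          head zero p lt = K.trans (K.*-congˡ (q (suc n) lt)) (K.zeroʳ _)
          head (suc k) p lt = K.trans (K.*-congʳ (p 0 (s≤s z≤n))) (K.zeroˡ _)
          double : 2 ℕ.* suc n ≡ suc (suc (2 ℕ.* n))
          double = ≡.cong suc (ℕP.+-suc n (n ℕ.+ 0))
          tail-part : ∀ k → Ord k f → 2 ℕ.* suc n < k ℕ.+ l → conv (tl f) g n ≈ 0#
          tail-part zero p lt = go n (tl f) 0 (λ _ ()) (ℕP.<-trans (ℕP.<-trans (ℕP.n<1+n _) (ℕP.n<1+n _)) (≡.subst (_< l) double lt))
          tail-part (suc zero) p lt = go n (tl f) 0 (λ _ ()) (ℕP.<-trans (ℕP.n<1+n _) (ℕP.≤-pred (≡.subst (_< suc l) double lt)))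
          tail-part (suc (suc k)) p lt = go n (tl f) k (λ m m< → p (suc m) (≡.subst (_< suc (suc k)) (≡.sym (≡.cong suc (ℕP.+-suc m (m ℕ.+ 0)))) (s≤s (s≤s m<))))
            (ℕP.≤-pred (ℕP.≤-pred (≡.subst (_< suc (suc (k ℕ.+ l))) double lt)))

      ord-zero : ∀ {f} → f 0 ≈ 0# → Ord 2 f
      ord-zero e zero _ = e
      ord-zero e (suc n) lt = ⊥-elim (ℕP.<⇒≱ lt (ℕP.≤-trans (s≤s (s≤s z≤n)) (ℕP.≤-reflexive (≡.sym (≡.cong suc (ℕP.+-suc n (n ℕ.+ 0)))))))

      ord-scale : ∀ {k} a {f} → Ord k f → Ord k (const a * f)
      ord-scale a {f} p n lt = K.trans (const-* a f n) (K.trans (K.*-congˡ (p n lt)) (K.zeroʳ _))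

      -- ⟨ f , a ⟩ = Σₖ fₖ aₖ for a family of series aₖ in w whose orders grow.
      partial : ℕ → PS → (ℕ → PS) → PS
      partial zero f a = A.0#
      partial (suc N) f a = partial N f a + const (f N) * a N

      bound : ℕ → ℕ
      bound n = 2 ℕ.* n ℕ.+ 5

      ⟨_,_⟩ : PS → (ℕ → PS) → PS
      ⟨ f , a ⟩ n = partial (bound n) f a n

      -- Only terms with k ≤ 2n + 4 reach the coefficient of wⁿ, so the sum cut off at `bound n` is
      -- exact. The families have order about k/2; the slack 4 leaves room for D, which lowers `Ord`
      -- by 2, and for the shift in `derive`.
      Summable : (ℕ → PS) → Set
      Summable a = ∀ n k → 2 ℕ.* n ℕ.+ 4 < k → a k n ≈ 0#

      term : ∀ (f : PS) (a : ℕ → PS) k n → (const (f k) * a k) n ≈ f k K.* a k n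
      term f a k n = const-* (f k) (a k) n

      partial-ext : ∀ {a} f → Summable a → ∀ n j → partial (bound n ℕ.+ j) f a n ≈ ⟨ f , a ⟩ n
      partial-ext {a} f s n zero = K.reflexive (≡.cong (λ N → partial N f a n) (ℕP.+-identityʳ (bound n)))
      partial-ext {a} f s n (suc j) rewrite ℕP.+-suc (bound n) j =
        K.trans (K.+-cong (partial-ext f s n j) (K.trans (term f a (bound n ℕ.+ j) n) (K.trans (K.*-congˡ (s n _ (ℕP.≤-trans lt (ℕP.m≤m+n (bound n) j)))) (K.zeroʳ _)))) (K.+-identityʳ _)
        where
        lt : 2 ℕ.* n ℕ.+ 4 < bound n
        lt = ℕP.+-monoʳ-< (2 ℕ.* n) (ℕP.n<1+n 4)

      partial-≥ : ∀ {a} f → Summable a → ∀ n N → bound n ≤ N → partial N f a n ≈ ⟨ f , a ⟩ n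
      partial-≥ f s n N le with ℕP.m≤n⇒∃[o]m+o≡n le
      ... | j , ≡.refl = partial-ext f s n j

      bound-mono : ∀ {m n} → m ≤ n → bound m ≤ bound n
      bound-mono le = ℕP.+-monoˡ-≤ 5 (ℕP.*-monoʳ-≤ 2 le)

      partial-cong : ∀ N {f g a b} → (∀ k → const (f k) * a k ≋ const (g k) * b k) → partial N f a ≋ partial N g b
      partial-cong zero e = A.refl
      partial-cong (suc N) e = +-cong (partial-cong N e) (e N)

      -- The adjoint of the derivative.
      derive : (ℕ → PS) → ℕ → PS
      derive a zero = A.0#
      derive a (suc k) = const (numeral (suc k)) * a k

      private
        open I using (solve; _:=_; _:+_; _:*_; :-_; con)

        partial-+ˡ : ∀ N f g a → partial N (f + g) a ≋ partial N f a + partial N g a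
        partial-+ˡ zero f g a = A.sym (A.+-identityˡ _)
        partial-+ˡ (suc N) f g a = A.trans (+-cong (partial-+ˡ N f g a) (A.trans (*-congʳ (const-add _ _)) (distribʳ _ _ _)))
          (solve 4 (λ a b c d → (a :+ b) :+ (c :+ d) := (a :+ c) :+ (b :+ d)) A.refl _ _ _ _)

        partial-+ʳ : ∀ N f a b → partial N f (λ k → a k + b k) ≋ partial N f a + partial N f b
        partial-+ʳ zero f a b = A.sym (A.+-identityˡ _)
        partial-+ʳ (suc N) f a b = A.trans (+-cong (partial-+ʳ N f a b) (distribˡ _ _ _))
          (solve 4 (λ a b c d → (a :+ b) :+ (c :+ d) := (a :+ c) :+ (b :+ d)) A.refl _ _ _ _)

        partial-*ʳ : ∀ N u f a → partial N f (λ k → u * a k) ≋ u * partial N f a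
        partial-*ʳ zero u f a = A.sym (zeroʳ u)
        partial-*ʳ (suc N) u f a = A.trans (+-congʳ (partial-*ʳ N u f a))
          (solve 4 (λ u p c a → u :* p :+ c :* (u :* a) := u :* (p :+ c :* a)) A.refl u (partial N f a) (const (f N)) (a N))

        partial-*ˡ : ∀ N c f a → partial N (const c * f) a ≋ const c * partial N f a
        partial-*ˡ zero c f a = A.sym (zeroʳ _)
        partial-*ˡ (suc N) c f a = A.trans (+-cong (partial-*ˡ N c f a) (*-congʳ (A.trans (const-cong (const-* c f N)) (const-mul c (f N)))))
          (solve 4 (λ u p c a → u :* p :+ (u :* c) :* a := u :* (p :+ c :* a)) A.refl (const c) (partial N f a) (const (f N)) (a N))

        partial-D : ∀ N f a → partial N f (λ k → D (a k)) ≋ D (partial N f a)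
        partial-D zero f a = A.sym D-zero
        partial-D (suc N) f a = A.trans (+-cong (partial-D N f a) (A.sym (A.trans (D-* (const (f N)) (a N)) (A.trans (+-congʳ (A.trans (*-congʳ (D-const (f N))) (zeroˡ _))) (+-identityˡ _)))))
          (A.sym (D-+ (partial N f a) (const (f N) * a N)))

        partial-shift : ∀ N f a → partial (suc N) (X * f) a ≋ partial N f (λ k → a (suc k))
        partial-shift zero f a = A.trans (+-identityˡ _) (A.trans (*-congʳ (A.trans (const-cong (X-*₀ f)) const-0)) (zeroˡ _))
        partial-shift (suc N) f a = +-cong (partial-shift N f a) (*-congʳ (const-cong (X-* f N)))

        partial-derive : ∀ N f a → partial (suc N) f (derive a) ≋ partial N (D f) a
        partial-derive zero f a = A.trans (+-identityˡ _) (zeroʳ _)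
        partial-derive (suc N) f a = +-cong (partial-derive N f a) (A.trans (solve 3 (λ f k a → f :* (k :* a) := (k :* f) :* a) A.refl (const (f (suc N))) (const (numeral (suc N))) (a N))
          (*-congʳ (A.sym (const-mul (numeral (suc N)) (f (suc N))))))

      pair-cong : ∀ {f g a b} → f ≋ g → (∀ k → a k ≋ b k) → ⟨ f , a ⟩ ≋ ⟨ g , b ⟩
      pair-cong {f} {g} {a} {b} p q = coeffs λ n → at (partial-cong (bound n) {f} {g} {a} {b} (λ k → *-cong (const-cong (at p k)) (q k))) n

      pair-+ˡ : ∀ f g a → ⟨ f + g , a ⟩ ≋ ⟨ f , a ⟩ + ⟨ g , a ⟩
      pair-+ˡ f g a = coeffs λ n → at (partial-+ˡ (bound n) f g a) n

      pair-*ˡ : ∀ c f a → ⟨ const c * f , a ⟩ ≋ const c * ⟨ f , a ⟩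
      pair-*ˡ c f a = coeffs λ n → K.trans (at (partial-*ˡ (bound n) c f a) n) (K.trans (const-* c _ n) (K.sym (const-* c _ n)))

      pair-+ʳ : ∀ f a b → ⟨ f , (λ k → a k + b k) ⟩ ≋ ⟨ f , a ⟩ + ⟨ f , b ⟩
      pair-+ʳ f a b = coeffs λ n → at (partial-+ʳ (bound n) f a b) n

      -- Multiplication by u mixes the coefficients up to n of the sum, which are cut off at
      -- different bounds; summability lets all of them be cut off at `bound n`.
      pair-*ʳ : ∀ u f a → Summable a → ⟨ f , (λ k → u * a k) ⟩ ≋ u * ⟨ f , a ⟩
      pair-*ʳ u f a s = coeffs λ n → K.trans (at (partial-*ʳ (bound n) u f a) n)
        (conv-≈ n {u} (λ _ _ → K.refl) (λ m m≤n → partial-≥ f s m (bound n) (bound-mono m≤n)) n ℕP.≤-refl)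

      pair-D : ∀ f a → Summable a → Summable (λ k → D (a k)) → ⟨ f , (λ k → D (a k)) ⟩ ≋ D ⟨ f , a ⟩
      pair-D f a s s′ = coeffs λ n → K.trans (K.sym (partial-≥ f s′ n (bound (suc n)) (bound-mono (ℕP.n≤1+n n)))) (at (partial-D (bound (suc n)) f a) n)

      pair-X : ∀ f a → Summable a → ⟨ X * f , a ⟩ ≋ ⟨ f , (λ k → a (suc k)) ⟩
      pair-X f a s = coeffs λ n → K.trans (K.sym (partial-≥ (X * f) s n (suc (bound n)) (ℕP.n≤1+n _))) (at (partial-shift (bound n) f a) n)

      pair-derive : ∀ f a → Summable (derive a) → ⟨ f , derive a ⟩ ≋ ⟨ D f , a ⟩
      pair-derive f a s = coeffs λ n → K.trans (K.sym (partial-≥ f s n (suc (bound n)) (ℕP.n≤1+n _)))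
        (at (partial-derive (bound n) f a) n)

      pair-1 : ∀ a → Summable a → ⟨ A.1# , a ⟩ ≋ a 0
      pair-1 a s = coeffs λ n → K.trans (K.sym (partial-≥ A.1# s n (suc (bound n)) (ℕP.n≤1+n _))) (at (go (bound n)) n)
        where
        go : ∀ N → partial (suc N) A.1# a ≋ a 0
        go zero = A.trans (+-identityˡ _) (*-identityˡ _)
        go (suc N) = A.trans (+-cong (go N) (A.trans (*-congʳ const-0) (zeroˡ _))) (+-identityʳ _)

      pair-θ : ∀ f a → ⟨ θ f , a ⟩ ≋ ⟨ f , (λ k → const (numeral k) * a k) ⟩
      pair-θ f a = coeffs λ n → at (partial-cong (bound n) {θ f} {f} {a} {λ k → const (numeral k) * a k} (λ k →
        A.trans (*-congʳ (const-mul (numeral k) (f k))) (solve 3 (λ k f a → (k :* f) :* a := f :* (k :* a)) A.refl (const (numeral k)) (const (f k)) (a k)))) n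

      pair-zero : ∀ f a → (∀ k → a k ≋ A.0#) → ⟨ f , a ⟩ ≋ A.0#
      pair-zero f a e = coeffs λ n → at (go (bound n)) n
        where
        go : ∀ N → partial N f a ≋ A.0#
        go zero = A.refl
        go (suc N) = A.trans (+-cong (go N) (A.trans (*-congˡ (e N)) (zeroʳ _))) (+-identityˡ _)

      summable : ∀ {a} j → j ≤ 4 → (∀ k → Ord (k ℕ.∸ j) (a k)) → Summable a
      summable j j≤4 h n k lt = h k n (ℕP.m+n≤o⇒m≤o∸n (suc (2 ℕ.* n)) (ℕP.≤-trans (s≤s (ℕP.+-monoʳ-≤ (2 ℕ.* n) j≤4)) lt))

      ord-D : ∀ {k f} → Ord k f → Ord (k ℕ.∸ 2) (D f)
      ord-D {suc (suc k)} p n lt = K.trans (K.*-congˡ (p (suc n) (≡.subst (_< suc (suc k)) (≡.sym (≡.cong suc (ℕP.+-suc n (n ℕ.+ 0)))) (s≤s (s≤s lt))))) (K.zeroʳ _)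

      pair-neg : ∀ f a → ⟨ f , (λ k → - a k) ⟩ ≋ - ⟨ f , a ⟩
      pair-neg f a = coeffs λ n → at (go (bound n)) n
        where
        go : ∀ N → partial N f (λ k → - a k) ≋ - partial N f a
        go zero = A.sym (Algebra.Properties.Ring.-0#≈0# A.ring)
          where import Algebra.Properties.Ring
        go (suc N) = A.trans (+-congʳ (go N)) (solve 3 (λ p f a → :- p :+ f :* (:- a) := :- (p :+ f :* a)) A.refl (partial N f a) (const (f N)) (a N))

      pair-ord : ∀ {f a} m c → (∀ j → j < m → f j ≈ 0#) → (∀ j → Ord (j ℕ.+ c) (a j)) → Ord (m ℕ.+ c) ⟨ f , a ⟩
      pair-ord {f} {a} m c f₀ oa n lt = go (bound n)
        where
        go : ∀ N → partial N f a n ≈ 0#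
        go zero = K.refl
        go (suc N) with N ℕ.<? m
        ... | yes N<m = K.trans (K.+-cong (go N) (K.trans (term f a N n) (K.trans (K.*-congʳ (f₀ N N<m)) (K.zeroˡ _)))) (K.+-identityˡ _)
        ... | no N≮m = K.trans (K.+-cong (go N) (K.trans (term f a N n) (K.trans (K.*-congˡ (oa N n (ℕP.<-≤-trans lt (ℕP.+-monoˡ-≤ c (ℕP.≮⇒≥ N≮m))))) (K.zeroʳ _)))) (K.+-identityˡ _)

      xpow : ℕ → PS → PS
      xpow zero f = f
      xpow (suc m) f = X * xpow m f

      pair-xpow : ∀ m f a → (∀ j → Summable (λ k → a (j ℕ.+ k))) → ⟨ xpow m f , a ⟩ ≋ ⟨ f , (λ k → a (m ℕ.+ k)) ⟩
      pair-xpow zero f a s = A.refl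
      pair-xpow (suc m) f a s = A.trans (pair-X (xpow m f) a (s 0)) (pair-xpow m f (λ k → a (suc k)) (λ j n k lt → K.trans (K.reflexive (≡.cong (λ i → a i n) (≡.sym (ℕP.+-suc j k)))) (K.trans (K.reflexive (≡.cong (λ i → a i n) (ℕP.+-suc j k))) (s (suc j) n k lt))))

      xpow-zero : ∀ m f i → (∀ j → j < i → f j ≈ 0#) → ∀ j → j < m ℕ.+ i → xpow m f j ≈ 0#
      xpow-zero zero f i h j lt = h j lt
      xpow-zero (suc m) f i h zero lt = X-*₀ (xpow m f)
      xpow-zero (suc m) f i h (suc j) (s≤s lt) = K.trans (X-* (xpow m f) j) (xpow-zero m f i h j lt)

    -- Moments of z + S + R/z and the loop equation.

    module Moments where
      open Pairing
      open A
      open I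

      ν : ℕ → PS
      ν k = const (numeral k)

      ν-suc : ∀ k → ν (suc k) ≋ 1# + ν k
      ν-suc k = trans (const-cong (numeral-suc k)) (const-add _ _)

      module Family (R S : PS) where

        -- The moments have the generating function (1 - 2Sy + Py²)^(-1/2), since 1 - 2Sy + Py² = (1
        -- - Sy)² - 4Ry²; the recursion for `Λ` is therefore that of rescaled Legendre polynomials.
        P : PS
        P = S * S + - (ι (+ 4) * R)

        -- The constant term in z of (z + S + R/z)ᵏ.
        Λ : ℕ → PS
        Λ zero = 1#
        Λ (suc zero) = S
        Λ (suc (suc k)) = const (inv (suc k)) * ((ι (+ 2) * ν k + ι (+ 3)) * S * Λ (suc k) + - ((ν k + 1#) * P * Λ k))

        Λ-rec : ∀ k → ν (suc (suc k)) * Λ (suc (suc k)) ≋ (ι (+ 2) * ν k + ι (+ 3)) * S * Λ (suc k) + - ((ν k + 1#) * P * Λ k)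
        Λ-rec k = trans (sym (*-assoc _ _ _)) (trans (*-congʳ (trans (sym (const-mul _ _)) (trans (const-cong (K.trans (K.*-comm _ _) (inv-law (suc k)))) refl))) (*-identityˡ _))

        module _ (R₀ : R 0 K.≈ K.0#) (S₀ : S 0 K.≈ K.0#) where

          ord-P : Ord 2 P
          ord-P = ord-+ (ord-≤ (s≤s (s≤s z≤n)) (ord-* 2 2 (ord-zero S₀) (ord-zero S₀))) (ord-neg (ord-* 0 2 {ι (+ 4)} (λ _ ()) (ord-zero R₀)))

          ord-Λ : ∀ k → Ord k (Λ k)
          ord-Λ zero n ()
          ord-Λ (suc zero) = ord-≤ (s≤s z≤n) (ord-zero S₀)
          ord-Λ (suc (suc k)) = ord-scale (inv (suc k)) (ord-+
            (ord-cong (sym (*-assoc _ _ _)) (ord-* 0 (suc (suc k)) {ι (+ 2) * ν k + ι (+ 3)} (λ _ ()) (ord-≤ (ℕP.n≤1+n _) (ord-* 2 (suc k) (ord-zero S₀) (ord-Λ (suc k))))))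
            (ord-neg (ord-cong (sym (*-assoc _ _ _)) (ord-* 0 (suc (suc k)) {ν k + 1#} (λ _ ()) (ord-* 2 k ord-P (ord-Λ k))))))

        private
          -- Series in y over series in w, where y marks the index of a moment.
          y : Y.PS
          y = Y.X
          c : PS → Y.PS
          c = Y.const
          inv-A : ∀ n → (const (inv n) * Y.numeral (suc n)) ≋ 1#
          inv-A n = trans (*-congˡ (numeral-const (suc n))) (trans (sym (const-mul _ _)) (trans (const-cong (inv-law n)) refl))
          module Q = Y.Rational (λ n → const (inv n)) inv-A

          Q̂ θQ̂ E₁ δQ̂ : Y.PS
          Q̂ = B.1# B.+ B.- (c S B.* (y B.+ y)) B.+ c P B.* (y B.* y)
          θQ̂ = B.- (c S B.* (y B.+ y)) B.+ c P B.* (y B.* y B.+ y B.* y)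
          E₁ = Y.θ Λ B.+ B.- (c S B.* (y B.* (Y.θ Λ B.+ Y.θ Λ B.+ Λ))) B.+ c P B.* (y B.* (y B.* (Y.θ Λ B.+ Λ)))
          δQ̂ = B.- (c (D S) B.* (y B.+ y)) B.+ c (D P) B.* (y B.* y)

          coeff-y : ∀ u f n → (c u B.* (y B.* f)) (suc n) ≋ u * f n
          coeff-y u f n = trans (Y.const-* u (y B.* f) (suc n)) (*-congˡ (Y.X-* f n))

          coeff-y₀ : ∀ u f → (c u B.* (y B.* f)) 0 ≋ 0#
          coeff-y₀ u f = trans (Y.const-* u (y B.* f) 0) (trans (*-congˡ (Y.X-*₀ f)) (zeroʳ u))

          coeff-yy : ∀ u f n → (c u B.* (y B.* (y B.* f))) (suc (suc n)) ≋ u * f n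
          coeff-yy u f n = trans (coeff-y u (y B.* f) (suc n)) (*-congˡ (Y.X-* f n))

          coeff-yy₁ : ∀ u f → (c u B.* (y B.* (y B.* f))) 1 ≋ 0#
          coeff-yy₁ u f = trans (coeff-y u (y B.* f) 0) (trans (*-congˡ (Y.X-*₀ f)) (zeroʳ u))

        -- The coefficient of y^(k+1) in Q̂ θΛ + ½ (θQ̂) Λ = 0, the differential equation in y of
        -- Q̂^(-1/2).
        E₁-zero : ∀ k → ν (suc k) * Λ (suc k) + - (S * (ν k * Λ k + ν k * Λ k + Λ k)) + P * derive Λ k ≋ 0#
        E₁-zero zero = trans (+-cong (+-cong (*-congʳ (trans (ν-suc 0) (+-congˡ const-0))) (-‿cong (*-congˡ (+-congʳ (+-cong (*-congʳ const-0) (*-congʳ const-0)))))) refl)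
          (solve 3 (λ S P z → (con (+ 1) :+ con (+ 0)) :* S :+ :- (S :* (con (+ 0) :* con (+ 1) :+ con (+ 0) :* con (+ 1) :+ con (+ 1))) :+ P :* con (+ 0) := con (+ 0)) refl S P S)
        E₁-zero (suc k) = trans (+-cong (+-cong (Λ-rec k) (-‿cong (*-congˡ (+-congʳ (+-cong (*-congʳ (ν-suc k)) (*-congʳ (ν-suc k))))))) (*-congˡ (*-congʳ (ν-suc k))))
          (solve 5 (λ n S P a b → (con (+ 2) :* n :+ con (+ 3)) :* S :* a :+ :- ((n :+ con (+ 1)) :* P :* b) :+ :- (S :* ((con (+ 1) :+ n) :* a :+ (con (+ 1) :+ n) :* a :+ a))
            :+ P :* ((con (+ 1) :+ n) :* b) := con (+ 0)) refl (ν k) S P (Λ (suc k)) (Λ k))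

        private
          E₁≋0 : E₁ Y.≋ B.0#
          E₁≋0 = Y.coeffs go
            where
            G H : Y.PS
            G = Y.θ Λ B.+ Y.θ Λ B.+ Λ
            H = Y.θ Λ B.+ Λ
            scaled : ∀ k → Y.θ Λ k ≋ ν k * Λ k
            scaled k = *-congʳ (numeral-const k)
            go : Y.Pointwise E₁ B.0#
            go zero = trans (+-cong (+-cong (trans (scaled 0) (*-congʳ const-0)) (-‿cong (coeff-y₀ S G))) (coeff-y₀ P (y B.* H)))
              (solve 0 (con (+ 0) :* con (+ 1) :+ :- con (+ 0) :+ con (+ 0) := con (+ 0)) refl)
            go (suc zero) = trans (+-cong (+-cong (scaled 1) (-‿cong (trans (coeff-y S G 0) (*-congˡ (+-congʳ (+-cong (scaled 0) (scaled 0))))))) (trans (coeff-yy₁ P H) (sym (zeroʳ P)))) (E₁-zero 0)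
            go (suc (suc k)) = trans (+-cong (+-cong (scaled (suc (suc k))) (-‿cong (trans (coeff-y S G (suc k)) (*-congˡ (+-congʳ (+-cong (scaled (suc k)) (scaled (suc k))))))))
                (trans (coeff-yy P H k) (*-congˡ (trans (+-congʳ (scaled k)) (trans (solve 2 (λ n a → n :* a :+ a := (con (+ 1) :+ n) :* a) refl (ν k) (Λ k)) (*-congʳ (sym (ν-suc k))))))))
              (E₁-zero (suc k))

          θ-2 : ∀ u f → Y.θ f Y.≋ f → Y.θ (c u B.* f) Y.≋ c u B.* f
          θ-2 u f e = B.trans (Y.θ-* (c u) f) (B.trans (B.+-cong (B.trans (B.*-congʳ (Y.θ-const u)) (B.zeroˡ f)) (B.*-congˡ e)) (B.+-identityˡ _))

          θQ̂≋ : Y.θ Q̂ Y.≋ θQ̂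
          θQ̂≋ = B.trans (Y.θ-+ (B.1# B.+ B.- (c S B.* (y B.+ y))) (c P B.* (y B.* y))) (B.+-cong
            (B.trans (Y.θ-+ B.1# (B.- (c S B.* (y B.+ y)))) (B.trans (B.+-cong (Y.θ-const 1#) (B.trans (Y.θ-neg (c S B.* (y B.+ y))) (B.-‿cong (θ-2 S (y B.+ y) (B.trans (Y.θ-+ y y) (B.+-cong Y.θ-X Y.θ-X)))))) (B.+-identityˡ _)))
            (B.trans (Y.θ-* (c P) (y B.* y)) (B.trans (B.+-cong (B.trans (B.*-congʳ (Y.θ-const P)) (B.zeroˡ _))
              (B.*-congˡ (B.trans (Y.θ-* y y) (B.+-cong (B.*-congʳ Y.θ-X) (B.*-congˡ Y.θ-X))))) (B.+-identityˡ _))))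

          -- θ(Q̂Λ²) = 2Λ E₁ = 0, so the product equals its constant term 1. This identifies the
          -- generating function of the moments as Q̂^(-1/2).
          QTT : Q̂ B.* (Λ B.* Λ) Y.≋ B.1#
          QTT = Q.θ-injective at-0 (B.trans dθ (B.sym (Y.θ-const 1#)))
            where
            at-0 : (Q̂ B.* (Λ B.* Λ)) 0 ≋ 1#
            at-0 = trans (*-cong (+-cong (+-congˡ (-‿cong (trans (Y.const-* S (y B.+ y) 0) (trans (*-congˡ (+-identityˡ 0#)) (zeroʳ S))))) (trans (Y.const-* P (y B.* y) 0) (trans (*-congˡ (Y.X-*₀ y)) (zeroʳ P)))) refl)
              (solve 0 ((con (+ 1) :+ :- con (+ 0) :+ con (+ 0)) :* (con (+ 1) :* con (+ 1)) := con (+ 1)) refl)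
            dθ : Y.θ (Q̂ B.* (Λ B.* Λ)) Y.≋ B.0#
            dθ = B.trans (Y.θ-* Q̂ (Λ B.* Λ)) (B.trans (B.+-cong (B.*-congʳ θQ̂≋) (B.*-congˡ (Y.θ-* Λ Λ)))
              (B.trans (J.solve 5 (λ S P y T t → (J.:- (S J.:* (y J.:+ y)) J.:+ P J.:* (y J.:* y J.:+ y J.:* y)) J.:* (T J.:* T)
                  J.:+ (J.con (+ 1) J.:+ J.:- (S J.:* (y J.:+ y)) J.:+ P J.:* (y J.:* y)) J.:* (t J.:* T J.:+ T J.:* t)
                  J.:= (T J.:+ T) J.:* (t J.:+ J.:- (S J.:* (y J.:* (t J.:+ t J.:+ T))) J.:+ P J.:* (y J.:* (y J.:* (t J.:+ T))))) B.refl (c S) (c P) y Λ (Y.θ Λ))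
              (B.trans (B.*-congˡ E₁≋0) (B.zeroʳ _))))

          δ : Y.PS → Y.PS
          δ = Y.lift D

          δ-* : ∀ f g → δ (f B.* g) Y.≋ δ f B.* g B.+ f B.* δ g
          δ-* = Y.lift-* D D-+ D-*

          δ-const : ∀ u → δ (c u) Y.≋ c (D u)
          δ-const u = Y.coeffs λ { zero → refl ; (suc n) → D-zero }

          D-1 : D 1# ≋ 0#
          D-1 = D-const K.1#

          δ-y : δ y Y.≋ B.0#
          δ-y = Y.coeffs λ { zero → D-zero ; (suc zero) → D-1 ; (suc (suc n)) → D-zero }

          δ-cy : ∀ u f → δ f Y.≋ B.0# → δ (c u B.* f) Y.≋ c (D u) B.* f
          δ-cy u f e = B.trans (δ-* (c u) f) (B.trans (B.+-cong (B.*-congʳ (δ-const u)) (B.trans (B.*-congˡ e) (B.zeroʳ _))) (B.+-identityʳ _))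

          δ-+ : ∀ f g → δ (f B.+ g) Y.≋ δ f B.+ δ g
          δ-+ f g = Y.coeffs λ n → D-+ (f n) (g n)

          δ-neg : ∀ f → δ (B.- f) Y.≋ B.- δ f
          δ-neg f = Y.coeffs λ n → D-neg (f n)

          δQ̂≋ : δ Q̂ Y.≋ δQ̂
          δQ̂≋ = B.trans (δ-+ (B.1# B.+ B.- (c S B.* (y B.+ y))) (c P B.* (y B.* y))) (B.+-cong
            (B.trans (δ-+ B.1# (B.- (c S B.* (y B.+ y)))) (B.trans (B.+-cong (B.trans (δ-const 1#) (B.trans (Y.const-cong D-1) Y.const-0))
              (B.trans (δ-neg (c S B.* (y B.+ y))) (B.-‿cong (δ-cy S (y B.+ y) (B.trans (δ-+ y y) (B.trans (B.+-cong δ-y δ-y) (B.+-identityˡ _))))))) (B.+-identityˡ _)))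
            (δ-cy P (y B.* y) (B.trans (δ-* y y) (B.trans (B.+-cong (B.trans (B.*-congʳ δ-y) (B.zeroˡ y)) (B.trans (B.*-congˡ δ-y) (B.zeroʳ y))) (B.+-identityˡ _)))))

          δ-cong : ∀ {f g} → f Y.≋ g → δ f Y.≋ δ g
          δ-cong p = Y.coeffs λ n → D-cong (Y.at p n)

          -- T δ(Q̂ T²) = 0 with T a unit.
          δT : δQ̂ B.* Λ B.+ (Q̂ B.* δ Λ B.+ Q̂ B.* δ Λ) Y.≋ B.0#
          δT = B.trans (B.sym (B.trans (B.*-congʳ QTT) (B.*-identityˡ _)))
            (B.trans (J.solve 4 (λ q T d e → q J.:* (T J.:* T) J.:* (d J.:* T J.:+ (q J.:* e J.:+ q J.:* e)) J.:= (q J.:* T) J.:* (d J.:* (T J.:* T) J.:+ q J.:* (e J.:* T J.:+ T J.:* e))) B.refl Q̂ Λ δQ̂ (δ Λ))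
            (B.trans (B.*-congˡ (B.trans (B.+-cong (B.*-congʳ (B.sym δQ̂≋)) (B.*-congˡ (B.sym (δ-* Λ Λ)))) (B.trans (B.sym (δ-* Q̂ (Λ B.* Λ))) (B.trans (δ-cong QTT) (B.trans (δ-const 1#) (B.trans (Y.const-cong D-1) Y.const-0))))))
              (B.zeroʳ _)))

          module _ where
            private
              R′ S′ u : PS
              R′ = D R
              S′ = D S
              u = ι (+ 2) * R * S′

            D-P : D P ≋ S′ * S + S * S′ + - (ι (+ 4) * R′)
            D-P = trans (D-+ (S * S) (- (ι (+ 4) * R))) (+-cong (D-* S S) (trans (D-neg (ι (+ 4) * R)) (-‿cong
              (trans (D-* (ι (+ 4)) R) (trans (+-congʳ (trans (*-congʳ (trans (D-cong (numeral-const 4)) (D-const (numeral 4)))) (zeroˡ R))) (+-identityˡ _))))))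

            -- Chosen for the chain rule 4R ∂Λ/∂w = 2 θ(ℓΛ). It combines ∂Λₖ/∂S = k Λₖ₋₁ with 2R
            -- ∂Λₖ/∂R = k (Λₖ - S Λₖ₋₁); the latter holds because z and R/z contribute equally to a
            -- constant term.
            ℓ : Y.PS
            ℓ = c u B.* y B.+ c R′ B.* (B.1# B.+ B.- (c S B.* y))

            θℓ : Y.θ ℓ Y.≋ c u B.* y B.+ c R′ B.* (B.- (c S B.* y))
            θℓ = B.trans (Y.θ-+ (c u B.* y) (c R′ B.* (B.1# B.+ B.- (c S B.* y)))) (B.+-cong (θ-2 u y Y.θ-X)
              (B.trans (Y.θ-* (c R′) (B.1# B.+ B.- (c S B.* y))) (B.trans (B.+-cong (B.trans (B.*-congʳ (Y.θ-const R′)) (B.zeroˡ _))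
                (B.*-congˡ (B.trans (Y.θ-+ B.1# (B.- (c S B.* y))) (B.trans (B.+-cong (Y.θ-const 1#) (B.trans (Y.θ-neg (c S B.* y)) (B.-‿cong (θ-2 S y Y.θ-X)))) (B.+-identityˡ _))))) (B.+-identityˡ _))))

            c-cong : ∀ {f g} → f ≋ g → c f Y.≋ c g
            c-cong = Y.const-cong

            c-ι : ∀ n → c (ι (+ n)) Y.≋ J.ι (+ n)
            c-ι n = B.sym (Y.numeral-const n)

            c-P : c P Y.≋ c S B.* c S B.+ B.- (J.ι (+ 4) B.* c R)
            c-P = B.trans (Y.const-add _ _) (B.+-cong (Y.const-mul S S) (B.trans (Y.const-neg _) (B.-‿cong (B.trans (Y.const-mul _ R) (B.*-congʳ (c-ι 4))))))

            c-DP : c (D P) Y.≋ c S′ B.* c S B.+ c S B.* c S′ B.+ B.- (J.ι (+ 4) B.* c R′)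
            c-DP = B.trans (c-cong D-P) (B.trans (Y.const-add _ _) (B.+-cong (B.trans (Y.const-add _ _) (B.+-cong (Y.const-mul S′ S) (Y.const-mul S S′)))
              (B.trans (Y.const-neg _) (B.-‿cong (B.trans (Y.const-mul _ R′) (B.*-congʳ (c-ι 4)))))))

            c-u : c u Y.≋ J.ι (+ 2) B.* c R B.* c S′
            c-u = B.trans (Y.const-mul _ S′) (B.*-congʳ (B.trans (Y.const-mul _ R) (B.*-congʳ (c-ι 2))))

            c-4R : c (ι (+ 4) * R) Y.≋ J.ι (+ 4) B.* c R
            c-4R = B.trans (Y.const-mul _ R) (B.*-congʳ (c-ι 4))

            private
              T t e : Y.PS
              T = Λ
              t = Y.θ Λ
              e = δ Λ

              cube-e : e B.+ e Y.≋ B.- (δQ̂ B.* (T B.* (T B.* T)))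
              cube-e = B.trans (B.sym (B.trans (B.*-congʳ QTT) (B.*-identityˡ _)))
                (B.trans (J.solve 4 (λ q T d e → q J.:* (T J.:* T) J.:* (e J.:+ e) J.:= (T J.:* T) J.:* (d J.:* T J.:+ (q J.:* e J.:+ q J.:* e)) J.:+ J.:- (d J.:* (T J.:* (T J.:* T)))) B.refl Q̂ T δQ̂ e)
                (B.trans (B.+-congʳ (B.trans (B.*-congˡ δT) (B.zeroʳ _))) (B.+-identityˡ _)))

              cube-t : t B.+ t Y.≋ B.- (θQ̂ B.* (T B.* (T B.* T)))
              cube-t = B.trans (B.sym (B.trans (B.*-congʳ QTT) (B.*-identityˡ _)))
                (B.trans (J.solve 5 (λ S P y T t → (J.con (+ 1) J.:+ J.:- (S J.:* (y J.:+ y)) J.:+ P J.:* (y J.:* y)) J.:* (T J.:* T) J.:* (t J.:+ t)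
                  J.:= (T J.:* T) J.:* (J.con (+ 2) J.:* (t J.:+ J.:- (S J.:* (y J.:* (t J.:+ t J.:+ T))) J.:+ P J.:* (y J.:* (y J.:* (t J.:+ T)))))
                    J.:+ J.:- ((J.:- (S J.:* (y J.:+ y)) J.:+ P J.:* (y J.:* y J.:+ y J.:* y)) J.:* (T J.:* (T J.:* T)))) B.refl (c S) (c P) y T t)
                (B.trans (B.+-congʳ (B.trans (B.*-congˡ (B.trans (B.*-congˡ E₁≋0) (B.zeroʳ _))) (B.zeroʳ _))) (B.+-identityˡ _)))

              -- What remains of the chain rule once both derivatives of Λ are written as -½
              -- (derivative of Q̂) Λ³ and Λ as Q̂Λ³: a polynomial identity multiplied by Λ³.
              key : B.- (J.ι (+ 2) B.* c R B.* δQ̂) Y.≋ J.ι (+ 2) B.* Y.θ ℓ B.* Q̂ B.+ B.- (ℓ B.* θQ̂)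
              key = B.trans (B.-‿cong (B.*-congˡ (B.+-congˡ (B.*-congʳ c-DP))))
                (B.trans (J.solve 5 (λ R S R′ S′ y →
                    J.:- (J.con (+ 2) J.:* R J.:* (J.:- (S′ J.:* (y J.:+ y)) J.:+ (S′ J.:* S J.:+ S J.:* S′ J.:+ J.:- (J.con (+ 4) J.:* R′)) J.:* (y J.:* y)))
                    J.:= J.con (+ 2) J.:* (J.con (+ 2) J.:* R J.:* S′ J.:* y J.:+ R′ J.:* (J.:- (S J.:* y)))
                        J.:* (J.con (+ 1) J.:+ J.:- (S J.:* (y J.:+ y)) J.:+ (S J.:* S J.:+ J.:- (J.con (+ 4) J.:* R)) J.:* (y J.:* y))
                      J.:+ J.:- ((J.con (+ 2) J.:* R J.:* S′ J.:* y J.:+ R′ J.:* (J.con (+ 1) J.:+ J.:- (S J.:* y)))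
                        J.:* (J.:- (S J.:* (y J.:+ y)) J.:+ (S J.:* S J.:+ J.:- (J.con (+ 4) J.:* R)) J.:* (y J.:* y J.:+ y J.:* y))))
                  B.refl (c R) (c S) (c R′) (c S′) y)
                (B.sym (B.+-cong (B.*-cong (B.*-congˡ (B.trans θℓ (B.+-congʳ (B.*-congʳ c-u)))) (B.+-congˡ (B.*-congʳ c-P)))
                  (B.-‿cong (B.*-cong (B.+-congʳ (B.*-congʳ c-u)) (B.+-congˡ (B.*-congʳ c-P)))))))

            θℓT : c (ι (+ 4) * R) B.* e Y.≋ Y.θ (ℓ B.* T) B.+ Y.θ (ℓ B.* T)
            θℓT = B.trans (B.*-congʳ c-4R) (B.trans (J.solve 2 (λ R e → J.con (+ 4) J.:* R J.:* e J.:= J.con (+ 2) J.:* R J.:* (e J.:+ e)) B.refl (c R) e)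
              (B.trans (B.*-congˡ cube-e) (B.trans (J.solve 3 (λ R d T → J.con (+ 2) J.:* R J.:* (J.:- (d J.:* (T J.:* (T J.:* T)))) J.:= J.:- (J.con (+ 2) J.:* R J.:* d) J.:* (T J.:* (T J.:* T))) B.refl (c R) δQ̂ T)
              (B.trans (B.*-congʳ key) (B.trans (J.solve 5 (λ l q ℓ tq T → (J.con (+ 2) J.:* l J.:* q J.:+ J.:- (ℓ J.:* tq)) J.:* (T J.:* (T J.:* T))
                  J.:= J.con (+ 2) J.:* (l J.:* T) J.:* (q J.:* (T J.:* T)) J.:+ ℓ J.:* (J.:- (tq J.:* (T J.:* (T J.:* T))))) B.refl (Y.θ ℓ) Q̂ ℓ θQ̂ T)
              (B.trans (B.+-cong (B.trans (B.*-congˡ QTT) (B.*-identityʳ _)) (B.*-congˡ (B.sym cube-t)))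
              (B.trans (J.solve 4 (λ l ℓ T t → J.con (+ 2) J.:* (l J.:* T) J.:+ ℓ J.:* (t J.:+ t) J.:= (l J.:* T J.:+ ℓ J.:* t) J.:+ (l J.:* T J.:+ ℓ J.:* t)) B.refl (Y.θ ℓ) ℓ T t)
                (B.sym (B.+-cong (Y.θ-* ℓ T) (Y.θ-* ℓ T))))))))))

            -- The moments depend on w only through R and S.
            shifted : ℕ → PS
            shifted k = u * Λ k + R′ * (Λ (suc k) + - (S * Λ k))

            D-Λ : ∀ k → ι (+ 4) * R * D (Λ k) ≋ derive shifted k + derive shifted k
            D-Λ zero = trans (*-congˡ D-1) (trans (zeroʳ _) (sym (+-identityˡ _)))
            D-Λ (suc k) = trans (sym (Y.const-* (ι (+ 4) * R) e (suc k))) (trans (Y.at θℓT (suc k)) (+-cong co co))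
              where
              co : Y.θ (ℓ B.* T) (suc k) ≋ derive shifted (suc k)
              co = *-cong (numeral-const (suc k)) (trans (Y.at (J.solve 5 (λ u R′ S y T → (u J.:* y J.:+ R′ J.:* (J.con (+ 1) J.:+ J.:- (S J.:* y))) J.:* T
                    J.:= u J.:* (y J.:* T) J.:+ R′ J.:* (T J.:+ J.:- (S J.:* (y J.:* T)))) B.refl (c u) (c R′) (c S) y T) (suc k))
                (+-cong (coeff-y u T k) (trans (Y.const-* R′ _ (suc k)) (*-congˡ (+-congˡ (-‿cong (coeff-y S T k)))))))

        module Functional (R₀ : R 0 K.≈ K.0#) (S₀ : S 0 K.≈ K.0#) where

          private
            oΛ : ∀ k → Ord k (Λ k)
            oΛ = ord-Λ R₀ S₀

          ΛS : ∀ j → Summable (λ k → Λ (j ℕ.+ k))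
          ΛS j = summable 0 z≤n (λ k → ord-≤ (ℕP.m≤n+m k j) (oΛ (j ℕ.+ k)))

          L : PS → PS
          L f = ⟨ f , Λ ⟩

          private

            derive-S : ∀ {a} → (∀ k → Ord k (a k)) → Summable (derive a)
            derive-S {a} o zero zero ()
            derive-S {a} o n (suc k) lt = ord-scale (numeral (suc k)) (o k) n (ℕP.≤-trans (s≤s (ℕP.m≤m+n (2 ℕ.* n) 3)) (ℕP.≤-trans (ℕP.≤-reflexive (≡.sym (ℕP.+-suc (2 ℕ.* n) 3))) (ℕP.≤-pred lt)))
            derive-S o (suc n) zero ()

          -- `E₁-zero` summed against the coefficients of f: multiplication of the moments by k is
          -- adjoint to θ, and `derive` is adjoint to the derivative. These are the linear relations
          -- among moments of algebraic functions such as s.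
          L4 : ∀ f → L (θ (X * f)) + - (S * (L (θ f) + L (θ f) + L f)) + P * L (D f) ≋ 0#
          L4 f = trans (sym (+-cong (+-cong e₁ (-‿cong e₂)) e₃)) (trans (sym (trans (pair-+ʳ f (λ k → a₁ k + - a₂ k) a₃) (+-congʳ (trans (pair-+ʳ f a₁ (λ k → - a₂ k)) (+-congˡ (pair-neg f a₂))))))
              (pair-zero f _ E₁-zero))
            where
            a₁ a₂ a₃ νΛ : ℕ → PS
            νΛ k = ν k * Λ k
            a₁ k = ν (suc k) * Λ (suc k)
            a₂ k = S * (νΛ k + νΛ k + Λ k)
            a₃ k = P * derive Λ k
            νΛS : Summable νΛ
            νΛS = summable 0 z≤n (λ k → ord-scale (numeral k) (oΛ k))
            e₁ : ⟨ f , a₁ ⟩ ≋ L (θ (X * f))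
            e₁ = trans (sym (pair-X f νΛ νΛS)) (sym (pair-θ (X * f) Λ))
            e₂ : ⟨ f , a₂ ⟩ ≋ S * (L (θ f) + L (θ f) + L f)
            e₂ = trans (pair-*ʳ S f (λ k → νΛ k + νΛ k + Λ k) (summable 0 z≤n (λ k → ord-+ (ord-+ (ord-scale (numeral k) (oΛ k)) (ord-scale (numeral k) (oΛ k))) (oΛ k))))
              (*-congˡ (trans (pair-+ʳ f (λ k → νΛ k + νΛ k) Λ) (+-congʳ (trans (pair-+ʳ f νΛ νΛ) (+-cong (sym (pair-θ f Λ)) (sym (pair-θ f Λ)))))))
            e₃ : ⟨ f , a₃ ⟩ ≋ P * L (D f)
            e₃ = trans (pair-*ʳ P f (derive Λ) (derive-S oΛ)) (*-congˡ (pair-derive f Λ (derive-S oΛ)))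

          DΛS : Summable (λ k → D (Λ k))
          DΛS = summable 2 (s≤s (s≤s z≤n)) (λ k → ord-D (oΛ k))

          D-L : ∀ f → D (L f) ≋ ⟨ f , (λ k → D (Λ k)) ⟩
          D-L f = sym (pair-D f Λ (ΛS 0) DΛS)

          -- The chain rule summed against f, cleared of its denominator: D L[f] = S′ L[f′] + R′
          -- (L[x f′] - S L[f′]) / (2R).
          L5 : ∀ f → let M = ι (+ 2) * R * D S * L (D f) + D R * (L (X * D f) + - (S * L (D f))) in ι (+ 4) * R * D (L f) ≋ M + M
          L5 f = trans (*-congˡ (D-L f)) (trans (sym (pair-*ʳ (ι (+ 4) * R) f (λ k → D (Λ k)) DΛS))
              (trans (pair-cong {f} {f} refl D-Λ) (trans (pair-+ʳ f (derive shifted) (derive shifted)) (+-cong half half))))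
            where
            osh : ∀ k → Ord k (shifted k)
            osh k = ord-+ (ord-* 0 k {ι (+ 2) * R * D S} (λ _ ()) (oΛ k)) (ord-* 0 k {D R} (λ _ ()) (ord-+ (ord-≤ (ℕP.n≤1+n k) (oΛ (suc k))) (ord-neg (ord-* 0 k {S} (λ _ ()) (oΛ k)))))
            half : ⟨ f , derive shifted ⟩ ≋ ι (+ 2) * R * D S * L (D f) + D R * (L (X * D f) + - (S * L (D f)))
            half = trans (pair-derive f shifted (derive-S osh)) (trans (pair-+ʳ (D f) (λ k → ι (+ 2) * R * D S * Λ k) (λ k → D R * (Λ (suc k) + - (S * Λ k))))
              (+-cong (pair-*ʳ (ι (+ 2) * R * D S) (D f) Λ (ΛS 0))
                (trans (pair-*ʳ (D R) (D f) (λ k → Λ (suc k) + - (S * Λ k)) (summable 0 z≤n (λ k → ord-+ (ord-≤ (ℕP.n≤1+n k) (oΛ (suc k))) (ord-neg (ord-* 0 k {S} (λ _ ()) (oΛ k))))))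
                  (*-congˡ (trans (pair-+ʳ (D f) (λ k → Λ (suc k)) (λ k → - (S * Λ k))) (+-cong (sym (pair-X (D f) Λ (ΛS 0)))
                    (trans (pair-neg (D f) (λ k → S * Λ k)) (-‿cong (pair-*ʳ S (D f) Λ (ΛS 0))))))))))

          private
            double-zero : ∀ {f} → f + f ≋ 0# → f ≋ 0#
            double-zero {f} e = coeffs λ n → cancel-numeral 1 (K.trans (IK.solve 1 (λ x → IK.con (+ 2) IK.:* x IK.:= x IK.:+ x) K.refl (f n)) (K.trans (at e n) (K.sym (K.zeroʳ _))))

            -- The operator T ↦ (δQ̂) T + 2 Q̂ δT, with e in the place of δT. It annihilates Λ =
            -- Q̂^(-1/2).
            Z : Y.PS → Y.PS → Y.PS
            Z T e = δQ̂ B.* T B.+ (Q̂ B.* e B.+ Q̂ B.* e)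

            rel : (ℕ → PS) → (ℕ → PS) → ℕ → PS
            rel T e n = e (suc (suc n)) + e (suc (suc n)) + - (D S * (T (suc n) + T (suc n))) + D P * T n
              + - (S * (e (suc n) + e (suc n) + (e (suc n) + e (suc n)))) + P * (e n + e n)

            Z-expand : ∀ T e → Z T e Y.≋ (e B.+ e) B.+ B.- (c (D S) B.* (y B.* (T B.+ T))) B.+ c (D P) B.* (y B.* (y B.* T))
              B.+ B.- (c S B.* (y B.* (e B.+ e B.+ (e B.+ e)))) B.+ c P B.* (y B.* (y B.* (e B.+ e)))
            Z-expand T e = J.solve 7 (λ y S P S′ P′ T e → (J.:- (S′ J.:* (y J.:+ y)) J.:+ P′ J.:* (y J.:* y)) J.:* T
                J.:+ ((J.con (+ 1) J.:+ J.:- (S J.:* (y J.:+ y)) J.:+ P J.:* (y J.:* y)) J.:* e J.:+ (J.con (+ 1) J.:+ J.:- (S J.:* (y J.:+ y)) J.:+ P J.:* (y J.:* y)) J.:* e)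
                J.:= (e J.:+ e) J.:+ J.:- (S′ J.:* (y J.:* (T J.:+ T))) J.:+ P′ J.:* (y J.:* (y J.:* T)) J.:+ J.:- (S J.:* (y J.:* (e J.:+ e J.:+ (e J.:+ e)))) J.:+ P J.:* (y J.:* (y J.:* (e J.:+ e))))
              B.refl y (c S) (c P) (c (D S)) (c (D P)) T e

            Z-coeff : ∀ T e n → Z T e (suc (suc n)) ≋ rel T e n
            Z-coeff T e n = trans (Y.at (Z-expand T e) (suc (suc n))) (+-cong (+-cong (+-cong (+-cong refl (-‿cong (coeff-y (D S) (T B.+ T) (suc n)))) (coeff-yy (D P) T n))
              (-‿cong (coeff-y S (e B.+ e B.+ (e B.+ e)) (suc n)))) (coeff-yy P (e B.+ e) n))

            Z-coeff₁ : ∀ T e → Z T e 1 ≋ e 1 + e 1 + - (D S * (T 0 + T 0)) + - (S * (e 0 + e 0 + (e 0 + e 0)))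
            Z-coeff₁ T e = trans (Y.at (Z-expand T e) 1) (trans (+-cong (+-cong (+-cong (+-cong refl (-‿cong (coeff-y (D S) (T B.+ T) 0))) (coeff-yy₁ (D P) T))
              (-‿cong (coeff-y S (e B.+ e B.+ (e B.+ e)) 0))) (coeff-yy₁ P (e B.+ e)))
              (solve 3 (λ a b c → a :+ b :+ con (+ 0) :+ c :+ con (+ 0) := a :+ b :+ c) refl (e 1 + e 1) (- (D S * (T 0 + T 0))) (- (S * (e 0 + e 0 + (e 0 + e 0))))))

            Z-coeff₀ : ∀ T e → Z T e 0 ≋ e 0 + e 0
            Z-coeff₀ T e = trans (Y.at (Z-expand T e) 0) (trans (+-cong (+-cong (+-cong (+-cong refl (-‿cong (coeff-y₀ (D S) (T B.+ T)))) (coeff-y₀ (D P) (y B.* T)))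
              (-‿cong (coeff-y₀ S (e B.+ e B.+ (e B.+ e))))) (coeff-y₀ P (y B.* (e B.+ e))))
              (solve 1 (λ a → a :+ :- con (+ 0) :+ con (+ 0) :+ :- con (+ 0) :+ con (+ 0) := a) refl (e 0 + e 0)))

            -- The coefficient of yᵏ expresses D (T k) by the two preceding coefficients and their
            -- derivatives. Together with T k = 0 at w = 0 this makes all coefficients vanish in
            -- turn.
            Z-zero : ∀ T → (∀ k → T k 0 K.≈ K.0#) → Z T (δ T) Y.≋ B.0# → ∀ k → T k ≋ 0#
            Z-zero T T₀ e k = proj₁ (go k)
              where
              from-D : ∀ k → D (T k) + D (T k) ≋ 0# → T k ≋ 0#
              from-D k p = D-injective (T₀ k) (trans (double-zero p) (sym D-zero))
              D-0 : ∀ {f} → f ≋ 0# → D f ≋ 0#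
              D-0 p = trans (D-cong p) D-zero
              go : ∀ k → T k ≋ 0# × T (suc k) ≋ 0#
              go zero = z , from-D 1 (trans (sym (trans (+-cong (+-congˡ (-‿cong (*-congˡ (+-cong z z)))) (-‿cong (*-congˡ (+-cong (+-cong (D-0 z) (D-0 z)) (+-cong (D-0 z) (D-0 z))))))
                  (solve 3 (λ a s t → a :+ :- (s :* (con (+ 0) :+ con (+ 0))) :+ :- (t :* (con (+ 0) :+ con (+ 0) :+ (con (+ 0) :+ con (+ 0)))) := a) refl (D (T 1) + D (T 1)) (D S) S)))
                  (trans (sym (Z-coeff₁ T (δ T))) (Y.at e 1)))
                where
                z : T 0 ≋ 0#
                z = from-D 0 (trans (sym (Z-coeff₀ T (δ T))) (Y.at e 0))
              go (suc k) with go k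
              ... | p , q = q , from-D (suc (suc k)) (trans (sym (trans (+-cong (+-cong (+-cong (+-congˡ (-‿cong (*-congˡ (+-cong q q)))) (*-congˡ p))
                    (-‿cong (*-congˡ (+-cong (+-cong (D-0 q) (D-0 q)) (+-cong (D-0 q) (D-0 q)))))) (*-congˡ (+-cong (D-0 p) (D-0 p))))
                  (solve 5 (λ a s d t p → a :+ :- (s :* (con (+ 0) :+ con (+ 0))) :+ d :* con (+ 0) :+ :- (t :* (con (+ 0) :+ con (+ 0) :+ (con (+ 0) :+ con (+ 0)))) :+ p :* (con (+ 0) :+ con (+ 0)) := a)
                    refl (D (T (suc (suc k))) + D (T (suc (suc k)))) (D S) (D P) S P)))
                  (trans (sym (Z-coeff T (δ T) k)) (Y.at e (suc (suc k)))))

          N : ℕ → PS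
          N k = ∫ (Λ k)

          ord-N : ∀ k → Ord (k ℕ.+ 2) (N k)
          ord-N k zero lt = K.refl
          ord-N k (suc n) lt = K.trans (K.*-congˡ (oΛ k n (ℕP.≤-pred (ℕP.≤-pred (≡.subst₂ _<_ (≡.cong suc (ℕP.+-suc n (n ℕ.+ 0))) (ℕP.+-comm k 2) lt))))) (K.zeroʳ _)

          NS : ∀ j → Summable (λ k → N (j ℕ.+ k))
          NS j = summable 0 z≤n (λ k → ord-≤ (ℕP.≤-trans (ℕP.m≤n+m k j) (ℕP.m≤m+n (j ℕ.+ k) 2)) (ord-N (j ℕ.+ k)))

          N-zero : N 0 ≋ X
          N-zero = D-injective K.refl (trans (D-∫ 1#) (sym D-X))

          private
            conv-ord : ∀ j (f g : Y.PS) → (∀ k → Ord j (f k)) → ∀ k → Ord j (Y.conv f g k)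
            conv-ord j f g o zero = ord-cong (*-comm (g 0) (f 0)) (ord-* 0 j {g 0} (λ _ ()) (o 0))
            conv-ord j f g o (suc k) = ord-+ (ord-cong (*-comm (g (suc k)) (f 0)) (ord-* 0 j {g (suc k)} (λ _ ()) (o 0))) (conv-ord j (Y.tl f) g (λ k → o (suc k)) k)

            N₁ : ∀ k → Ord 1 (N k)
            N₁ k = ord-≤ (ℕP.≤-trans (s≤s z≤n) (ℕP.m≤n+m 2 k)) (ord-N k)

          module Saddle (V : PS) (V₀ : V 0 K.≈ K.0#) (saddle₀ : L V ≋ 0#) (saddle₁ : L (X * V) ≋ ι (+ 2) * X) where

            private
              𝒜 C : Y.PS
              𝒜 k = L (xpow k V)
              C = y B.* (N B.* Λ) B.+ y B.* (N B.* Λ)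

              V-zero : ∀ k j → j < suc k → xpow k V j K.≈ K.0#
              V-zero k j lt = xpow-zero k V 1 (λ { zero (s≤s z≤n) → V₀ }) j (≡.subst (j <_) (ℕP.+-comm 1 k) lt)

              𝒜-at : ∀ k → 𝒜 k ≋ ⟨ V , (λ j → Λ (k ℕ.+ j)) ⟩
              𝒜-at k = pair-xpow k V Λ ΛS

              D𝒜-at : ∀ k → D (𝒜 k) ≋ ⟨ V , (λ j → D (Λ (k ℕ.+ j))) ⟩
              D𝒜-at k = trans (D-cong (𝒜-at k)) (sym (pair-D V (λ j → Λ (k ℕ.+ j)) (ΛS k)
                (summable 2 (s≤s (s≤s z≤n)) (λ j → ord-D (ord-≤ (ℕP.m≤n+m j k) (oΛ (k ℕ.+ j)))))))

              pair-rel : ∀ f (T e : ℕ → ℕ → PS) → (∀ k → Summable (T k)) → (∀ k → Summable (e k)) → ∀ n →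
                rel (λ k → ⟨ f , T k ⟩) (λ k → ⟨ f , e k ⟩) n ≋ ⟨ f , (λ j → rel (λ k → T k j) (λ k → e k j) n) ⟩
              pair-rel f T e sT se n = sym (trans (pair-+ʳ f t₄ (λ j → P * (e n j + e n j))) (+-cong (trans (pair-+ʳ f t₃ (λ j → - (S * (e₁ j + e₁ j + (e₁ j + e₁ j)))))
                  (+-cong (trans (pair-+ʳ f t₂ (λ j → D P * T n j)) (+-cong (trans (pair-+ʳ f t₁ (λ j → - (D S * (T (suc n) j + T (suc n) j))))
                    (+-cong (pair-+ʳ f e₂ e₂) (trans (pair-neg f (λ j → D S * (T (suc n) j + T (suc n) j))) (-‿cong (trans (pair-*ʳ (D S) f (λ j → T (suc n) j + T (suc n) j) (s-+ (sT (suc n)) (sT (suc n)))) (*-congˡ (pair-+ʳ f (T (suc n)) (T (suc n)))))))))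
                    (pair-*ʳ (D P) f (T n) (sT n))))
                  (trans (pair-neg f (λ j → S * (e₁ j + e₁ j + (e₁ j + e₁ j)))) (-‿cong (trans (pair-*ʳ S f (λ j → e₁ j + e₁ j + (e₁ j + e₁ j)) (s-+ (s-+ (se (suc n)) (se (suc n))) (s-+ (se (suc n)) (se (suc n)))))
                    (*-congˡ (trans (pair-+ʳ f (λ j → e₁ j + e₁ j) (λ j → e₁ j + e₁ j)) (+-cong (pair-+ʳ f e₁ e₁) (pair-+ʳ f e₁ e₁)))))))))
                  (trans (pair-*ʳ P f (λ j → e n j + e n j) (s-+ (se n) (se n))) (*-congˡ (pair-+ʳ f (e n) (e n))))))
                where
                e₁ e₂ t₁ t₂ t₃ t₄ : ℕ → PS
                e₁ = e (suc n)
                e₂ = e (suc (suc n))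
                t₁ j = e₂ j + e₂ j
                t₂ j = t₁ j + - (D S * (T (suc n) j + T (suc n) j))
                t₃ j = t₂ j + D P * T n j
                t₄ j = t₃ j + - (S * (e₁ j + e₁ j + (e₁ j + e₁ j)))
                s-+ : ∀ {a b} → Summable a → Summable b → Summable (λ j → a j + b j)
                s-+ sa sb n k lt = K.trans (K.+-cong (sa n k lt) (sb n k lt)) (K.+-identityˡ _)

              rel-Λ : ∀ n → rel Λ (λ k → D (Λ k)) n ≋ 0#
              rel-Λ n = trans (sym (Z-coeff Λ (δ Λ) n)) (Y.at δT (suc (suc n)))

              rel-cong : ∀ {T e T′ e′} → (∀ k → T k ≋ T′ k) → (∀ k → e k ≋ e′ k) → ∀ n → rel T e n ≋ rel T′ e′ n
              rel-cong p q n = +-cong (+-cong (+-cong (+-cong (+-cong (q _) (q _)) (-‿cong (*-congˡ (+-cong (p _) (p _))))) (*-congˡ (p n)))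
                (-‿cong (*-congˡ (+-cong (+-cong (q _) (q _)) (+-cong (q _) (q _)))))) (*-congˡ (+-cong (q n) (q n)))

              -- From y² on, the coefficients pair V with the recurrence `rel-Λ` and so vanish. The
              -- first two are given by the saddle point equations: L[V] = 0, and L[xV] = 2w has
              -- derivative 2, which produces 4y.
              Z-𝒜 : Z 𝒜 (δ 𝒜) Y.≋ J.ι (+ 4) B.* y
              Z-𝒜 = Y.coeffs go
                where
                rhs : ∀ n → (J.ι (+ 4) B.* y) n ≋ ι (+ 4) * y n
                rhs n = trans (Y.at (B.*-congʳ (Y.numeral-const 4)) n) (Y.const-* (ι (+ 4)) y n)
                D0 : D (𝒜 0) ≋ 0#
                D0 = trans (D-cong saddle₀) D-zero
                D1 : D (𝒜 1) ≋ ι (+ 2)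
                D1 = trans (D-cong saddle₁) (trans (D-* (ι (+ 2)) X) (trans (+-cong (trans (*-congʳ (trans (D-cong (numeral-const 2)) (D-const (numeral 2)))) (zeroˡ X)) (trans (*-congˡ D-X) (*-identityʳ _))) (+-identityˡ _)))
                go : Y.Pointwise (Z 𝒜 (δ 𝒜)) (J.ι (+ 4) B.* y)
                go zero = trans (Z-coeff₀ 𝒜 (δ 𝒜)) (trans (+-cong D0 D0) (trans (+-identityˡ 0#) (sym (trans (rhs 0) (zeroʳ _)))))
                go (suc zero) = trans (Z-coeff₁ 𝒜 (δ 𝒜)) (trans (+-cong (+-cong (+-cong D1 D1) (-‿cong (*-congˡ (+-cong saddle₀ saddle₀)))) (-‿cong (*-congˡ (+-cong (+-cong D0 D0) (+-cong D0 D0)))))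
                  (trans (solve 2 (λ s t → con (+ 2) :+ con (+ 2) :+ :- (s :* (con (+ 0) :+ con (+ 0))) :+ :- (t :* (con (+ 0) :+ con (+ 0) :+ (con (+ 0) :+ con (+ 0)))) := con (+ 4) :* con (+ 1)) refl (D S) S) (sym (rhs 1))))
                go (suc (suc n)) = trans (Z-coeff 𝒜 (δ 𝒜) n) (trans (rel-cong 𝒜-at D𝒜-at n)
                  (trans (pair-rel V (λ k j → Λ (k ℕ.+ j)) (λ k j → D (Λ (k ℕ.+ j))) ΛS (λ k → summable 2 (s≤s (s≤s z≤n)) (λ j → ord-D (ord-≤ (ℕP.m≤n+m j k) (oΛ (k ℕ.+ j))))) n)
                  (trans (pair-zero V _ (λ j → rel-Λ (n ℕ.+ j))) (sym (trans (rhs (suc (suc n))) (zeroʳ _))))))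

              δN : δ N Y.≋ Λ
              δN = Y.coeffs λ k → D-∫ (Λ k)

              δC : δ C Y.≋ y B.* (Λ B.* Λ B.+ N B.* δ Λ) B.+ y B.* (Λ B.* Λ B.+ N B.* δ Λ)
              δC = B.trans (δ-+ (y B.* (N B.* Λ)) (y B.* (N B.* Λ))) (B.+-cong half half)
                where
                half : δ (y B.* (N B.* Λ)) Y.≋ y B.* (Λ B.* Λ B.+ N B.* δ Λ)
                half = B.trans (δ-* y (N B.* Λ)) (B.trans (B.+-cong (B.trans (B.*-congʳ δ-y) (B.zeroˡ _)) (B.*-congˡ (B.trans (δ-* N Λ) (B.+-congʳ (B.*-congʳ δN))))) (B.+-identityˡ _))

              -- As Z is of first order, Z(2yNΛ) = 2yN Z(Λ) + 4y Q̂ Λ δN. Here Z(Λ) = 0, and δN = Λ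
              -- turns the second term into 4y Q̂Λ² = 4y. So C solves the same problem as `𝒜`.
              Z-C : Z C (δ C) Y.≋ J.ι (+ 4) B.* y
              Z-C = B.trans (B.+-congˡ (B.+-cong (B.*-congˡ δC) (B.*-congˡ δC)))
                (B.trans (J.solve 6 (λ d q y N T e → d J.:* (y J.:* (N J.:* T) J.:+ y J.:* (N J.:* T))
                    J.:+ (q J.:* (y J.:* (T J.:* T J.:+ N J.:* e) J.:+ y J.:* (T J.:* T J.:+ N J.:* e)) J.:+ q J.:* (y J.:* (T J.:* T J.:+ N J.:* e) J.:+ y J.:* (T J.:* T J.:+ N J.:* e)))
                    J.:= (y J.:* N J.:+ y J.:* N) J.:* (d J.:* T J.:+ (q J.:* e J.:+ q J.:* e)) J.:+ (J.con (+ 4) J.:* y) J.:* (q J.:* (T J.:* T))) B.refl δQ̂ Q̂ y N Λ (δ Λ))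
                (B.trans (B.+-cong (B.trans (B.*-congˡ δT) (B.zeroʳ _)) (B.trans (B.*-congˡ QTT) (B.*-identityʳ _))) (B.+-identityˡ _)))

              𝒜≋C : ∀ k → 𝒜 k ≋ C k
              𝒜≋C k = trans (solve 2 (λ a c → a := a :+ :- c :+ c) refl (𝒜 k) (C k)) (trans (+-congʳ (Z-zero (𝒜 B.+ B.- C) Δ₀ ZΔ k)) (+-identityˡ _))
                where
                C₀ : ∀ k → C k 0 K.≈ K.0#
                C₀ zero = K.trans (K.+-cong (at (Y.X-*₀ (N B.* Λ)) 0) (at (Y.X-*₀ (N B.* Λ)) 0)) (K.+-identityˡ _)
                C₀ (suc k) = K.trans (K.+-cong h h) (K.+-identityˡ _)
                  where
                  h = K.trans (at (Y.X-* (N B.* Λ) k) 0) (conv-ord 1 N Λ N₁ k 0 (s≤s z≤n))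
                Δ₀ : ∀ k → (𝒜 B.+ B.- C) k 0 K.≈ K.0#
                Δ₀ k = K.trans (K.+-cong (pair-ord (suc k) 0 (V-zero k) (λ j → ord-≤ (ℕP.≤-reflexive (ℕP.+-identityʳ j)) (oΛ j)) 0 (s≤s z≤n)) (K.-‿cong (C₀ k))) (K.-‿inverseʳ K.0#)
                ZΔ : Z (𝒜 B.+ B.- C) (δ (𝒜 B.+ B.- C)) Y.≋ B.0#
                ZΔ = B.trans (B.+-congˡ (B.+-cong (B.*-congˡ dΔ) (B.*-congˡ dΔ)))
                  (B.trans (J.solve 6 (λ d q a c a′ c′ → d J.:* (a J.:+ J.:- c) J.:+ (q J.:* (a′ J.:+ J.:- c′) J.:+ q J.:* (a′ J.:+ J.:- c′))
                      J.:= (d J.:* a J.:+ (q J.:* a′ J.:+ q J.:* a′)) J.:+ J.:- (d J.:* c J.:+ (q J.:* c′ J.:+ q J.:* c′))) B.refl δQ̂ Q̂ 𝒜 C (δ 𝒜) (δ C))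
                  (B.trans (B.+-cong Z-𝒜 (B.-‿cong Z-C)) (B.-‿inverseʳ _)))
                  where
                  dΔ : δ (𝒜 B.+ B.- C) Y.≋ δ 𝒜 B.+ B.- δ C
                  dΔ = B.trans (δ-+ 𝒜 (B.- C)) (B.+-congˡ (δ-neg C))

              pair-V : ℕ → PS
              pair-V m = ⟨ xpow m V , N ⟩

              D-pair-V : ∀ m → D (pair-V m) ≋ 𝒜 m
              D-pair-V m = trans (sym (pair-D (xpow m V) N (NS 0) (λ n k lt → K.trans (at (D-∫ (Λ k)) n) (ΛS 0 n k lt)))) (pair-cong {xpow m V} refl (λ k → D-∫ (Λ k)))

              pair-V₀ : ∀ m → pair-V m 0 K.≈ K.0#
              pair-V₀ m = pair-ord (suc m) 0 (V-zero m) (λ j → ord-≤ (ℕP.≤-trans (ℕP.≤-reflexive (ℕP.+-identityʳ j)) (ℕP.m≤m+n j 2)) (ord-N j)) 0 (s≤s z≤n)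

            loop₀ : ⟨ V , N ⟩ ≋ 0#
            loop₀ = D-injective (pair-V₀ 0) (trans (D-pair-V 0) (trans saddle₀ (sym D-zero)))

            -- Both sides vanish at w = 0. Their derivatives are L[x^(m+1) V] and 2 Σ Nᵢ Λₘ₋ᵢ, which
            -- agree by `𝒜≋C`.
            loop : ∀ m → ⟨ xpow (suc m) V , N ⟩ ≋ Y.conv N N m
            loop m = D-injective (K.trans (pair-V₀ (suc m)) (K.sym (conv-ord 1 N N N₁ m 0 (s≤s z≤n))))
              (trans (D-pair-V (suc m)) (trans (𝒜≋C (suc m)) (trans (+-cong (Y.X-* (N B.* Λ) m) (Y.X-* (N B.* Λ) m))
                (sym (trans (Y.at (δ-* N N) m) (trans (+-cong (Y.at (B.*-congʳ δN) m) (Y.at (B.*-congˡ δN) m)) (+-congʳ (Y.at (B.*-comm Λ N) m))))))))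

    -- A value of β: its inverse occurs in W, and 1 + β is the leading factor to be cancelled for
    -- uniqueness.
    record Parameter : Set where
      field
        b b⁻¹ : K.Carrier
        b-unit : b K.* b⁻¹ K.≈ K.1#
        cancel : ∀ {x} → (b K.+ K.1#) K.* x K.≈ K.0# → x K.≈ K.0#

    module Point (parameter : Parameter) where
      open Parameter parameter

      -- Binary trees, the saddle point solution, and the series of forested maps.

      module Forests where
        open Pairing
        open Moments
        open A
        open I

        -- s = √(1 − 4x), and c = (1 − s)/2 is the generating function of binary trees.
        s : PS
        s zero = K.1#
        s (suc n) = inv n K.* ((IK.ι (+ 4) K.* numeral n K.+ K.- IK.ι (+ 2)) K.* s n)

        s-ode : D s ≋ ι (+ 4) * θ s + - (ι (+ 2) * s)
        s-ode = coeffs λ n → K.trans (numeral-inv n _) (K.trans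
          (IK.solve 2 (λ k x → (IK.con (+ 4) IK.:* k IK.:+ IK.:- IK.con (+ 2)) IK.:* x IK.:= IK.con (+ 4) IK.:* (k IK.:* x) IK.:+ IK.:- (IK.con (+ 2) IK.:* x)) K.refl (numeral n) (s n))
          (K.sym (K.+-cong (scaled 4 (θ s) n) (K.-‿cong (scaled 2 s n)))))
          where
          scaled : ∀ k f n → (ι (+ k) * f) n K.≈ numeral k K.* f n
          scaled k f n = K.trans (at (*-congʳ (numeral-const k)) n) (const-* (numeral k) f n)

        -- From (1 - 4x) s′ = -2s, the difference v of the two sides satisfies v′ = 4xv′ - 4v with v
        -- = 0 at x = 0. This determines its coefficients recursively as 0.
        s² : s * s ≋ 1# + - (ι (+ 4) * X)
        s² = trans (solve 2 (λ a c → a := a :+ :- c :+ c) refl (s * s) (1# + - (ι (+ 4) * X))) (trans (+-congʳ v≋0) (+-identityˡ _))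
          where
          v : PS
          v = s * s + - (1# + - (ι (+ 4) * X))
          D-ι : ∀ n f → D (ι (+ n) * f) ≋ ι (+ n) * D f
          D-ι n f = trans (D-* (ι (+ n)) f) (trans (+-congʳ (trans (*-congʳ (trans (D-cong (numeral-const n)) (D-const (numeral n)))) (zeroˡ f))) (+-identityˡ _))
          Dv : D v ≋ D s * s + s * D s + ι (+ 4)
          Dv = trans (D-+ (s * s) (- (1# + - (ι (+ 4) * X)))) (+-cong (D-* s s) (trans (D-neg (1# + - (ι (+ 4) * X))) (trans (-‿cong (trans (D-+ 1# (- (ι (+ 4) * X)))
            (+-cong (D-const K.1#) (trans (D-neg (ι (+ 4) * X)) (-‿cong (trans (D-ι 4 X) (*-congˡ D-X))))))) (solve 0 (:- (con (+ 0) :+ :- (con (+ 4) :* con (+ 1))) := con (+ 4)) refl))))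
          θv : θ v ≋ X * (D s * s + s * D s + ι (+ 4))
          θv = trans (θ-D v) (*-congˡ Dv)
          v-ode : D v ≋ ι (+ 4) * θ v + - (ι (+ 4) * v)
          v-ode = trans Dv (trans (+-congʳ (+-cong (*-congʳ ode) (*-congˡ ode)))
            (trans (solve 3 (λ s x d → (con (+ 4) :* (x :* d) :+ :- (con (+ 2) :* s)) :* s :+ s :* (con (+ 4) :* (x :* d) :+ :- (con (+ 2) :* s)) :+ con (+ 4)
                := con (+ 4) :* (x :* (d :* s :+ s :* d :+ con (+ 4))) :+ :- (con (+ 4) :* (s :* s :+ :- (con (+ 1) :+ :- (con (+ 4) :* x))))) refl s X (D s))
              (+-congʳ (*-congˡ (sym θv)))))
            where
            ode : D s ≋ ι (+ 4) * (X * D s) + - (ι (+ 2) * s)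
            ode = trans s-ode (+-congʳ (*-congˡ (θ-D s)))
          scaled : ∀ k f n → (ι (+ k) * f) n K.≈ numeral k K.* f n
          scaled k f n = K.trans (at (*-congʳ (numeral-const k)) n) (const-* (numeral k) f n)
          go : ∀ n → v n K.≈ K.0#
          go zero = K.trans (K.+-congˡ (K.-‿cong (K.+-congˡ (K.-‿cong (K.trans (at (*-comm (ι (+ 4)) X) 0) (X-*₀ (ι (+ 4))))))))
            (IK.solve 0 (IK.con (+ 1) IK.:* IK.con (+ 1) IK.:+ IK.:- (IK.con (+ 1) IK.:+ IK.:- IK.con (+ 0)) IK.:= IK.con (+ 0)) K.refl)
          go (suc n) = cancel-numeral n (K.trans (at v-ode n) (K.trans (K.+-cong (K.trans (scaled 4 (θ v) n) (K.*-congˡ (K.*-congˡ (go n)))) (K.-‿cong (K.trans (scaled 4 v n) (K.*-congˡ (go n)))))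
            (IK.solve 2 (λ k m → IK.con (+ 4) IK.:* (k IK.:* IK.con (+ 0)) IK.:+ IK.:- (IK.con (+ 4) IK.:* IK.con (+ 0)) IK.:= m IK.:* IK.con (+ 0)) K.refl (numeral n) (numeral (suc n)))))
          v≋0 : v ≋ 0#
          v≋0 = coeffs go

        h : PS
        h = const (inv 1)

        2h : ι (+ 2) * h ≋ 1#
        2h = trans (*-congʳ (numeral-const 2)) (trans (sym (const-mul (numeral 2) (inv 1))) (const-cong (K.trans (K.*-comm _ _) (inv-law 1))))

        c : PS
        c = h * (1# + - s)

        c-eq : c ≋ c * c + X
        c-eq = sym (trans (solve 3 (λ h s x → h :* (con (+ 1) :+ :- s) :* (h :* (con (+ 1) :+ :- s)) :+ x := h :* h :* (con (+ 1) :+ :- (con (+ 2) :* s) :+ s :* s) :+ x) refl h s X)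
          (trans (+-congʳ (*-congˡ (+-congˡ s²)))
          (trans (solve 3 (λ h s x → h :* h :* (con (+ 1) :+ :- (con (+ 2) :* s) :+ (con (+ 1) :+ :- (con (+ 4) :* x))) :+ x
              := (con (+ 2) :* h) :* (h :* (con (+ 1) :+ :- s)) :+ :- ((con (+ 2) :* h) :* (con (+ 2) :* h) :* x) :+ x) refl h s X)
          (trans (+-congʳ (+-cong (*-congʳ 2h) (-‿cong (*-congʳ (*-cong 2h 2h)))))
            (solve 2 (λ c x → con (+ 1) :* c :+ :- (con (+ 1) :* con (+ 1) :* x) :+ x := c) refl c X)))))

        c₀ : c 0 K.≈ K.0#
        c₀ = K.trans (K.*-congˡ (K.-‿inverseʳ K.1#)) (K.zeroʳ _)

        cpow : ℕ → PS
        cpow zero = 1#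
        cpow (suc p) = c * cpow p

        cpow-zero : ∀ p j → j < p → cpow p j K.≈ K.0#
        cpow-zero (suc p) zero _ = K.trans (K.*-congʳ c₀) (K.zeroˡ _)
        cpow-zero (suc p) (suc j) (s≤s lt) = K.trans (at (trans (*-congʳ (X-tl {c} c₀)) (*-assoc X (tl c) (cpow p))) (suc j)) (K.trans (X-* (tl c * cpow p) j) (small j (tl c) lt))
          where
          small : ∀ j f → j < p → conv f (cpow p) j K.≈ K.0#
          small zero f lt = K.trans (K.*-congˡ (cpow-zero p 0 lt)) (K.zeroʳ _)
          small (suc j) f lt = K.trans (K.+-cong (K.trans (K.*-congˡ (cpow-zero p (suc j) lt)) (K.zeroʳ _)) (small j (tl f) (ℕP.<-trans (ℕP.n<1+n j) lt))) (K.+-identityˡ _)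

        γ V : PS
        γ = cpow 2
        V = X + - (const b * γ)

        V₀ : V 0 K.≈ K.0#
        V₀ = K.trans (K.+-congˡ (K.-‿cong (K.trans (const-* b γ 0) (K.trans (K.*-congˡ (cpow-zero 2 0 (s≤s z≤n))) (K.zeroʳ b))))) (K.-‿inverseʳ K.0#)

        private
          moment : PS → PS → ℕ → PS
          moment R S = Family.Λ R S

          ≈-trans : ∀ {n f g h} → f ≈[ n ] g → g ≈[ n ] h → f ≈[ n ] h
          ≈-trans p q m le = K.trans (p m le) (q m le)

          ≈-+ : ∀ {n f f′ g g′} → f ≈[ n ] f′ → g ≈[ n ] g′ → (f + g) ≈[ n ] (f′ + g′)
          ≈-+ p q m le = K.+-cong (p m le) (q m le)

          ≈-neg : ∀ {n f f′} → f ≈[ n ] f′ → (- f) ≈[ n ] (- f′)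
          ≈-neg p m le = K.-‿cong (p m le)

          ≈-scale : ∀ {n f f′} u → f ≈[ n ] f′ → (u * f) ≈[ n ] (u * f′)
          ≈-scale {n} {f} {f′} u p = conv-≈ n {u} {u} {f} {f′} (λ _ _ → K.refl) p

          ≋⇒≈ : ∀ {n f g} → f ≋ g → f ≈[ n ] g
          ≋⇒≈ p m _ = at p m

          pair-≈ : ∀ {f a a′} n m → (∀ j → j < m → f j K.≈ K.0#) → (∀ j → m ≤ j → a j ≈[ n ] a′ j) → ⟨ f , a ⟩ ≈[ n ] ⟨ f , a′ ⟩
          pair-≈ {f} {a} {a′} n m f₀ e i i≤n = go (bound i)
            where
            go : ∀ N → partial N f a i K.≈ partial N f a′ i
            go zero = K.refl
            go (suc N) = K.+-cong (go N) (K.trans (term f a N i) (K.trans each (K.sym (term f a′ N i))))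
              where
              each : f N K.* a N i K.≈ f N K.* a′ N i
              each with N ℕ.<? m
              ... | yes N<m = K.trans (K.trans (K.*-congʳ (f₀ N N<m)) (K.zeroˡ _)) (K.sym (K.trans (K.*-congʳ (f₀ N N<m)) (K.zeroˡ _)))
              ... | no N≮m = K.*-congˡ (e N (ℕP.≮⇒≥ N≮m) i i≤n)

        module Agree {R S R′ S′ : PS} (R₀ : R 0 K.≈ K.0#) (S₀ : S 0 K.≈ K.0#) (R′₀ : R′ 0 K.≈ K.0#) (S′₀ : S′ 0 K.≈ K.0#)
          (n : ℕ) (eR : R ≈[ n ] R′) (eS : S ≈[ n ] S′) where
          private
            P P′ : PS
            P = Family.P R S
            P′ = Family.P R′ S′
            eP : P ≈[ n ] P′
            eP = ≈-+ {n} {S * S} {S′ * S′} (conv-≈ n eS eS) (≈-neg {n} {ι (+ 4) * R} {ι (+ 4) * R′} (≈-scale {n} {R} {R′} (ι (+ 4)) eR))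
            zero-Λ : ∀ R S → R 0 K.≈ K.0# → S 0 K.≈ K.0# → ∀ k → moment R S (suc k) 0 K.≈ K.0#
            zero-Λ R S R₀ S₀ k = Family.ord-Λ R S R₀ S₀ (suc k) 0 (s≤s z≤n)

            step : ∀ m k {f f′ g g′} → f ≈[ m ] f′ → g ≈[ m ] g′ →
              (const (inv (suc k)) * ((ι (+ 2) * ν k + ι (+ 3)) * f + - ((ν k + 1#) * g))) ≈[ m ] (const (inv (suc k)) * ((ι (+ 2) * ν k + ι (+ 3)) * f′ + - ((ν k + 1#) * g′)))
            step m k {f} {f′} {g} {g′} p q = ≈-scale {m} (const (inv (suc k))) (≈-+ {m} {(ι (+ 2) * ν k + ι (+ 3)) * f} (≈-scale {m} {f} {f′} (ι (+ 2) * ν k + ι (+ 3)) p)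
              (≈-neg {m} {(ν k + 1#) * g} (≈-scale {m} {g} {g′} (ν k + 1#) q)))

            regroup : ∀ R S k → moment R S (suc (suc k)) ≋ const (inv (suc k)) * ((ι (+ 2) * ν k + ι (+ 3)) * (S * moment R S (suc k)) + - ((ν k + 1#) * (Family.P R S * moment R S k)))
            regroup R S k = *-congˡ (+-cong (*-assoc _ _ _) (-‿cong (*-assoc _ _ _)))

            via : ∀ m k → (S * moment R S (suc k)) ≈[ m ] (S′ * moment R′ S′ (suc k)) → (P * moment R S k) ≈[ m ] (P′ * moment R′ S′ k) →
              moment R S (suc (suc k)) ≈[ m ] moment R′ S′ (suc (suc k))
            via m k p q = ≈-trans {m} {moment R S (suc (suc k))} (≋⇒≈ {m} (regroup R S k)) (≈-trans {m} (step m k p q) (≋⇒≈ {m} (sym (regroup R′ S′ k))))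

          Λ-≈ : ∀ k → moment R S k ≈[ n ] moment R′ S′ k
          Λ-≈ zero m _ = K.refl
          Λ-≈ (suc zero) = eS
          Λ-≈ (suc (suc k)) = via n k (conv-≈ n {S} {S′} {moment R S (suc k)} eS (Λ-≈ (suc k))) (conv-≈ n {P} {P′} {moment R S k} eP (Λ-≈ k))

          SS : (S * S) ≈[ suc n ] (S′ * S′)
          SS = conv-≈⁺ n S₀ S′₀ S₀ S′₀ eS eS

          -- From the third moment on, the recursion consists of products of two factors that vanish
          -- at w = 0, so that one order is gained. The second moment S² + 2R contains R linearly
          -- and gains only if R does.
          Λ-≈⁺ : ∀ k → moment R S (suc (suc (suc k))) ≈[ suc n ] moment R′ S′ (suc (suc (suc k)))
          Λ-≈⁺ k = via (suc n) (suc k)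
            (conv-≈⁺ n {S} {S′} {moment R S (suc (suc k))} S₀ S′₀ (zero-Λ R S R₀ S₀ (suc k)) (zero-Λ R′ S′ R′₀ S′₀ (suc k)) eS (Λ-≈ (suc (suc k))))
            (conv-≈⁺ n {P} {P′} {moment R S (suc k)} (Family.ord-P R S R₀ S₀ 0 (s≤s z≤n)) (Family.ord-P R′ S′ R′₀ S′₀ 0 (s≤s z≤n)) (zero-Λ R S R₀ S₀ k) (zero-Λ R′ S′ R′₀ S′₀ k) eP (Λ-≈ (suc k)))

          Λ₂-≈⁺ : R ≈[ suc n ] R′ → moment R S 2 ≈[ suc n ] moment R′ S′ 2
          Λ₂-≈⁺ eR⁺ = via (suc n) 0 SS (conv-≈ (suc n) {P} {P′} {1#} {1#} (≈-+ {suc n} {S * S} {S′ * S′} SS (≈-neg {suc n} {ι (+ 4) * R} {ι (+ 4) * R′} (≈-scale {suc n} {R} {R′} (ι (+ 4)) eR⁺))) (λ _ _ → K.refl))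

          Λ-≥2 : R ≈[ suc n ] R′ → ∀ j → 2 ≤ j → moment R S j ≈[ suc n ] moment R′ S′ j
          Λ-≥2 eR⁺ (suc (suc zero)) _ = Λ₂-≈⁺ eR⁺
          Λ-≥2 eR⁺ (suc (suc (suc k))) _ = Λ-≈⁺ k
          Λ-≥2 eR⁺ (suc zero) (s≤s ())

          Λ-≥3 : ∀ j → 3 ≤ j → moment R S j ≈[ suc n ] moment R′ S′ j
          Λ-≥3 (suc (suc (suc k))) _ = Λ-≈⁺ k
          Λ-≥3 (suc zero) (s≤s ())
          Λ-≥3 (suc (suc zero)) (s≤s (s≤s ()))

        -- The saddle point equations in fixed point form: L[xV] = 2w reads S² + 2R - β L[xγ] = 2w,
        -- and L[V] = 0 reads S = β L[γ]. `Φ₂` uses the R already improved by `Φ₁`, because γ begins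
        -- with x² and the second moment is linear in R; so each round gains an order in both.
        Φ₁ Φ₂ : PS → PS → PS
        Φ₁ R S = X + h * (const b * ⟨ X * γ , moment R S ⟩ + - (S * S))
        Φ₂ R S = const b * ⟨ γ , moment (Φ₁ R S) S ⟩

        private
          Xγ-zero : ∀ j → j < 3 → (X * γ) j K.≈ K.0#
          Xγ-zero j lt = xpow-zero 1 γ 2 (cpow-zero 2) j lt

          pair₀ : ∀ R S → R 0 K.≈ K.0# → S 0 K.≈ K.0# → ∀ m f → (∀ j → j < suc m → f j K.≈ K.0#) → ⟨ f , moment R S ⟩ 0 K.≈ K.0#
          pair₀ R S R₀ S₀ m f f₀ = pair-ord (suc m) 0 f₀ (λ j → ord-≤ (ℕP.≤-reflexive (ℕP.+-identityʳ j)) (Family.ord-Λ R S R₀ S₀ j)) 0 (s≤s z≤n)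

        Φ₁-zero : ∀ R S → R 0 K.≈ K.0# → S 0 K.≈ K.0# → Φ₁ R S 0 K.≈ K.0#
        Φ₁-zero R S R₀ S₀ = K.trans (K.+-identityˡ _) (K.trans (K.*-congˡ (K.trans (K.+-cong (K.trans (K.*-congˡ (pair₀ R S R₀ S₀ 2 (X * γ) Xγ-zero)) (K.zeroʳ b)) (K.-‿cong (K.trans (K.*-congʳ S₀) (K.zeroˡ _)))) (K.-‿inverseʳ K.0#))) (K.zeroʳ _))

        Φ₂-zero : ∀ R S → R 0 K.≈ K.0# → S 0 K.≈ K.0# → Φ₂ R S 0 K.≈ K.0#
        Φ₂-zero R S R₀ S₀ = K.trans (K.*-congˡ (pair₀ (Φ₁ R S) S (Φ₁-zero R S R₀ S₀) S₀ 1 γ (cpow-zero 2))) (K.zeroʳ b)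

        module Improve {R S R′ S′ : PS} (R₀ : R 0 K.≈ K.0#) (S₀ : S 0 K.≈ K.0#) (R′₀ : R′ 0 K.≈ K.0#) (S′₀ : S′ 0 K.≈ K.0#)
          (n : ℕ) (eR : R ≈[ n ] R′) (eS : S ≈[ n ] S′) where
          private module G = Agree R₀ S₀ R′₀ S′₀ n eR eS

          Φ₁-≈ : Φ₁ R S ≈[ suc n ] Φ₁ R′ S′
          Φ₁-≈ = ≈-+ {suc n} {X} {X} (λ _ _ → K.refl) (≈-scale {suc n} h (≈-+ {suc n} {const b * ⟨ X * γ , moment R S ⟩} {const b * ⟨ X * γ , moment R′ S′ ⟩}
            (≈-scale {suc n} {⟨ X * γ , moment R S ⟩} {⟨ X * γ , moment R′ S′ ⟩} (const b) (pair-≈ {X * γ} {moment R S} {moment R′ S′} (suc n) 3 Xγ-zero G.Λ-≥3))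
            (≈-neg {suc n} {S * S} {S′ * S′} G.SS)))

          Φ₂-≈ : Φ₂ R S ≈[ suc n ] Φ₂ R′ S′
          Φ₂-≈ = ≈-scale {suc n} {⟨ γ , moment (Φ₁ R S) S ⟩} {⟨ γ , moment (Φ₁ R′ S′) S′ ⟩} (const b)
            (pair-≈ {γ} {moment (Φ₁ R S) S} {moment (Φ₁ R′ S′) S′} (suc n) 2 (cpow-zero 2)
              (Agree.Λ-≥2 (Φ₁-zero R S R₀ S₀) S₀ (Φ₁-zero R′ S′ R′₀ S′₀) S′₀ n (λ m le → Φ₁-≈ m (ℕP.m≤n⇒m≤1+n le)) eS Φ₁-≈))

        private
          Rᵢ Sᵢ : ℕ → PS
          Rᵢ zero = 0#
          Rᵢ (suc i) = Φ₁ (Rᵢ i) (Sᵢ i)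
          Sᵢ zero = 0#
          Sᵢ (suc i) = Φ₂ (Rᵢ i) (Sᵢ i)

          zeros : ∀ i → Rᵢ i 0 K.≈ K.0# × Sᵢ i 0 K.≈ K.0#
          zeros zero = K.refl , K.refl
          zeros (suc i) = Φ₁-zero (Rᵢ i) (Sᵢ i) (proj₁ (zeros i)) (proj₂ (zeros i)) , Φ₂-zero (Rᵢ i) (Sᵢ i) (proj₁ (zeros i)) (proj₂ (zeros i))

          agree : ∀ i → Rᵢ i ≈[ i ] Rᵢ (suc i) × Sᵢ i ≈[ i ] Sᵢ (suc i)
          agree zero = (λ { zero z≤n → K.sym (proj₁ (zeros 1)) }) , (λ { zero z≤n → K.sym (proj₂ (zeros 1)) })
          agree (suc i) = Improve.Φ₁-≈ (proj₁ (zeros i)) (proj₂ (zeros i)) (proj₁ (zeros (suc i))) (proj₂ (zeros (suc i))) i (proj₁ (agree i)) (proj₂ (agree i)) ,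
            Improve.Φ₂-≈ (proj₁ (zeros i)) (proj₂ (zeros i)) (proj₁ (zeros (suc i))) (proj₂ (zeros (suc i))) i (proj₁ (agree i)) (proj₂ (agree i))

          chain : ∀ (Z : ℕ → PS) → (∀ i → Z i ≈[ i ] Z (suc i)) → ∀ m j → Z m m K.≈ Z (j ℕ.+ m) m
          chain Z h m zero = K.refl
          chain Z h m (suc j) = K.trans (chain Z h m j) (h (j ℕ.+ m) m (ℕP.m≤n+m m j))

          limit : ∀ (Z : ℕ → PS) → (∀ i → Z i ≈[ i ] Z (suc i)) → ∀ i → (λ n → Z n n) ≈[ i ] Z i
          limit Z h i m m≤i with ℕP.m≤n⇒∃[o]m+o≡n m≤i
          ... | o , ≡.refl = K.trans (chain Z h m o) (K.reflexive (≡.cong (λ k → Z k m) (ℕP.+-comm o m)))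

        -- The diagonal limit: iterate n is already correct up to wⁿ.
        R S : PS
        R n = Rᵢ n n
        S n = Sᵢ n n

        R₀ : R 0 K.≈ K.0#
        R₀ = K.refl
        S₀ : S 0 K.≈ K.0#
        S₀ = K.refl

        private
          R-limit : ∀ i → R ≈[ i ] Rᵢ i
          R-limit = limit Rᵢ (λ i → proj₁ (agree i))
          S-limit : ∀ i → S ≈[ i ] Sᵢ i
          S-limit = limit Sᵢ (λ i → proj₂ (agree i))

        fix₁ : Φ₁ R S ≋ R
        fix₁ = coeffs λ n → K.trans (Improve.Φ₁-≈ R₀ S₀ (proj₁ (zeros n)) (proj₂ (zeros n)) n (R-limit n) (S-limit n) n (ℕP.n≤1+n n)) (K.sym (R-limit (suc n) n (ℕP.n≤1+n n)))

        fix₂ : Φ₂ R S ≋ S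
        fix₂ = coeffs λ n → K.trans (Improve.Φ₂-≈ R₀ S₀ (proj₁ (zeros n)) (proj₂ (zeros n)) n (R-limit n) (S-limit n) n (ℕP.n≤1+n n)) (K.sym (S-limit (suc n) n (ℕP.n≤1+n n)))

        P = Family.P R S
        Λ = Family.Λ R S
        ord-Λ = Family.ord-Λ R S
        L = Family.Functional.L R S R₀ S₀
        L4 = Family.Functional.L4 R S R₀ S₀
        L5 = Family.Functional.L5 R S R₀ S₀
        ΛS = Family.Functional.ΛS R S R₀ S₀
        N = Family.Functional.N R S R₀ S₀
        NS = Family.Functional.NS R S R₀ S₀
        ord-N = Family.Functional.ord-N R S R₀ S₀
        N-zero = Family.Functional.N-zero R S R₀ S₀

        private
          S-fixed : S ≋ const b * L γ
          S-fixed = trans (sym fix₂) (*-congˡ (pair-cong {γ} refl λ k → coeffs λ n →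
            Agree.Λ-≈ (Φ₁-zero R S R₀ S₀) S₀ R₀ S₀ n (λ m _ → at fix₁ m) (λ _ _ → K.refl) k n ℕP.≤-refl))

        Λ₂ : Λ 2 ≋ S * S + ι (+ 2) * R
        Λ₂ = trans (*-congˡ (+-cong (*-congʳ (*-congʳ (+-congʳ (*-congˡ const-0)))) (-‿cong (*-congʳ (*-congʳ (+-congʳ const-0))))))
          (trans (solve 3 (λ h S R → h :* ((con (+ 2) :* con (+ 0) :+ con (+ 3)) :* S :* S :+ :- ((con (+ 0) :+ con (+ 1)) :* (S :* S :+ :- (con (+ 4) :* R)) :* con (+ 1)))
              := (con (+ 2) :* h) :* (S :* S :+ con (+ 2) :* R)) refl h S R) (trans (*-congʳ 2h) (*-identityˡ _)))

        L-X : L X ≋ S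
        L-X = trans (pair-cong (sym (trans (*-comm X 1#) (*-identityˡ X))) (λ _ → refl)) (trans (pair-X 1# Λ (ΛS 0)) (pair-1 (λ k → Λ (suc k)) (ΛS 1)))

        L-XX : L (X * X) ≋ Λ 2
        L-XX = trans (pair-cong (*-congˡ (sym (trans (*-comm X 1#) (*-identityˡ X)))) (λ _ → refl)) (trans (pair-X (X * 1#) Λ (ΛS 0))
          (trans (pair-X 1# (λ k → Λ (suc k)) (ΛS 1)) (pair-1 (λ k → Λ (suc (suc k))) (ΛS 2))))

        L-sub : ∀ f g → L (f + - (const b * g)) ≋ L f + - (const b * L g)
        L-sub f g = trans (pair-+ˡ f (- (const b * g)) Λ) (+-congˡ (trans (pair-cong (solve 2 (λ b g → :- (b :* g) := (:- b) :* g) refl (const b) g) (λ _ → refl))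
          (trans (pair-cong (*-congʳ (sym (const-neg b))) (λ _ → refl)) (trans (pair-*ˡ (K.- b) g Λ) (trans (*-congʳ (const-neg b)) (solve 2 (λ b g → (:- b) :* g := :- (b :* g)) refl (const b) (L g)))))))

        saddle₀ : L V ≋ 0#
        saddle₀ = trans (L-sub X γ) (trans (+-cong L-X (-‿cong (sym S-fixed))) (-‿inverseʳ S))

        saddle₁ : L (X * V) ≋ ι (+ 2) * X
        saddle₁ = trans (pair-cong (solve 3 (λ x b g → x :* (x :+ :- (b :* g)) := x :* x :+ :- (b :* (x :* g))) refl X (const b) γ) (λ _ → refl))
          (trans (L-sub (X * X) (X * γ)) (trans (+-congʳ (trans L-XX (trans Λ₂ (+-congˡ (*-congˡ (sym fix₁))))))
            (trans (solve 4 (λ S x h u → S :* S :+ con (+ 2) :* (x :+ h :* (u :+ :- (S :* S))) :+ :- u := S :* S :+ con (+ 2) :* x :+ (con (+ 2) :* h) :* (u :+ :- (S :* S)) :+ :- u) refl S X h (const b * L (X * γ)))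
            (trans (+-congʳ (+-congˡ (*-congʳ 2h))) (solve 3 (λ S x u → S :* S :+ con (+ 2) :* x :+ con (+ 1) :* (u :+ :- (S :* S)) :+ :- u := con (+ 2) :* x) refl S X (const b * L (X * γ)))))))

        loop₀ = Family.Functional.Saddle.loop₀ R S R₀ S₀ V V₀ saddle₀ saddle₁
        loop = Family.Functional.Saddle.loop R S R₀ S₀ V V₀ saddle₀ saddle₁

        -- F p m counts forested maps whose root vertex has p darts that may be in the forest and m that are not.
        F : ℕ → ℕ → PS
        F p m = ⟨ xpow m (cpow p) , N ⟩

        private
          xpow-+ : ∀ m f g → xpow m (f + g) ≋ xpow m f + xpow m g
          xpow-+ zero f g = refl
          xpow-+ (suc m) f g = trans (*-congˡ (xpow-+ m f g)) (distribˡ _ _ _)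

          xpow-X : ∀ m f → xpow m (X * f) ≋ xpow (suc m) f
          xpow-X zero f = refl
          xpow-X (suc m) f = *-congˡ (xpow-X m f)

          xpow-cong : ∀ m {f g} → f ≋ g → xpow m f ≋ xpow m g
          xpow-cong zero e = e
          xpow-cong (suc m) e = *-congˡ (xpow-cong m e)

          xpow-scale : ∀ m u f → xpow m (u * f) ≋ u * xpow m f
          xpow-scale zero u f = refl
          xpow-scale (suc m) u f = trans (*-congˡ (xpow-scale m u f)) (solve 3 (λ x u f → x :* (u :* f) := u :* (x :* f)) refl X u (xpow m f))

        F-tree : ∀ p m → F (suc p) m ≋ F (suc (suc p)) m + F p (suc m)
        F-tree p m = trans (pair-cong (trans (xpow-cong m (trans (*-congʳ c-eq) (solve 3 (λ c x q → (c :* c :+ x) :* q := c :* (c :* q) :+ x :* q) refl c X (cpow p))))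
            (trans (xpow-+ m (cpow (suc (suc p))) (X * cpow p)) (+-congˡ (xpow-X m (cpow p))))) (λ _ → refl))
          (pair-+ˡ (xpow m (cpow (suc (suc p)))) (xpow (suc m) (cpow p)) N)

        F-N : ∀ k → F 0 k ≋ N k
        F-N k = trans (pair-xpow k 1# N NS) (trans (pair-1 (λ j → N (k ℕ.+ j)) (NS k)) (coeffs λ n → K.reflexive (≡.cong (λ i → N i n) (ℕP.+-identityʳ k))))

        F-empty : F 0 0 ≋ X
        F-empty = trans (F-N 0) N-zero

        private
          V-split : ∀ m → ⟨ xpow m V , N ⟩ ≋ F 0 (suc m) + - (const b * F 2 m)
          V-split m = trans (pair-cong (trans (xpow-cong m (solve 3 (λ x b g → x :+ :- (b :* g) := x :* con (+ 1) :+ (:- b) :* g) refl X (const b) γ))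
              (trans (xpow-+ m (X * 1#) (- const b * γ)) (+-cong (xpow-X m 1#) (xpow-scale m (- const b) γ)))) (λ _ → refl))
            (trans (pair-+ˡ (xpow (suc m) 1#) (- const b * xpow m γ) N) (+-congˡ (trans (pair-cong (*-congʳ (sym (const-neg b))) (λ _ → refl))
              (trans (pair-*ˡ (K.- b) (xpow m γ) N) (trans (*-congʳ (const-neg b)) (solve 2 (λ b g → (:- b) :* g := :- (b :* g)) refl (const b) (F 2 m)))))))

          move : ∀ {f g u} → f + - g ≋ u → f ≋ u + g
          move {f} {g} e = trans (solve 2 (λ f g → f := f :+ :- g :+ g) refl f g) (+-congʳ e)

        F-new₀ : F 0 1 ≋ const b * F 2 0
        F-new₀ = trans (move (trans (sym (V-split 0)) loop₀)) (+-identityˡ _)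

        -- The loop equation for V = x - β c², read combinatorially: the first of m + 2 darts
        -- outside the forest is matched, cutting the other m into two blocks, or leads to a new
        -- vertex with two pending darts, which opens a forest component and costs β.
        F-new : ∀ m → F 0 (suc (suc m)) ≋ Y.conv (F 0) (F 0) m + const b * F 2 (suc m)
        F-new m = move (trans (sym (V-split (suc m))) (trans (loop m) (sym (Y.at (B.*-cong F≋N F≋N) m))))
          where
          F≋N : F 0 Y.≋ N
          F≋N = Y.coeffs F-N

        -- The analytic form of Euler's bound: p + m root darts need at least (p + m + 2)/2 faces.
        ord-F : ∀ p m → Ord (p ℕ.+ m ℕ.+ 2) (F p m)
        ord-F p m = ≡.subst (λ k → Ord (k ℕ.+ 2) (F p m)) (ℕP.+-comm m p) (pair-ord (m ℕ.+ p) 2 (xpow-zero m (cpow p) p (cpow-zero p)) ord-N)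

      -- The differential equation at a fixed value of β.

      module Equation where
        open A
        open I using (ι)

        pow : PS → ℕ → PS
        pow f zero = 1#
        pow f (suc k) = f * pow f k

        W X̂ equation : PS → PS
        W G = ι (+ 2) * G + - (X * const b⁻¹)
        X̂ G = ι (+ 5) * W G * const b + - (const b * X) + X
        equation G =
          (ι (+ 3) * pow (const b) 4 * X * pow (D (W G)) 4 + - (pow (const b) 3 * X̂ G * pow (D (W G)) 3) + ι (+ 4) * (const b + 1#) * pow (X̂ G) 2) * D (D (W G))
          + - (ι (+ 48) * pow (const b) 2 * X * (const b + 1#) * pow (D (W G)) 3)
          + ι (+ 8) * const b * (const b + 1#) * X̂ G * pow (D (W G)) 2
          + ι (+ 4) * (pow (const b) 2 + - 1#) * X̂ G * D (W G)

      -- From the moment relations to the differential equation.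

      module Solution where
        open Pairing
        open Moments
        open A
        open I
        open Forests
        open Equation

        private
          -- `r̂` is 1/s, so r = L[1/s] and q = L[x/s]. E equals L[V′], and Q is the defect S L[V′]
          -- - L[x V′]. U′ is the derivative of U = βW, and Y is the cofactor in 5U - (β - 1)w =
          -- U′Y.
          β r̂ r q E Q G U′ Y S′ R′ : PS
          β = const b
          r̂ = h * (- D s)
          r = L r̂
          q = L (X * r̂)
          E = 1# + β + - (β * r)
          Q = β * (q + - (S * r))
          G = F 1 0
          S′ = D S
          R′ = D R
          U′ = ι (+ 2) * (1# + β) * S + - 1#
          Y = (1# + β) * R + ι (+ 3) * X

          halve : ∀ {f g} → ι (+ 2) * f ≋ ι (+ 2) * g → f ≋ g
          halve {f} {g} e = trans (half f) (trans (*-congˡ e) (sym (half g)))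
            where
            half : ∀ f → f ≋ h * (ι (+ 2) * f)
            half f = trans (sym (trans (*-congʳ 2h) (*-identityˡ f))) (solve 2 (λ h f → con (+ 2) :* h :* f := h :* (con (+ 2) :* f)) refl h f)

          to-0 : ∀ {f g} → f ≋ g → f + - g ≋ 0#
          to-0 {g = g} e = trans (+-congʳ e) (-‿inverseʳ g)

          from-0 : ∀ {f g} → f + - g ≋ 0# → f ≋ g
          from-0 {f} {g} e = trans (solve 2 (λ f g → f := f :+ :- g :+ g) refl f g) (trans (+-congʳ e) (+-identityˡ g))

          0*₁ : ∀ {x} u → x ≋ 0# → u * x ≋ 0#
          0*₁ u e = trans (*-congˡ e) (zeroʳ u)

          0+ : ∀ {x y} → x ≋ 0# → y ≋ 0# → x + y ≋ 0#
          0+ p q = trans (+-cong p q) (+-identityˡ 0#)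

          D-ι : ∀ n f → D (ι (+ n) * f) ≋ ι (+ n) * D f
          D-ι n f = trans (D-* (ι (+ n)) f) (trans (+-congʳ (trans (*-congʳ (trans (D-cong (numeral-const n)) (D-const (numeral n)))) (zeroˡ f))) (+-identityˡ _))

          D-β : ∀ u f → D (const u * f) ≋ const u * D f
          D-β u f = trans (D-* (const u) f) (trans (+-congʳ (trans (*-congʳ (D-const u)) (zeroˡ f))) (+-identityˡ _))

          L-ι : ∀ n f → L (ι (+ n) * f) ≋ ι (+ n) * L f
          L-ι n f = trans (pair-cong (*-congʳ (numeral-const n)) (λ _ → refl)) (trans (pair-*ˡ (numeral n) f Λ) (*-congʳ (sym (numeral-const n))))

          L-neg : ∀ f → L (- f) ≋ - L f
          L-neg f = trans (pair-cong (trans (solve 1 (λ f → :- f := (:- con (+ 1)) :* f) refl f) (*-congʳ (sym (const-neg K.1#)))) (λ _ → refl))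
            (trans (pair-*ˡ (K.- K.1#) f Λ) (trans (*-congʳ (const-neg K.1#)) (solve 1 (λ f → (:- con (+ 1)) :* f := :- f) refl (L f))))

          L-cong : ∀ {f g} → f ≋ g → L f ≋ L g
          L-cong e = pair-cong e (λ _ → refl)

          L-+ : ∀ f g → L (f + g) ≋ L f + L g
          L-+ f g = pair-+ˡ f g Λ

          L-1 : L 1# ≋ 1#
          L-1 = pair-1 Λ (ΛS 0)

          Ds : D s ≋ - (ι (+ 2) * r̂)
          Ds = sym (trans (solve 2 (λ h d → :- (con (+ 2) :* (h :* (:- d))) := (con (+ 2) :* h) :* d) refl h (D s)) (trans (*-congʳ 2h) (*-identityˡ _)))

          s-r̂ : s ≋ r̂ + - (ι (+ 4) * (X * r̂))
          s-r̂ = halve (trans (from-0 (trans (solve 4 (λ s d x r → con (+ 2) :* s :+ :- (con (+ 2) :* r :+ :- (con (+ 8) :* (x :* r))) := (d :+ :- (con (+ 4) :* (x :* d) :+ :- (con (+ 2) :* s)))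
                    :+ (:- (con (+ 1) :+ :- (con (+ 4) :* x))) :* (d :+ :- (:- (con (+ 2) :* r)))) refl s (D s) X r̂)
                  (0+ (to-0 (trans s-ode (+-congʳ (*-congˡ (θ-D s))))) (0*₁ _ (to-0 Ds)))))
              (solve 2 (λ x r → con (+ 2) :* r :+ :- (con (+ 8) :* (x :* r)) := con (+ 2) :* (r :+ :- (con (+ 4) :* (x :* r)))) refl X r̂))

          2c : ι (+ 2) * c ≋ 1# + - s
          2c = trans (sym (*-assoc _ h _)) (trans (*-congʳ 2h) (*-identityˡ _))

          2γ : ι (+ 2) * γ ≋ 1# + - s + - (ι (+ 2) * X)
          2γ = trans (solve 2 (λ c x → con (+ 2) :* (c :* (c :* con (+ 1))) := con (+ 2) :* (c :* c :+ x) :+ :- (con (+ 2) :* x)) refl c X)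
            (+-congʳ (trans (*-congˡ (sym c-eq)) 2c))

          Dγ : D γ ≋ r̂ + - 1#
          Dγ = halve (trans (sym (D-ι 2 γ)) (trans (D-cong 2γ) (trans (D-+ (1# + - s) (- (ι (+ 2) * X))) (trans (+-cong
              (trans (D-+ 1# (- s)) (+-cong (D-const K.1#) (trans (D-neg s) (-‿cong Ds)))) (trans (D-neg (ι (+ 2) * X)) (-‿cong (trans (D-ι 2 X) (*-congˡ D-X)))))
            (solve 1 (λ r → con (+ 0) :+ :- :- (con (+ 2) :* r) :+ :- (con (+ 2) :* con (+ 1)) := con (+ 2) :* (r :+ :- con (+ 1))) refl r̂)))))

          DV : D V ≋ 1# + - (β * (r̂ + - 1#))
          DV = trans (D-+ X (- (β * γ))) (+-cong D-X (trans (D-neg (β * γ)) (-‿cong (trans (D-β b γ) (*-congˡ Dγ)))))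

          L-DV : L (D V) ≋ E
          L-DV = trans (L-cong DV) (trans (L-sub 1# (r̂ + - 1#)) (trans (+-cong L-1 (-‿cong (*-congˡ (trans (L-+ r̂ (- 1#)) (+-congˡ (trans (L-neg 1#) (-‿cong L-1)))))))
            (solve 2 (λ β r → con (+ 1) :+ :- (β :* (r :+ :- con (+ 1))) := con (+ 1) :+ β :+ :- (β :* r)) refl β r)))

          L-XDV : L (X * D V) ≋ S * E + - Q
          L-XDV = trans (L-cong (trans (*-congˡ DV) (solve 3 (λ x β r → x :* (con (+ 1) :+ :- (β :* (r :+ :- con (+ 1)))) := x :+ :- (β :* (x :* r :+ :- x))) refl X β r̂)))
            (trans (L-sub X (X * r̂ + - X)) (trans (+-cong L-X (-‿cong (*-congˡ (trans (L-+ (X * r̂) (- X)) (+-congˡ (trans (L-neg X) (-‿cong L-X)))))))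
              (solve 4 (λ S β q r → S :+ :- (β :* (q :+ :- S)) := S :* (con (+ 1) :+ β :+ :- (β :* r)) :+ :- (β :* (q :+ :- (S :* r)))) refl S β q r)))

          L-s : L s ≋ r + - (ι (+ 4) * q)
          L-s = trans (L-cong s-r̂) (trans (L-+ r̂ _) (+-congˡ (trans (L-neg (ι (+ 4) * (X * r̂))) (-‿cong (L-ι 4 (X * r̂))))))

          2Lγ : ι (+ 2) * L γ ≋ 1# + - L s + - (ι (+ 2) * S)
          2Lγ = trans (sym (L-ι 2 γ)) (trans (L-cong 2γ) (trans (L-+ (1# + - s) (- (ι (+ 2) * X))) (+-cong (trans (L-+ 1# (- s)) (+-cong L-1 (L-neg s)))
            (trans (L-neg (ι (+ 2) * X)) (-‿cong (trans (L-ι 2 X) (*-congˡ L-X)))))))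

          2LXγ : ι (+ 2) * L (X * γ) ≋ S + - L (X * s) + - (ι (+ 2) * (S * S + ι (+ 2) * R))
          2LXγ = trans (sym (L-ι 2 (X * γ))) (trans (L-cong (trans (solve 2 (λ x g → con (+ 2) :* (x :* g) := x :* (con (+ 2) :* g)) refl X γ) (trans (*-congˡ 2γ)
              (solve 2 (λ x s → x :* (con (+ 1) :+ :- s :+ :- (con (+ 2) :* x)) := x :+ :- (x :* s) :+ :- (con (+ 2) :* (x :* x))) refl X s))))
            (trans (L-+ (X + - (X * s)) (- (ι (+ 2) * (X * X)))) (+-cong (trans (L-+ X (- (X * s))) (+-cong L-X (L-neg (X * s))))
              (trans (L-neg (ι (+ 2) * (X * X))) (-‿cong (trans (L-ι 2 (X * X)) (*-congˡ (trans L-XX Λ₂))))))))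

          -- The two saddle point equations, in terms of the moments of s = √(1 − 4x).
          βLs : β * L s + - β + ι (+ 2) * (1# + β) * S ≋ 0#
          βLs = trans (solve 4 (λ β l S g → β :* l :+ :- β :+ con (+ 2) :* (con (+ 1) :+ β) :* S := con (+ 2) :* (S :+ :- (β :* g)) :+ β :* (con (+ 2) :* g :+ :- (con (+ 1) :+ :- l :+ :- (con (+ 2) :* S)))) refl β (L s) S (L γ))
            (0+ (0*₁ _ (trans (+-congʳ (sym L-X)) (trans (sym (L-sub X γ)) saddle₀))) (0*₁ _ (to-0 2Lγ)))

          βLXs : β * L (X * s) + - (ι (+ 4) * X + β * S + - (ι (+ 2) * (1# + β) * (S * S + ι (+ 2) * R))) ≋ 0#
          βLXs = trans (solve 6 (λ β l S R w g → β :* l :+ :- (con (+ 4) :* w :+ β :* S :+ :- (con (+ 2) :* (con (+ 1) :+ β) :* (S :* S :+ con (+ 2) :* R)))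
              := con (+ 2) :* (S :* S :+ con (+ 2) :* R :+ :- (β :* g) :+ :- (con (+ 2) :* w)) :+ β :* (con (+ 2) :* g :+ :- (S :+ :- l :+ :- (con (+ 2) :* (S :* S :+ con (+ 2) :* R))))) refl β (L (X * s)) S R X (L (X * γ)))
            (0+ (0*₁ _ (to-0 (trans (+-congʳ (sym (trans L-XX Λ₂))) (trans (sym (L-sub (X * X) (X * γ))) (trans (L-cong (solve 3 (λ x β g → x :* x :+ :- (β :* (x :* g)) := x :* (x :+ :- (β :* g))) refl X β γ)) saddle₁))))) (0*₁ _ (to-0 2LXγ)))

          h₁ : β * (r + - (ι (+ 4) * q)) + - β + ι (+ 2) * (1# + β) * S ≋ 0#
          h₁ = trans (+-congʳ (+-congʳ (*-congˡ (sym L-s)))) βLs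

          -- `L4` for f = s, with s′ = -2/s and 2θ(xs) = 3xs - x/s. The moments of s and xs are then
          -- removed by the saddle point equations, leaving r and q.
          h₂ : ι (+ 3) * (ι (+ 4) * X + β * S + - (ι (+ 2) * (1# + β) * (S * S + ι (+ 2) * R))) + - (β * q)
            + - (ι (+ 2) * S * (- (ι (+ 4) * (β * q)) + β * (r + - (ι (+ 4) * q)))) + - (ι (+ 4) * P * (β * r)) ≋ 0#
          h₂ = trans (solve 7 (λ u β l q r S P → con (+ 3) :* u :+ :- (β :* q) :+ :- (con (+ 2) :* S :* (:- (con (+ 4) :* (β :* q)) :+ β :* (r :+ :- (con (+ 4) :* q)))) :+ :- (con (+ 4) :* P :* (β :* r))
              := :- (con (+ 3) :* (β :* l :+ :- u)) :+ β :* (con (+ 3) :* l :+ :- q :+ :- (con (+ 2) :* (S :* ((:- (con (+ 2) :* q) :+ :- (con (+ 2) :* q)) :+ (r :+ :- (con (+ 4) :* q))))) :+ con (+ 2) :* (P :* (:- (con (+ 2) :* r))))) refl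
                (ι (+ 4) * X + β * S + - (ι (+ 2) * (1# + β) * (S * S + ι (+ 2) * R))) β (L (X * s)) q r S P)
            (0+ (trans (-‿cong (0*₁ _ βLXs)) (solve 0 (:- con (+ 0) := con (+ 0)) refl)) (0*₁ _ (trans (+-cong (+-cong (sym first) (-‿cong (*-congˡ (*-congˡ (+-cong (+-cong (sym second) (sym second)) (sym L-s)))))) (*-congˡ (*-congˡ (sym third))))
              (trans (solve 4 (λ a S m d → con (+ 2) :* a :+ :- (con (+ 2) :* (S :* m)) :+ con (+ 2) :* d := con (+ 2) :* (a :+ :- (S :* m) :+ d)) refl (L (θ (X * s))) S (L (θ s) + L (θ s) + L s) (P * L (D s)))
                (0*₁ _ (L4 s))))))
            where
            θs : θ s ≋ - (ι (+ 2) * (X * r̂))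
            θs = trans (θ-D s) (trans (*-congˡ Ds) (solve 2 (λ x r → x :* :- (con (+ 2) :* r) := :- (con (+ 2) :* (x :* r))) refl X r̂))
            second : L (θ s) ≋ - (ι (+ 2) * q)
            second = trans (L-cong θs) (trans (L-neg (ι (+ 2) * (X * r̂))) (-‿cong (L-ι 2 (X * r̂))))
            third : L (D s) ≋ - (ι (+ 2) * r)
            third = trans (L-cong Ds) (trans (L-neg (ι (+ 2) * r̂)) (-‿cong (L-ι 2 r̂)))
            2θXs : ι (+ 2) * θ (X * s) ≋ ι (+ 3) * (X * s) + - (X * r̂)
            2θXs = trans (*-congˡ (trans (θ-* X s) (+-cong (*-congʳ θ-X) (*-congˡ θs))))
              (from-0 (trans (solve 3 (λ x s r → con (+ 2) :* (x :* s :+ x :* :- (con (+ 2) :* (x :* r))) :+ :- (con (+ 3) :* (x :* s) :+ :- (x :* r)) := :- (x :* (s :+ :- (r :+ :- (con (+ 4) :* (x :* r)))))) refl X s r̂)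
                (trans (-‿cong (0*₁ _ (to-0 s-r̂))) (solve 0 (:- con (+ 0) := con (+ 0)) refl))))
            first : ι (+ 2) * L (θ (X * s)) ≋ ι (+ 3) * L (X * s) + - q
            first = trans (sym (L-ι 2 (θ (X * s)))) (trans (L-cong 2θXs) (trans (L-+ (ι (+ 3) * (X * s)) (- (X * r̂))) (+-cong (L-ι 3 (X * s)) (L-neg (X * r̂)))))

          -- With k₂ this is a linear system for E and Q, of determinant (1 - 4S)² - 64R.
          k₁ : (1# + - (ι (+ 4) * S)) * E + ι (+ 4) * Q + U′ ≋ 0#
          k₁ = trans (solve 4 (λ β S r q → (con (+ 1) :+ :- (con (+ 4) :* S)) :* (con (+ 1) :+ β :+ :- (β :* r)) :+ con (+ 4) :* (β :* (q :+ :- (S :* r))) :+ (con (+ 2) :* (con (+ 1) :+ β) :* S :+ :- con (+ 1))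
              := (:- con (+ 1)) :* (β :* (r :+ :- (con (+ 4) :* q)) :+ :- β :+ con (+ 2) :* (con (+ 1) :+ β) :* S)) refl β S r q) (0*₁ _ h₁)

          k₂ : (1# + - (ι (+ 4) * S)) * Q + ι (+ 16) * R * E + - (ι (+ 4) * Y) ≋ 0#
          k₂ = trans (solve 6 (λ β S r q R w → (con (+ 1) :+ :- (con (+ 4) :* S)) :* (β :* (q :+ :- (S :* r))) :+ con (+ 16) :* R :* (con (+ 1) :+ β :+ :- (β :* r)) :+ :- (con (+ 4) :* ((con (+ 1) :+ β) :* R :+ con (+ 3) :* w))
              := (:- con (+ 1)) :* (con (+ 3) :* (con (+ 4) :* w :+ β :* S :+ :- (con (+ 2) :* (con (+ 1) :+ β) :* (S :* S :+ con (+ 2) :* R))) :+ :- (β :* q)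
                :+ :- (con (+ 2) :* S :* (:- (con (+ 4) :* (β :* q)) :+ β :* (r :+ :- (con (+ 4) :* q)))) :+ :- (con (+ 4) :* (S :* S :+ :- (con (+ 4) :* R)) :* (β :* r)))
                :+ (:- (con (+ 3) :* S)) :* (β :* (r :+ :- (con (+ 4) :* q)) :+ :- β :+ con (+ 2) :* (con (+ 1) :+ β) :* S)) refl β S r q R X)
            (0+ (0*₁ _ h₂) (0*₁ _ h₁))

          -- L[V] = 0, differentiated by the chain rule `L5`.
          h₃ : ι (+ 2) * R * S′ * E + - (R′ * Q) ≋ 0#
          h₃ = halve (trans (solve 5 (λ a R′ S E Q → con (+ 2) :* (a :* E :+ :- (R′ :* Q)) := (a :* E :+ R′ :* (S :* E :+ :- Q :+ :- (S :* E))) :+ (a :* E :+ R′ :* (S :* E :+ :- Q :+ :- (S :* E)))) refl (ι (+ 2) * R * S′) R′ S E Q)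
            (trans (+-cong M M) (trans (sym (L5 V)) (trans (*-congˡ (trans (D-cong saddle₀) D-zero)) (trans (zeroʳ _) (sym (zeroʳ _)))))))
            where
            M : ι (+ 2) * R * S′ * E + R′ * (S * E + - Q + - (S * E)) ≋ ι (+ 2) * R * S′ * L (D V) + R′ * (L (X * D V) + - (S * L (D V)))
            M = sym (+-cong (*-congˡ L-DV) (*-congˡ (+-cong L-XDV (-‿cong (*-congˡ L-DV)))))

          R₁ : R 1 K.≈ K.1#
          R₁ = K.trans (at (sym fix₁) 1) (K.trans (K.+-congˡ (K.trans (const-* (inv 1) (β * L (X * γ) + - (S * S)) 1) (K.trans (K.*-congˡ
            (K.trans (K.+-cong (K.trans (const-* b (L (X * γ)) 1) (K.trans (K.*-congˡ small) (K.zeroʳ b))) (K.-‿cong (ord-* 2 2 {S} {S} (ord-zero S₀) (ord-zero S₀) 1 (s≤s (s≤s (s≤s z≤n)))))) (K.-‿inverseʳ K.0#))) (K.zeroʳ _)))) (K.+-identityʳ _))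
            where
            small : L (X * γ) 1 K.≈ K.0#
            small = pair-ord 3 0 (xpow-zero 1 γ 2 (cpow-zero 2)) (λ j → ord-≤ (ℕP.≤-reflexive (ℕP.+-identityʳ j)) (ord-Λ R₀ S₀ j)) 1 (s≤s (s≤s (s≤s z≤n)))

          R-cancel : ∀ {f} → R * f ≋ 0# → f ≋ 0#
          R-cancel {f} e = coeffs λ n → agree n n ℕP.≤-refl
            where
            u : PS
            u = tl R
            uf : u * f ≋ 0#
            uf = coeffs λ n → K.trans (K.sym (X-* (u * f) n)) (at (trans (sym (*-assoc X u f)) (trans (*-congʳ (sym (X-tl R₀))) e)) (suc n))
            agree : ∀ n → f ≈[ n ] 0#
            agree zero zero z≤n = K.trans (K.sym (K.trans (K.*-congʳ R₁) (K.*-identityˡ _))) (at uf 0)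
            agree (suc n) m le with ℕP.m≤n⇒m<n∨m≡n le
            ... | inj₁ (s≤s lt) = agree n m lt
            ... | inj₂ ≡.refl = K.trans (K.sym (K.trans (K.+-cong (K.trans (K.*-congʳ R₁) (K.*-identityˡ _))
              (K.trans (conv-≈ n {tl u} {tl u} {f} {0#} (λ _ _ → K.refl) (agree n) n ℕP.≤-refl) (at (zeroʳ (tl u)) n))) (K.+-identityʳ _))) (at uf (suc n))

          -- L[xV] = 2w, differentiated by the chain rule; `L4` reduces L[x (xV)′] to E and Q. A
          -- factor R appears and is cancelled, since R = w + O(w²).
          h₄ : ι (+ 2) * (R′ * E) + - (S′ * Q) + - ι (+ 2) ≋ 0#
          h₄ = R-cancel (halve (trans combine (sym (zeroʳ _))))
            where
            LDXV : L (D (X * V)) ≋ S * E + - Q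
            LDXV = trans (L-cong (trans (D-* X V) (+-congʳ (trans (*-congʳ D-X) (*-identityˡ V))))) (trans (L-+ V (X * D V)) (trans (+-cong saddle₀ L-XDV) (+-identityˡ _)))
            LXDXV : L (X * D (X * V)) ≋ ι (+ 2) * S * (S * E + - Q) + - (P * E)
            LXDXV = from-0 (trans (+-cong (L-cong (sym (θ-D (X * V)))) (-‿cong (+-cong (*-congˡ (sym L-XDV)) (-‿cong (*-congˡ (sym L-DV))))))
              (trans (solve 5 (λ a S t P d → a :+ :- (con (+ 2) :* S :* t :+ :- (P :* d)) := a :+ :- (S :* (t :+ t :+ con (+ 0))) :+ P :* d) refl (L (θ (X * V))) S (L (X * D V)) P (L (D V)))
              (trans (+-congʳ (+-congˡ (-‿cong (*-congˡ (+-cong (+-cong (L-cong (sym (θ-D V))) (L-cong (sym (θ-D V)))) (sym saddle₀)))))) (L4 V))))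
            M : ι (+ 2) * R * S′ * (S * E + - Q) + R′ * (ι (+ 2) * S * (S * E + - Q) + - (P * E) + - (S * (S * E + - Q))) ≋ ι (+ 4) * R
            M = halve (trans (solve 1 (λ m → con (+ 2) :* m := m :+ m) refl _) (trans (+-cong back back) (trans (sym (L5 (X * V))) (trans (*-congˡ (trans (D-cong saddle₁) (trans (D-ι 2 X) (*-congˡ D-X))))
              (solve 1 (λ R → con (+ 4) :* R :* (con (+ 2) :* con (+ 1)) := con (+ 2) :* (con (+ 4) :* R)) refl R)))))
              where
              back : ι (+ 2) * R * S′ * (S * E + - Q) + R′ * (ι (+ 2) * S * (S * E + - Q) + - (P * E) + - (S * (S * E + - Q)))
                ≋ ι (+ 2) * R * S′ * L (D (X * V)) + R′ * (L (X * D (X * V)) + - (S * L (D (X * V))))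
              back = sym (+-cong (*-congˡ LDXV) (*-congˡ (+-cong LXDXV (-‿cong (*-congˡ LDXV)))))
            combine : ι (+ 2) * (R * (ι (+ 2) * (R′ * E) + - (S′ * Q) + - ι (+ 2))) ≋ 0#
            combine = trans (solve 6 (λ R S R′ S′ E Q → con (+ 2) :* (R :* (con (+ 2) :* (R′ :* E) :+ :- (S′ :* Q) :+ :- con (+ 2)))
                := (con (+ 2) :* R :* S′ :* (S :* E :+ :- Q) :+ R′ :* (con (+ 2) :* S :* (S :* E :+ :- Q) :+ :- ((S :* S :+ :- (con (+ 4) :* R)) :* E) :+ :- (S :* (S :* E :+ :- Q))) :+ :- (con (+ 4) :* R))
                  :+ (:- S) :* (con (+ 2) :* R :* S′ :* E :+ :- (R′ :* Q))) refl R S R′ S′ E Q)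
              (0+ (to-0 M) (0*₁ _ h₃))

          -- 2R′k₁ - S′k₂ together with 8h₃ - (1 - 4S)h₄ is free of E and Q. The result is what the
          -- derivative of U′Y requires.
          U′R′ : U′ * R′ + ι (+ 2) * S′ * Y ≋ ι (+ 4) * S + - 1#
          U′R′ = halve (from-0 (trans (solve 8 (λ S R S′ R′ E Q U Y → con (+ 2) :* (U :* R′ :+ con (+ 2) :* S′ :* Y) :+ :- (con (+ 2) :* (con (+ 4) :* S :+ :- con (+ 1)))
              := (con (+ 2) :* R′ :* ((con (+ 1) :+ :- (con (+ 4) :* S)) :* E :+ con (+ 4) :* Q :+ U) :+ (:- S′) :* ((con (+ 1) :+ :- (con (+ 4) :* S)) :* Q :+ con (+ 16) :* R :* E :+ :- (con (+ 4) :* Y)))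
                :+ ((:- (con (+ 1) :+ :- (con (+ 4) :* S))) :* (con (+ 2) :* (R′ :* E) :+ :- (S′ :* Q) :+ :- con (+ 2)) :+ con (+ 8) :* (con (+ 2) :* R :* S′ :* E :+ :- (R′ :* Q)))) refl S R S′ R′ E Q U′ Y)
            (0+ (0+ (0*₁ _ k₁) (0*₁ _ k₂)) (0+ (0*₁ _ h₄) (0*₁ _ h₃)))))

          -- 2E h₃ + Q h₄ eliminates R′ and gives S′ (4RE² - Q²) = 2Q. Under the linear system k₁,
          -- k₂ the quadratic form is multiplied by the determinant δ: with u₀ = -U′ and z₀ = 4Y one
          -- has z₀² - 4R u₀² = δ (Q² - 4RE²), while Cramer's rule gives δQ = 4κY + 16RU′. Finally
          -- (1 + β)κ = β - 1 - 2U′ removes κ.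
          bracket : S′ * (ι (+ 4) * (1# + β) * (Y * Y) + - ((1# + β) * R * (U′ * U′))) + ι (+ 4) * U′ * ((1# + β) * R + - (ι (+ 3) * X)) + ι (+ 2) * (β + - 1#) * Y ≋ 0#
          bracket = halve (trans (halve (trans (solve 8 (λ S R S′ R′ E Q β w →
              let a = con (+ 1) :+ β ; κ = con (+ 1) :+ :- (con (+ 4) :* S) ; U = con (+ 2) :* a :* S :+ :- con (+ 1) ; Y = a :* R :+ con (+ 3) :* w
                  u₀ = κ :* E :+ con (+ 4) :* Q ; z₀ = κ :* Q :+ con (+ 16) :* R :* E
                  k₁ = κ :* E :+ con (+ 4) :* Q :+ U ; k₂ = κ :* Q :+ con (+ 16) :* R :* E :+ :- (con (+ 4) :* Y)
                  h₃ = con (+ 2) :* R :* S′ :* E :+ :- (R′ :* Q) ; h₄ = con (+ 2) :* (R′ :* E) :+ :- (S′ :* Q) :+ :- con (+ 2)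
                  δ = κ :* κ :+ :- (con (+ 64) :* R)
              in con (+ 2) :* (con (+ 2) :* (S′ :* (con (+ 4) :* a :* (Y :* Y) :+ :- (a :* R :* (U :* U))) :+ con (+ 4) :* U :* (a :* R :+ :- (con (+ 3) :* w)) :+ con (+ 2) :* (β :+ :- con (+ 1)) :* Y))
              := ((con (+ 32) :* a :* R :+ :- (con (+ 4) :* S′ :* a :* R :* (U :+ :- u₀))) :* k₁ :+ (:- (con (+ 2) :* a :* κ) :+ :- (S′ :* a :* (con (+ 4) :* Y :+ z₀))) :* k₂)
                :+ ((:- (con (+ 2) :* a :* E :* δ)) :* h₃ :+ (:- (a :* Q :* δ)) :* h₄)) refl S R S′ R′ E Q β X)
            (trans (0+ (0+ (0*₁ _ k₁) (0*₁ _ k₂)) (0+ (0*₁ _ h₃) (0*₁ _ h₄))) (sym (trans (*-congˡ (zeroʳ _)) (zeroʳ _))))) ) refl)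

          D-aβ : ∀ f → D ((1# + β) * f) ≋ (1# + β) * D f
          D-aβ f = trans (D-cong (trans (distribʳ f 1# β) (+-congʳ (*-identityˡ f)))) (trans (D-+ f (β * f)) (trans (+-congˡ (D-β b f)) (solve 2 (λ β d → d :+ β :* d := (con (+ 1) :+ β) :* d) refl β (D f))))

          DG : D G ≋ L c
          DG = trans (D-cong (pair-cong 1-c (λ _ → refl))) (trans (sym (pair-D c N (NS 0) (λ n k lt → K.trans (at (D-∫ (Λ k)) n) (ΛS 0 n k lt)))) (pair-cong {c} refl (λ k → D-∫ (Λ k))))
            where
            1-c : cpow 1 ≋ c
            1-c = *-identityʳ c

          DW : β * D (W G) ≋ U′
          DW = trans (*-congˡ (trans (D-+ (ι (+ 2) * G) (- (X * const b⁻¹))) (+-cong (trans (D-ι 2 G) (trans (*-congˡ DG) (trans (sym (L-ι 2 c)) (trans (L-cong 2c) (trans (L-+ 1# (- s)) (+-cong L-1 (L-neg s)))))))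
              (trans (D-neg (X * const b⁻¹)) (-‿cong (trans (D-cong (*-comm X (const b⁻¹))) (trans (D-β b⁻¹ X) (*-congˡ D-X))))))))
            (from-0 (trans (solve 4 (λ β l b′ S → β :* (con (+ 1) :+ :- l :+ :- (b′ :* con (+ 1))) :+ :- (con (+ 2) :* (con (+ 1) :+ β) :* S :+ :- con (+ 1))
                := (:- con (+ 1)) :* (β :* l :+ :- β :+ con (+ 2) :* (con (+ 1) :+ β) :* S) :+ (:- con (+ 1)) :* (β :* b′ :+ :- con (+ 1))) refl β (L s) (const b⁻¹) S)
              (0+ (0*₁ _ βLs) (0*₁ _ (to-0 (trans (sym (const-mul b b⁻¹)) (const-cong b-unit)))))))

          DU′ : D U′ ≋ ι (+ 2) * (1# + β) * S′
          DU′ = trans (D-+ (ι (+ 2) * (1# + β) * S) (- 1#)) (trans (+-cong (trans (D-cong (*-assoc (ι (+ 2)) (1# + β) S)) (trans (D-ι 2 ((1# + β) * S)) (*-congˡ (D-aβ S))))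
              (trans (D-neg 1#) (-‿cong (D-const K.1#))))
            (solve 2 (λ β d → con (+ 2) :* ((con (+ 1) :+ β) :* d) :+ :- con (+ 0) := con (+ 2) :* (con (+ 1) :+ β) :* d) refl β S′))

          DDW : β * D (D (W G)) ≋ ι (+ 2) * (1# + β) * S′
          DDW = trans (sym (D-β b (D (W G)))) (trans (D-cong DW) DU′)

        G₀ : G 0 K.≈ K.0#
        G₀ = ord-F 1 0 0 (s≤s z≤n)

        G₁ : G 1 K.≈ K.0#
        G₁ = ord-F 1 0 1 (s≤s (s≤s (s≤s z≤n)))

        private
          -- X̂ = U′Y integrates the identity U′R′ + 2S′Y = 4S − 1.
          X̂-Y : X̂ G ≋ β * D (W G) * Y
          X̂-Y = trans (D-injective {X̂ G} {U′ * Y} (K.trans X̂₀ (K.sym (K.trans (K.*-congˡ Y₀) (K.zeroʳ _)))) (trans left (sym right))) (*-congʳ (sym DW))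
            where
            W₀ : W G 0 K.≈ K.0#
            W₀ = K.trans (K.+-cong (K.trans (K.*-congˡ G₀) (K.zeroʳ _)) (K.-‿cong (X-*₀ (const b⁻¹)))) (K.-‿inverseʳ K.0#)
            X̂₀ : X̂ G 0 K.≈ K.0#
            X̂₀ = K.trans (K.+-cong (K.+-cong (K.trans (K.*-congʳ (K.trans (K.*-congˡ W₀) (K.zeroʳ _))) (K.zeroˡ _)) (K.-‿cong (K.zeroʳ b))) K.refl)
              (K.trans (K.+-congʳ (K.-‿inverseʳ K.0#)) (K.+-identityˡ K.0#))
            Y₀ : Y 0 K.≈ K.0#
            Y₀ = K.trans (K.+-cong (K.zeroʳ _) (K.zeroʳ _)) (K.+-identityˡ K.0#)
            left : D (X̂ G) ≋ ι (+ 5) * U′ + - β + 1#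
            left = trans (D-+ (ι (+ 5) * W G * β + - (β * X)) X) (+-cong (trans (D-+ (ι (+ 5) * W G * β) (- (β * X))) (+-cong
              (trans (D-cong (solve 2 (λ w β → con (+ 5) :* w :* β := con (+ 5) :* (β :* w)) refl (W G) β)) (trans (D-ι 5 (β * W G)) (*-congˡ (trans (D-β b (W G)) DW))))
              (trans (D-neg (β * X)) (-‿cong (trans (D-β b X) (trans (*-congˡ D-X) (*-identityʳ β))))))) D-X)
            right : D (U′ * Y) ≋ ι (+ 5) * U′ + - β + 1#
            right = trans (D-* U′ Y) (trans (+-cong (*-congʳ DU′) (*-congˡ (trans (D-+ ((1# + β) * R) (ι (+ 3) * X)) (+-cong (D-aβ R) (trans (D-ι 3 X) (*-congˡ D-X))))))
              (from-0 (trans (solve 6 (λ β S S′ R′ Y U → con (+ 2) :* (con (+ 1) :+ β) :* S′ :* Y :+ U :* ((con (+ 1) :+ β) :* R′ :+ con (+ 3) :* con (+ 1)) :+ :- (con (+ 5) :* U :+ :- β :+ con (+ 1))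
                  := (con (+ 1) :+ β) :* (U :* R′ :+ con (+ 2) :* S′ :* Y :+ :- (con (+ 4) :* S :+ :- con (+ 1))) :+ (:- con (+ 2)) :* (U :+ :- (con (+ 2) :* (con (+ 1) :+ β) :* S :+ :- con (+ 1)))) refl β S S′ R′ Y U′)
                (0+ (0*₁ _ (to-0 U′R′)) (0*₁ _ (to-0 (refl {U′})))))))

          power : ∀ {f g} k → f ≋ g → pow f k ≋ pow g k
          power zero e = refl
          power (suc k) e = *-cong e (power k e)

        -- After substituting 5U - (β - 1)w = βW′Y every term contains β(W′)². The remaining factor,
        -- written in U′ = βW′ and βW″ = 2(1 + β)S′, is 2(1 + β) times `bracket`.
        G-solves : equation G ≋ 0#
        G-solves = trans (+-cong (+-cong (+-cong (*-congʳ (+-cong (+-congˡ (-‿cong (*-congʳ (*-congˡ X̂-Y)))) (*-congˡ (power 2 X̂-Y)))) refl) (*-congʳ (*-congˡ X̂-Y))) (*-congʳ (*-congˡ X̂-Y)))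
          (trans (solve 5 (λ β w u v Y → let a = β :+ con (+ 1) ; x = β :* u :* Y ; one = con (+ 1) in
              ((con (+ 3) :* (β :* (β :* (β :* (β :* one)))) :* w :* (u :* (u :* (u :* (u :* one)))) :+ :- ((β :* (β :* (β :* one))) :* x :* (u :* (u :* (u :* one)))) :+ con (+ 4) :* a :* (x :* (x :* one))) :* v)
                :+ :- (con (+ 48) :* (β :* (β :* one)) :* w :* a :* (u :* (u :* (u :* one)))) :+ con (+ 8) :* β :* a :* x :* (u :* (u :* one)) :+ con (+ 4) :* (β :* (β :* one) :+ :- one) :* x :* u
              := β :* u :* u :* ((con (+ 4) :* a :* (Y :* Y) :+ :- ((β :* u) :* (β :* u) :* (Y :+ :- (con (+ 3) :* w)))) :* (β :* v) :+ con (+ 8) :* a :* (β :* u) :* (Y :+ :- (con (+ 6) :* w)) :+ con (+ 4) :* a :* (β :+ :- one) :* Y))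
            refl β X (D (W G)) (D (D (W G))) Y)
          (0*₁ _ (trans (+-congʳ (+-cong (*-cong (+-congˡ (-‿cong (*-congʳ (*-cong DW DW)))) DDW) (*-congʳ (*-congˡ DW))))
            (trans (solve 6 (λ β w U S′ R Y → let a = con (+ 1) :+ β ; one = con (+ 1) in
                (con (+ 4) :* (β :+ one) :* (Y :* Y) :+ :- (U :* U :* (Y :+ :- (con (+ 3) :* w)))) :* (con (+ 2) :* a :* S′) :+ con (+ 8) :* (β :+ one) :* U :* (Y :+ :- (con (+ 6) :* w)) :+ con (+ 4) :* (β :+ one) :* (β :+ :- one) :* Y
                := con (+ 2) :* a :* (S′ :* (con (+ 4) :* a :* (Y :* Y) :+ :- (a :* R :* (U :* U))) :+ con (+ 4) :* U :* (a :* R :+ :- (con (+ 3) :* w)) :+ con (+ 2) :* (β :+ :- one) :* Y)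
                  :+ (con (+ 8) :* a :* U :+ :- (con (+ 2) :* a :* S′ :* U :* U)) :* (Y :+ :- (a :* R :+ con (+ 3) :* w)))
              refl β X U′ S′ R Y)
            (0+ (0*₁ _ bracket) (0*₁ _ (to-0 (refl {Y}))))))))

      -- The weighted number of words equals the coefficients of F.

      module Weighted where
        open Pairing
        open I using (solve; _:=_; _:+_; _:*_)
        open Forests

        weight : ℕ → K.Carrier
        weight zero = K.1#
        weight (suc k) = b K.* weight k

        total : List Word → K.Carrier
        total [] = K.0#
        total (w ∷ ws) = weight (news w) K.+ total ws

        private
          total-++ : ∀ ws {ws′} → total (ws ++ ws′) K.≈ total ws K.+ total ws′
          total-++ [] = K.sym (K.+-identityˡ _)
          total-++ (w ∷ ws) = K.trans (K.+-congˡ (total-++ ws)) (K.sym (K.+-assoc _ _ _))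

          total-same : ∀ c → (∀ w → news (c w) ≡ news w) → ∀ ws → total (map c ws) K.≈ total ws
          total-same c e [] = K.refl
          total-same c e (w ∷ ws) = K.+-cong (K.reflexive (≡.cong weight (e w))) (total-same c e ws)

          total-new : ∀ ws → total (map new ws) K.≈ b K.* total ws
          total-new [] = K.sym (K.zeroʳ b)
          total-new (w ∷ ws) = K.trans (K.+-congˡ (total-new ws)) (K.sym (K.distribˡ _ _ _))

          blocks : List ℕ → PS
          blocks [] = A.1#
          blocks (m ∷ st) = F 0 m A.* blocks st

          -- The blocks on the stack are explored independently of each other, so a state
          -- contributes a product.
          T : ℕ → ℕ → List ℕ → PS
          T p m st = F p m A.* blocks st

          ord-blocks : ∀ st → Ord (needs st) (blocks st)
          ord-blocks [] = λ _ ()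
          ord-blocks (m ∷ st) = ord-* (m ℕ.+ 2) (needs st) {F 0 m} {blocks st} (ord-F 0 m) (ord-blocks st)

          ord-T : ∀ p m st → Ord (need p m st) (T p m st)
          ord-T p m st = ord-* (p ℕ.+ m ℕ.+ 2) (needs st) {F p m} {blocks st} (ord-F p m) (ord-blocks st)

          sum-splits : (ℕ → PS) → (ℕ → PS) → List (ℕ × ℕ) → PS
          sum-splits f g [] = A.0#
          sum-splits f g ((i , j) ∷ ijs) = f i A.* g j A.+ sum-splits f g ijs

          conv-splits : ∀ f g m → Y.conv f g m ≋ sum-splits f g (splits m)
          conv-splits f g zero = A.sym (A.+-identityʳ _)
          conv-splits f g (suc m) = A.+-congˡ (A.trans (conv-splits (λ k → f (suc k)) g m) (shifted (splits m)))
            where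
            shifted : ∀ ijs → sum-splits (λ k → f (suc k)) g ijs ≋ sum-splits f g (map (λ ij → suc (proj₁ ij) , proj₂ ij) ijs)
            shifted [] = A.refl
            shifted (_ ∷ ijs) = A.+-congˡ (shifted ijs)

          -- Zero fuel is enough only if Euler's relation admits no v, that is, if 2n < `need`; then
          -- the order of T makes its coefficient vanish.
          too-big : ∀ {n p m st} → Enough 0 n p m st → T p m st n K.≈ K.0#
          too-big {n} {p} {m} {st} h = ord-T p m st n (ℕP.≰⇒> λ le → go (2 ℕ.* n ℕ.∸ need p m st) (ℕP.m∸n+n≡m le))
            where
            go : ∀ v → v ℕ.+ need p m st ≡ 2 ℕ.* n → ⊥
            go v e with spare h v e
            ... | ()

        mutual
          -- `words` and T obey the same recursion: `F-tree` for `forest` and `skip`, `F-new₀` and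
          -- `F-new` for `match` and `new`, and F 0 0 = w for `pop` and `done`.
          total-words : ∀ f n p m st → Enough f n p m st → total (words f n p m st) K.≈ T p m st n
          total-words zero n p m st h = K.sym (too-big {n} {p} {m} {st} h)
          total-words (suc f) zero zero zero [] h = K.sym (ord-T 0 0 [] 0 (s≤s z≤n))
          total-words (suc f) (suc zero) zero zero [] h = K.trans (K.+-identityʳ _) (K.sym (at (A.trans (A.*-identityʳ _) F-empty) 1))
          total-words (suc f) (suc (suc n)) zero zero [] h = K.sym (at (A.trans (A.*-identityʳ _) F-empty) (suc (suc n)))
          total-words (suc f) zero zero zero (m ∷ st) h = K.sym (ord-T 0 0 (m ∷ st) 0 (s≤s z≤n))
          total-words (suc f) (suc n) zero zero (m ∷ st) h = K.trans (total-same pop (λ _ → ≡.refl) (words f n 0 m st)) (K.trans (total-words f n 0 m st (enough-pop h))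
            (K.sym (K.trans (at (A.*-congʳ {blocks (m ∷ st)} F-empty) (suc n)) (X-* (T 0 m st) n))))
          total-words (suc f) n zero (suc zero) st h = total-new₀ f n st (enough-new h)
          total-words (suc f) n zero (suc (suc m)) st h = total-new₊ f n m st h
          total-words (suc f) n (suc p) m st h = total-tree f n p m st h

          total-tree : ∀ f n p m st → Enough (suc f) n (suc p) m st →
            total (map forest (words f n (suc (suc p)) m st) ++ map skip (words f n p (suc m) st)) K.≈ T (suc p) m st n
          total-tree f n p m st h = K.trans (total-++ (map forest (words f n (suc (suc p)) m st))) (K.trans (K.+-cong
              (K.trans (total-same forest (λ _ → ≡.refl) (words f n (suc (suc p)) m st)) (total-words f n (suc (suc p)) m st (enough-forest {p = p} h)))
              (K.trans (total-same skip (λ _ → ≡.refl) (words f n p (suc m) st)) (total-words f n p (suc m) st (enough-skip {p = p} h))))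
            (K.sym (at (A.trans (A.*-congʳ {blocks st} (F-tree p m)) (A.distribʳ (blocks st) (F (suc (suc p)) m) (F p (suc m)))) n)))

          total-new₀ : ∀ f n st → Enough f n 2 0 st → total (map new (words f n 2 0 st)) K.≈ T 0 1 st n
          total-new₀ f n st h = K.trans (total-new (words f n 2 0 st)) (K.trans (K.*-congˡ (total-words f n 2 0 st h))
            (K.trans (K.sym (const-* b (T 2 0 st) n)) (K.sym (at (A.trans (A.*-congʳ {blocks st} F-new₀) (A.*-assoc (const b) (F 2 0) (blocks st))) n))))

          total-new₊ : ∀ f n m st → Enough (suc f) n 0 (suc (suc m)) st →
            total (matches f n st (splits m) ++ map new (words f n 2 (suc m) st)) K.≈ T 0 (suc (suc m)) st n
          total-new₊ f n m st h = K.trans (total-++ (matches f n st (splits m))) (K.trans (K.+-cong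
              (total-matches f n m st h (splits-sound m))
              (K.trans (total-new (words f n 2 (suc m) st)) (K.trans (K.*-congˡ (total-words f n 2 (suc m) st (enough-new h))) (K.sym (const-* b (T 2 (suc m) st) n)))))
            (K.sym (at (A.trans (A.*-congʳ {blocks st} (A.trans (F-new m) (A.+-congʳ (conv-splits (F 0) (F 0) m))))
              (A.trans (A.distribʳ (blocks st) (sum-splits (F 0) (F 0) (splits m)) (const b A.* F 2 (suc m))) (A.+-congˡ (A.*-assoc (const b) (F 2 (suc m)) (blocks st))))) n)))

          total-matches : ∀ f n m st → Enough (suc f) n 0 (suc (suc m)) st → ∀ {ijs} → All (λ ij → proj₁ ij ℕ.+ proj₂ ij ≡ m) ijs →
            total (matches f n st ijs) K.≈ (sum-splits (F 0) (F 0) ijs A.* blocks st) n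
          total-matches f n m st h [] = K.sym (at (A.zeroˡ (blocks st)) n)
          total-matches f n m st h {(i , j) ∷ ijs} (e ∷ es) = K.trans (total-++ (map (match i) (words f n 0 i (j ∷ st)))) (K.trans (K.+-cong
              (K.trans (total-same (match i) (λ _ → ≡.refl) (words f n 0 i (j ∷ st))) (total-words f n 0 i (j ∷ st) (enough-match {i = i} {j} e h)))
              (total-matches f n m st h es))
            (K.sym (at (A.trans (A.distribʳ (blocks st) (F 0 i A.* F 0 j) (sum-splits (F 0) (F 0) ijs)) (A.+-congʳ (A.*-assoc (F 0 i) (F 0 j) (blocks st)))) n)))

      -- Uniqueness of the solution with G = O(w²).

      module UniqueSolution where
        open Pairing
        open A
        open I
        open Equation

        private
          record Agree (m : ℕ) (f g : PS) : Set where
            constructor agree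
            field upto : f ≈[ m ] g

          open Agree

          module _ {m : ℕ} where
            ~refl : ∀ {f} → Agree m f f
            ~refl = agree λ _ _ → K.refl

            ~+ : ∀ {f f′ g g′} → Agree m f f′ → Agree m g g′ → Agree m (f + g) (f′ + g′)
            ~+ p q = agree λ n le → K.+-cong (upto p n le) (upto q n le)

            ~- : ∀ {f f′} → Agree m f f′ → Agree m (- f) (- f′)
            ~- p = agree λ n le → K.-‿cong (upto p n le)

            ~* : ∀ {f f′ g g′} → Agree m f f′ → Agree m g g′ → Agree m (f * g) (f′ * g′)
            ~* {f} {f′} {g} {g′} p q = agree (conv-≈ m {f} {f′} {g} {g′} (upto p) (upto q))

            ~pow : ∀ {f f′} k → Agree m f f′ → Agree m (pow f k) (pow f′ k)
            ~pow zero p = ~refl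
            ~pow (suc k) p = ~* p (~pow k p)

            ~trans : ∀ {f g h} → Agree m f g → Agree m g h → Agree m f h
            ~trans p q = agree λ n le → K.trans (upto p n le) (upto q n le)

            ~sym : ∀ {f g} → Agree m f g → Agree m g f
            ~sym p = agree λ n le → K.sym (upto p n le)

            ≋⇒~ : ∀ {f g} → f ≋ g → Agree m f g
            ≋⇒~ p = agree λ n _ → at p n

            ~tl : ∀ {f g} → Agree (suc m) f g → Agree m (tl f) (tl g)
            ~tl p = agree λ n le → upto p (suc n) (s≤s le)

            ~D : ∀ {f g} → Agree (suc m) f g → Agree m (D f) (D g)
            ~D p = agree λ n le → K.*-congˡ (upto p (suc n) (s≤s le))

            ~∫ : ∀ {f g} → f 0 K.≈ g 0 → Agree m (D f) (D g) → Agree (suc m) f g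
            ~∫ e p = agree λ { zero _ → e ; (suc n) (s≤s le) → cancel-numeral n (upto p n le) }

          cancel-≈ : ∀ {u f} → (∀ {x} → u 0 K.* x K.≈ K.0# → x K.≈ K.0#) → ∀ m → (u * f) ≈[ m ] 0# → f ≈[ m ] 0#
          cancel-≈ {u} {f} c zero e zero z≤n = c (e 0 z≤n)
          cancel-≈ {u} {f} c (suc m) e n le with ℕP.m≤n⇒m<n∨m≡n le
          ... | inj₁ (s≤s lt) = cancel-≈ {u} {f} c m (λ i i≤ → e i (ℕP.m≤n⇒m≤1+n i≤)) n lt
          ... | inj₂ ≡.refl = c (K.trans (K.sym (K.trans (K.+-congˡ (K.trans (conv-≈ m {tl u} {tl u} {f} {0#} (λ _ _ → K.refl)
            (cancel-≈ {u} {f} c m (λ i i≤ → e i (ℕP.m≤n⇒m≤1+n i≤))) m ℕP.≤-refl) (at (zeroʳ (tl u)) m))) (K.+-identityʳ _))) (e (suc m) ℕP.≤-refl))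

          β : PS
          β = const b

          -- The series 5βW - βw + w vanishes at w = 0. With one w taken out as w x̃, the equation
          -- becomes w (Q W″ + T), in which Q and T contain no second derivative.
          x̃ Q T : PS → PS
          x̃ f = tl (X̂ f)
          Q f = ι (+ 3) * pow β 4 * pow (D (W f)) 4 + - (pow β 3 * x̃ f * pow (D (W f)) 3) + ι (+ 4) * (β + 1#) * (X * pow (x̃ f) 2)
          T f = - (ι (+ 48) * pow β 2 * (β + 1#) * pow (D (W f)) 3) + ι (+ 8) * β * (β + 1#) * x̃ f * pow (D (W f)) 2 + ι (+ 4) * (pow β 2 + - 1#) * x̃ f * D (W f)

          scaled : ∀ k f n → (ι (+ k) * f) n K.≈ numeral k K.* f n
          scaled k f n = K.trans (at (*-congʳ (numeral-const k)) n) (const-* (numeral k) f n)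

          module Initial {f : PS} (f₀ : f 0 K.≈ K.0#) (f₁ : f 1 K.≈ K.0#) where

            X̂-zero : X̂ f 0 K.≈ K.0#
            X̂-zero = K.trans (K.+-cong (K.+-cong (K.trans (K.*-congʳ (K.trans (scaled 5 (W f) 0) (K.trans (K.*-congˡ
                (K.trans (K.+-cong (K.trans (scaled 2 f 0) (K.trans (K.*-congˡ f₀) (K.zeroʳ _))) (K.-‿cong (X-*₀ (const b⁻¹)))) (K.-‿inverseʳ K.0#))) (K.zeroʳ _)))) (K.zeroˡ b))
              (K.-‿cong (K.zeroʳ b))) K.refl) (K.trans (K.+-congʳ (K.-‿inverseʳ K.0#)) (K.+-identityˡ K.0#))

            factor : equation f ≋ X * (Q f * D (D (W f)) + T f)
            factor = trans (+-cong (+-cong (+-cong (*-congʳ (+-cong (+-congˡ (-‿cong (*-congʳ (*-congˡ X̂≋)))) (*-congˡ (*-cong X̂≋ (*-congʳ X̂≋))))) refl) (*-congʳ (*-congˡ X̂≋))) (*-congʳ (*-congˡ X̂≋)))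
              (solve 5 (λ β w u v x → let a = β :+ one ; u³ = u :* (u :* (u :* one)) ; β³ = β :* (β :* (β :* one)) in
                (con (+ 3) :* (β :* β³) :* w :* (u :* u³) :+ :- (β³ :* (w :* x) :* u³) :+ con (+ 4) :* a :* ((w :* x) :* ((w :* x) :* one))) :* v
                  :+ :- (con (+ 48) :* (β :* (β :* one)) :* w :* a :* u³) :+ con (+ 8) :* β :* a :* (w :* x) :* (u :* (u :* one)) :+ con (+ 4) :* (β :* (β :* one) :+ :- one) :* (w :* x) :* u
                := w :* ((con (+ 3) :* (β :* β³) :* (u :* u³) :+ :- (β³ :* x :* u³) :+ con (+ 4) :* a :* (w :* (x :* (x :* one)))) :* v
                  :+ (:- (con (+ 48) :* (β :* (β :* one)) :* a :* u³) :+ con (+ 8) :* β :* a :* x :* (u :* (u :* one)) :+ con (+ 4) :* (β :* (β :* one) :+ :- one) :* x :* u)))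
                refl β X (D (W f)) (D (D (W f))) (x̃ f))
              where
              X̂≋ : X̂ f ≋ X * x̃ f
              X̂≋ = X-tl {X̂ f} X̂-zero
              one : ∀ {n} → Polynomial n
              one = con (+ 1)

            W₁ : W f 1 K.≈ K.- b⁻¹
            W₁ = K.trans (K.+-cong (K.trans (scaled 2 f 1) (K.trans (K.*-congˡ f₁) (K.zeroʳ _))) (K.-‿cong (X-* (const b⁻¹) 0))) (K.+-identityˡ _)

            u₀ : D (W f) 0 K.≈ K.- b⁻¹
            u₀ = K.trans (K.*-identityˡ _) W₁

            W₀ : W f 0 K.≈ K.0#
            W₀ = K.trans (K.+-cong (K.trans (scaled 2 f 0) (K.trans (K.*-congˡ f₀) (K.zeroʳ _))) (K.-‿cong (X-*₀ (const b⁻¹)))) (K.-‿inverseʳ K.0#)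

            x̃₀ : x̃ f 0 K.≈ K.- (b K.+ IK.ι (+ 4))
            x̃₀ = K.trans (K.+-congʳ (K.+-cong (K.trans (at (*-comm (ι (+ 5) * W f) β) 1) (K.trans (const-* b (ι (+ 5) * W f) 1) (K.*-congˡ (K.trans (scaled 5 (W f) 1) (K.*-congˡ W₁)))))
                (K.-‿cong (const-* b X 1))))
              (K.trans (IK.solve 2 (λ b c → b IK.:* (IK.con (+ 5) IK.:* (IK.:- c)) IK.:+ IK.:- (b IK.:* IK.con (+ 1)) IK.:+ IK.con (+ 1)
                IK.:= (IK.con (+ 5) IK.:+ IK.:- (IK.con (+ 5) IK.:* (b IK.:* c))) IK.:+ IK.:- (b IK.:+ IK.con (+ 4))) K.refl b b⁻¹)
              (K.trans (K.+-congʳ (K.trans (K.+-congˡ (K.-‿cong (K.*-congˡ b-unit))) (IK.solve 0 (IK.con (+ 5) IK.:+ IK.:- (IK.con (+ 5) IK.:* IK.con (+ 1)) IK.:= IK.con (+ 0)) K.refl))) (K.+-identityˡ _)))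

            -- The leading coefficient that makes the recursion for the coefficients of f solvable.
            Q₀ : Q f 0 K.≈ K.- (b K.+ K.1#)
            Q₀ = K.trans (K.+-cong (K.+-cong (K.*-cong (K.trans (scaled 3 (pow β 4) 0) K.refl) (p 4)) (K.-‿cong (K.*-cong (K.*-congˡ x̃₀) (p 3)))) (K.trans (K.*-congˡ (X-*₀ (pow (x̃ f) 2))) (K.zeroʳ _)))
              (K.trans (IK.solve 2 (λ b c → let e = b IK.:* c in
                  IK.con (+ 3) IK.:* (b IK.:* (b IK.:* (b IK.:* (b IK.:* IK.con (+ 1))))) IK.:* ((IK.:- c) IK.:* ((IK.:- c) IK.:* ((IK.:- c) IK.:* ((IK.:- c) IK.:* IK.con (+ 1)))))
                  IK.:+ IK.:- ((b IK.:* (b IK.:* (b IK.:* IK.con (+ 1)))) IK.:* (IK.:- (b IK.:+ IK.con (+ 4))) IK.:* ((IK.:- c) IK.:* ((IK.:- c) IK.:* ((IK.:- c) IK.:* IK.con (+ 1))))) IK.:+ IK.con (+ 0)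
                  IK.:= (e IK.:* e IK.:* e) IK.:* (IK.con (+ 3) IK.:* e IK.:+ IK.:- (b IK.:+ IK.con (+ 4)))) K.refl b b⁻¹)
              (K.trans (K.*-cong (K.*-cong (K.*-cong b-unit b-unit) b-unit) (K.+-congʳ (K.*-congˡ b-unit)))
                (IK.solve 1 (λ b → IK.con (+ 1) IK.:* IK.con (+ 1) IK.:* IK.con (+ 1) IK.:* (IK.con (+ 3) IK.:* IK.con (+ 1) IK.:+ IK.:- (b IK.:+ IK.con (+ 4))) IK.:= IK.:- (b IK.:+ IK.con (+ 1))) K.refl b)))
              where
              p : ∀ k → pow (D (W f)) k 0 K.≈ pow (const (K.- b⁻¹)) k 0
              p zero = K.refl
              p (suc k) = K.*-cong u₀ (p k)

            Q-cancel : ∀ {x} → Q f 0 K.* x K.≈ K.0# → x K.≈ K.0#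
            Q-cancel {x} e = cancel (K.trans (IK.solve 2 (λ a x → a IK.:* x IK.:= IK.:- ((IK.:- a) IK.:* x)) K.refl (b K.+ K.1#) x)
              (K.trans (K.-‿cong (K.trans (K.*-congʳ (K.sym Q₀)) e)) (IK.solve 0 (IK.:- IK.con (+ 0) IK.:= IK.con (+ 0)) K.refl)))

            solved : ∀ {m} → equation f ≈[ suc m ] 0# → Agree m (Q f * D (D (W f)) + T f) 0#
            solved h = agree λ n le → K.trans (K.sym (X-* (Q f * D (D (W f)) + T f) n)) (K.trans (K.sym (at factor (suc n))) (h (suc n) (s≤s le)))

        module _ {f g : PS} (f₀ : f 0 K.≈ K.0#) (f₁ : f 1 K.≈ K.0#) (g₀ : g 0 K.≈ K.0#) (g₁ : g 1 K.≈ K.0#) where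
          private
            module F = Initial {f} f₀ f₁
            module G = Initial {g} g₀ g₁

            -- Agreement of W up to w^(m+1) makes Q and T agree up to wᵐ. So Q times the difference
            -- of the W″ vanishes to that order, Q can be cancelled because of its constant term -(1
            -- + β), and two integrations gain two orders.
            step : ∀ m → equation f ≈[ suc m ] 0# → equation g ≈[ suc m ] 0# → Agree (suc m) (W f) (W g) → Agree (suc (suc m)) (W f) (W g)
            step m hf hg e = ~∫ (K.trans F.W₀ (K.sym G.W₀)) (~∫ (K.trans F.u₀ (K.sym G.u₀)) v~)
              where
              u~ : Agree m (D (W f)) (D (W g))
              u~ = ~D e
              x~ : Agree m (x̃ f) (x̃ g)
              x~ = ~tl {f = X̂ f} {X̂ g} (~+ (~+ (~* (~* ~refl e) ~refl) ~refl) ~refl)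
              Q~ : Agree m (Q f) (Q g)
              Q~ = ~+ (~+ (~* ~refl (~pow 4 u~)) (~- (~* (~* ~refl x~) (~pow 3 u~)))) (~* ~refl (~* ~refl (~pow 2 x~)))
              T~ : Agree m (T f) (T g)
              T~ = ~+ (~+ (~- (~* ~refl (~pow 3 u~))) (~* (~* ~refl x~) (~pow 2 u~))) (~* (~* ~refl x~) u~)
              Qv : Agree m (Q g * (D (D (W f)) + - D (D (W g)))) 0#
              Qv = ~trans (≋⇒~ (solve 4 (λ q v v′ t → q :* (v :+ :- v′) := q :* v :+ t :+ :- (q :* v′ :+ t)) refl (Q g) (D (D (W f))) (D (D (W g))) (T g)))
                (~trans (~+ (~trans (~+ (~* (~sym Q~) ~refl) (~sym T~)) (F.solved hf)) (~- (G.solved hg))) (≋⇒~ (-‿inverseʳ 0#)))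
              v~ : Agree m (D (D (W f))) (D (D (W g)))
              v~ = ~trans (≋⇒~ (solve 2 (λ v v′ → v := v :+ :- v′ :+ v′) refl (D (D (W f))) (D (D (W g)))))
                (~trans (~+ (agree (cancel-≈ {Q g} {D (D (W f)) + - D (D (W g))} G.Q-cancel m (upto Qv))) ~refl) (≋⇒~ (+-identityˡ _)))

            W~ : ∀ m → equation f ≈[ m ] 0# → equation g ≈[ m ] 0# → Agree (suc m) (W f) (W g)
            W~ zero _ _ = agree λ { zero _ → K.trans F.W₀ (K.sym G.W₀) ; (suc zero) _ → K.trans F.W₁ (K.sym G.W₁) ; (suc (suc n)) (s≤s ()) }
            W~ (suc m) hf hg = step m hf hg (W~ m (λ n le → hf n (ℕP.m≤n⇒m≤1+n le)) (λ n le → hg n (ℕP.m≤n⇒m≤1+n le)))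

          solution-unique : ∀ m → equation f ≈[ m ] 0# → equation g ≈[ m ] 0# → f ≈[ m ] g
          solution-unique m hf hg n le = cancel-numeral 1 (K.trans (K.sym (scaled 2 f n)) (K.trans
            (IK.solve 2 (λ a c → a IK.:= a IK.:+ IK.:- c IK.:+ c) K.refl ((ι (+ 2) * f) n) ((X * const b⁻¹) n))
            (K.trans (K.+-congʳ (upto (W~ m hf hg) n (ℕP.m≤n⇒m≤1+n le)))
            (K.trans (IK.solve 2 (λ a c → a IK.:+ IK.:- c IK.:+ c IK.:= a) K.refl ((ι (+ 2) * g) n) ((X * const b⁻¹) n)) (scaled 2 g n)))))

      open Evaluation K b

      -- Values of rational functions and of series over them at a point.

      module Valued where
        open K using (_≈_; 0#; 1#)
        open I using (ι)
        open Equation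

        -- The fraction r takes the value x at β = b, stated without division and only where the
        -- denominator does not vanish.
        record Value (r : RatFun) (x : K.Carrier) : Set where
          constructor value
          field
            defined : ¬ ev (den r) ≈ 0#
            ratio : ev (num r) ≈ x K.* ev (den r)

        open Value public

        value-cong : ∀ {r x y} → x ≈ y → Value r x → Value r y
        value-cong e v = value (defined v) (K.trans (ratio v) (K.*-congʳ e))

        private
          nonzero-* : ∀ {x y} → ¬ x ≈ 0# → ¬ y ≈ 0# → ¬ x K.* y ≈ 0#
          nonzero-* p q e = q (zero-divisor e p)

          ev-1 : ev (constP (+ 1)) ≈ 1#
          ev-1 = ev-const (+ 1)

        value-poly : ∀ p → Value (fromPoly p) (ev p)
        value-poly p = value (λ e → char0 0 (K.trans (K.sym ev-1) e)) (K.sym (K.trans (K.*-congˡ ev-1) (K.*-identityʳ _)))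

        value-0 : Value 0F 0#
        value-0 = value-poly []

        value-ℤ : ∀ n → Value (fromPoly (constP (+ n))) (numeral n)
        value-ℤ n = value-cong (ev-const (+ n)) (value-poly (constP (+ n)))

        value-+ : ∀ {r s x y} → Value r x → Value s y → Value (r +F s) (x K.+ y)
        value-+ {p , q} {p′ , q′} {x} {y} v v′ = value (λ e → nonzero-* (defined v) (defined v′) (K.trans (K.sym (ev-* q q′)) e))
          (K.trans (ev-+ (p Frozen.*P q′) (p′ Frozen.*P q)) (K.trans (K.+-cong (K.trans (ev-* p q′) (K.*-congʳ (ratio v))) (K.trans (ev-* p′ q) (K.*-congʳ (ratio v′))))
            (K.trans (IK.solve 4 (λ x y q q′ → x IK.:* q IK.:* q′ IK.:+ y IK.:* q′ IK.:* q IK.:= (x IK.:+ y) IK.:* (q IK.:* q′)) K.refl x y (ev q) (ev q′)) (K.*-congˡ (K.sym (ev-* q q′))))))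

        value-* : ∀ {r s x y} → Value r x → Value s y → Value (r *F s) (x K.* y)
        value-* {p , q} {p′ , q′} {x} {y} v v′ = value (λ e → nonzero-* (defined v) (defined v′) (K.trans (K.sym (ev-* q q′)) e))
          (K.trans (ev-* p p′) (K.trans (K.*-cong (ratio v) (ratio v′))
            (K.trans (IK.solve 4 (λ x y q q′ → x IK.:* q IK.:* (y IK.:* q′) IK.:= (x IK.:* y) IK.:* (q IK.:* q′)) K.refl x y (ev q) (ev q′)) (K.*-congˡ (K.sym (ev-* q q′))))))

        value-neg : ∀ {r x} → Value r x → Value (negF r) (K.- x)
        value-neg {p , q} {x} v = value (defined v) (K.trans (ev-neg p) (K.trans (K.-‿cong (ratio v)) (IK.solve 2 (λ x q → IK.:- (x IK.:* q) IK.:= (IK.:- x) IK.:* q) K.refl x (ev q))))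

        record Values (N : ℕ) (F : Series) (f : PS) : Set where
          constructor values
          field upto : ∀ n → n ≤ N → Value (F n) (f n)

        open Values public

        values-cong : ∀ {N F f g} → f ≋ g → Values N F f → Values N F g
        values-cong e v = values λ n le → value-cong (at e n) (upto v n le)

        module _ {N : ℕ} where

          values-⊕ : ∀ {F G f g} → Values N F f → Values N G g → Values N (F ⊕ G) (f A.+ g)
          values-⊕ v w = values λ n le → value-+ (upto v n le) (upto w n le)

          values-⊖ : ∀ {F G f g} → Values N F f → Values N G g → Values N (F ⊖ G) (f A.+ A.- g)
          values-⊖ v w = values λ n le → value-+ (upto v n le) (value-neg (upto w n le))

          private
            sum : ℕ → PS → K.Carrier
            sum zero x = x 0
            sum (suc n) x = sum n x K.+ x (suc n)

            sum-cong : ∀ n {x y : PS} → (∀ i → i ≤ n → x i ≈ y i) → sum n x ≈ sum n y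
            sum-cong zero h = h 0 z≤n
            sum-cong (suc n) h = K.+-cong (sum-cong n (λ i le → h i (ℕP.m≤n⇒m≤1+n le))) (h (suc n) ℕP.≤-refl)

            conv-tl : ∀ (f g : PS) n → conv f g (suc n) ≈ conv f (tl g) n K.+ f (suc n) K.* g 0
            conv-tl f g zero = K.refl
            conv-tl f g (suc n) = K.trans (K.+-congˡ (conv-tl (tl f) g n)) (K.sym (K.+-assoc _ _ _))

            sum-conv : ∀ n (f g : PS) → sum n (λ i → f i K.* g (n ∸ i)) ≈ conv f g n
            sum-conv zero f g = K.refl
            sum-conv (suc n) f g = K.trans (K.+-cong
              (K.trans (sum-cong n (λ i le → K.reflexive (≡.cong (λ k → f i K.* g k) (ℕP.+-∸-assoc 1 le)))) (sum-conv n f (tl g)))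
              (K.reflexive (≡.cong (λ k → f (suc n) K.* g k) (ℕP.n∸n≡0 n)))) (K.sym (conv-tl f g n))

            value-sum : ∀ n {h : ℕ → RatFun} {x : PS} → (∀ i → i ≤ n → Value (h i) (x i)) → Value (sumTo n h) (sum n x)
            value-sum zero v = v 0 z≤n
            value-sum (suc n) v = value-+ (value-sum n (λ i le → v i (ℕP.m≤n⇒m≤1+n le))) (v (suc n) ℕP.≤-refl)

          values-⊗ : ∀ {F G f g} → Values N F f → Values N G g → Values N (F ⊗ G) (f A.* g)
          values-⊗ {F} {G} {f} {g} v w = values λ n le → value-cong (sum-conv n f g)
            (value-sum n {λ i → F i *F G (n ∸ i)} {λ i → f i K.* g (n ∸ i)} λ i i≤n → value-* (upto v i (ℕP.≤-trans i≤n le)) (upto w (n ∸ i) (ℕP.≤-trans (ℕP.m∸n≤m n i) le)))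

          values-cst : ∀ {r x} → Value r x → Values N (cst r) (const x)
          values-cst v = values λ { zero _ → v ; (suc n) _ → value-0 }

          values-ℤ : ∀ n → Values N (cstℤ (+ n)) (ι (+ n))
          values-ℤ n = values-cong (A.sym (numeral-const n)) (values-cst (value-ℤ n))

          values-w : Values N wS X
          values-w = values λ { zero _ → value-0 ; (suc zero) _ → value-ℤ 1 ; (suc (suc n)) _ → value-0 }

          values-β : Values N βS (const b)
          values-β = values-cst (value-cong ev-β (value-poly βP))

          values-β⁻¹ : Values N invβS (const b⁻¹)
          values-β⁻¹ = values-cst (value (λ e → char0 0 (K.trans (K.sym b-unit) (K.trans (K.*-congʳ (K.trans (K.sym ev-β) e)) (K.zeroˡ b⁻¹))))
            (K.trans ev-1 (K.sym (K.trans (K.*-congˡ ev-β) (K.trans (K.*-comm b⁻¹ b) b-unit)))))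

          values-^ : ∀ {F f} k → Values N F f → Values N (F ^S k) (pow f k)
          values-^ zero v = values-ℤ 1
          values-^ (suc k) v = values-⊗ v (values-^ k v)

          values-W : ∀ {F f} → Values N F f → Values N (Wof F) (W f)
          values-W v = values-⊖ (values-⊗ (values-ℤ 2) v) (values-⊗ values-w values-β⁻¹)

        values-D : ∀ {N F f} → Values (suc N) F f → Values N (Frozen.D F) (D f)
        values-D v = values λ n le → value-* (value-ℤ (suc n)) (upto v (suc n) (s≤s le))

        values-≤ : ∀ {M N F f} → M ≤ N → Values N F f → Values M F f
        values-≤ le v = values λ n n≤ → upto v n (ℕP.≤-trans n≤ le)

        -- The second derivative of W costs two coefficients.
        values-equation : ∀ {N F f} → Values (suc (suc N)) F f → Values N (odeExpr F) (equation f)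
        values-equation {N} {F} {f} v = values-⊕ (values-⊕ (values-⊖
            (values-⊗ (values-⊕ (values-⊖ (values-⊗ (values-⊗ (values-⊗ (values-ℤ 3) (values-^ 4 values-β)) values-w) (values-^ 4 W′)) (values-⊗ (values-⊗ (values-^ 3 values-β) X̂′) (values-^ 3 W′)))
              (values-⊗ (values-⊗ (values-ℤ 4) a) (values-^ 2 X̂′))) W″)
            (values-⊗ (values-⊗ (values-⊗ (values-⊗ (values-ℤ 48) (values-^ 2 values-β)) values-w) a) (values-^ 3 W′)))
            (values-⊗ (values-⊗ (values-⊗ (values-⊗ (values-ℤ 8) values-β) a) X̂′) (values-^ 2 W′)))
            (values-⊗ (values-⊗ (values-⊗ (values-ℤ 4) (values-⊖ (values-^ 2 values-β) (values-ℤ 1))) X̂′) W′)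
          where
          v₁ : Values (suc N) F f
          v₁ = values-≤ (ℕP.n≤1+n _) v
          W′ : Values N (Frozen.D (Wof F)) (D (W f))
          W′ = values-D (values-W v₁)
          W″ : Values N (Frozen.D (Frozen.D (Wof F))) (D (D (W f)))
          W″ = values-D (values-D (values-W v))
          a : Values N (βS ⊕ cstℤ (+ 1)) (const b A.+ A.1#)
          a = values-⊕ values-β (values-ℤ 1)
          X̂′ : Values N _ (X̂ f)
          X̂′ = values-⊕ (values-⊖ (values-⊗ (values-⊗ (values-ℤ 5) (values-W (values-≤ (ℕP.n≤1+n _) v₁))) values-β) (values-⊗ values-β values-w)) values-w

      -- The generating function of maps, evaluated at a point.

      module Evaluated where
        open K
        open Weighted using (weight; total)
        open Valued

        G : PS
        G = Forests.F 1 0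

        ev-βpow : ∀ i → ev (βpow i) ≈ weight i
        ev-βpow zero = ev-const (+ 1)
        ev-βpow (suc i) = trans (ev-* Frozen.βP (βpow i)) (*-cong ev-β (ev-βpow i))

        total-↭ : ∀ {ws ws′} → ws ↭ ws′ → total ws ≈ total ws′
        total-↭ Perm.refl = refl
        total-↭ (Perm.prep w p) = +-congˡ (total-↭ p)
        total-↭ (Perm.swap v w p) = trans (sym (+-assoc _ _ _)) (trans (+-cong (+-comm _ _) (total-↭ p)) (+-assoc _ _ _))
        total-↭ (Perm.trans p q) = trans (total-↭ p) (total-↭ q)

        item-weight : Item → Carrier
        item-weight ((d , M) , S) = weight (Map.components M S ∸ 1)

        weigh : List Item → Carrier
        weigh [] = 0#
        weigh (x ∷ xs) = item-weight x + weigh xs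

        weigh-++ : ∀ xs ys → weigh (xs ++ ys) ≈ weigh xs + weigh ys
        weigh-++ [] ys = sym (+-identityˡ _)
        weigh-++ (x ∷ xs) ys = trans (+-congˡ (weigh-++ xs ys)) (sym (+-assoc _ _ _))

        weigh-filter : ∀ {A : Set} (p : A → Bool) (c : A → Poly) (h : A → Item) → (∀ x → ev (c x) ≈ item-weight (h x)) →
          ∀ xs → ev (sumP (map (λ x → if p x then c x else []) xs)) ≈ weigh (map h (filterᵇ p xs))
        weigh-filter p c h e [] = refl
        weigh-filter p c h e (x ∷ xs) with p x
        ... | true = trans (ev-+ (c x) _) (+-cong (e x) (weigh-filter p c h e xs))
        ... | false = weigh-filter p c h e xs

        ev-forest : ∀ M → ev (Map.forestPoly (proj₂ M)) ≈ weigh (itemsOf M)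
        ev-forest (d , M) = trans (reflexive (≡.cong ev (forestPoly≡ M))) (weigh-filter (Map.isForest M) (λ S → βpow (Map.components M S ∸ 1)) (λ S → (d , M) , S)
          (λ S → ev-βpow (Map.components M S ∸ 1)) (subsets M d))

        ev-maps : ∀ Ms → ev (sumP (map (λ M → Map.forestPoly (proj₂ M)) Ms)) ≈ weigh (items Ms)
        ev-maps [] = refl
        ev-maps (M ∷ Ms) = trans (ev-+ (Map.forestPoly (proj₂ M)) _) (trans (+-cong (ev-forest M) (ev-maps Ms)) (sym (weigh-++ (itemsOf M) (items Ms))))

        weigh-total : ∀ {xs ws} → Zip.Pointwise Weighs xs ws → weigh xs ≈ total ws
        weigh-total [] = refl
        weigh-total {((d , M) , S) ∷ _} {w ∷ _} (e ∷ es) = +-cong (reflexive (≡.cong (λ c → weight (c ∸ 1)) e)) (weigh-total es)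

        -- The evaluated forest polynomials of the representatives add up to the weight of all pairs
        -- of a map and a forest. `bijection` turns this into the weight of the enumerated words,
        -- which `total-words` identifies with a coefficient of F 1 0.
        ev-g : ∀ {g} → IsMapGF g → ∀ n → ev (g n) ≈ G n
        ev-g {g} gf n = trans (ev-cong (g n) (sumP (map (λ M → Map.forestPoly (proj₂ M)) Ms)) (proj₂ (proj₂ (proj₂ (proj₂ (gf n)))))) (trans (ev-maps Ms) (trans (weigh-total (proj₂ (proj₂ pairing)))
          (trans (total-↭ (proj₁ (proj₂ pairing))) (trans (Weighted.total-words fuel n 1 0 [] (plenty n)) (at (A.*-identityʳ G) n)))))
          where
          fuel : ℕ
          fuel = suc (4 ℕ.* (2 ℕ.* n))
          Ms : List RMap
          Ms = proj₁ (gf n)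
          pairing : ∃ λ ws → ws ↭ words fuel n 1 0 [] × Zip.Pointwise Weighs (items Ms) ws
          pairing = bijection Ms (proj₁ (proj₂ (gf n))) (proj₁ (proj₂ (proj₂ (gf n)))) (proj₁ (proj₂ (proj₂ (proj₂ (gf n))))) (words fuel n 1 0 []) (words-unique fuel n 1 0 [])
            (All.lookup (words-sound fuel n 1 0 [])) (words-complete fuel (plenty n))

        values-G : ∀ {g} → IsMapGF g → ∀ N → Values N (GSeries g) G
        values-G {g} gf N = values λ n _ → value-cong (ev-g {g} gf n) (value-poly (g n))

        ode-G : ∀ {g} → IsMapGF g → ∀ n → ev (num (odeExpr (GSeries g) n)) ≈ 0#
        ode-G {g} gf n = trans (ratio v) (trans (*-congʳ (at (Solution.G-solves) n)) (zeroˡ _))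
          where
          v : Value (odeExpr (GSeries g) n) (Equation.equation G n)
          v = upto (values-equation (values-G {g} gf (suc (suc n)))) n ℕP.≤-refl

        value-zero : ∀ {r x} → Value r x → r ≈F 0F → x ≈ 0#
        value-zero {p , q} {x} v e = zero-divisor (trans (*-comm _ _) (trans (sym (ratio v)) (trans (sym (trans (ev-* p (constP (+ 1))) (trans (*-congˡ (ev-const (+ 1))) (*-identityʳ _)))) (ev-cong (p *P constP (+ 1)) [] e)))) (defined v)

        module _ (H : Series) (N : ℕ) (nz : ∀ i → i ≤ N → ¬ ev (den (H i)) ≈ 0#) where

          -- H is evaluated only up to a fixed degree: a given β may be a zero of some denominator
          -- further on.
          value-of : PS
          value-of i with i ℕ.≤? N
          ... | yes le = ev (num (H i)) * proj₁ (recip (ev (den (H i))) (nz i le))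
          ... | no _ = 0#

          values-of : Values N H value-of
          values-of = values go
            where
            go : ∀ i → i ≤ N → Value (H i) (value-of i)
            go i i≤N with i ℕ.≤? N
            ... | no i≰N = ⊥-elim (i≰N i≤N)
            ... | yes le = value (nz i le) (sym (trans (*-assoc _ _ _) (trans (*-congˡ (trans (*-comm _ _) (proj₂ (recip (ev (den (H i))) (nz i le))))) (*-identityʳ _))))

        -- Comparing the coefficients of wⁿ uses the equation up to wⁿ and hence values of H up to
        -- degree n + 2.
        unique-at : ∀ {g} → IsMapGF g → ∀ H n → (∀ i → i ≤ suc (suc n) → ¬ ev (den (H i)) ≈ 0#) → H 0 ≈F 0F → H 1 ≈F 0F → ODE H →
          ev (num (H n)) ≈ ev (g n) * ev (den (H n))
        unique-at {g} gf H n nz H₀ H₁ ode = trans (ratio (upto v n n≤)) (*-congʳ (trans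
            (UniqueSolution.solution-unique {h} {G} (value-zero (upto v 0 z≤n) H₀) (value-zero (upto v 1 (s≤s z≤n)) H₁) (Solution.G₀) (Solution.G₁) n
              (λ i i≤n → value-zero (upto (values-equation v) i i≤n) (ode i)) (λ i _ → at (Solution.G-solves) i) n ℕP.≤-refl)
            (sym (ev-g {g} gf n))))
          where
          h : PS
          h = value-of H (suc (suc n)) nz
          v : Values (suc (suc n)) H h
          v = values-of H (suc (suc n)) nz
          n≤ : n ≤ suc (suc n)
          n≤ = ℕP.m≤n⇒m≤1+n (ℕP.n≤1+n n)

    open K

    private
      b b⁻¹ : ℕ → Carrier
      b k = numeral (suc k)
      b⁻¹ k = proj₁ (recip (b k) (char0 k))

      b-unit : ∀ k → b k * b⁻¹ k ≈ 1#
      b-unit k = proj₂ (recip (b k) (char0 k))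

      cancel : ∀ k {x} → (b k + 1#) * x ≈ 0# → x ≈ 0#
      cancel k e = zero-divisor e λ z → char0 (suc k) (trans (numeral-suc (suc k)) (trans (+-comm 1# (b k)) z))

      point : ℕ → Parameter
      point k = record { b = b k ; b⁻¹ = b⁻¹ k ; b-unit = b-unit k ; cancel = λ {x} → cancel k {x} }

      -- The points are β = k + 1, because 1/β has no value at 0.
      eventually-suc : ∀ {P : ℕ → Set} → (∀ k → P (suc k)) → Eventually P
      eventually-suc h = 1 , λ { (suc k) _ → h k }

      vanishing : ∀ r → (∀ k → Evaluation.ev K (numeral (suc k)) (num r) ≈ 0#) → r ≈F 0F
      vanishing r h = Specialise.≈P-eventually K char0 (num r *P constP (+ 1)) [] (eventually-suc λ k →
        trans (Evaluation.ev-* K (numeral (suc k)) (num r) (constP (+ 1))) (trans (*-congʳ (h k)) (zeroˡ _)))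

    theorem : (g : ℕ → Poly) → IsMapGF g →
      (GSeries g 0 ≈F 0F × GSeries g 1 ≈F 0F × ODE (GSeries g)) ×
      ((H : Series) → (∀ n → NonZeroP (den (H n))) → H 0 ≈F 0F → H 1 ≈F 0F → ODE H → ∀ n → H n ≈F GSeries g n)
    theorem g gf = (vanishing (GSeries g 0) (λ k → trans (Point.Evaluated.ev-g (point k) {g} gf 0) (Point.Solution.G₀ (point k))) ,
        vanishing (GSeries g 1) (λ k → trans (Point.Evaluated.ev-g (point k) {g} gf 1) (Point.Solution.G₁ (point k))) , λ n → vanishing (odeExpr (GSeries g) n) (λ k → Point.Evaluated.ode-G (point k) {g} gf n)) ,
      λ H nz H₀ H₁ ode n → Specialise.≈P-eventually K char0 (num (H n) *P constP (+ 1)) (g n *P den (H n))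
        (eventually-map (agree H n H₀ H₁ ode) (eventually-× (1 , λ _ le → le) (eventually-upto (λ i → Specialise.nonzero-eventually K char0 (den (H i)) (nz i)) (suc (suc n)))))
      where
      agree : ∀ H n → H 0 ≈F 0F → H 1 ≈F 0F → ODE H → ∀ k → 1 ≤ k × (∀ i → i ≤ suc (suc n) → ¬ Evaluation.ev K (numeral k) (den (H i)) ≈ 0#) →
        Evaluation.ev K (numeral k) (num (H n) *P constP (+ 1)) ≈ Evaluation.ev K (numeral k) (g n *P den (H n))
      agree H n H₀ H₁ ode (suc k) (_ , nz) = trans (ev-* (num (H n)) (constP (+ 1))) (trans (*-congˡ (ev-const (+ 1))) (trans (*-identityʳ _)
        (trans (Point.Evaluated.unique-at (point k) {g} gf H n nz H₀ H₁ ode) (sym (ev-* (g n) (den (H n)))))))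
        where open Evaluation K (numeral (suc k))

open import Defs
open import Data.Rational as ℚ using (ℚ)
import Data.Rational.Properties as ℚP
open import Relation.Binary.PropositionalEquality as ≡ using (_≡_)

private
  module N = Ring.PowerSeries ℚP.+-*-commutativeRing

  numeral-positive : ∀ n → ℚ.0ℚ ℚ.< N.numeral (suc n)
  numeral-positive zero = ℚP.positive⁻¹ ℚ.1ℚ
  numeral-positive (suc n) = ≡.subst₂ ℚ._<_ (ℚP.+-identityˡ ℚ.0ℚ) (≡.sym (N.numeral-suc (suc n))) (ℚP.+-mono-< (ℚP.positive⁻¹ ℚ.1ℚ) (numeral-positive n))

theorem15 : (g : ℕ → Poly) → IsMapGF g →
    (GSeries g 0 ≈F 0F × GSeries g 1 ≈F 0F × ODE (GSeries g)) ×
    ((H : Series) → (∀ n → NonZeroP (den (H n))) →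
    H 0 ≈F 0F → H 1 ≈F 0F → ODE H → ∀ n → H n ≈F GSeries g n)
theorem15 = Analysis.Theorem.theorem (record { K = ℚP.+-*-commutativeRing ; recip = λ x x≢0 → ℚ.1/_ x {{ℚ.≢-nonZero x≢0}} , ℚP.*-inverseʳ x {{ℚ.≢-nonZero x≢0}}
  ; char0 = λ n e → ℚP.<⇒≢ (numeral-positive n) (≡.sym e) })
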